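{- Let $w\in S_n$ have length $n-1$, factor it uniquely as $w=w_1\times w_2\times\dots\times w_k$ with each $w_i$ indecomposable, and let $w^{(i)}=(w_i\times w_{i+1}\times\dots\times w_k)\times(w_1\times\dots\times w_{i-1})$ for $i=1,\dots,k$. Then $$\sum_{i=1}^k a_{w^{(i)}}(q)=\sum_{\mathbf{a}\in\mathrm{Red}(w)}q^{\mathrm{comaj}(\mathbf{a})}.$$
   Context: $\mathbf{k}$ is a field of characteristic zero and $q\in\mathbf{k}$ is not a nontrivial root of unity. For $u\in S_a$, $v\in S_b$, $u\times v\in S_{a+b}$ is defined by $(u\times v)(i)=u(i)$ for $i\le a$ and $(u\times v)(i)=a+v(i-a)$ for $i>a$. A permutation is indecomposable if it cannot be written as $u\times v$ with $u,v$ each in a symmetric group $S_m$ with $m\ge1$. Schubert polynomials: $\mathfrak{S}_{w_0}=x_1^{n-1}\cdots x_{n-1}$ for $w_0$ longest in $S_n$, and $\mathfrak{S}_{ws_i}=\partial_i\mathfrak{S}_w$ when $w(i)>w(i+1)$, with $\partial_if=(f-s_if)/(x_i-x_{i+1})$. For $w\in S_n$ of length $n-1$, $a_w(q):=\langle\mathfrak{S}_w\rangle_n^q$, where $\langle f\rangle_n^q:=\partial_{w_0}\big(f\prod_{1\le i,\ i+2\le j\le n}(qx_i-x_j)\big)$ and $\partial_{w_0}g=\big(\sum_{\sigma\in S_n}\mathrm{sgn}(\sigma)g(x_{\sigma(1)},\dots,x_{\sigma(n)})\big)/\prod_{i<j}(x_i-x_j)$. $\mathrm{Red}(w)$ is the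 set of reduced words $a_1\cdots a_\ell$ of $w$ ($w=s_{a_1}\cdots s_{a_\ell}$, $\ell=\ell(w)$) and $\mathrm{comaj}(\mathbf{a})=\sum\{i\in\{1,\dots,\ell-1\}: a_i<a_{i+1}\}$. -}

module Defs where

open import Level using (Level)
open import Data.Nat as ℕ using (ℕ; zero; suc; _∸_; _<ᵇ_; _≡ᵇ_)
open import Data.Maybe using (Maybe; just; nothing)
open import Data.Bool using (Bool; true; false; if_then_else_)
open import Data.List using (List; []; _∷_; _++_; map; concatMap; foldr; length; upTo; filter; drop; take; replicate; zipWith; lookup)
open import Data.List.Properties using (≡-dec)
open import Data.List.Relation.Binary.Permutation.Propositional using (_↭_)
open import Data.List.Relation.Unary.All using (All)
open import Data.Product using (_×_; _,_; ∃)
open import Relation.Binary.PropositionalEquality using (_≡_; _≢_)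
open import Relation.Nullary using (¬_)
open import Algebra.Bundles using (CommutativeRing)

-- Permutations in one-line notation, 0-based values:
-- w ∈ S_n is the list [w(1)-1, …, w(n)-1].

IsPerm : ℕ → List ℕ → Set
IsPerm n w = (length w ≡ n) × (w ↭ upTo n)

_×ₚ_ : List ℕ → List ℕ → List ℕ
u ×ₚ v = u ++ map (length u ℕ.+_) v

Indecomposable : List ℕ → Set
Indecomposable w =
  IsPerm (length w) w × (1 ℕ.≤ length w) ×
  (∀ u v → IsPerm (length u) u → IsPerm (length v) v →
           1 ℕ.≤ length u → 1 ℕ.≤ length v → w ≢ u ×ₚ v)

countLess : ℕ → List ℕ → ℕ
countLess a [] = 0
countLess a (b ∷ bs) = (if b <ᵇ a then 1 else 0) ℕ.+ countLess a bs

len : List ℕ → ℕ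
len [] = 0
len (a ∷ as) = countLess a as ℕ.+ len as

-- swap the entries in positions i, i+1 (0-based i); on a permutation w
-- this is right multiplication w ↦ w s_{i+1}.
swapAt : ℕ → List ℕ → List ℕ
swapAt zero (a ∷ b ∷ xs) = b ∷ a ∷ xs
swapAt zero xs = xs
swapAt (suc i) [] = []
swapAt (suc i) (a ∷ xs) = a ∷ swapAt i xs

wordProd : ℕ → List ℕ → List ℕ
wordProd n a = go (upTo n) a
  where
  go : List ℕ → List ℕ → List ℕ
  go w [] = w
  go w (i ∷ is) = go (swapAt (i ∸ 1) w) is

allWords : ℕ → ℕ → List (List ℕ)
allWords n zero = [] ∷ []
allWords n (suc ℓ) =
  concatMap (λ a → map (λ ws → suc a ∷ ws) (allWords n ℓ)) (upTo (n ∸ 1))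

Red : ℕ → List ℕ → List (List ℕ)
Red n w = filter (λ a → ≡-dec ℕ._≟_ (wordProd n a) w) (allWords n (len w))

comaj : List ℕ → ℕ
comaj a = go 1 a
  where
  go : ℕ → List ℕ → ℕ
  go i [] = 0
  go i (x ∷ []) = 0
  go i (x ∷ y ∷ ys) = (if x <ᵇ y then i else 0) ℕ.+ go (suc i) (y ∷ ys)

insertions : ℕ → List ℕ → List (List ℕ)
insertions a [] = (a ∷ []) ∷ []
insertions a (b ∷ bs) = (a ∷ b ∷ bs) ∷ map (b ∷_) (insertions a bs)

perms : List ℕ → List (List ℕ)
perms [] = [] ∷ []
perms (a ∷ as) = concatMap (insertions a) (perms as)

indexOf : ℕ → List ℕ → ℕ
indexOf a [] = 0
indexOf a (b ∷ bs) = if a ≡ᵇ b then 0 else suc (indexOf a bs)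

firstAscent : List ℕ → Maybe ℕ
firstAscent [] = nothing
firstAscent (a ∷ xs) = go a xs
  where
  go : ℕ → List ℕ → Maybe ℕ
  go a [] = nothing
  go a (b ∷ ys) = if a <ᵇ b then just 0 else Data.Maybe.map suc (go b ys)

at : List ℕ → ℕ → ℕ
at [] _ = 0
at (a ∷ as) zero = a
at (a ∷ as) (suc i) = at as i

setAt : ℕ → ℕ → List ℕ → List ℕ
setAt i v [] = []
setAt zero v (a ∷ as) = v ∷ as
setAt (suc i) v (a ∷ as) = a ∷ setAt i v as

pairs : ℕ → List (ℕ × ℕ)
pairs n = concatMap (λ j → map (λ i → (i , j)) (upTo j)) (upTo n)

farPairs : ℕ → List (ℕ × ℕ)
farPairs n = concatMap (λ j → map (λ i → (i , j)) (upTo (j ∸ 1))) (upTo n)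

-- Polynomials in x₁,…,xₙ over a commutative ring, as (unnormalised)
-- finite lists of terms (coefficient , exponent vector of length n).
-- Equality of polynomials is equality of all coefficients.

module Poly {c ℓ : Level} (R : CommutativeRing c ℓ) where
  open CommutativeRing R

  IsField : Set (c Level.⊔ ℓ)
  IsField = (¬ (1# ≈ 0#)) × (∀ x → ¬ (x ≈ 0#) → ∃ λ y → x * y ≈ 1#)

  pow : Carrier → ℕ → Carrier
  pow x zero = 1#
  pow x (suc m) = x * pow x m

  fromℕ : ℕ → Carrier
  fromℕ zero = 0#
  fromℕ (suc m) = 1# + fromℕ m

  CharZero : Set ℓ
  CharZero = ∀ m → ¬ (fromℕ (suc m) ≈ 0#)

  NotNontrivialRootOfUnity : Carrier → Set ℓ
  NotNontrivialRootOfUnity q = ∀ m → pow q (suc m) ≈ 1# → q ≈ 1#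

  sumR : List Carrier → Carrier
  sumR = foldr _+_ 0#

  Pol : Set c
  Pol = List (Carrier × List ℕ)

  coeff : List ℕ → Pol → Carrier
  coeff α [] = 0#
  coeff α ((a , β) ∷ p) with ≡-dec ℕ._≟_ α β
  ... | Relation.Nullary.yes _ = a + coeff α p
  ... | Relation.Nullary.no _ = coeff α p

  _≈P_ : Pol → Pol → Set ℓ
  p ≈P r = ∀ α → coeff α p ≈ coeff α r

  _+P_ : Pol → Pol → Pol
  _+P_ = _++_

  sumP : List Pol → Pol
  sumP = foldr _+P_ []

  scaleP : Carrier → Pol → Pol
  scaleP a = map (λ { (b , β) → (a * b , β) })

  -P_ : Pol → Pol
  -P_ = map (λ { (b , β) → (- b , β) })

  _*P_ : Pol → Pol → Pol
  p *P r = concatMap (λ { (a , α) → map (λ { (b , β) → (a * b , zipWith ℕ._+_ α β) }) r }) p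

  constP : ℕ → Carrier → Pol
  constP n a = (a , replicate n 0) ∷ []

  prodP : ℕ → List Pol → Pol
  prodP n = foldr _*P_ (constP n 1#)

  varP : ℕ → ℕ → Pol
  varP n i = (1# , map (λ k → if k ≡ᵇ i then 1 else 0) (upTo n)) ∷ []

  swapVars : ℕ → Pol → Pol
  swapVars i = map (λ { (a , α) → (a , swapAt i α) })

  -- f(x_{σ(1)},…,x_{σ(n)}) for σ ∈ S_n in 0-based one-line notation
  actP : ℕ → List ℕ → Pol → Pol
  actP n σ = map (λ { (a , α) → (a , map (λ k → at α (indexOf k σ)) (upTo n)) })

  sgn : List ℕ → Carrier
  sgn σ = pow (- 1#) (len σ)

  -- exact division by (x_{i+1} - x_{j+1}) (0-based i ≠ j):
  -- returns (f - f|_{x_{i+1} := x_{j+1}}) / (x_{i+1} - x_{j+1}), computed via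
  -- (x_i^k - x_j^k)/(x_i - x_j) = Σ_{m<k} x_i^m x_j^{k-1-m};
  -- this is the exact quotient whenever (x_{i+1} - x_{j+1}) divides f.
  quoP : ℕ → ℕ → Pol → Pol
  quoP i j = concatMap (λ { (a , α) →
      map (λ m → (a , setAt i m (setAt j (at α j ℕ.+ (at α i ∸ 1 ∸ m)) α)))
          (upTo (at α i)) })

  ∂ : ℕ → Pol → Pol
  ∂ i f = quoP i (suc i) (f +P (-P (swapVars i f)))

  antisym : ℕ → Pol → Pol
  antisym n g = sumP (map (λ σ → scaleP (sgn σ) (actP n σ g)) (perms (upTo n)))

  ∂w₀ : ℕ → Pol → Pol
  ∂w₀ n g = foldr (λ { (i , j) p → quoP i j p }) (antisym n g) (pairs n)

  bracket : ℕ → Carrier → Pol → Pol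
  bracket n q f =
    ∂w₀ n (f *P prodP n (map (λ { (i , j) → scaleP q (varP n i) +P (-P varP n j) })
                             (farPairs n)))

  -- Schubert polynomials: 𝔖_{w₀} = x₁^{n-1} ⋯ x_{n-1}, and
  -- 𝔖_{w s_i} = ∂_i 𝔖_w when w(i) > w(i+1).  If w has an ascent at i
  -- (0-based position), then w = (w s_i) s_i with w s_i having a descent
  -- there, so 𝔖_w = ∂_i 𝔖_{w s_i}.  Recursion with fuel (n*n ≥ ℓ(w₀) suffices).
  schubW₀ : ℕ → Pol
  schubW₀ n = (1# , map (λ k → n ∸ 1 ∸ k) (upTo n)) ∷ []

  schubF : ℕ → ℕ → List ℕ → Pol
  schubF fuel n w with firstAscent w
  ... | nothing = schubW₀ n
  schubF zero n w | just i = []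
  schubF (suc fuel) n w | just i = ∂ i (schubF fuel n (swapAt i w))

  schubert : List ℕ → Pol
  schubert w = schubF (length w ℕ.* length w) (length w) w

  aW : Carrier → List ℕ → Pol
  aW q w = bracket (length w) q (schubert w)

  rot : ℕ → List (List ℕ) → List ℕ
  rot j ws = foldr _×ₚ_ [] (drop j ws ++ take j ws)

  redSum : Carrier → ℕ → List ℕ → Carrier
  redSum q n w = sumR (map (λ a → pow q (comaj a)) (Red n w))

{-# OPTIONS --safe #-}
module Submission where

-- The functional f ↦ ⟨f⟩ on polynomials of degree n − 1 is the coefficient of x₁^{n-1}⋯x_{n-1} in the
-- antisymmetrisation of f ∏ (q xᵢ − xⱼ).  Two polynomials are identified when their multiples have
-- equal values; in the quotient S so obtained uᵢ = x₁ + ⋯ + xᵢ satisfies uᵢ (q xᵢ − xᵢ₊₁) = 0 and uₙ = 0,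
-- so S is the Klyachko algebra.  Evaluating at the points (q x₁, …, q xᵢ₋₁, xᵢ + (1 − q) uᵢ₋₁, xᵢ₊₁, …)
-- of S turns differences of consecutive values into divided differences, which gives a q-analogue of
-- Macdonald's identity in S, [ℓ]! 𝔖_w = Σ q^{comaj a} u_{a₁}⋯u_{a_ℓ} over the reduced words a of w.
-- Word sums of u × v factor, as reduced words of u × v are shuffles; hence a_{w^{(i)}} is the word sum of
-- w with the indices of the uₐ shifted cyclically so that the cut falls between the blocks, and a cut
-- inside an indecomposable block contributes 0 because every reduced word then contains the factor uₙ.
-- So the left hand side is a sum over all n cyclic shifts.  The relations make the value of a word,
-- as a function of the position of one letter, geometric between the other letters; this shows that the
-- values of the n shifts of any word of length n − 1 add up to the same number [n-1]!.

open import Defs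
open import Level using (Level; _⊔_)
open import Algebra.Bundles using (CommutativeRing; RawRing; CommutativeMonoid)
open import Algebra.Structures using (IsCommutativeRing)
import Algebra.Properties.Ring
import Algebra.Properties.Semiring.Mult.TCOptimised
import Algebra.Solver.Ring
import Algebra.Solver.Ring.AlmostCommutativeRing as ACR
import Algebra.Solver.Ring.NaturalCoefficients.Default
open import Data.Bool using (Bool; true; false; if_then_else_)
open import Data.Empty using (⊥; ⊥-elim)
open import Data.List as List using (List; []; _∷_; _++_; _∷ʳ_; length; map; upTo; concatMap; filter; applyUpTo; replicate; zipWith; take; downFrom; foldr; drop)
open import Data.List.Membership.Propositional using (_∈_; _∉_)
import Data.List.Membership.Propositional.Properties as Memₚ
open import Data.List.Properties using (length-map; length-++; length-replicate; length-upTo; ++-assoc; ≡-dec; map-upTo; length-downFrom; ++-identityʳ; take++drop≡id; take-all; applyUpTo-∷ʳ; map-∘; map-cong; ∷-injective; map-++; map-id; map-cong-local; length-take; length-drop; length-zipWith; foldr-++)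
open import Data.List.Relation.Binary.Equality.Propositional using (≋⇒≡)
open import Data.List.Relation.Binary.Permutation.Propositional as Perm using (_↭_; ↭⇒↭ₛ)
import Data.List.Relation.Binary.Permutation.Propositional.Properties as Permₚ
open import Data.List.Relation.Unary.All as All using (All; []; _∷_; all?)
import Data.List.Relation.Unary.All.Properties as Allₚ
open import Data.List.Relation.Unary.AllPairs using (AllPairs; []; _∷_)
import Data.List.Relation.Unary.AllPairs.Properties as AllPairsₚ
open import Data.List.Relation.Unary.Any as Any using (here; there)
open import Data.List.Relation.Unary.Linked using (Linked; []; [-]; _∷_)
open import Data.List.Relation.Unary.Linked.Properties using (AllPairs⇒Linked; Linked⇒AllPairs)
open import Data.List.Relation.Unary.Sorted.TotalOrder.Properties using (↗↭↗⇒≋)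
open import Data.List.Relation.Unary.Unique.Propositional using (Unique)
import Data.List.Relation.Unary.Unique.Propositional.Properties as Uniqueₚ
open import Data.Maybe as Maybe using (Maybe; just; nothing)
open import Data.Nat as ℕ using (ℕ; zero; suc; z≤n; s≤s; _<ᵇ_; _≡ᵇ_)
import Data.Nat.Properties as ℕₚ
open import Data.Nat.DivMod using (_%_; _/_; m≡m%n+[m/n]*n; m%n<n; m<n⇒m%n≡m; [m+kn]%n≡m%n; n%n≡0; [m+n]%n≡m%n; %-distribˡ-+; m%n%n≡m%n)
open import Data.Nat.ListAction using (sum)
open import Data.Nat.ListAction.Properties using (sum-↭; sum-++)
open import Data.Nat.Solver using (module +-*-Solver)
open import Data.List.Membership.DecPropositional ℕ._≟_ using (_∈?_)
open import Data.List.Sort ℕₚ.≤-decTotalOrder using (sort; sort-↭; sort-↗)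
open import Data.Product using (_×_; _,_; proj₁; proj₂; ∃; ∃-syntax)
open import Data.Sum using (_⊎_; inj₁; inj₂)
open import Function using (_∘_; id)
open import Relation.Binary.Definitions using (Tri; tri<; tri≈; tri>)
open import Relation.Binary.PropositionalEquality as ≡ using (_≡_; _≢_)
open import Data.List.Relation.Binary.Permutation.Setoid.Properties (≡.setoid ℕ) using () renaming (Unique-resp-↭ to Unique-resp-↭ₛ)
import Relation.Binary.Reasoning.Setoid
open import Relation.Nullary using (¬_; yes; no; Dec; does)
open import Relation.Unary using (Decidable)

module BigOp {c ℓ : Level} (M : CommutativeMonoid c ℓ) where
  open CommutativeMonoid M
  open Relation.Binary.Reasoning.Setoid setoid

  private variable
    a b : Level
    A : Set a
    B : Set b

  big : List A → (A → Carrier) → Carrier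
  big [] f = ε
  big (x ∷ xs) f = f x ∙ big xs f

  bigN : ℕ → (ℕ → Carrier) → Carrier
  bigN zero f = ε
  bigN (suc n) f = f 0 ∙ bigN n (f ∘ suc)

  interchange : ∀ a b c d → (a ∙ b) ∙ (c ∙ d) ≈ (a ∙ c) ∙ (b ∙ d)
  interchange a b c d = trans (assoc a b _) (trans (∙-congˡ (trans (sym (assoc b c d))
    (trans (∙-congʳ (comm b c)) (assoc c b d)))) (sym (assoc a c _)))

  big-cong-All : ∀ {xs : List A} {f g} → All (λ x → f x ≈ g x) xs → big xs f ≈ big xs g
  big-cong-All [] = refl
  big-cong-All (e ∷ es) = ∙-cong e (big-cong-All es)

  big-cong : ∀ (xs : List A) {f g} → (∀ x → f x ≈ g x) → big xs f ≈ big xs g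
  big-cong [] e = refl
  big-cong (x ∷ xs) e = ∙-cong (e x) (big-cong xs e)

  big-ε : ∀ (xs : List A) {f} → (∀ x → f x ≈ ε) → big xs f ≈ ε
  big-ε [] e = refl
  big-ε (x ∷ xs) e = trans (∙-cong (e x) (big-ε xs e)) (identityˡ ε)

  big-∙ : ∀ (xs : List A) f g → big xs (λ x → f x ∙ g x) ≈ big xs f ∙ big xs g
  big-∙ [] f g = sym (identityˡ ε)
  big-∙ (x ∷ xs) f g = trans (∙-congˡ (big-∙ xs f g)) (interchange _ _ _ _)

  big-++ : ∀ (xs : List A) ys f → big (xs ++ ys) f ≈ big xs f ∙ big ys f
  big-++ [] ys f = sym (identityˡ _)
  big-++ (x ∷ xs) ys f = trans (∙-congˡ (big-++ xs ys f)) (sym (assoc _ _ _))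

  big-map : ∀ (h : A → B) xs f → big (map h xs) f ≈ big xs (f ∘ h)
  big-map h [] f = refl
  big-map h (x ∷ xs) f = ∙-congˡ (big-map h xs f)

  big-concatMap : ∀ (h : A → List B) xs f → big (concatMap h xs) f ≈ big xs (λ x → big (h x) f)
  big-concatMap h [] f = refl
  big-concatMap h (x ∷ xs) f = trans (big-++ (h x) _ f) (∙-congˡ (big-concatMap h xs f))

  big-↭ : ∀ {xs ys : List A} f → xs ↭ ys → big xs f ≈ big ys f
  big-↭ f Perm.refl = refl
  big-↭ f (Perm.prep x p) = ∙-congˡ (big-↭ f p)
  big-↭ f (Perm.swap x y p) = trans (sym (assoc _ _ _)) (trans (∙-cong (comm _ _) (big-↭ f p)) (assoc _ _ _))
  big-↭ f (Perm.trans p q) = trans (big-↭ f p) (big-↭ f q)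

  big-applyUpTo : ∀ (h : ℕ → A) n f → big (applyUpTo h n) f ≈ bigN n (f ∘ h)
  big-applyUpTo h zero f = refl
  big-applyUpTo h (suc n) f = ∙-congˡ (big-applyUpTo (h ∘ suc) n f)

  big-upTo : ∀ n f → big (upTo n) f ≈ bigN n f
  big-upTo n f = big-applyUpTo id n f

  bigN-cong : ∀ n {f g} → (∀ i → i ℕ.< n → f i ≈ g i) → bigN n f ≈ bigN n g
  bigN-cong zero e = refl
  bigN-cong (suc n) e = ∙-cong (e 0 (ℕ.s≤s ℕ.z≤n)) (bigN-cong n (λ i i<n → e (suc i) (ℕ.s≤s i<n)))

  bigN-ε : ∀ n {f} → (∀ i → i ℕ.< n → f i ≈ ε) → bigN n f ≈ ε
  bigN-ε zero e = refl
  bigN-ε (suc n) e = trans (∙-cong (e 0 (ℕ.s≤s ℕ.z≤n)) (bigN-ε n (λ i i<n → e (suc i) (ℕ.s≤s i<n)))) (identityˡ ε)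

  bigN-∙ : ∀ n f g → bigN n (λ x → f x ∙ g x) ≈ bigN n f ∙ bigN n g
  bigN-∙ zero f g = sym (identityˡ ε)
  bigN-∙ (suc n) f g = trans (∙-congˡ (bigN-∙ n _ _)) (interchange _ _ _ _)

  bigN-+ : ∀ m n f → bigN (m ℕ.+ n) f ≈ bigN m f ∙ bigN n (λ i → f (m ℕ.+ i))
  bigN-+ zero n f = sym (identityˡ _)
  bigN-+ (suc m) n f = trans (∙-congˡ (bigN-+ m n (f ∘ suc))) (sym (assoc _ _ _))

  bigN-snoc : ∀ n f → bigN (suc n) f ≈ bigN n f ∙ f n
  bigN-snoc zero f = trans (identityʳ _) (sym (identityˡ _))
  bigN-snoc (suc n) f = trans (∙-congˡ (bigN-snoc n (f ∘ suc))) (sym (assoc _ _ _))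

  bigN-reverse : ∀ m (f : ℕ → Carrier) → bigN m (λ i → f (m ℕ.∸ suc i)) ≈ bigN m f
  bigN-reverse zero f = refl
  bigN-reverse (suc m) f = trans (∙-congˡ (bigN-reverse m f)) (trans (comm _ _) (sym (bigN-snoc m f)))

  bigN-swap : ∀ m n (f : ℕ → ℕ → Carrier) → bigN m (λ i → bigN n (f i)) ≈ bigN n (λ j → bigN m (λ i → f i j))
  bigN-swap zero n f = sym (bigN-ε n (λ _ _ → refl))
  bigN-swap (suc m) n f = trans (∙-congˡ (bigN-swap m n (f ∘ suc))) (sym (bigN-∙ n (f 0) _))

  bigN-transpose : ∀ n k (f g : ℕ → Carrier) → suc k ℕ.< n → f k ≈ g (suc k) → f (suc k) ≈ g k →
    (∀ j → ¬ (j ≡ k) → ¬ (j ≡ suc k) → j ℕ.< n → f j ≈ g j) → bigN n f ≈ bigN n g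
  bigN-transpose (suc (suc n)) zero f g _ e e′ rest = trans (sym (assoc _ _ _))
    (trans (∙-cong (trans (comm _ _) (∙-cong e′ e)) (bigN-cong n λ i i<n → rest (suc (suc i)) (λ ()) (λ ()) (ℕ.s≤s (ℕ.s≤s i<n)))) (assoc _ _ _))
  bigN-transpose (suc zero) zero f g (ℕ.s≤s ()) e e′ rest
  bigN-transpose (suc n) (suc k) f g (ℕ.s≤s l) e e′ rest = ∙-cong (rest 0 (λ ()) (λ ()) (ℕ.s≤s ℕ.z≤n))
    (bigN-transpose n k (f ∘ suc) (g ∘ suc) l e e′ λ j n1 n2 j<n → rest (suc j) (n1 ∘ ℕₚ.suc-injective) (n2 ∘ ℕₚ.suc-injective) (ℕ.s≤s j<n))

  bigN-single : ∀ n k f → k ℕ.< n → (∀ i → i ℕ.< n → ¬ (i ≡ k) → f i ≈ ε) → bigN n f ≈ f k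
  bigN-single (suc n) zero f _ e = trans (∙-congˡ (bigN-ε n (λ i i<n → e (suc i) (ℕ.s≤s i<n) (λ ())))) (identityʳ _)
  bigN-single (suc n) (suc k) f (ℕ.s≤s k<n) e = trans (∙-cong (e 0 (ℕ.s≤s ℕ.z≤n) (λ ()))
    (bigN-single n k (f ∘ suc) k<n (λ i i<n i≢k → e (suc i) (ℕ.s≤s i<n) (i≢k ∘ ℕₚ.suc-injective)))) (identityˡ _)

module RingTools {c ℓ : Level} (R : CommutativeRing c ℓ) where
  open CommutativeRing R
  open Algebra.Properties.Ring ring using (-‿distribˡ-*; -‿distribʳ-*; -‿involutive; -‿+-comm; -0#≈0#; x+x≈x⇒x≈0) public
  open Algebra.Properties.Semiring.Mult.TCOptimised semiring using (×-homo-+; ×1-homo-*) renaming (_×_ to _×ₙ_)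
  open Relation.Binary.Reasoning.Setoid setoid

  private
    norm : ℕ × ℕ → ℕ × ℕ
    norm (a , b) = (a ℕ.∸ b , b ℕ.∸ a)

    -- Integer coefficients for the ring solver: (a , b) stands for a − b.
    DiffRing : RawRing _ _
    DiffRing = record
      { Carrier = ℕ × ℕ
      ; _≈_ = _≡_
      ; _+_ = λ (a , b) (a′ , b′) → norm (a ℕ.+ a′ , b ℕ.+ b′)
      ; _*_ = λ (a , b) (a′ , b′) → norm (a ℕ.* a′ ℕ.+ b ℕ.* b′ , a ℕ.* b′ ℕ.+ b ℕ.* a′)
      ; -_ = λ (a , b) → (b , a)
      ; 0# = (0 , 0)
      ; 1# = (1 , 0)
      }

    ⟦_⟧ᵈ : ℕ × ℕ → Carrier
    ⟦ (a , 0) ⟧ᵈ = a ×ₙ 1#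
    ⟦ (a , suc b) ⟧ᵈ = a ×ₙ 1# + - (suc b ×ₙ 1#)

    ⟦⟧≈ : ∀ a b → ⟦ (a , b) ⟧ᵈ ≈ a ×ₙ 1# + - (b ×ₙ 1#)
    ⟦⟧≈ a zero = sym (trans (+-congˡ -0#≈0#) (+-identityʳ _))
    ⟦⟧≈ a (suc b) = refl

    module NS = Algebra.Solver.Ring.NaturalCoefficients.Default commutativeSemiring

    mulDiff : ∀ a b c d → a * c + b * d + - (a * d + b * c) ≈ (a + - b) * (c + - d)
    mulDiff a b c d = begin
      a * c + b * d + - (a * d + b * c)
        ≈⟨ +-cong (+-congˡ bd) (trans (sym (-‿+-comm _ _)) (+-cong (-‿distribʳ-* a d) (-‿distribˡ-* b c))) ⟩
      a * c + - b * - d + (a * - d + - b * c)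
        ≈⟨ NS.solve 4 (λ a b c d → a NS.:* c NS.:+ b NS.:* d NS.:+ (a NS.:* d NS.:+ b NS.:* c) NS.:= (a NS.:+ b) NS.:* (c NS.:+ d)) refl a (- b) c (- d) ⟩
      (a + - b) * (c + - d) ∎
      where
      bd : b * d ≈ - b * - d
      bd = trans (sym (-‿involutive _)) (trans (-‿cong (-‿distribˡ-* b d)) (-‿distribʳ-* (- b) d))

    addDiff : ∀ a b c d → a + c + - (b + d) ≈ (a + - b) + (c + - d)
    addDiff a b c d = trans (+-congˡ (sym (-‿+-comm b d)))
      (NS.solve 4 (λ a b c d → a NS.:+ c NS.:+ (b NS.:+ d) NS.:= (a NS.:+ b) NS.:+ (c NS.:+ d)) refl a (- b) c (- d))

    ×ₙ-diff : ∀ a b a′ b′ → a ℕ.+ b′ ≡ a′ ℕ.+ b → ⟦ (a , b) ⟧ᵈ ≈ ⟦ (a′ , b′) ⟧ᵈ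
    ×ₙ-diff a b a′ b′ eq = trans (⟦⟧≈ a b) (trans (lem _ _ _ _ (trans (sym (×-homo-+ 1# a b′)) (trans (reflexive (≡.cong (_×ₙ 1#) eq)) (×-homo-+ 1# a′ b)))) (sym (⟦⟧≈ a′ b′)))
      where
      lem : ∀ a b c d → a + d ≈ c + b → a + - b ≈ c + - d
      lem a b c d e = begin
        a + - b ≈⟨ +-congʳ (sym (trans (+-assoc _ _ _) (trans (+-congˡ (-‿inverseʳ d)) (+-identityʳ a)))) ⟩
        a + d + - d + - b ≈⟨ +-congʳ (+-congʳ e) ⟩
        c + b + - d + - b ≈⟨ NS.solve 4 (λ c b d b′ → c NS.:+ b NS.:+ d NS.:+ b′ NS.:= c NS.:+ d NS.:+ (b NS.:+ b′)) refl c b (- d) (- b) ⟩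
        c + - d + (b + - b) ≈⟨ trans (+-congˡ (-‿inverseʳ b)) (+-identityʳ _) ⟩
        c + - d ∎

    norm-≈ : ∀ a b → ⟦ norm (a , b) ⟧ᵈ ≈ a ×ₙ 1# + - (b ×ₙ 1#)
    norm-≈ a b = trans (×ₙ-diff (a ℕ.∸ b) (b ℕ.∸ a) a b (e a b)) (⟦⟧≈ a b)
      where
      e : ∀ a b → a ℕ.∸ b ℕ.+ b ≡ a ℕ.+ (b ℕ.∸ a)
      e zero zero = ≡.refl
      e zero (suc b) = ≡.refl
      e (suc a) zero = ≡.refl
      e (suc a) (suc b) = ≡.trans (ℕₚ.+-suc _ b) (≡.cong suc (e a b))

    morph : DiffRing ACR.-Raw-AlmostCommutative⟶ ACR.fromCommutativeRing R
    morph = record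
      { ⟦_⟧ = ⟦_⟧ᵈ
      ; +-homo = λ (a , b) (a′ , b′) → trans (norm-≈ (a ℕ.+ a′) (b ℕ.+ b′))
          (trans (+-cong (×-homo-+ 1# a a′) (-‿cong (×-homo-+ 1# b b′)))
          (trans (addDiff _ _ _ _) (sym (+-cong (⟦⟧≈ a b) (⟦⟧≈ a′ b′)))))
      ; *-homo = λ (a , b) (a′ , b′) → trans (norm-≈ (a ℕ.* a′ ℕ.+ b ℕ.* b′) _)
          (trans (+-cong (hom a a′ b b′) (-‿cong (hom a b′ b a′)))
          (trans (mulDiff _ _ _ _) (sym (*-cong (⟦⟧≈ a b) (⟦⟧≈ a′ b′)))))
      ; -‿homo = λ (a , b) → trans (⟦⟧≈ b a) (trans (+-comm _ _) (trans (+-congˡ (sym (-‿involutive _)))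
          (trans (-‿+-comm _ _) (-‿cong (sym (⟦⟧≈ a b))))))
      ; 0-homo = refl
      ; 1-homo = refl
      }
      where
      hom : ∀ a a′ b b′ → (a ℕ.* a′ ℕ.+ b ℕ.* b′) ×ₙ 1# ≈ a ×ₙ 1# * a′ ×ₙ 1# + b ×ₙ 1# * b′ ×ₙ 1#
      hom a a′ b b′ = trans (×-homo-+ 1# (a ℕ.* a′) (b ℕ.* b′)) (+-cong (×1-homo-* a a′) (×1-homo-* b b′))

    diff≟ : ∀ x y → Maybe (⟦ x ⟧ᵈ ≈ ⟦ y ⟧ᵈ)
    diff≟ (a , b) (a′ , b′) with a ℕ.+ b′ ℕ.≟ a′ ℕ.+ b
    ... | no _ = nothing
    ... | yes eq = just (×ₙ-diff a b a′ b′ eq)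

  open Algebra.Solver.Ring DiffRing (ACR.fromCommutativeRing R) morph diff≟ public
    using (solve; _:=_; _:+_; _:*_; :-_; _:-_; con; _:^_; Polynomial)

  :1 : ∀ {m} → Polynomial m
  :1 = con (1 , 0)

  :0 : ∀ {m} → Polynomial m
  :0 = con (0 , 0)

  module Sum = BigOp +-commutativeMonoid
  module Prod = BigOp *-commutativeMonoid
  open Sum public using () renaming (big to sumL; bigN to sumN)
  open Prod public using () renaming (big to prodL; bigN to prodN)

  private variable
    a : Level
    A : Set a

  sumL-*ˡ : ∀ (xs : List A) a f → a * sumL xs f ≈ sumL xs (λ x → a * f x)
  sumL-*ˡ [] a f = zeroʳ a
  sumL-*ˡ (x ∷ xs) a f = trans (distribˡ a _ _) (+-congˡ (sumL-*ˡ xs a f))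

  sumL-- : ∀ (xs : List A) f → - sumL xs f ≈ sumL xs (λ x → - f x)
  sumL-- [] f = -0#≈0#
  sumL-- (x ∷ xs) f = trans (sym (-‿+-comm _ _)) (+-congˡ (sumL-- xs f))

  sumN-*ˡ : ∀ n a f → a * sumN n f ≈ sumN n (λ x → a * f x)
  sumN-*ˡ zero a f = zeroʳ a
  sumN-*ˡ (suc n) a f = trans (distribˡ a _ _) (+-congˡ (sumN-*ˡ n a (f ∘ suc)))

  sumN-- : ∀ n f → - sumN n f ≈ sumN n (λ x → - f x)
  sumN-- zero f = -0#≈0#
  sumN-- (suc n) f = trans (sym (-‿+-comm _ _)) (+-congˡ (sumN-- n (f ∘ suc)))

  open Poly R using (pow; fromℕ)

  pow-+ : ∀ x m n → pow x (m ℕ.+ n) ≈ pow x m * pow x n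
  pow-+ x zero n = sym (*-identityˡ _)
  pow-+ x (suc m) n = trans (*-congˡ (pow-+ x m n)) (sym (*-assoc _ _ _))

  pow-cong : ∀ {x y} n → x ≈ y → pow x n ≈ pow y n
  pow-cong zero e = refl
  pow-cong (suc n) e = *-cong e (pow-cong n e)

  pow-* : ∀ x y n → pow (x * y) n ≈ pow x n * pow y n
  pow-* x y zero = sym (*-identityˡ _)
  pow-* x y (suc n) = trans (*-congˡ (pow-* x y n)) (solve 4 (λ x y a b → x :* y :* (a :* b) := x :* a :* (y :* b)) refl x y _ _)

  pow-1 : ∀ n → pow 1# n ≈ 1#
  pow-1 zero = refl
  pow-1 (suc n) = trans (*-identityˡ _) (pow-1 n)

  qnum : Carrier → ℕ → Carrier
  qnum q zero = 0#
  qnum q (suc n) = 1# + q * qnum q n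

  qfac : Carrier → ℕ → Carrier
  qfac q zero = 1#
  qfac q (suc n) = qnum q (suc n) * qfac q n

  qnum-+ : ∀ q m n → qnum q (m ℕ.+ n) ≈ qnum q m + pow q m * qnum q n
  qnum-+ q zero n = solve 1 (λ x → x := :0 :+ :1 :* x) refl _
  qnum-+ q (suc m) n = trans (+-congˡ (*-congˡ (qnum-+ q m n)))
    (solve 4 (λ q a p b → :1 :+ q :* (a :+ p :* b) := :1 :+ q :* a :+ q :* p :* b) refl q _ _ _)

  qnum-suc : ∀ q n → qnum q (suc n) ≈ qnum q n + pow q n
  qnum-suc q zero = solve 1 (λ q → :1 :+ q :* :0 := :0 :+ :1) refl q
  qnum-suc q (suc n) = trans (+-congˡ (*-congˡ (qnum-suc q n)))
    (solve 3 (λ q a p → :1 :+ q :* (a :+ p) := :1 :+ q :* a :+ q :* p) refl q _ _)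

  1-q*qnum : ∀ q n → (1# + - q) * qnum q n ≈ 1# + - pow q n
  1-q*qnum q zero = solve 1 (λ q → (:1 :- q) :* :0 := :1 :- :1) refl q
  1-q*qnum q (suc n) = begin
    (1# + - q) * (1# + q * qnum q n) ≈⟨ solve 2 (λ q a → (:1 :- q) :* (:1 :+ q :* a) := :1 :- q :+ q :* ((:1 :- q) :* a)) refl q _ ⟩
    1# + - q + q * ((1# + - q) * qnum q n) ≈⟨ +-congˡ (*-congˡ (1-q*qnum q n)) ⟩
    1# + - q + q * (1# + - pow q n) ≈⟨ solve 2 (λ q a → :1 :- q :+ q :* (:1 :- a) := :1 :- q :* a) refl q _ ⟩
    1# + - (q * pow q n) ∎

module Permutations where
  open import Data.Bool using (T)
  open import Data.Nat using (_+_; _*_; _∸_; _<_; _≤_)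
  open ≡ using (refl; sym; trans; cong; cong₂; subst; subst₂; module ≡-Reasoning)

  Unique-resp-↭ : ∀ {xs ys : List ℕ} → xs ↭ ys → Unique xs → Unique ys
  Unique-resp-↭ p = Unique-resp-↭ₛ (↭⇒↭ₛ p)

  length-setAt : ∀ i v α → length (setAt i v α) ≡ length α
  length-setAt i v [] = refl
  length-setAt zero v (a ∷ α) = refl
  length-setAt (suc i) v (a ∷ α) = cong suc (length-setAt i v α)

  length-swapAt : ∀ i α → length (swapAt i α) ≡ length α
  length-swapAt zero [] = refl
  length-swapAt zero (a ∷ []) = refl
  length-swapAt zero (a ∷ b ∷ α) = refl
  length-swapAt (suc i) [] = refl
  length-swapAt (suc i) (a ∷ α) = cong suc (length-swapAt i α)

  swapAt-involutive : ∀ i α → swapAt i (swapAt i α) ≡ α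
  swapAt-involutive zero [] = refl
  swapAt-involutive zero (a ∷ []) = refl
  swapAt-involutive zero (a ∷ b ∷ α) = refl
  swapAt-involutive (suc i) [] = refl
  swapAt-involutive (suc i) (a ∷ α) = cong (a ∷_) (swapAt-involutive i α)

  swapAt-↭ : ∀ i α → swapAt i α ↭ α
  swapAt-↭ zero [] = Perm.refl
  swapAt-↭ zero (a ∷ []) = Perm.refl
  swapAt-↭ zero (a ∷ b ∷ α) = Perm.swap b a Perm.refl
  swapAt-↭ (suc i) [] = Perm.refl
  swapAt-↭ (suc i) (a ∷ α) = Perm.prep a (swapAt-↭ i α)

  at-setAt : ∀ i v α → i < length α → at (setAt i v α) i ≡ v
  at-setAt zero v (a ∷ α) _ = refl
  at-setAt (suc i) v (a ∷ α) (s≤s l) = at-setAt i v α l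

  at-setAt-≢ : ∀ i j v α → i ≢ j → at (setAt i v α) j ≡ at α j
  at-setAt-≢ i j v [] ne = refl
  at-setAt-≢ zero zero v (a ∷ α) ne = ⊥-elim (ne refl)
  at-setAt-≢ zero (suc j) v (a ∷ α) ne = refl
  at-setAt-≢ (suc i) zero v (a ∷ α) ne = refl
  at-setAt-≢ (suc i) (suc j) v (a ∷ α) ne = at-setAt-≢ i j v α (ne ∘ cong suc)

  setAt-setAt : ∀ i v w α → setAt i v (setAt i w α) ≡ setAt i v α
  setAt-setAt i v w [] = refl
  setAt-setAt zero v w (a ∷ α) = refl
  setAt-setAt (suc i) v w (a ∷ α) = cong (a ∷_) (setAt-setAt i v w α)

  setAt-at : ∀ i α → setAt i (at α i) α ≡ α
  setAt-at i [] = refl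
  setAt-at zero (a ∷ α) = refl
  setAt-at (suc i) (a ∷ α) = cong (a ∷_) (setAt-at i α)

  setAt-at≡ : ∀ i v α → at α i ≡ v → setAt i v α ≡ α
  setAt-at≡ i v α refl = setAt-at i α

  sum-setAt : ∀ i v α → i < length α → sum (setAt i v α) + at α i ≡ sum α + v
  sum-setAt zero v (a ∷ α) _ = trans (ℕₚ.+-comm (v + sum α) a) (trans (cong (a +_) (ℕₚ.+-comm v (sum α))) (sym (ℕₚ.+-assoc a (sum α) v)))
  sum-setAt (suc i) v (a ∷ α) (s≤s l) = trans (ℕₚ.+-assoc a _ _) (trans (cong (a +_) (sum-setAt i v α l)) (sym (ℕₚ.+-assoc a _ _)))

  sum-swapAt : ∀ i α → sum (swapAt i α) ≡ sum α
  sum-swapAt zero [] = refl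
  sum-swapAt zero (a ∷ []) = refl
  sum-swapAt zero (a ∷ b ∷ α) = trans (sym (ℕₚ.+-assoc b a _)) (trans (cong (_+ sum α) (ℕₚ.+-comm b a)) (ℕₚ.+-assoc a b _))
  sum-swapAt (suc i) [] = refl
  sum-swapAt (suc i) (a ∷ α) = cong (a +_) (sum-swapAt i α)

  quoM : ℕ → ℕ → List ℕ → ℕ → List ℕ
  quoM i j α m = setAt i m (setAt j (at α j + (at α i ∸ 1 ∸ m)) α)

  length-quoM : ∀ i j α m → length (quoM i j α m) ≡ length α
  length-quoM i j α m = trans (length-setAt i m (setAt j (at α j + (at α i ∸ 1 ∸ m)) α)) (length-setAt j _ α)

  sum-quoM : ∀ i j α m → i ≢ j → i < length α → j < length α → m < at α i → suc (sum (quoM i j α m)) ≡ sum α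
  sum-quoM i j α m i≢j i<n j<n m<a = ℕₚ.+-cancelʳ-≡ (at α i + at α j) _ _ (begin
    suc (sum (quoM i j α m)) + (at α i + at α j) ≡⟨ cong suc (sym (ℕₚ.+-assoc _ (at α i) (at α j))) ⟩
    suc (sum (quoM i j α m) + at α i + at α j) ≡⟨ cong (λ z → suc (sum (quoM i j α m) + z + at α j)) (sym (at-setAt-≢ j i v α (i≢j ∘ sym))) ⟩
    suc (sum (quoM i j α m) + at (setAt j v α) i + at α j) ≡⟨ cong (λ z → suc (z + at α j)) (sum-setAt i m (setAt j v α) (subst (i <_) (sym (length-setAt j v α)) i<n)) ⟩
    suc (sum (setAt j v α) + m + at α j) ≡⟨ cong suc (swp (sum (setAt j v α)) m (at α j)) ⟩
    suc (sum (setAt j v α) + at α j + m) ≡⟨ cong (λ z → suc (z + m)) (sum-setAt j v α j<n) ⟩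
    suc (sum α + v + m) ≡⟨ lem (sum α) (at α j) (at α i) m<a ⟩
    sum α + (at α i + at α j) ∎)
    where
    open ≡-Reasoning
    v : ℕ
    v = at α j + (at α i ∸ 1 ∸ m)
    swp : ∀ a b c → a + b + c ≡ a + c + b
    swp a b c = trans (ℕₚ.+-assoc a b c) (trans (cong (a +_) (ℕₚ.+-comm b c)) (sym (ℕₚ.+-assoc a c b)))
    lem : ∀ s b a → m < a → suc (s + (b + (a ∸ 1 ∸ m)) + m) ≡ s + (a + b)
    lem s b (suc a) (s≤s m≤a) = begin
      suc (s + (b + (a ∸ m)) + m) ≡⟨ cong suc (ℕₚ.+-assoc s _ m) ⟩
      suc (s + ((b + (a ∸ m)) + m)) ≡⟨ cong (λ z → suc (s + z)) (trans (ℕₚ.+-assoc b _ m) (cong (b +_) (ℕₚ.m∸n+n≡m m≤a))) ⟩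
      suc (s + (b + a)) ≡⟨ cong (λ z → suc (s + z)) (ℕₚ.+-comm b a) ⟩
      suc (s + (a + b)) ≡⟨ sym (ℕₚ.+-suc s (a + b)) ⟩
      s + suc (a + b) ∎

  suc-setAt : ℕ → List ℕ → List ℕ
  suc-setAt i β = setAt i (suc (at β i)) β

  -- With β_j = 0, the monomial x^β occurs in the quotient of x^α by x_i − x_j
  -- only through the term of highest degree in x_i.
  quoM-inv : ∀ i j α β m → i ≢ j → i < length α → j < length α → m < at α i → at β j ≡ 0 →
    β ≡ quoM i j α m → α ≡ suc-setAt i β
  quoM-inv i j α β m i≢j i<n j<n m<a βj refl = sym (begin
    setAt i (suc (at (setAt i m γ) i)) (setAt i m γ) ≡⟨ setAt-setAt i _ m γ ⟩
    setAt i (suc (at (setAt i m γ) i)) γ ≡⟨ cong₂ (λ z w → setAt i (suc z) w) (at-setAt i m γ i<γ) γ≡α ⟩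
    setAt i (suc m) α ≡⟨ setAt-at≡ i (suc m) α (ai m<a (ℕₚ.m+n≡0⇒n≡0 (at α j) v≡0)) ⟩
    α ∎)
    where
    open ≡-Reasoning
    v : ℕ
    v = at α j + (at α i ∸ 1 ∸ m)
    γ : List ℕ
    γ = setAt j v α
    i<γ : i < length γ
    i<γ = subst (i <_) (sym (length-setAt j v α)) i<n
    v≡0 : v ≡ 0
    v≡0 = trans (sym (at-setAt j v α j<n)) (trans (sym (at-setAt-≢ i j m γ i≢j)) βj)
    γ≡α : γ ≡ α
    γ≡α = setAt-at≡ j v α (trans (ℕₚ.m+n≡0⇒m≡0 (at α j) v≡0) (sym v≡0))
    ai : ∀ {a} → m < a → a ∸ 1 ∸ m ≡ 0 → a ≡ suc m
    ai {suc a} (s≤s m≤a) e = cong suc (ℕₚ.≤-antisym (ℕₚ.m∸n≡0⇒m≤n e) m≤a)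

  quoM-top : ∀ i j β → i ≢ j → at β j ≡ 0 → i < length β → quoM i j (suc-setAt i β) (at β i) ≡ β
  quoM-top i j β i≢j βj i<n = begin
    setAt i b (setAt j (at α j + (at α i ∸ 1 ∸ b)) α) ≡⟨ cong (λ z → setAt i b (setAt j z α)) v≡ ⟩
    setAt i b (setAt j 0 α) ≡⟨ cong (setAt i b) (setAt-at≡ j 0 α αj) ⟩
    setAt i b (setAt i (suc b) β) ≡⟨ setAt-setAt i b _ β ⟩
    setAt i b β ≡⟨ setAt-at i β ⟩
    β ∎
    where
    open ≡-Reasoning
    b : ℕ
    b = at β i
    α : List ℕ
    α = suc-setAt i β
    αj : at α j ≡ 0
    αj = trans (at-setAt-≢ i j _ β i≢j) βj
    v≡ : at α j + (at α i ∸ 1 ∸ b) ≡ 0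
    v≡ = cong₂ _+_ αj (trans (cong (λ z → z ∸ 1 ∸ b) (at-setAt i (suc b) β i<n)) (ℕₚ.n∸n≡0 b))

  map-suc-downFrom : ∀ j → map suc (downFrom j) ++ 0 ∷ [] ≡ downFrom (suc j)
  map-suc-downFrom zero = refl
  map-suc-downFrom (suc j) = cong (suc j ∷_) (map-suc-downFrom j)

  setAt-++ : ∀ P m M v → setAt (length P) v (P ++ m ∷ M) ≡ P ++ v ∷ M
  setAt-++ [] m M v = refl
  setAt-++ (a ∷ P) m M v = cong (a ∷_) (setAt-++ P m M v)

  at-++ : ∀ P m M → at (P ++ m ∷ M) (length P) ≡ m
  at-++ [] m M = refl
  at-++ (a ∷ P) m M = at-++ P m M

  <ᵇ-true : ∀ {a b} → a < b → (a <ᵇ b) ≡ true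
  <ᵇ-true {zero} {suc b} _ = refl
  <ᵇ-true {suc a} {suc b} (s≤s l) = <ᵇ-true l

  <ᵇ-false : ∀ {a b} → b ≤ a → (a <ᵇ b) ≡ false
  <ᵇ-false {a} {zero} _ = refl
  <ᵇ-false {suc a} {suc b} (s≤s l) = <ᵇ-false l

  ≡ᵇ-true : ∀ a → (a ≡ᵇ a) ≡ true
  ≡ᵇ-true zero = refl
  ≡ᵇ-true (suc a) = ≡ᵇ-true a

  ≡ᵇ-false : ∀ {a b} → a ≢ b → (a ≡ᵇ b) ≡ false
  ≡ᵇ-false {zero} {zero} ne = ⊥-elim (ne refl)
  ≡ᵇ-false {zero} {suc b} ne = refl
  ≡ᵇ-false {suc a} {zero} ne = refl
  ≡ᵇ-false {suc a} {suc b} ne = ≡ᵇ-false (ne ∘ cong suc)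

  countLess-swapAt : ∀ x i α → countLess x (swapAt i α) ≡ countLess x α
  countLess-swapAt x zero [] = refl
  countLess-swapAt x zero (a ∷ []) = refl
  countLess-swapAt x zero (a ∷ b ∷ α) = trans (sym (ℕₚ.+-assoc B A _)) (trans (cong (_+ countLess x α) (ℕₚ.+-comm B A)) (ℕₚ.+-assoc A B _))
    where
    A B : ℕ
    A = if a <ᵇ x then 1 else 0
    B = if b <ᵇ x then 1 else 0
  countLess-swapAt x (suc i) [] = refl
  countLess-swapAt x (suc i) (a ∷ α) = cong (_ +_) (countLess-swapAt x i α)

  len-swapAt-ascent : ∀ i w → suc i < length w → at w i < at w (suc i) → len (swapAt i w) ≡ suc (len w)
  len-swapAt-ascent zero (a ∷ b ∷ w) _ a<b rewrite <ᵇ-true a<b | <ᵇ-false {b} {a} (ℕₚ.<⇒≤ a<b) =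
    cong suc (trans (sym (ℕₚ.+-assoc (countLess b w) (countLess a w) _)) (trans (cong (_+ len w) (ℕₚ.+-comm (countLess b w) (countLess a w))) (ℕₚ.+-assoc (countLess a w) _ _)))
  len-swapAt-ascent zero (a ∷ []) (s≤s ()) _
  len-swapAt-ascent (suc i) (a ∷ w) (s≤s l) asc = trans (cong₂ _+_ (countLess-swapAt a i w) (len-swapAt-ascent i w l asc)) (ℕₚ.+-suc _ _)

  at-swapAt-fst : ∀ i w → suc i < length w → at (swapAt i w) i ≡ at w (suc i)
  at-swapAt-fst zero (a ∷ b ∷ w) _ = refl
  at-swapAt-fst zero (a ∷ []) (s≤s ())
  at-swapAt-fst (suc i) (a ∷ w) (s≤s l) = at-swapAt-fst i w l

  at-swapAt-snd : ∀ i w → suc i < length w → at (swapAt i w) (suc i) ≡ at w i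
  at-swapAt-snd zero (a ∷ b ∷ w) _ = refl
  at-swapAt-snd zero (a ∷ []) (s≤s ())
  at-swapAt-snd (suc i) (a ∷ w) (s≤s l) = at-swapAt-snd i w l

  at-swapAt-other : ∀ i j w → j ≢ i → j ≢ suc i → at (swapAt i w) j ≡ at w j
  at-swapAt-other zero j [] _ _ = refl
  at-swapAt-other zero j (a ∷ []) _ _ = refl
  at-swapAt-other zero zero (a ∷ b ∷ w) ne _ = ⊥-elim (ne refl)
  at-swapAt-other zero (suc zero) (a ∷ b ∷ w) _ ne = ⊥-elim (ne refl)
  at-swapAt-other zero (suc (suc j)) (a ∷ b ∷ w) _ _ = refl
  at-swapAt-other (suc i) j [] _ _ = refl
  at-swapAt-other (suc i) zero (a ∷ w) _ _ = refl
  at-swapAt-other (suc i) (suc j) (a ∷ w) ne ne′ = at-swapAt-other i j w (ne ∘ cong suc) (ne′ ∘ cong suc)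

  len-swapAt-descent : ∀ i w → suc i < length w → at w (suc i) < at w i → len w ≡ suc (len (swapAt i w))
  len-swapAt-descent i w l desc = trans (cong len (sym (swapAt-involutive i w)))
    (len-swapAt-ascent i (swapAt i w) (subst (suc i <_) (sym (length-swapAt i w)) l)
      (subst (_< at (swapAt i w) (suc i)) (sym (at-swapAt-fst i w l)) (subst (at w (suc i) <_) (sym (at-swapAt-snd i w l)) desc)))

  actL : ℕ → List ℕ → List ℕ → List ℕ
  actL n σ α = map (λ k → at α (indexOf k σ)) (upTo n)

  at-swap-indexOf : ∀ k v σ α → length σ ≡ length α → at σ k ≢ at σ (suc k) → suc k < length σ →
    at (swapAt k α) (indexOf v σ) ≡ at α (indexOf v (swapAt k σ))
  at-swap-indexOf zero v (a ∷ b ∷ σ) (x ∷ y ∷ α) e ne l with v ℕ.≟ a | v ℕ.≟ b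
  ... | yes refl | yes refl = ⊥-elim (ne refl)
  ... | yes refl | no v≢b rewrite ≡ᵇ-true v | ≡ᵇ-false v≢b = refl
  ... | no v≢a | yes refl rewrite ≡ᵇ-true v | ≡ᵇ-false v≢a = refl
  ... | no v≢a | no v≢b rewrite ≡ᵇ-false v≢a | ≡ᵇ-false v≢b = refl
  at-swap-indexOf zero v (a ∷ []) α e ne (s≤s ())
  at-swap-indexOf zero v (a ∷ b ∷ σ) (x ∷ []) () ne l
  at-swap-indexOf (suc k) v (a ∷ σ) (x ∷ α) e ne (s≤s l) with v ≡ᵇ a
  ... | true = refl
  ... | false = at-swap-indexOf k v σ α (ℕₚ.suc-injective e) ne l

  insAt : ℕ → ℕ → List ℕ → List ℕ
  insAt zero a σ = a ∷ σ
  insAt (suc j) a [] = a ∷ []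
  insAt (suc j) a (b ∷ σ) = b ∷ insAt j a σ

  swapAt-insAt-< : ∀ j k a σ → j ≤ k → swapAt (suc k) (insAt j a σ) ≡ insAt j a (swapAt k σ)
  swapAt-insAt-< zero k a σ _ = refl
  swapAt-insAt-< (suc j) (suc k) a [] l = refl
  swapAt-insAt-< (suc j) (suc k) a (b ∷ σ) (s≤s l) = cong (b ∷_) (swapAt-insAt-< j k a σ l)

  swapAt-insAt-> : ∀ j k a σ → suc k < j → suc k < length σ → swapAt k (insAt j a σ) ≡ insAt j a (swapAt k σ)
  swapAt-insAt-> (suc (suc j)) zero a (b ∷ d ∷ σ) _ _ = refl
  swapAt-insAt-> (suc (suc j)) zero a (b ∷ []) _ (s≤s ())
  swapAt-insAt-> (suc zero) zero a σ (s≤s ()) _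
  swapAt-insAt-> (suc j) (suc k) a (b ∷ σ) (s≤s l) (s≤s l′) = cong (b ∷_) (swapAt-insAt-> j k a σ l l′)

  swapAt-insAt-≡ : ∀ k a σ → k < length σ → swapAt k (insAt k a σ) ≡ insAt (suc k) a σ
  swapAt-insAt-≡ zero a (b ∷ σ) _ = refl
  swapAt-insAt-≡ (suc k) a (b ∷ σ) (s≤s l) = cong (b ∷_) (swapAt-insAt-≡ k a σ l)

  swapAt-insAt-suc : ∀ k a σ → k < length σ → swapAt k (insAt (suc k) a σ) ≡ insAt k a σ
  swapAt-insAt-suc k a σ l = trans (cong (swapAt k) (sym (swapAt-insAt-≡ k a σ l))) (swapAt-involutive k _)

  firstAscentFrom : ℕ → List ℕ → Maybe ℕ
  firstAscentFrom a [] = nothing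
  firstAscentFrom a (b ∷ ys) = if a <ᵇ b then just 0 else Maybe.map suc (firstAscentFrom b ys)

  -- The local functions `go` of Defs cannot be named and carry the arguments of their parent.
  -- In each mutual block below, `with` generalises those arguments, so that `_` is solved by `go`.

  mutual
    firstAscent-go : ∀ (a : ℕ) (zs : List ℕ) (b : ℕ) (ys : List ℕ) → _ ≡ Maybe.map suc (firstAscentFrom b ys)

    firstAscent≡ : ∀ a xs → firstAscent (a ∷ xs) ≡ firstAscentFrom a xs
    firstAscent≡ a [] = refl
    firstAscent≡ a (b ∷ ys) with a <ᵇ b
    ... | true = refl
    ... | false with b List.∷ ys
    ... | zs = firstAscent-go a zs b ys

    firstAscent-go a zs b [] = refl
    firstAscent-go a zs b (c ∷ ys) with b <ᵇ c
    ... | true = refl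
    ... | false = cong (Maybe.map suc) (firstAscent-go a zs c ys)

  comajFrom : ℕ → List ℕ → ℕ
  comajFrom i [] = 0
  comajFrom i (x ∷ []) = 0
  comajFrom i (x ∷ y ∷ ys) = (if x <ᵇ y then i else 0) + comajFrom (suc i) (y ∷ ys)

  mutual
    comaj-go : ∀ (zs : List ℕ) (i : ℕ) (ys : List ℕ) → _ ≡ comajFrom i ys

    comaj≡ : ∀ xs → comaj xs ≡ comajFrom 1 xs
    comaj≡ [] = refl
    comaj≡ (x ∷ []) = refl
    comaj≡ (x ∷ y ∷ ys) with x List.∷ y List.∷ ys
    ... | zs with y List.∷ ys | 2
    ... | ys′ | k = cong ((if x <ᵇ y then 1 else 0) +_) (comaj-go zs k ys′)

    comaj-go zs i [] = refl
    comaj-go zs i (x ∷ []) = refl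
    comaj-go zs i (x ∷ y ∷ ys) = cong ((if x <ᵇ y then i else 0) +_) (comaj-go zs (suc i) (y ∷ ys))

  wordProdFrom : List ℕ → List ℕ → List ℕ
  wordProdFrom w [] = w
  wordProdFrom w (i ∷ is) = wordProdFrom (swapAt (i ∸ 1) w) is

  mutual
    wordProd-go : ∀ (n : ℕ) (zs : List ℕ) (w ys : List ℕ) → _ ≡ wordProdFrom w ys

    wordProd≡ : ∀ n a → wordProd n a ≡ wordProdFrom (upTo n) a
    wordProd≡ n [] = refl
    wordProd≡ n (i ∷ is) with i List.∷ is | swapAt (i ∸ 1) (upTo n)
    ... | zs | w = wordProd-go n zs w is

    wordProd-go n zs w [] = refl
    wordProd-go n zs w (i ∷ is) = wordProd-go n zs (swapAt (i ∸ 1) w) is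

  transpose : ℕ → ℕ → ℕ
  transpose zero zero = 1
  transpose zero (suc zero) = 0
  transpose zero (suc (suc j)) = suc (suc j)
  transpose (suc k) zero = 0
  transpose (suc k) (suc j) = suc (transpose k j)

  transpose-fst : ∀ k → transpose k k ≡ suc k
  transpose-fst zero = refl
  transpose-fst (suc k) = cong suc (transpose-fst k)

  transpose-snd : ∀ k → transpose k (suc k) ≡ k
  transpose-snd zero = refl
  transpose-snd (suc k) = cong suc (transpose-snd k)

  transpose-other : ∀ k j → j ≢ k → j ≢ suc k → transpose k j ≡ j
  transpose-other zero zero n _ = ⊥-elim (n refl)
  transpose-other zero (suc zero) _ n = ⊥-elim (n refl)
  transpose-other zero (suc (suc j)) _ _ = refl
  transpose-other (suc k) zero _ _ = refl
  transpose-other (suc k) (suc j) n n′ = cong suc (transpose-other k j (n ∘ cong suc) (n′ ∘ cong suc))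

  transpose-+ : ∀ i k j → transpose (i + k) (i + j) ≡ i + transpose k j
  transpose-+ zero k j = refl
  transpose-+ (suc i) k j = cong suc (transpose-+ i k j)

  transpose-≡ᵇ : ∀ k i j → (transpose k j ≡ᵇ i) ≡ (j ≡ᵇ transpose k i)
  transpose-≡ᵇ zero zero zero = refl
  transpose-≡ᵇ zero (suc zero) zero = refl
  transpose-≡ᵇ zero (suc (suc i)) zero = refl
  transpose-≡ᵇ zero zero (suc zero) = refl
  transpose-≡ᵇ zero (suc zero) (suc zero) = refl
  transpose-≡ᵇ zero (suc (suc i)) (suc zero) = refl
  transpose-≡ᵇ zero zero (suc (suc j)) = refl
  transpose-≡ᵇ zero (suc zero) (suc (suc j)) = refl
  transpose-≡ᵇ zero (suc (suc i)) (suc (suc j)) = refl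
  transpose-≡ᵇ (suc k) zero zero = refl
  transpose-≡ᵇ (suc k) zero (suc j) = refl
  transpose-≡ᵇ (suc k) (suc i) zero = refl
  transpose-≡ᵇ (suc k) (suc i) (suc j) = transpose-≡ᵇ k i j

  at-swapAt : ∀ k α j → suc k < length α → at (swapAt k α) j ≡ at α (transpose k j)
  at-swapAt zero (a ∷ b ∷ α) zero _ = refl
  at-swapAt zero (a ∷ b ∷ α) (suc zero) _ = refl
  at-swapAt zero (a ∷ b ∷ α) (suc (suc j)) _ = refl
  at-swapAt zero (a ∷ []) j (s≤s ())
  at-swapAt (suc k) (a ∷ α) zero _ = refl
  at-swapAt (suc k) (a ∷ α) (suc j) (s≤s l) = at-swapAt k α j l

  at-applyUpTo : ∀ n (f : ℕ → ℕ) j → j < n → at (applyUpTo f n) j ≡ f j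
  at-applyUpTo (suc n) f zero _ = refl
  at-applyUpTo (suc n) f (suc j) (s≤s l) = at-applyUpTo n (f ∘ suc) j l

  at-map-upTo : ∀ n f j → j < n → at (map f (upTo n)) j ≡ f j
  at-map-upTo n f j l = trans (cong (λ z → at z j) (map-upTo f n)) (at-applyUpTo n f j l)

  at-ext : ∀ α β → length α ≡ length β → (∀ j → j < length α → at α j ≡ at β j) → α ≡ β
  at-ext [] [] _ _ = refl
  at-ext (a ∷ α) (b ∷ β) e h = cong₂ _∷_ (h 0 (s≤s z≤n)) (at-ext α β (ℕₚ.suc-injective e) (λ j l → h (suc j) (s≤s l)))

  transpose-< : ∀ n k j → suc k < n → j < n → transpose k j < n
  transpose-< n zero zero l _ = l
  transpose-< n zero (suc zero) l l′ = ℕₚ.<-trans (s≤s z≤n) l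
  transpose-< n zero (suc (suc j)) _ l = l
  transpose-< (suc n) (suc k) zero _ _ = s≤s z≤n
  transpose-< (suc n) (suc k) (suc j) (s≤s l) (s≤s l′) = s≤s (transpose-< n k j l l′)

  unitVec : ℕ → ℕ → List ℕ
  unitVec n i = map (λ k → if k ≡ᵇ i then 1 else 0) (upTo n)

  length-unitVec : ∀ n i → length (unitVec n i) ≡ n
  length-unitVec n i = trans (length-map _ (upTo n)) (length-upTo n)

  swapAt-unitVec : ∀ n k i → suc k < n → swapAt k (unitVec n i) ≡ unitVec n (transpose k i)
  swapAt-unitVec n k i l = at-ext _ _ (trans (length-swapAt k _) (trans (length-unitVec n i) (sym (length-unitVec n (transpose k i))))) λ j j<′ →
    let j<n : j < n
        j<n = subst (j <_) (trans (length-swapAt k _) (length-unitVec n i)) j<′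
    in trans (at-swapAt k (unitVec n i) j (subst (suc k <_) (sym (length-unitVec n i)) l))
       (trans (at-map-upTo n _ (transpose k j) (transpose-< n k j l j<n))
       (trans (cong (if_then 1 else 0) (transpose-≡ᵇ k i j)) (sym (at-map-upTo n _ j j<n))))

  swapAt-replicate : ∀ k n → swapAt k (replicate n 0) ≡ replicate n 0
  swapAt-replicate zero zero = refl
  swapAt-replicate zero (suc zero) = refl
  swapAt-replicate zero (suc (suc n)) = refl
  swapAt-replicate (suc k) zero = refl
  swapAt-replicate (suc k) (suc n) = cong (0 ∷_) (swapAt-replicate k n)

  take-swapAt : ∀ k n (α : List ℕ) → suc k < n → take n (swapAt k α) ≡ swapAt k (take n α)
  take-swapAt zero (suc zero) α (s≤s ())
  take-swapAt zero (suc (suc n)) [] _ = refl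
  take-swapAt zero (suc (suc n)) (a ∷ []) _ = refl
  take-swapAt zero (suc (suc n)) (a ∷ b ∷ α) _ = refl
  take-swapAt (suc k) (suc n) [] _ = refl
  take-swapAt (suc k) (suc n) (a ∷ α) (s≤s l) = cong (a ∷_) (take-swapAt k n α l)

  swapAt-⊕ : ∀ k α β → length α ≡ length β → swapAt k (zipWith _+_ α β) ≡ zipWith _+_ (swapAt k α) (swapAt k β)
  swapAt-⊕ zero [] [] _ = refl
  swapAt-⊕ zero (a ∷ []) (b ∷ []) _ = refl
  swapAt-⊕ zero (a ∷ a′ ∷ α) (b ∷ b′ ∷ β) _ = refl
  swapAt-⊕ (suc k) [] [] _ = refl
  swapAt-⊕ (suc k) (a ∷ α) (b ∷ β) e = cong (a + b ∷_) (swapAt-⊕ k α β (ℕₚ.suc-injective e))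

  swapAt-++ : ∀ pre a b rest → swapAt (length pre) (pre ++ a ∷ b ∷ rest) ≡ pre ++ b ∷ a ∷ rest
  swapAt-++ [] a b rest = refl
  swapAt-++ (x ∷ pre) a b rest = cong (x ∷_) (swapAt-++ pre a b rest)

  tri : ℕ → ℕ
  tri n = sum (downFrom n)

  tri-+ : ∀ a b → tri (a + b) ≡ tri a + tri b + a * b
  tri-+ zero b = sym (ℕₚ.+-identityʳ _)
  tri-+ (suc a) b = trans (cong (a + b +_) (tri-+ a b))
    (solve 4 (λ a b s t → a :+ b :+ (s :+ t :+ a :* b) := a :+ s :+ t :+ (b :+ a :* b)) refl a b (tri a) (tri b))
    where open +-*-Solver

  adjacentDup⊎< : ∀ x xs → Linked _≤_ (x ∷ xs) →
    (∃[ ys ] ∃[ a ] ∃[ zs ] x ∷ xs ≡ ys ++ a ∷ a ∷ zs) ⊎ Linked _<_ (x ∷ xs)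
  adjacentDup⊎< x [] _ = inj₂ [-]
  adjacentDup⊎< x (y ∷ xs) (x≤y ∷ l) with adjacentDup⊎< y xs l | x ℕ.≟ y
  ... | _ | yes refl = inj₁ ([] , x , xs , refl)
  ... | inj₁ (ys , a , zs , e) | no _ = inj₁ (x ∷ ys , a , zs , cong (x ∷_) e)
  ... | inj₂ l′ | no x≢y = inj₂ (ℕₚ.≤∧≢⇒< x≤y x≢y ∷ l′)

  tri≤sum : ∀ c x xs → Linked _<_ (x ∷ xs) → c ≤ x → c * length (x ∷ xs) + tri (length (x ∷ xs)) ≤ sum (x ∷ xs)
  tri≤sum c x [] _ c≤x = ℕₚ.≤-trans (ℕₚ.≤-reflexive (trans (ℕₚ.+-identityʳ _) (ℕₚ.*-identityʳ c))) (ℕₚ.≤-trans c≤x (ℕₚ.m≤m+n x 0))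
  tri≤sum c x (y ∷ xs) (x<y ∷ l) c≤x = ℕₚ.≤-trans (ℕₚ.≤-reflexive
      (solve 3 (λ c m t → c :* (con 1 :+ m) :+ (m :+ t) := c :+ ((con 1 :+ c) :* m :+ t)) refl c (suc (length xs)) (tri (suc (length xs)))))
    (ℕₚ.+-mono-≤ c≤x (tri≤sum (suc c) y xs l (ℕₚ.≤-<-trans c≤x x<y)))
    where open +-*-Solver

  sorted-dup : ∀ xs → Linked _≤_ xs → sum xs < tri (length xs) → ∃[ ys ] ∃[ a ] ∃[ zs ] xs ≡ ys ++ a ∷ a ∷ zs
  sorted-dup (x ∷ xs) l lt with adjacentDup⊎< x xs l
  ... | inj₁ dup = dup
  ... | inj₂ l′ = ⊥-elim (ℕₚ.<⇒≱ lt (tri≤sum 0 x xs l′ z≤n))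

  countLess-↭ : ∀ x {α β} → α ↭ β → countLess x α ≡ countLess x β
  countLess-↭ x Perm.refl = refl
  countLess-↭ x (Perm.prep a p) = cong (_ +_) (countLess-↭ x p)
  countLess-↭ x (Perm.swap a b p) = trans (sym (ℕₚ.+-assoc A B _)) (trans (cong₂ _+_ (ℕₚ.+-comm A B) (countLess-↭ x p)) (ℕₚ.+-assoc B A _))
    where
    A B : ℕ
    A = if a <ᵇ x then 1 else 0
    B = if b <ᵇ x then 1 else 0
  countLess-↭ x (Perm.trans p q) = trans (countLess-↭ x p) (countLess-↭ x q)

  countLess-≥ : ∀ x α → All (x ≤_) α → countLess x α ≡ 0
  countLess-≥ x [] [] = refl
  countLess-≥ x (a ∷ α) (p ∷ ps) rewrite <ᵇ-false {a} {x} p = countLess-≥ x α ps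

  countLess-< : ∀ x α → All (_< x) α → countLess x α ≡ length α
  countLess-< x [] [] = refl
  countLess-< x (a ∷ α) (p ∷ ps) rewrite <ᵇ-true {a} {x} p = cong suc (countLess-< x α ps)

  indicator≤1 : ∀ b → (if b then 1 else 0) ≤ 1
  indicator≤1 true = ℕₚ.≤-refl
  indicator≤1 false = z≤n

  countLess≤ : ∀ x i α → (∀ k → i ≤ k → k < length α → x ≤ at α k) → countLess x α ≤ i
  countLess≤ x i [] _ = z≤n
  countLess≤ x zero (a ∷ α) h rewrite <ᵇ-false {a} {x} (h 0 z≤n (s≤s z≤n)) = countLess≤ x 0 α (λ k _ l → h (suc k) z≤n (s≤s l))
  countLess≤ x (suc i) (a ∷ α) h = ℕₚ.+-mono-≤ (indicator≤1 (a <ᵇ x)) (countLess≤ x i α (λ k l l′ → h (suc k) (s≤s l) (s≤s l′)))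

  downFrom-< : ∀ n → All (_< n) (downFrom n)
  downFrom-< n = Allₚ.applyDownFrom⁺₁ id n id

  countLess-downFrom : ∀ x n → x ≤ n → countLess x (downFrom n) ≡ x
  countLess-downFrom zero n _ = countLess-≥ 0 (downFrom n) (All.universal (λ _ → z≤n) _)
  countLess-downFrom (suc x) (suc n) (s≤s x≤n) with x ℕ.≟ n
  ... | yes refl = trans (countLess-< (suc x) (downFrom (suc x)) (downFrom-< (suc x))) (length-downFrom (suc x))
  ... | no x≢n rewrite <ᵇ-false {n} {suc x} (ℕₚ.≤∧≢⇒< x≤n x≢n) = countLess-downFrom (suc x) n (ℕₚ.≤∧≢⇒< x≤n x≢n)

  missing-value : ∀ n i α → length α ≡ n → i < n → (∀ k → i ≤ k → k < n → suc i ≤ at α k) → ¬ (α ↭ downFrom n)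
  missing-value n i α refl i<n h p = ℕₚ.<-irrefl (trans (countLess-↭ (suc i) p) (countLess-downFrom (suc i) n i<n))
    (s≤s (countLess≤ (suc i) i α h))

  at-downFrom : ∀ n j → j < n → at (downFrom n) j ≡ n ∸ suc j
  at-downFrom (suc n) zero _ = refl
  at-downFrom (suc n) (suc j) (s≤s l) = at-downFrom n j l

  indexOf-< : ∀ v σ → v ∈ σ → indexOf v σ < length σ
  indexOf-< v (a ∷ σ) m with v ℕ.≟ a
  ... | yes refl rewrite ≡ᵇ-true v = s≤s z≤n
  indexOf-< v (a ∷ σ) (here e) | no ne = ⊥-elim (ne e)
  indexOf-< v (a ∷ σ) (there m) | no ne rewrite ≡ᵇ-false ne = s≤s (indexOf-< v σ m)

  at-indexOf : ∀ v σ → v ∈ σ → at σ (indexOf v σ) ≡ v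
  at-indexOf v (a ∷ σ) m with v ℕ.≟ a
  ... | yes refl rewrite ≡ᵇ-true v = refl
  at-indexOf v (a ∷ σ) (here e) | no ne = ⊥-elim (ne e)
  at-indexOf v (a ∷ σ) (there m) | no ne rewrite ≡ᵇ-false ne = at-indexOf v σ m

  indexOf-applyUpTo : ∀ n (f : ℕ → ℕ) v → v < n → (∀ {i j} → f i ≡ f j → i ≡ j) → indexOf (f v) (applyUpTo f n) ≡ v
  indexOf-applyUpTo (suc n) f zero _ inj rewrite ≡ᵇ-true (f 0) = refl
  indexOf-applyUpTo (suc n) f (suc v) (s≤s l) inj rewrite ≡ᵇ-false {f (suc v)} {f 0} (λ e → ℕₚ.1+n≢0 (inj e)) =
    cong suc (indexOf-applyUpTo n (f ∘ suc) v l (ℕₚ.suc-injective ∘ inj))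

  actL-upTo : ∀ n α → length α ≡ n → actL n (upTo n) α ≡ α
  actL-upTo n α refl = at-ext _ _ (trans (Data.List.Properties.length-map _ (upTo n)) (length-upTo n)) λ j j<′ →
    let j<n = subst (j <_) (trans (Data.List.Properties.length-map _ (upTo n)) (length-upTo n)) j<′
    in trans (at-map-upTo n _ j j<n) (cong (at α) (indexOf-applyUpTo n id j j<n id))

  actL-fixes : ∀ n σ → σ ↭ upTo n → actL n σ (downFrom n) ≡ downFrom n → σ ≡ upTo n
  actL-fixes n σ p e = at-ext σ (upTo n) lσ′ λ v v<σ →
    let v<n = subst (v <_) lσ v<σ
        v∈ = Permₚ.∈-resp-↭ (Perm.↭-sym p) (Memₚ.∈-upTo⁺ v<n)
        idx<n = subst (indexOf v σ <_) lσ (indexOf-< v σ v∈)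
        eq : n ∸ suc (indexOf v σ) ≡ n ∸ suc v
        eq = trans (sym (at-downFrom n _ idx<n)) (trans (sym (at-map-upTo n (λ k → at (downFrom n) (indexOf k σ)) v v<n)) (trans (cong (λ z → at z v) e) (at-downFrom n v v<n)))
    in trans (cong (at σ) (sym (ℕₚ.suc-injective (ℕₚ.∸-cancelˡ-≡ idx<n v<n eq))))
         (trans (at-indexOf v σ v∈) (sym (at-applyUpTo n id v v<n)))
    where
    lσ′ : length σ ≡ length (upTo n)
    lσ′ = Permₚ.↭-length p
    lσ : length σ ≡ n
    lσ = trans lσ′ (length-upTo n)

  len-applyUpTo : ∀ n (f : ℕ → ℕ) → (∀ {i j} → i ≤ j → f i ≤ f j) → len (applyUpTo f n) ≡ 0
  len-applyUpTo zero f mono = refl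
  len-applyUpTo (suc n) f mono = cong₂ _+_ (countLess-≥ (f 0) (applyUpTo (f ∘ suc) n) (Allₚ.applyUpTo⁺₂ (f ∘ suc) n (λ i → mono z≤n)))
    (len-applyUpTo n (f ∘ suc) (mono ∘ s≤s))

  len-upTo : ∀ n → len (upTo n) ≡ 0
  len-upTo n = len-applyUpTo n id id

  swapAt-braid : ∀ i α → suc (suc i) < length α → swapAt i (swapAt (suc i) (swapAt i α)) ≡ swapAt (suc i) (swapAt i (swapAt (suc i) α))
  swapAt-braid zero (a ∷ b ∷ c ∷ α) _ = refl
  swapAt-braid zero (a ∷ b ∷ []) (s≤s (s≤s ()))
  swapAt-braid zero (a ∷ []) (s≤s ())
  swapAt-braid (suc i) (a ∷ α) (s≤s l) = cong (a ∷_) (swapAt-braid i α l)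

  swapAt-comm : ∀ i j α → suc i < j → swapAt i (swapAt j α) ≡ swapAt j (swapAt i α)
  swapAt-comm zero (suc zero) α (s≤s ())
  swapAt-comm zero (suc (suc j)) [] _ = refl
  swapAt-comm zero (suc (suc j)) (a ∷ []) _ = refl
  swapAt-comm zero (suc (suc j)) (a ∷ b ∷ α) _ = refl
  swapAt-comm (suc i) (suc j) [] _ = refl
  swapAt-comm (suc i) (suc j) (a ∷ α) (s≤s l) = cong (a ∷_) (swapAt-comm i j α l)

  Ascent : ℕ → List ℕ → Set
  Ascent i w = suc i < length w × at w i < at w (suc i)

  firstAscentFrom-just : ∀ a w i → firstAscentFrom a w ≡ just i → Ascent i (a ∷ w)
  firstAscentFrom-just a (b ∷ w) i e with a <ᵇ b in eq
  firstAscentFrom-just a (b ∷ w) .0 refl | true = s≤s (s≤s z≤n) , ℕₚ.<ᵇ⇒< a b (subst Data.Bool.T (sym eq) _)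
  firstAscentFrom-just a (b ∷ w) i e | false with firstAscentFrom b w in eq′
  firstAscentFrom-just a (b ∷ w) .(suc j) refl | false | just j with firstAscentFrom-just b w j eq′
  ... | l , lt = s≤s l , lt

  firstAscent-just : ∀ w i → firstAscent w ≡ just i → Ascent i w
  firstAscent-just (a ∷ w) i e = firstAscentFrom-just a w i (trans (sym (firstAscent≡ a w)) e)

  firstAscentFrom-nothing : ∀ a w → Unique (a ∷ w) → firstAscentFrom a w ≡ nothing → All (_< a) w × len w ≡ tri (length w)
  firstAscentFrom-nothing a [] _ _ = [] , refl
  firstAscentFrom-nothing a (b ∷ w) ((a≢b ∷ _) ∷ u) e with a <ᵇ b in eq
  firstAscentFrom-nothing a (b ∷ w) ((a≢b ∷ _) ∷ u) e | false with firstAscentFrom b w in eq′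
  ... | nothing with firstAscentFrom-nothing b w u eq′
  ... | lts , lw = b<a ∷ All.map (λ lt → ℕₚ.<-trans lt b<a) lts , cong₂ _+_ (countLess-< b w lts) lw
    where
    b<a : b < a
    b<a = ℕₚ.≤∧≢⇒< (ℕₚ.≮⇒≥ (λ a<b → subst Data.Bool.T eq (ℕₚ.<⇒<ᵇ a<b))) (a≢b ∘ sym)

  len-decreasing : ∀ w → Unique w → firstAscent w ≡ nothing → len w ≡ tri (length w)
  len-decreasing [] _ _ = refl
  len-decreasing (a ∷ w) u e with firstAscentFrom-nothing a w u (trans (sym (firstAscent≡ a w)) e)
  ... | lts , lw = cong₂ _+_ (countLess-< a w lts) lw

  firstAscent-decreasing : ∀ n → firstAscent (downFrom n) ≡ nothing
  firstAscent-decreasing zero = refl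
  firstAscent-decreasing (suc n) = trans (firstAscent≡ n (downFrom n)) (go n)
    where
    go : ∀ n → firstAscentFrom n (downFrom n) ≡ nothing
    go zero = refl
    go (suc n) rewrite <ᵇ-false {suc n} {n} (ℕₚ.n≤1+n n) | go n = refl

  countLess≤length : ∀ x w → countLess x w ≤ length w
  countLess≤length x [] = z≤n
  countLess≤length x (a ∷ w) = ℕₚ.+-mono-≤ (indicator≤1 (a <ᵇ x)) (countLess≤length x w)

  len≤tri : ∀ w → len w ≤ tri (length w)
  len≤tri [] = z≤n
  len≤tri (a ∷ w) = ℕₚ.+-mono-≤ (countLess≤length a w) (len≤tri w)

  tri≤square : ∀ n → tri n ≤ n * n
  tri≤square zero = z≤n
  tri≤square (suc n) = ℕₚ.+-mono-≤ (ℕₚ.n≤1+n n) (ℕₚ.≤-trans (tri≤square n) (ℕₚ.*-monoʳ-≤ n (ℕₚ.n≤1+n n)))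

  map-∸-upTo : ∀ n → map (λ k → n ∸ 1 ∸ k) (upTo n) ≡ downFrom n
  map-∸-upTo n = at-ext _ _ (trans (trans (Data.List.Properties.length-map _ (upTo n)) (length-upTo n)) (sym (length-downFrom n))) λ j j<′ →
    let j<n = subst (j <_) (trans (Data.List.Properties.length-map _ (upTo n)) (length-upTo n)) j<′
    in trans (at-map-upTo n _ j j<n) (trans (ℕₚ.∸-+-assoc n 1 j) (sym (at-downFrom n j j<n)))

  countLess-0 : ∀ a w → countLess a w ≡ 0 → All (a ≤_) w
  countLess-0 a [] _ = []
  countLess-0 a (b ∷ w) e with b <ᵇ a in eq
  ... | false = ℕₚ.≮⇒≥ (λ b<a → subst Data.Bool.T eq (ℕₚ.<⇒<ᵇ b<a)) ∷ countLess-0 a w e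

  len-0 : ∀ w → len w ≡ 0 → AllPairs _≤_ w
  len-0 [] _ = []
  len-0 (a ∷ w) e = countLess-0 a w (ℕₚ.m+n≡0⇒m≡0 _ e) ∷ len-0 w (ℕₚ.m+n≡0⇒n≡0 (countLess a w) e)

  sorted-unique : ∀ {v w} → AllPairs _≤_ v → AllPairs _≤_ w → v ↭ w → v ≡ w
  sorted-unique sv sw p = ≋⇒≡ (↗↭↗⇒≋ ℕₚ.≤-totalOrder (AllPairs⇒Linked sv) (AllPairs⇒Linked sw) (↭⇒↭ₛ p))

  upTo-sorted : ∀ n → AllPairs _≤_ (upTo n)
  upTo-sorted n = AllPairsₚ.applyUpTo⁺₁ id n (λ i<j _ → ℕₚ.<⇒≤ i<j)

  len-0⇒upTo : ∀ n w → w ↭ upTo n → len w ≡ 0 → w ≡ upTo n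
  len-0⇒upTo n w p e = sorted-unique (len-0 w e) (upTo-sorted n) p

  unique-⊆ : ∀ (xs ys : List ℕ) → Unique xs → All (_∈ ys) xs → ∃ λ zs → ys ↭ xs ++ zs
  unique-⊆ [] ys _ _ = ys , Perm.refl
  unique-⊆ (x ∷ xs) ys (x∉ ∷ u) (x∈ ∷ xs∈) with Memₚ.∈-∃++ x∈
  ... | as , bs , refl with unique-⊆ xs (as ++ bs) u (All.tabulate λ {y} y∈ → drop-x y (All.lookup x∉ y∈) (All.lookup xs∈ y∈))
    where
    drop-x : ∀ y → x ≢ y → y ∈ as ++ x ∷ bs → y ∈ as ++ bs
    drop-x y ne m with Memₚ.∈-++⁻ as m
    ... | inj₁ l = Memₚ.∈-++⁺ˡ l
    ... | inj₂ (here e) = ⊥-elim (ne (sym e))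
    ... | inj₂ (there r) = Memₚ.∈-++⁺ʳ as r
  ... | zs , p = zs , Perm.trans (Permₚ.shift x as bs) (Perm.prep x p)

  missing-residue : ∀ m D → Unique D → All (_< suc m) D → length D ≡ m → ∃ λ z → z ∷ D ↭ upTo (suc m)
  missing-residue m D u b e = go (proj₁ rest) (proj₂ rest) (trans (trans (cong (_+ length (proj₁ rest)) (sym e)) (sym (length-++ D))) (trans (sym (Permₚ.↭-length (proj₂ rest))) (length-upTo (suc m))))
    where
    rest : ∃ λ zs → upTo (suc m) ↭ D ++ zs
    rest = unique-⊆ D (upTo (suc m)) u (All.map Memₚ.∈-upTo⁺ b)
    go : ∀ zs → upTo (suc m) ↭ D ++ zs → m + length zs ≡ suc m → ∃ λ z → z ∷ D ↭ upTo (suc m)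
    go [] p l = ⊥-elim (ℕₚ.1+n≢n (trans (sym l) (ℕₚ.+-identityʳ m)))
    go (z ∷ []) p l = z , Perm.↭-sym (Perm.trans p (Perm.↭-sym (Permₚ.∷↭∷ʳ z D)))
    go (_ ∷ _ ∷ zs) p l = ⊥-elim (ℕₚ.m≢1+m+n m (ℕₚ.suc-injective (trans (sym l) (trans (ℕₚ.+-suc m _) (cong suc (ℕₚ.+-suc m _))))))

  exists-missing : ∀ n D → length D < n → ∃ λ j → j < n × j ∉ D
  exists-missing n D l = search n (λ all → ℕₚ.<⇒≱ l (bound all))
    where
    bound : All (_∈ D) (upTo n) → n ≤ length D
    bound all with unique-⊆ (upTo n) D (Data.List.Relation.Unary.Unique.Propositional.Properties.upTo⁺ n) all
      where import Data.List.Relation.Unary.Unique.Propositional.Properties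
    ... | zs , p = subst (n ≤_) (sym (trans (Permₚ.↭-length p) (trans (length-++ (upTo n)) (cong (_+ length zs) (length-upTo n))))) (ℕₚ.m≤m+n n _)
    search : ∀ k → ¬ All (_∈ D) (upTo k) → ∃ λ j → j < k × j ∉ D
    search zero na = ⊥-elim (na [])
    search (suc k) na with k ∈? D
    ... | no k∉ = k , ℕₚ.≤-refl , k∉
    ... | yes k∈ with search k (λ all → na (subst (All (_∈ D)) (applyUpTo-∷ʳ id k) (Allₚ.∷ʳ⁺ all k∈)))
    ... | j , j<k , j∉ = j , ℕₚ.m<n⇒m<1+n j<k , j∉

  module Residues (m : ℕ) where
    n : ℕ
    n = suc m

    suc-% : ∀ k → (k % n ≡ m × suc k % n ≡ 0) ⊎ (k % n < m × suc k % n ≡ suc (k % n))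
    suc-% k with ℕₚ.m≤n⇒m<n∨m≡n (ℕₚ.≤-pred (m%n<n k n))
    ... | inj₁ lt = inj₂ (lt , trans step (m<n⇒m%n≡m (s≤s lt)))
      where
      step : suc k % n ≡ suc (k % n) % n
      step = trans (cong (λ z → suc z % n) (m≡m%n+[m/n]*n k n)) ([m+kn]%n≡m%n (suc (k % n)) (k / n) n)
    ... | inj₂ e = inj₁ (e , trans (trans (cong (λ z → suc z % n) (m≡m%n+[m/n]*n k n)) ([m+kn]%n≡m%n (suc (k % n)) (k / n) n)) (trans (cong (λ z → suc z % n) e) (n%n≡0 n)))

    %-+ : ∀ d p → (d % n + p) % n ≡ (d + p) % n
    %-+ d p = trans (%-distribˡ-+ (d % n) p n) (trans (cong (λ z → (z + p % n) % n) (m%n%n≡m%n d n)) (sym (%-distribˡ-+ d p n)))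

    rotate-↭ : ∀ p → map (λ d → (d + p) % n) (upTo n) ↭ upTo n
    rotate-↭ zero = Perm.↭-reflexive (trans (Data.List.Properties.map-cong-local (All.map (λ {d} d<n → trans (cong (_% n) (ℕₚ.+-identityʳ d)) (m<n⇒m%n≡m d<n)) (Allₚ.applyUpTo⁺₁ id n id))) (Data.List.Properties.map-id (upTo n)))
    rotate-↭ (suc p) = Perm.trans (Perm.↭-reflexive (trans (map-cong (λ d → trans (cong (_% n) (trans (ℕₚ.+-suc d p) (ℕₚ.+-comm 1 (d + p)))) (sym (%-+ (d + p) 1))) (upTo n)) (map-∘ (upTo n))))
      (Perm.trans (Permₚ.map⁺ (λ d → (d + 1) % n) (rotate-↭ p)) rotate1)
      where
      rotate1 : map (λ d → (d + 1) % n) (upTo n) ↭ upTo n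
      rotate1 = Perm.trans (Perm.↭-reflexive (trans (cong (map (λ d → (d + 1) % n)) (sym (applyUpTo-∷ʳ id m)))
          (trans (Data.List.Properties.map-++ _ (upTo m) (m ∷ [])) (cong₂ _++_
            (trans (Data.List.Properties.map-cong-local (All.map (λ {d} d<m → trans (cong (_% n) (ℕₚ.+-comm d 1)) (m<n⇒m%n≡m (s≤s d<m))) (Allₚ.applyUpTo⁺₁ id m id))) (map-upTo suc m))
            (cong (_∷ []) (trans (cong (_% n) (ℕₚ.+-comm m 1)) (n%n≡0 n)))))))
        (Perm.↭-sym (Permₚ.∷↭∷ʳ 0 (applyUpTo suc m)))

    hits-top : ∀ z p → z < n → p < n → (z + p) % n ≡ m → p ≡ m ∸ z
    hits-top z p z<n p<n e with ℕₚ.<-≤-connex (z + p) n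
    ... | inj₁ lt = trans (sym (ℕₚ.m+n∸m≡n z p)) (cong (_∸ z) (trans (sym (m<n⇒m%n≡m lt)) e))
    ... | inj₂ ge = ⊥-elim (ℕₚ.<⇒≢ (subst (_< m) (sym red) small) e)
      where
      r : ℕ
      r = z + p ∸ n
      small : r < m
      small = ℕₚ.+-cancelʳ-< n r m (subst (_< m + n) (sym (ℕₚ.m∸n+n≡m ge)) (ℕₚ.+-mono-≤-< (ℕₚ.≤-pred z<n) p<n))
      red : (z + p) % n ≡ r
      red = trans (cong (_% n) (sym (ℕₚ.m∸n+n≡m ge))) (trans ([m+n]%n≡m%n r n) (m<n⇒m%n≡m (ℕₚ.m<n⇒m<1+n small)))

    top-hit : ∀ z → z < n → (z + (m ∸ z)) % n ≡ m
    top-hit z (s≤s z≤m) = trans (cong (_% n) (ℕₚ.m+[n∸m]≡n z≤m)) (m<n⇒m%n≡m ℕₚ.≤-refl)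

open Permutations

module Nat = BigOp ℕₚ.+-0-commutativeMonoid

sum-big : ∀ xs → sum xs ≡ Nat.big xs id
sum-big [] = ≡.refl
sum-big (x ∷ xs) = ≡.cong (x ℕ.+_) (sum-big xs)

sum-map-upTo : ∀ n f → sum (map f (upTo n)) ≡ Nat.bigN n f
sum-map-upTo n f = ≡.trans (sum-big (map f (upTo n))) (≡.trans (Nat.big-map f (upTo n) id) (Nat.big-upTo n f))

length-concatMap : ∀ {A B : Set} (f : A → List B) xs → length (concatMap f xs) ≡ Nat.big xs (length ∘ f)
length-concatMap f [] = ≡.refl
length-concatMap f (x ∷ xs) = ≡.trans (length-++ (f x)) (≡.cong (length (f x) ℕ.+_) (length-concatMap f xs))

length-pairs : ∀ m → length (pairs (suc m)) ≡ m ℕ.+ length (farPairs (suc m))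
length-pairs m = begin
  length (pairs (suc m)) ≡⟨ ≡.trans (length-concatMap (λ j → map (λ i → (i , j)) (upTo j)) (upTo (suc m))) (Nat.big-upTo (suc m) (λ j → length (map (λ i → (i , j)) (upTo j)))) ⟩
  Nat.bigN (suc m) (λ j → length (map (λ i → (i , j)) (upTo j))) ≡⟨ Nat.bigN-cong (suc m) {f = λ j → length (map (λ i → (i , j)) (upTo j))} {g = id} (λ j _ → lenblk j j) ⟩
  Nat.bigN m (λ j → 1 ℕ.+ j) ≡⟨ Nat.bigN-∙ m (λ _ → 1) id ⟩
  Nat.bigN m (λ _ → 1) ℕ.+ Nat.bigN m id ≡⟨ ≡.cong (ℕ._+ Nat.bigN m id) (ones m) ⟩
  m ℕ.+ Nat.bigN m id ≡⟨ ≡.cong (m ℕ.+_) (Nat.bigN-cong (suc m) {f = λ j → length (map (λ i → (i , j)) (upTo (j ℕ.∸ 1)))} {g = λ j → j ℕ.∸ 1} (λ j _ → lenblk j (j ℕ.∸ 1))) ⟨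
  m ℕ.+ Nat.bigN (suc m) (λ j → length (map (λ i → (i , j)) (upTo (j ℕ.∸ 1))))
    ≡⟨ ≡.cong (m ℕ.+_) (≡.trans (length-concatMap (λ j → map (λ i → (i , j)) (upTo (j ℕ.∸ 1))) (upTo (suc m))) (Nat.big-upTo (suc m) (λ j → length (map (λ i → (i , j)) (upTo (j ℕ.∸ 1)))))) ⟨
  m ℕ.+ length (farPairs (suc m)) ∎
  where
  open ≡.≡-Reasoning
  lenblk : ∀ j k → length (map (λ i → (i , j)) (upTo k)) ≡ k
  lenblk j k = ≡.trans (length-map _ (upTo k)) (length-upTo k)
  ones : ∀ m → Nat.bigN m (λ _ → 1) ≡ m
  ones zero = ≡.refl
  ones (suc m) = ≡.cong suc (ones m)

module TriangularProducts {c ℓ : Level} (T : CommutativeRing c ℓ) (F : ℕ → ℕ → CommutativeRing.Carrier T) where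
  open CommutativeRing T
  open RingTools T
  open Relation.Binary.Reasoning.Setoid setoid

  column : ℕ → Carrier
  column j = prodN (j ℕ.∸ 1) (λ a → F a j)

  columns : ℕ → Carrier
  columns n = prodN n column

  -- The pairs (a , j) with a < i′ + 1 ≤ j are the far pairs across the cut together with (i′ , i′ + 1).
  columns-cut : ∀ i′ m → ∃ λ r → F i′ (suc i′) * columns (suc i′ ℕ.+ suc m) ≈ r * prodN (suc i′) (λ a → prodN (suc m) (λ b → F a (suc i′ ℕ.+ b)))
  columns-cut i′ zero = columns i , (begin
    F i′ i * columns (i ℕ.+ 1) ≈⟨ *-congˡ (reflexive (≡.cong columns (ℕₚ.+-comm i 1))) ⟩
    F i′ i * columns (suc i) ≈⟨ *-congˡ (Prod.bigN-snoc i column) ⟩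
    F i′ i * (columns i * prodN i′ (λ a → F a i)) ≈⟨ solve 3 (λ f c p → f :* (c :* p) := c :* (p :* f)) refl _ _ _ ⟩
    columns i * (prodN i′ (λ a → F a i) * F i′ i) ≈⟨ *-congˡ (Prod.bigN-snoc i′ (λ a → F a i)) ⟨
    columns i * prodN i (λ a → F a i) ≈⟨ *-congˡ (Prod.bigN-cong i (λ a _ → trans (*-identityʳ _) (reflexive (≡.cong (F a) (ℕₚ.+-identityʳ i))))) ⟨
    columns i * prodN i (λ a → prodN 1 (λ b → F a (i ℕ.+ b))) ∎)
    where
    i : ℕ
    i = suc i′
  columns-cut i′ (suc m) with columns-cut i′ m
  ... | r , e = r * prodN m (λ a → F (i ℕ.+ a) j) , (begin
    F i′ i * columns (i ℕ.+ suc (suc m)) ≈⟨ *-congˡ (reflexive (≡.cong columns (ℕₚ.+-suc i (suc m)))) ⟩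
    F i′ i * columns (suc j) ≈⟨ *-congˡ (Prod.bigN-snoc j column) ⟩
    F i′ i * (columns j * prodN (j ℕ.∸ 1) (λ a → F a j)) ≈⟨ *-assoc _ _ _ ⟨
    F i′ i * columns j * prodN (j ℕ.∸ 1) (λ a → F a j)
      ≈⟨ *-cong e (trans (reflexive (≡.cong (λ z → prodN z (λ a → F a j)) (ℕₚ.+-suc i′ m))) (Prod.bigN-+ i m (λ a → F a j))) ⟩
    r * prodN i (λ a → row a) * (prodN i (λ a → F a j) * prodN m (λ a → F (i ℕ.+ a) j))
      ≈⟨ solve 4 (λ r p c d → r :* p :* (c :* d) := r :* d :* (p :* c)) refl _ _ _ _ ⟩
    r * prodN m (λ a → F (i ℕ.+ a) j) * (prodN i (λ a → row a) * prodN i (λ a → F a j))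
      ≈⟨ *-congˡ (trans (Prod.bigN-cong i (λ a _ → Prod.bigN-snoc (suc m) (λ b → F a (i ℕ.+ b)))) (Prod.bigN-∙ i row (λ a → F a j))) ⟨
    r * prodN m (λ a → F (i ℕ.+ a) j) * prodN i (λ a → prodN (suc (suc m)) (λ b → F a (i ℕ.+ b))) ∎)
    where
    i j : ℕ
    i = suc i′
    j = i ℕ.+ suc m
    row : ℕ → Carrier
    row a = prodN (suc m) (λ b → F a (i ℕ.+ b))

  rows : ℕ → Carrier
  rows n = prodN n (λ a → prodN (n ℕ.∸ (2 ℕ.+ a)) (λ b → F a (2 ℕ.+ a ℕ.+ b)))

  columns≈rows : ∀ n → columns n ≈ rows n
  columns≈rows zero = refl
  columns≈rows (suc zero) = refl
  columns≈rows (suc (suc n)) = begin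
    columns (suc m) ≈⟨ Prod.bigN-snoc m column ⟩
    columns m * prodN n (λ a → F a m) ≈⟨ *-congʳ (columns≈rows (suc n)) ⟩
    rows m * prodN n (λ a → F a m) ≈⟨ *-congʳ (snocTriv n m (row m) (row-empty m n (ℕₚ.n≤1+n (suc n)))) ⟩
    prodN n (row m) * prodN n (λ a → F a m) ≈⟨ Prod.bigN-∙ n (row m) (λ a → F a m) ⟨
    prodN n (λ a → row m a * F a m) ≈⟨ Prod.bigN-cong n (λ a a<n → sym (rowSnoc a a<n)) ⟩
    prodN n (row (suc m)) ≈⟨ trans (snocTriv m (suc m) (row (suc m)) (row-empty (suc m) m (ℕₚ.n≤1+n (suc m)))) (snocTriv n m (row (suc m)) (row-empty (suc m) n ℕₚ.≤-refl)) ⟨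
    rows (suc m) ∎
    where
    m : ℕ
    m = suc n
    row : ℕ → ℕ → Carrier
    row k a = prodN (k ℕ.∸ (2 ℕ.+ a)) (λ b → F a (2 ℕ.+ a ℕ.+ b))
    row-empty : ∀ k a → k ℕ.≤ 2 ℕ.+ a → row k a ≈ 1#
    row-empty k a le = reflexive (≡.cong (λ z → prodN z (λ b → F a (2 ℕ.+ a ℕ.+ b))) (ℕₚ.m≤n⇒m∸n≡0 le))
    snocTriv : ∀ n m f → f n ≈ 1# → prodN (suc n) f ≈ prodN n f
    snocTriv n m f e = trans (Prod.bigN-snoc n f) (trans (*-congˡ e) (*-identityʳ _))
    rowSnoc : ∀ a → a ℕ.< n → row (suc m) a ≈ row m a * F a m
    rowSnoc a a<n = trans (reflexive (≡.cong (λ z → prodN z (λ b → F a (2 ℕ.+ a ℕ.+ b))) e))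
      (trans (Prod.bigN-snoc (n ℕ.∸ suc a) (λ b → F a (2 ℕ.+ a ℕ.+ b))) (*-congˡ (reflexive (≡.cong (F a) (≡.cong suc (ℕₚ.m+[n∸m]≡n a<n))))))
      where
      e : n ℕ.∸ a ≡ suc (n ℕ.∸ suc a)
      e = ℕₚ.+-∸-assoc 1 a<n

module TwistedDerivations {r ℓ w : Level} (T : CommutativeRing r ℓ) (W : CommutativeRing.Carrier T → Set w)
  (W-* : ∀ a b → W a → W b → W (CommutativeRing._*_ T a b)) (W-+ : ∀ {a b} → W a → W b → W (CommutativeRing._+_ T a b))
  (W-neg : ∀ {a} → W a → W (CommutativeRing.-_ T a)) where
  open CommutativeRing T
  open RingTools T
  open Relation.Binary.Reasoning.Setoid setoid

  W-- : ∀ {a b} → W a → W b → W (a + - b)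
  W-- wa wb = W-+ wa (W-neg wb)

  telescope : ∀ x y z → x + - z ≈ (x + - y) + (y + - z)
  telescope = solve 3 (λ x y z → x :- z := (x :- y) :+ (y :- z)) refl

  anticommute : ∀ x y → y + - x ≈ - (x + - y)
  anticommute = solve 2 (λ x y → y :- x := :- (x :- y)) refl

  record Twisted (s ∂ : Carrier → Carrier) (a : Carrier) : Set (r ⊔ ℓ ⊔ w) where
    field
      W-s : ∀ {f} → W f → W (s f)
      W-∂ : ∀ {f} → W f → W (∂ f)
      W-a : W a
      s-cong : ∀ {f g} → f ≈ g → s f ≈ s g
      s-- : ∀ f g → s (f + - g) ≈ s f + - s g
      s-* : ∀ f g → W f → W g → s (f * g) ≈ s f * s g
      s-involutive : ∀ f → s (s f) ≈ f
      s-a : s a ≈ - a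
      a-∂ : ∀ f → W f → a * ∂ f ≈ f + - s f
      cancel : ∀ {f g} → W f → W g → a * f ≈ a * g → f ≈ g

    s-a∂ : ∀ {f} → W f → s a * s (∂ f) ≈ s f + - f
    s-a∂ {f} wf = begin
      s a * s (∂ f) ≈⟨ s-* a (∂ f) W-a (W-∂ wf) ⟨
      s (a * ∂ f) ≈⟨ s-cong (a-∂ f wf) ⟩
      s (f + - s f) ≈⟨ s-- f (s f) ⟩
      s f + - s (s f) ≈⟨ +-congˡ (-‿cong (s-involutive f)) ⟩
      s f + - f ∎

    ∂-fixed : ∀ {f} → W f → s (∂ f) ≈ ∂ f
    ∂-fixed {f} wf = cancel (W-s (W-∂ wf)) (W-∂ wf) (begin
      a * s (∂ f) ≈⟨ solve 2 (λ a x → a :* x := :- ((:- a) :* x)) refl a (s (∂ f)) ⟩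
      - (- a * s (∂ f)) ≈⟨ -‿cong (*-congʳ (sym s-a)) ⟩
      - (s a * s (∂ f)) ≈⟨ -‿cong (s-a∂ wf) ⟩
      - (s f + - f) ≈⟨ solve 2 (λ f x → :- (x :- f) := f :- x) refl f (s f) ⟩
      f + - s f ≈⟨ a-∂ f wf ⟨
      a * ∂ f ∎)

    ∂-square : W 0# → ∀ {f} → W f → ∂ (∂ f) ≈ 0#
    ∂-square w0 {f} wf = cancel (W-∂ (W-∂ wf)) w0 (begin
      a * ∂ (∂ f) ≈⟨ a-∂ (∂ f) (W-∂ wf) ⟩
      ∂ f + - s (∂ f) ≈⟨ +-congˡ (-‿cong (∂-fixed wf)) ⟩
      ∂ f + - ∂ f ≈⟨ -‿inverseʳ (∂ f) ⟩
      0# ≈⟨ zeroʳ a ⟨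
      a * 0# ∎)

  module Pair {s ∂ₛ a t ∂ₜ b} (A : Twisted s ∂ₛ a) (B : Twisted t ∂ₜ b) where
    private
      module A = Twisted A
      module B = Twisted B

    alternating : Carrier → Carrier
    alternating f = ((f + - s f) + - (t f + - t (s f))) + (s (t f) + - s (t (s f)))

    t-a∂ : ∀ {c f} → t a ≈ c → W f → c * t (∂ₛ f) ≈ t f + - t (s f)
    t-a∂ {c} {f} ta wf = begin
      c * t (∂ₛ f) ≈⟨ *-congʳ (sym ta) ⟩
      t a * t (∂ₛ f) ≈⟨ B.s-* a (∂ₛ f) A.W-a (A.W-∂ wf) ⟨
      t (a * ∂ₛ f) ≈⟨ B.s-cong (A.a-∂ f wf) ⟩
      t (f + - s f) ≈⟨ B.s-- f (s f) ⟩
      t f + - t (s f) ∎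

    -- Multiplying ∂ₛ∂ₜ∂ₛ f by the three differences gives the alternating sum of f over the S₃
    -- generated by s and t.
    ∂∂∂-clear : ∀ c → W c → t a ≈ c → s b ≈ c → s c ≈ b → c ≈ a + b →
      ∀ {f} → W f → (b * c) * (a * ∂ₛ (∂ₜ (∂ₛ f))) ≈ alternating f
    ∂∂∂-clear c wc ta sb sc c=a+b {f} wf = A.cancel (W-* _ _ (W-* b c B.W-a wc) (W-* a _ A.W-a (A.W-∂ wk))) wAlt (begin
      a * ((b * c) * (a * ∂ₛ k)) ≈⟨ *-congˡ (*-congˡ (A.a-∂ k wk)) ⟩
      a * ((b * c) * (k + - s k)) ≈⟨ solve 5 (λ a b c k x → a :* ((b :* c) :* (k :- x)) := ((a :* c) :* b) :* k :+ (((:- a) :* b) :* c) :* x) refl a b c k (s k) ⟩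
      ((a * c) * b) * k + ((- a * b) * c) * s k ≈⟨ +-cong eq eqₛ ⟩
      (c * (f + - s f) + - (a * x)) + (b * (s f + - f) + - (- a * s x)) ≈⟨ +-congʳ (+-congʳ (*-congʳ c=a+b)) ⟩
      ((a + b) * (f + - s f) + - (a * x)) + (b * (s f + - f) + - (- a * s x))
        ≈⟨ solve 6 (λ a b f g x y → (((a :+ b) :* (f :- g)) :- (a :* x)) :+ ((b :* (g :- f)) :- ((:- a) :* y)) := a :* (((f :- g) :- x) :+ y)) refl a b f (s f) x (s x) ⟩
      a * (((f + - s f) + - x) + s x) ≈⟨ *-congˡ (+-congˡ (A.s-- (t f) (t (s f)))) ⟩
      a * alternating f ∎)
      where
      k x : Carrier
      k = ∂ₜ (∂ₛ f)
      x = t f + - t (s f)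
      wk : W k
      wk = B.W-∂ (A.W-∂ wf)
      wx : W x
      wx = W-- (B.W-s wf) (B.W-s (A.W-s wf))
      wac : W (a * c)
      wac = W-* a c A.W-a wc
      wd : W (f + - s f)
      wd = W-- wf (A.W-s wf)
      wAlt : W (alternating f)
      wAlt = W-+ (W-- wd wx) (W-- (A.W-s (B.W-s wf)) (A.W-s (B.W-s (A.W-s wf))))
      eq : ((a * c) * b) * k ≈ c * (f + - s f) + - (a * x)
      eq = begin
        ((a * c) * b) * k ≈⟨ *-assoc (a * c) b k ⟩
        (a * c) * (b * k) ≈⟨ *-congˡ (B.a-∂ (∂ₛ f) (A.W-∂ wf)) ⟩
        (a * c) * (∂ₛ f + - t (∂ₛ f)) ≈⟨ solve 4 (λ a c g h → (a :* c) :* (g :- h) := c :* (a :* g) :- a :* (c :* h)) refl a c (∂ₛ f) (t (∂ₛ f)) ⟩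
        c * (a * ∂ₛ f) + - (a * (c * t (∂ₛ f))) ≈⟨ +-cong (*-congˡ (A.a-∂ f wf)) (-‿cong (*-congˡ (t-a∂ ta wf))) ⟩
        c * (f + - s f) + - (a * x) ∎
      eqₛ : ((- a * b) * c) * s k ≈ b * (s f + - f) + - (- a * s x)
      eqₛ = begin
        ((- a * b) * c) * s k ≈⟨ *-congʳ (*-cong (*-cong (sym A.s-a) (sym sc)) (sym sb)) ⟩
        ((s a * s c) * s b) * s k ≈⟨ *-congʳ (trans (*-congʳ (sym (A.s-* a c A.W-a wc))) (sym (A.s-* (a * c) b wac B.W-a))) ⟩
        s ((a * c) * b) * s k ≈⟨ A.s-* _ k (W-* _ b wac B.W-a) wk ⟨
        s (((a * c) * b) * k) ≈⟨ A.s-cong eq ⟩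
        s (c * (f + - s f) + - (a * x)) ≈⟨ A.s-- _ _ ⟩
        s (c * (f + - s f)) + - s (a * x) ≈⟨ +-cong (trans (A.s-* c _ wc wd) (*-cong sc (trans (A.s-- f (s f)) (+-congˡ (-‿cong (A.s-involutive f)))))) (-‿cong (trans (A.s-* a x A.W-a wx) (*-congʳ A.s-a))) ⟩
        b * (s f + - f) + - (- a * s x) ∎

    ∂∂-clear : t a ≈ a → ∀ {f} → W f → a * (b * ∂ₜ (∂ₛ f)) ≈ (f + - s f) + - (t f + - t (s f))
    ∂∂-clear ta {f} wf = begin
      a * (b * ∂ₜ (∂ₛ f)) ≈⟨ *-congˡ (B.a-∂ (∂ₛ f) (A.W-∂ wf)) ⟩
      a * (∂ₛ f + - t (∂ₛ f)) ≈⟨ solve 3 (λ a g h → a :* (g :- h) := a :* g :- a :* h) refl a (∂ₛ f) (t (∂ₛ f)) ⟩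
      a * ∂ₛ f + - (a * t (∂ₛ f)) ≈⟨ +-cong (A.a-∂ f wf) (-‿cong (t-a∂ ta wf)) ⟩
      (f + - s f) + - (t f + - t (s f)) ∎

  braid : ∀ {s ∂ₛ a t ∂ₜ b} → Twisted s ∂ₛ a → Twisted t ∂ₜ b →
    ∀ c → W c → (∀ {f g} → W f → W g → c * f ≈ c * g → f ≈ g) →
    t a ≈ c → s b ≈ c → s c ≈ b → t c ≈ a → c ≈ a + b →
    ∀ {f} → W f → s (t (s f)) ≈ t (s (t f)) → ∂ₛ (∂ₜ (∂ₛ f)) ≈ ∂ₜ (∂ₛ (∂ₜ f))
  braid {s} {∂ₛ} {a} {t} {∂ₜ} {b} A B c wc cancel-c ta sb sc tc c=a+b {f} wf sts = A.cancel wl wl′ (B.cancel wal wal′ (cancel-c (W-* b _ B.W-a wal) (W-* b _ B.W-a wal′) (begin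
    c * (b * (a * l)) ≈⟨ solve 3 (λ b c x → c :* (b :* x) := (b :* c) :* x) refl b c (a * l) ⟩
    (b * c) * (a * l) ≈⟨ Pair.∂∂∂-clear A B c wc ta sb sc c=a+b wf ⟩
    ((f + - s f) + - (t f + - t (s f))) + (s (t f) + - s (t (s f))) ≈⟨ +-congˡ (+-congˡ (-‿cong sts)) ⟩
    ((f + - s f) + - (t f + - t (s f))) + (s (t f) + - t (s (t f)))
      ≈⟨ solve 6 (λ f sf tf ts st tst → ((f :- sf) :- (tf :- ts)) :+ (st :- tst) := ((f :- tf) :- (sf :- st)) :+ (ts :- tst)) refl f (s f) (t f) (t (s f)) (s (t f)) (t (s (t f))) ⟩
    ((f + - t f) + - (s f + - s (t f))) + (t (s f) + - t (s (t f))) ≈⟨ Pair.∂∂∂-clear B A c wc sb ta tc (trans c=a+b (+-comm a b)) wf ⟨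
    (a * c) * (b * l′) ≈⟨ solve 4 (λ a b c x → (a :* c) :* (b :* x) := c :* (b :* (a :* x))) refl a b c l′ ⟩
    c * (b * (a * l′)) ∎)))
    where
    module A = Twisted A
    module B = Twisted B
    l l′ : Carrier
    l = ∂ₛ (∂ₜ (∂ₛ f))
    l′ = ∂ₜ (∂ₛ (∂ₜ f))
    wl : W l
    wl = A.W-∂ (B.W-∂ (A.W-∂ wf))
    wl′ : W l′
    wl′ = B.W-∂ (A.W-∂ (B.W-∂ wf))
    wal : W (a * l)
    wal = W-* a l A.W-a wl
    wal′ : W (a * l′)
    wal′ = W-* a l′ A.W-a wl′

  commute : ∀ {s ∂ₛ a t ∂ₜ b} → Twisted s ∂ₛ a → Twisted t ∂ₜ b → t a ≈ a → s b ≈ b →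
    ∀ {f} → W f → s (t f) ≈ t (s f) → ∂ₛ (∂ₜ f) ≈ ∂ₜ (∂ₛ f)
  commute {s} {∂ₛ} {a} {t} {∂ₜ} {b} A B ta sb {f} wf st = A.cancel w₁ w₂ (B.cancel (W-* a _ A.W-a w₁) (W-* a _ A.W-a w₂) (begin
    b * (a * ∂ₛ (∂ₜ f)) ≈⟨ Pair.∂∂-clear B A sb wf ⟩
    (f + - t f) + - (s f + - s (t f)) ≈⟨ +-congˡ (-‿cong (+-congˡ (-‿cong st))) ⟩
    (f + - t f) + - (s f + - t (s f)) ≈⟨ solve 4 (λ f t s x → (f :- t) :- (s :- x) := (f :- s) :- (t :- x)) refl f (t f) (s f) (t (s f)) ⟩
    (f + - s f) + - (t f + - t (s f)) ≈⟨ Pair.∂∂-clear A B ta wf ⟨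
    a * (b * ∂ₜ (∂ₛ f)) ≈⟨ solve 3 (λ a b x → a :* (b :* x) := b :* (a :* x)) refl a b (∂ₜ (∂ₛ f)) ⟩
    b * (a * ∂ₜ (∂ₛ f)) ∎))
    where
    module A = Twisted A
    module B = Twisted B
    w₁ : W (∂ₛ (∂ₜ f))
    w₁ = A.W-∂ (B.W-∂ wf)
    w₂ : W (∂ₜ (∂ₛ f))
    w₂ = B.W-∂ (A.W-∂ wf)

module Points {r ℓ : Level} (S : CommutativeRing r ℓ) (q : CommutativeRing.Carrier S) (x : ℕ → CommutativeRing.Carrier S) where
  open CommutativeRing S
  open RingTools S
  open Poly S using (pow)
  open Relation.Binary.Reasoning.Setoid setoid

  u : ℕ → Carrier
  u i = sumN i x

  h : Carrier
  h = 1# + - q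

  y : ℕ → Carrier
  y k = x k + h * u k

  u-suc : ∀ k → u (suc k) ≈ u k + x k
  u-suc k = Sum.bigN-snoc k x

  y-lower : ∀ k → y k ≈ q * x k + h * u (suc k)
  y-lower k = sym (trans (+-congˡ (*-congˡ (u-suc k))) (solve 3 (λ q x u → q :* x :+ (:1 :- q) :* (u :+ x) := x :+ (:1 :- q) :* u) refl q (x k) (u k)))

  hsum : ℕ → Carrier → Carrier → Carrier
  hsum a c d = sumN a (λ m → pow d m * pow c (a ℕ.∸ 1 ℕ.∸ m))

  hsum-+ : ∀ a b c d → hsum (a ℕ.+ b) c d ≈ pow c b * hsum a c d + pow d a * hsum b c d
  hsum-+ a b c d = trans (Sum.bigN-+ a b _) (+-cong
    (trans (Sum.bigN-cong a λ m m<a → trans (*-congˡ (trans (reflexive (≡.cong (pow c) (e₁ a m m<a))) (pow-+ c b _))) (solve 3 (λ d c c′ → d :* (c :* c′) := c :* (d :* c′)) refl _ _ _)) (sym (sumN-*ˡ a (pow c b) _)))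
    (trans (Sum.bigN-cong b λ m m<b → trans (*-cong (pow-+ d a m) (reflexive (≡.cong (pow c) (e₂ m)))) (*-assoc _ _ _)) (sym (sumN-*ˡ b (pow d a) _))))
    where
    e₁ : ∀ a m → m ℕ.< a → a ℕ.+ b ℕ.∸ 1 ℕ.∸ m ≡ b ℕ.+ (a ℕ.∸ 1 ℕ.∸ m)
    e₁ (suc a) m (s≤s m≤a) = ≡.trans (≡.cong (ℕ._∸ m) (ℕₚ.+-comm a b)) (ℕₚ.+-∸-assoc b m≤a)
    e₂ : ∀ m → a ℕ.+ b ℕ.∸ 1 ℕ.∸ (a ℕ.+ m) ≡ b ℕ.∸ 1 ℕ.∸ m
    e₂ m = ≡.trans (ℕₚ.∸-+-assoc (a ℕ.+ b) 1 (a ℕ.+ m)) (≡.trans (≡.cong (a ℕ.+ b ℕ.∸_) (≡.sym (ℕₚ.+-suc a m))) (≡.trans (ℕₚ.[m+n]∸[m+o]≡n∸o a b (suc m)) (≡.sym (ℕₚ.∸-+-assoc b 1 m))))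

  hsum-1 : ∀ c d → hsum 1 c d ≈ 1#
  hsum-1 c d = solve 0 (:1 :* :1 :+ :0 := :1) refl

  hsum-suc : ∀ a c d → hsum (suc a) c d ≈ c * hsum a c d + pow d a
  hsum-suc a c d = trans (reflexive (≡.cong (λ z → hsum z c d) (ℕₚ.+-comm 1 a))) (trans (hsum-+ a 1 c d)
    (+-cong (*-congʳ (*-identityʳ c)) (trans (*-congˡ (hsum-1 c d)) (*-identityʳ _))))

  hsum-mul : ∀ a c d → (c + - d) * hsum a c d ≈ pow c a + - pow d a
  hsum-mul zero c d = trans (zeroʳ _) (sym (-‿inverseʳ 1#))
  hsum-mul (suc a) c d = begin
    (c + - d) * hsum (suc a) c d ≈⟨ *-congˡ (hsum-suc a c d) ⟩
    (c + - d) * (c * hsum a c d + pow d a) ≈⟨ solve 4 (λ c d s p → (c :- d) :* (c :* s :+ p) := c :* ((c :- d) :* s) :+ (c :- d) :* p) refl c d _ _ ⟩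
    c * ((c + - d) * hsum a c d) + (c + - d) * pow d a ≈⟨ +-congʳ (*-congˡ (hsum-mul a c d)) ⟩
    c * (pow c a + - pow d a) + (c + - d) * pow d a ≈⟨ solve 4 (λ c d p r → c :* (p :- r) :+ (c :- d) :* r := c :* p :- d :* r) refl c d _ _ ⟩
    c * pow c a + - (d * pow d a) ∎

  hsum-exchange : ∀ a b c d → pow c b * hsum a c d + - (pow c a * hsum b c d) ≈ hsum a c d * pow d b + - (pow d a * hsum b c d)
  hsum-exchange a b c d = begin
    pow c b * hsum a c d + - (pow c a * hsum b c d)
      ≈⟨ solve 3 (λ p r s → p :- r := (p :+ s) :- (r :+ s)) refl _ _ (pow d a * hsum b c d + pow d b * hsum a c d) ⟩
    (pow c b * A + (pow d a * B + pow d b * A)) + - (pow c a * B + (pow d a * B + pow d b * A))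
      ≈⟨ solve 4 (λ p r s t → (p :+ (r :+ s)) :- (t :+ (r :+ s)) := ((p :+ r) :- (t :+ s)) :+ (s :- r)) refl (pow c b * A) (pow d a * B) (pow d b * A) (pow c a * B) ⟩
    ((pow c b * A + pow d a * B) + - (pow c a * B + pow d b * A)) + (pow d b * A + - (pow d a * B))
      ≈⟨ +-cong (trans (+-cong (sym (hsum-+ a b c d)) (-‿cong (trans (sym (hsum-+ b a c d)) (reflexive (≡.cong (λ z → hsum z c d) (ℕₚ.+-comm b a)))))) (-‿inverseʳ _)) (+-congʳ (*-comm _ _)) ⟩
    0# + (A * pow d b + - (pow d a * B)) ≈⟨ +-identityˡ _ ⟩
    A * pow d b + - (pow d a * B) ∎
    where
    A B : Carrier
    A = hsum a c d
    B = hsum b c d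

  slot : ∀ k a → u (suc k) * hsum a (y k) (q * x k) + - (u k * hsum a (y k) (x k)) ≈ qnum q a * pow (x k) a
  slot k zero = solve 2 (λ a b → a :* :0 :- b :* :0 := :0 :* :1) refl _ _
  slot k (suc a) = begin
    U * hsum (suc a) Y (q * X) + - (V * hsum (suc a) Y X) ≈⟨ +-cong (*-congˡ (hsum-suc a Y (q * X))) (-‿cong (*-congˡ (hsum-suc a Y X))) ⟩
    U * (Y * H + pow (q * X) a) + - (V * (Y * H′ + pow X a))
      ≈⟨ solve 7 (λ U Y H p V H′ r → U :* (Y :* H :+ p) :- V :* (Y :* H′ :+ r) := Y :* (U :* H :- V :* H′) :+ U :* p :- V :* r) refl U Y H (pow (q * X) a) V H′ (pow X a) ⟩
    Y * (U * H + - (V * H′)) + U * pow (q * X) a + - (V * pow X a) ≈⟨ +-congʳ (+-cong (*-congˡ (slot k a)) (*-cong (u-suc k) (pow-* q X a))) ⟩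
    Y * (n * p) + (V + X) * (pow q a * p) + - (V * p)
      ≈⟨ solve 6 (λ X V q n p r → (X :+ (:1 :- q) :* V) :* (n :* p) :+ (V :+ X) :* (r :* p) :- V :* p
                 := ((:1 :- q) :* n) :* V :* p :+ X :* (n :* p) :+ (V :+ X) :* (r :* p) :- V :* p) refl X V q n p (pow q a) ⟩
    (h * n) * V * p + X * (n * p) + (V + X) * (pow q a * p) + - (V * p) ≈⟨ +-congʳ (+-congʳ (+-congʳ (*-congʳ (*-congʳ (1-q*qnum q a))))) ⟩
    (1# + - pow q a) * V * p + X * (n * p) + (V + X) * (pow q a * p) + - (V * p)
      ≈⟨ solve 5 (λ r V p X n → (:1 :- r) :* V :* p :+ X :* (n :* p) :+ (V :+ X) :* (r :* p) :- V :* p := (n :+ r) :* (X :* p)) refl (pow q a) V p X n ⟩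
    (n + pow q a) * (X * p) ≈⟨ *-congʳ (qnum-suc q a) ⟨
    qnum q (suc a) * pow X (suc a) ∎
    where
    U V X Y H H′ n p : Carrier
    U = u (suc k)
    V = u k
    X = x k
    Y = y k
    H = hsum a Y (q * X)
    H′ = hsum a Y X
    n = qnum q a
    p = pow X a

  evX : ℕ → List ℕ → Carrier
  evX k [] = 1#
  evX k (a ∷ α) = pow (x k) a * evX (suc k) α

  -- x^α, its first exponent belonging to the variable k, at (q x_k, …, q x_{k+i-1}, y_{k+i}, x_{k+i+1}, …)
  evP : ℕ → ℕ → List ℕ → Carrier
  evP i k [] = 1#
  evP zero k (a ∷ α) = pow (y k) a * evX (suc k) α
  evP (suc i) k (a ∷ α) = pow (q * x k) a * evP i (suc k) α

  -- the divided difference ∂ᵢ x^α at the next point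
  evD : ℕ → ℕ → List ℕ → Carrier
  evD i k α = sumN (at α i) (λ m → evP (suc i) k (quoM i (suc i) α m)) + - sumN (at (swapAt i α) i) (λ m → evP (suc i) k (quoM i (suc i) (swapAt i α) m))

  evD-suc : ∀ i k a α → evD (suc i) k (a ∷ α) ≈ pow (q * x k) a * evD i (suc k) α
  evD-suc i k a α = begin
    sumN (at α i) (λ m → p * evP (suc i) (suc k) (quoM i (suc i) α m)) + - sumN (at (swapAt i α) i) (λ m → p * evP (suc i) (suc k) (quoM i (suc i) (swapAt i α) m))
      ≈⟨ +-cong (sumN-*ˡ (at α i) p _) (-‿cong (sumN-*ˡ (at (swapAt i α) i) p _)) ⟨
    p * A + - (p * B) ≈⟨ solve 3 (λ p a b → p :* a :- p :* b := p :* (a :- b)) refl p A B ⟩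
    p * (A + - B) ∎
    where
    p A B : Carrier
    p = pow (q * x k) a
    A = sumN (at α i) (λ m → evP (suc i) (suc k) (quoM i (suc i) α m))
    B = sumN (at (swapAt i α) i) (λ m → evP (suc i) (suc k) (quoM i (suc i) (swapAt i α) m))

  module Relations (n : ℕ) (rel : ∀ k → suc k ℕ.< n → u (suc k) * (q * x k + - x (suc k)) ≈ 0#) (top : u n ≈ 0#) where

    module Slot (k : ℕ) (k<n : suc k ℕ.< n) where
      U d e s c : Carrier
      U = u (suc k)
      d = q * x k
      e = x (suc k)
      s = h * U
      c = d + s

      Ud≈Ue : U * d ≈ U * e
      Ud≈Ue = begin
        U * d ≈⟨ solve 3 (λ U d e → U :* d := U :* (d :- e) :+ U :* e) refl U d e ⟩
        U * (d + - e) + U * e ≈⟨ trans (+-congʳ (rel k k<n)) (+-identityˡ _) ⟩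
        U * e ∎

      U-* : ∀ {a a′ b b′} → U * a ≈ U * a′ → U * b ≈ U * b′ → U * (a * b) ≈ U * (a′ * b′)
      U-* {a} {a′} {b} {b′} ea eb = trans (sym (*-assoc U a b)) (trans (*-congʳ ea) (trans (solve 3 (λ U a b → U :* a :* b := a :* (U :* b)) refl U a′ b)
        (trans (*-congˡ eb) (solve 3 (λ U a b → a :* (U :* b) := U :* (a :* b)) refl U a′ b′))))

      U-+ : ∀ {a a′ b b′} → U * a ≈ U * a′ → U * b ≈ U * b′ → U * (a + b) ≈ U * (a′ + b′)
      U-+ ea eb = trans (distribˡ U _ _) (trans (+-cong ea eb) (sym (distribˡ U _ _)))

      U-- : ∀ {a a′} → U * a ≈ U * a′ → U * (- a) ≈ U * (- a′)
      U-- ea = trans (sym (-‿distribʳ-* U _)) (trans (-‿cong ea) (-‿distribʳ-* U _))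

      U-pow : ∀ {a a′} m → U * a ≈ U * a′ → U * pow a m ≈ U * pow a′ m
      U-pow zero ea = refl
      U-pow (suc m) ea = U-* ea (U-pow m ea)

      U-sumN : ∀ m {f g} → (∀ i → U * f i ≈ U * g i) → U * sumN m f ≈ U * sumN m g
      U-sumN zero eq = refl
      U-sumN (suc m) eq = U-+ (eq 0) (U-sumN m (eq ∘ suc))

      U-hsum : ∀ a {c c′ d d′} → U * c ≈ U * c′ → U * d ≈ U * d′ → U * hsum a c d ≈ U * hsum a c′ d′
      U-hsum a ec ed = U-sumN a (λ m → U-* (U-pow m ed) (U-pow (a ℕ.∸ 1 ℕ.∸ m) ec))

      yk : y k ≈ c
      yk = y-lower k

      Uc : U * y (suc k) ≈ U * c
      Uc = U-+ (sym Ud≈Ue) refl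

      quotient : ℕ → ℕ → Carrier
      quotient a b = hsum a c d * pow e b + - (pow d a * hsum b (y (suc k)) e)

      h-quotient : ∀ a b → h * (U * quotient a b) ≈ pow c a * pow e b + - (pow d a * pow (y (suc k)) b)
      h-quotient a b = begin
        h * (U * (hsum a c d * pow e b + - (pow d a * B))) ≈⟨ solve 6 (λ h U A p r B → h :* (U :* (A :* p :- r :* B)) := (h :* U) :* A :* p :- r :* ((h :* U) :* B)) refl h U (hsum a c d) (pow e b) (pow d a) B ⟩
        s * hsum a c d * pow e b + - (pow d a * (s * B))
          ≈⟨ +-cong (*-congʳ (trans (*-congʳ (solve 2 (λ d s → s := d :+ s :- d) refl d s)) (hsum-mul a c d)))
               (-‿cong (*-congˡ (trans (*-congʳ (solve 2 (λ e s → s := e :+ s :- e) refl e s)) (hsum-mul b (y (suc k)) e)))) ⟩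
        (pow c a + - pow d a) * pow e b + - (pow d a * (pow (y (suc k)) b + - pow e b)) ≈⟨ solve 4 (λ ca da eb yb → (ca :- da) :* eb :- da :* (yb :- eb) := ca :* eb :- da :* yb) refl _ _ _ _ ⟩
        pow c a * pow e b + - (pow d a * pow (y (suc k)) b) ∎
        where
        B : Carrier
        B = hsum b (y (suc k)) e

      U-evD : ∀ a b B → U * evD 0 k (a ∷ b ∷ B) ≈ U * quotient a b * evX (suc (suc k)) B
      U-evD a b B = begin
        U * (sumN a (λ m → pow d m * (pow Y (b ℕ.+ (a ℕ.∸ 1 ℕ.∸ m)) * X)) + - sumN b (λ m → pow d m * (pow Y (a ℕ.+ (b ℕ.∸ 1 ℕ.∸ m)) * X)))
          ≈⟨ *-congˡ (trans (+-cong (half a b) (-‿cong (half b a))) (solve 3 (λ p r x → p :* x :- r :* x := (p :- r) :* x) refl (pow Y b * hsum a Y d) (pow Y a * hsum b Y d) X)) ⟩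
        U * ((pow Y b * hsum a Y d + - (pow Y a * hsum b Y d)) * X) ≈⟨ *-assoc U _ X ⟨
        U * (pow Y b * hsum a Y d + - (pow Y a * hsum b Y d)) * X
          ≈⟨ *-congʳ (U-+ (U-* (U-pow b Uc) (U-hsum a Uc refl)) (U-- (U-* (U-pow a Uc) (U-hsum b Uc refl)))) ⟩
        U * (pow c b * hsum a c d + - (pow c a * hsum b c d)) * X ≈⟨ *-congʳ (*-congˡ (hsum-exchange a b c d)) ⟩
        U * (hsum a c d * pow d b + - (pow d a * hsum b c d)) * X
          ≈⟨ *-congʳ (U-+ (U-* refl (U-pow b Ud≈Ue)) (U-- (U-* refl (U-hsum b (sym Uc) Ud≈Ue)))) ⟩
        U * quotient a b * X ∎
        where
        X Y : Carrier
        X = evX (suc (suc k)) B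
        Y = y (suc k)
        half : ∀ a b → sumN a (λ m → pow d m * (pow Y (b ℕ.+ (a ℕ.∸ 1 ℕ.∸ m)) * X)) ≈ pow Y b * hsum a Y d * X
        half a b = trans (Sum.bigN-cong a (λ m _ → trans (*-congˡ (*-congʳ (pow-+ Y b _))) (solve 4 (λ d y z x → d :* (y :* z :* x) := y :* x :* (d :* z)) refl (pow d m) (pow Y b) _ X)))
          (trans (sym (sumN-*ˡ a _ _)) (solve 3 (λ y x z → y :* x :* z := y :* z :* x) refl (pow Y b) X _))

    step-monomial : ∀ i k α → k ℕ.+ length α ≡ n → suc (k ℕ.+ i) ℕ.< n → evP i k α + - evP (suc i) k α ≈ h * (u (suc (k ℕ.+ i)) * evD i k α)
    step-monomial i k [] e l = ⊥-elim (ℕₚ.<⇒≱ l (ℕₚ.≤-trans (ℕₚ.≤-reflexive (≡.trans (≡.sym e) (ℕₚ.+-identityʳ k))) (ℕₚ.m≤n⇒m≤1+n (ℕₚ.m≤m+n k i))))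
    step-monomial zero k (a ∷ []) e l = ⊥-elim (ℕₚ.<⇒≢ l (≡.trans (≡.cong suc (ℕₚ.+-identityʳ k)) (≡.trans (ℕₚ.+-comm 1 k) e)))
    step-monomial zero k (a ∷ b ∷ B) kn l = begin
      pow (y k) a * (pow (x (suc k)) b * X) + - (pow d a * (pow (y (suc k)) b * X)) ≈⟨ +-congʳ (*-congʳ (pow-cong a yk)) ⟩
      pow c a * (pow (x (suc k)) b * X) + - (pow d a * (pow (y (suc k)) b * X)) ≈⟨ solve 5 (λ p r s t x → p :* (r :* x) :- s :* (t :* x) := (p :* r :- s :* t) :* x) refl _ _ _ _ X ⟩
      (pow c a * pow (x (suc k)) b + - (pow d a * pow (y (suc k)) b)) * X ≈⟨ *-congʳ (h-quotient a b) ⟨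
      h * (U * quotient a b) * X ≈⟨ *-assoc h _ X ⟩
      h * (U * quotient a b * X) ≈⟨ *-congˡ (U-evD a b B) ⟨
      h * (U * evD 0 k (a ∷ b ∷ B)) ≈⟨ *-congˡ (*-congʳ (reflexive (≡.cong (u ∘ suc) (ℕₚ.+-identityʳ k)))) ⟨
      h * (u (suc (k ℕ.+ 0)) * evD 0 k (a ∷ b ∷ B)) ∎
      where
      open Slot k (≡.subst (λ z → suc z ℕ.< n) (ℕₚ.+-identityʳ k) l)
      X : Carrier
      X = evX (suc (suc k)) B
    step-monomial (suc i) k (a ∷ α) e l = begin
      p * evP i (suc k) α + - (p * evP (suc i) (suc k) α) ≈⟨ solve 3 (λ p a b → p :* a :- p :* b := p :* (a :- b)) refl p _ _ ⟩
      p * (evP i (suc k) α + - evP (suc i) (suc k) α) ≈⟨ *-congˡ (step-monomial i (suc k) α (≡.trans (≡.sym (ℕₚ.+-suc k _)) e) (≡.subst (λ z → suc z ℕ.< n) (ℕₚ.+-suc k i) l)) ⟩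
      p * (h * (u (suc (suc k ℕ.+ i)) * evD i (suc k) α)) ≈⟨ solve 4 (λ p h u e → p :* (h :* (u :* e)) := h :* (u :* (p :* e))) refl p h _ _ ⟩
      h * (u (suc (suc k ℕ.+ i)) * (p * evD i (suc k) α)) ≈⟨ *-congˡ (*-cong (reflexive (≡.cong (u ∘ suc) (≡.sym (ℕₚ.+-suc k i)))) (sym (evD-suc i k a α))) ⟩
      h * (u (suc (k ℕ.+ suc i)) * evD (suc i) k (a ∷ α)) ∎
      where
      p : Carrier
      p = pow (q * x k) a

    total : ℕ → List ℕ → Carrier
    total k α = sumN (length α ℕ.∸ 1) (λ i → u (suc (k ℕ.+ i)) * evD i k α)

    total-monomial : ∀ k a α → k ℕ.+ suc (length α) ≡ n →
      total k (a ∷ α) ≈ qnum q (a ℕ.+ sum α) * evX k (a ∷ α) + u k * hsum a (y k) (x k) * evX (suc k) α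
    total-monomial k a [] e = begin
      0# ≈⟨ trans (*-congʳ (trans (reflexive (≡.cong u (≡.trans (ℕₚ.+-comm 1 k) e))) top)) (zeroˡ _) ⟨
      u (suc k) * hsum a (y k) (q * x k) ≈⟨ solve 2 (λ a b → a := a :- b :+ b) refl _ (u k * hsum a (y k) (x k)) ⟩
      u (suc k) * hsum a (y k) (q * x k) + - (u k * hsum a (y k) (x k)) + u k * hsum a (y k) (x k) ≈⟨ +-cong (slot k a) (sym (*-identityʳ _)) ⟩
      qnum q a * pow (x k) a + u k * hsum a (y k) (x k) * 1# ≈⟨ +-congʳ (*-cong (reflexive (≡.cong (qnum q) (≡.sym (ℕₚ.+-identityʳ a)))) (sym (*-identityʳ _))) ⟩
      qnum q (a ℕ.+ 0) * (pow (x k) a * 1#) + u k * hsum a (y k) (x k) * 1# ∎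
    total-monomial k a (b ∷ B) kn = begin
      u (suc (k ℕ.+ 0)) * evD 0 k (a ∷ b ∷ B) + sumN (length B) (λ i → u (suc (k ℕ.+ suc i)) * evD (suc i) k (a ∷ b ∷ B))
        ≈⟨ +-cong (trans (*-congʳ (reflexive (≡.cong (u ∘ suc) (ℕₚ.+-identityʳ k)))) (U-evD a b B)) (trans (Sum.bigN-cong (length B) λ i _ → trans (*-cong (reflexive (≡.cong (u ∘ suc) (ℕₚ.+-suc k i))) (evD-suc i k a (b ∷ B)))
             (solve 3 (λ u p e → u :* (p :* e) := p :* (u :* e)) refl _ p _)) (sym (sumN-*ˡ (length B) p _))) ⟩
      U * quotient a b * X + p * total (suc k) (b ∷ B) ≈⟨ +-congˡ (*-congˡ (total-monomial (suc k) b B (≡.trans (≡.sym (ℕₚ.+-suc k _)) kn))) ⟩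
      U * (hsum a c d * pow (x (suc k)) b + - (p * Hb)) * X + p * (m * (pow (x (suc k)) b * X) + U * Hb * X)
        ≈⟨ solve 7 (λ U H w p Hb X m → U :* (H :* w :- p :* Hb) :* X :+ p :* (m :* (w :* X) :+ U :* Hb :* X) := U :* H :* (w :* X) :+ p :* m :* (w :* X)) refl U (hsum a c d) (pow (x (suc k)) b) p Hb X m ⟩
      U * hsum a c d * W + p * m * W
        ≈⟨ +-cong (*-congʳ (trans (*-congˡ (Sum.bigN-cong a (λ m _ → *-congˡ (pow-cong (a ℕ.∸ 1 ℕ.∸ m) (sym yk))))) (trans (solve 2 (λ a b → a := a :- b :+ b) refl _ (u k * hsum a (y k) (x k))) (+-congʳ (slot k a))))) (*-congʳ (*-congʳ (pow-* q (x k) a))) ⟩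
      (qnum q a * pow (x k) a + u k * hsum a (y k) (x k)) * W + pow q a * pow (x k) a * m * W
        ≈⟨ solve 6 (λ n w g v r m → (n :* w :+ g) :* v :+ r :* w :* m :* v := (n :+ r :* m) :* (w :* v) :+ g :* v) refl (qnum q a) (pow (x k) a) (u k * hsum a (y k) (x k)) W (pow q a) m ⟩
      (qnum q a + pow q a * m) * (pow (x k) a * W) + u k * hsum a (y k) (x k) * W ≈⟨ +-congʳ (*-congʳ (qnum-+ q a (b ℕ.+ sum B))) ⟨
      qnum q (a ℕ.+ (b ℕ.+ sum B)) * (pow (x k) a * W) + u k * hsum a (y k) (x k) * W ∎
      where
      k<n : suc k ℕ.< n
      k<n = ≡.subst (suc k ℕ.<_) (≡.trans (≡.sym (ℕₚ.+-suc k _)) kn) (s≤s (ℕₚ.m<m+n k (s≤s z≤n)))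
      open Slot k k<n
      p X W m Hb : Carrier
      p = pow (q * x k) a
      X = evX (suc (suc k)) B
      W = evX (suc k) (b ∷ B)
      m = qnum q (b ℕ.+ sum B)
      Hb = hsum b (y (suc k)) (x (suc k))

    evP-0 : ∀ α → evP 0 0 α ≈ evX 0 α
    evP-0 [] = refl
    evP-0 (a ∷ α) = *-congʳ (pow-cong a (trans (+-congˡ (zeroʳ h)) (+-identityʳ _)))

    sum-monomial : ∀ α → length α ≡ n → sumN (n ℕ.∸ 1) (λ i → u (suc i) * evD i 0 α) ≈ qnum q (sum α) * evP 0 0 α
    sum-monomial [] ≡.refl = sym (zeroˡ _)
    sum-monomial (a ∷ α) ≡.refl = trans (total-monomial 0 a α ≡.refl) (trans (+-congˡ (trans (*-congʳ (zeroˡ _)) (zeroˡ _))) (trans (+-identityʳ _) (*-congˡ (sym (evP-0 (a ∷ α))))))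

module WordSum {r ℓ : Level} (S : CommutativeRing r ℓ) (q : CommutativeRing.Carrier S) (U : ℕ → CommutativeRing.Carrier S) where
  open CommutativeRing S
  open RingTools S
  open Poly S using (pow)
  open Relation.Binary.Reasoning.Setoid setoid

  weight : ℕ → ℕ → ℕ → Carrier
  weight ℓ d i = if d <ᵇ i then pow q ℓ else 1#

  -- wordSum ℓ w i is the sum over the reduced words a of w, ℓ being the length of w, of
  -- q^{comaj (a i)} U_a, with letters counted from 0; wordSumLast is the part of
  -- wordSum (1 + ℓ) w 0 coming from the words ending in d.
  mutual
    wordSum : ℕ → List ℕ → ℕ → Carrier
    wordSum zero w i = 1#
    wordSum (suc ℓ) w i = sumN (length w ℕ.∸ 1) (λ d → weight (suc ℓ) d i * wordSumLast ℓ w d)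

    wordSumLast : ℕ → List ℕ → ℕ → Carrier
    wordSumLast ℓ w d = if at w (suc d) <ᵇ at w d then U d * wordSum ℓ (swapAt d w) (suc d) else 0#

  wordSumLast-descent : ∀ ℓ w d → at w (suc d) ℕ.< at w d → wordSumLast ℓ w d ≡ U d * wordSum ℓ (swapAt d w) (suc d)
  wordSumLast-descent ℓ w d lt = ≡.cong (if_then U d * wordSum ℓ (swapAt d w) (suc d) else 0#) (<ᵇ-true lt)

  wordSumLast-ascent : ∀ ℓ w d → at w d ℕ.≤ at w (suc d) → wordSumLast ℓ w d ≡ 0#
  wordSumLast-ascent ℓ w d le = ≡.cong (if_then U d * wordSum ℓ (swapAt d w) (suc d) else 0#) (<ᵇ-false le)

  wordSum-0 : ∀ ℓ w → wordSum (suc ℓ) w 0 ≈ sumN (length w ℕ.∸ 1) (wordSumLast ℓ w)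
  wordSum-0 ℓ w = Sum.bigN-cong (length w ℕ.∸ 1) (λ d _ → *-identityˡ _)

  wordSum-step : ∀ ℓ w i → i ℕ.< length w ℕ.∸ 1 → wordSum (suc ℓ) w i + - wordSum (suc ℓ) w (suc i) ≈ (1# + - pow q (suc ℓ)) * wordSumLast ℓ w i
  wordSum-step ℓ w i i<m = begin
    wordSum (suc ℓ) w i + - wordSum (suc ℓ) w (suc i) ≈⟨ trans (+-congˡ (sumN-- m _)) (sym (Sum.bigN-∙ m _ _)) ⟩
    sumN m (λ d → weight (suc ℓ) d i * wordSumLast ℓ w d + - (weight (suc ℓ) d (suc i) * wordSumLast ℓ w d)) ≈⟨ Sum.bigN-single m i _ i<m other ⟩
    weight (suc ℓ) i i * W + - (weight (suc ℓ) i (suc i) * W) ≈⟨ +-cong (*-congʳ (reflexive (≡.cong (if_then p else 1#) (<ᵇ-false {i} {i} ℕₚ.≤-refl)))) (-‿cong (*-congʳ (reflexive (≡.cong (if_then p else 1#) (<ᵇ-true {i} {suc i} ℕₚ.≤-refl))))) ⟩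
    1# * W + - (p * W) ≈⟨ solve 2 (λ p w → :1 :* w :- p :* w := (:1 :- p) :* w) refl p W ⟩
    (1# + - p) * W ∎
    where
    m : ℕ
    m = length w ℕ.∸ 1
    W p : Carrier
    W = wordSumLast ℓ w i
    p = pow q (suc ℓ)
    same : ∀ d → d ≢ i → (d <ᵇ i) ≡ (d <ᵇ suc i)
    same d ne with ℕₚ.<-cmp d i
    ... | tri< l _ _ = ≡.trans (<ᵇ-true l) (≡.sym (<ᵇ-true (ℕₚ.m<n⇒m<1+n l)))
    ... | tri≈ _ e _ = ⊥-elim (ne e)
    ... | tri> _ _ l = ≡.trans (<ᵇ-false (ℕₚ.<⇒≤ l)) (≡.sym (<ᵇ-false l))
    other : ∀ d → d ℕ.< m → ¬ (d ≡ i) → weight (suc ℓ) d i * wordSumLast ℓ w d + - (weight (suc ℓ) d (suc i) * wordSumLast ℓ w d) ≈ 0#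
    other d _ ne = trans (+-congʳ (*-congʳ (reflexive (≡.cong (if_then p else 1#) (same d ne))))) (-‿inverseʳ _)

at-++ˡ : ∀ a b d → d ℕ.< length a → at (a ++ b) d ≡ at a d
at-++ˡ (x ∷ a) b zero _ = ≡.refl
at-++ˡ (x ∷ a) b (suc d) (s≤s l) = at-++ˡ a b d l

at-++ʳ : ∀ a b e → at (a ++ b) (length a ℕ.+ e) ≡ at b e
at-++ʳ [] b e = ≡.refl
at-++ʳ (x ∷ a) b e = at-++ʳ a b e

at-map : ∀ (f : ℕ → ℕ) b e → e ℕ.< length b → at (map f b) e ≡ f (at b e)
at-map f (x ∷ b) zero _ = ≡.refl
at-map f (x ∷ b) (suc e) (s≤s l) = at-map f b e l

at-All : ∀ {P : ℕ → Set} {a} d → d ℕ.< length a → All P a → P (at a d)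
at-All zero _ (p ∷ _) = p
at-All (suc d) (s≤s l) (_ ∷ ps) = at-All d l ps

swapAt-++ˡ : ∀ d a b → suc d ℕ.< length a → swapAt d (a ++ b) ≡ swapAt d a ++ b
swapAt-++ˡ zero (x ∷ y ∷ a) b _ = ≡.refl
swapAt-++ˡ zero (x ∷ []) b (s≤s ())
swapAt-++ˡ (suc d) (x ∷ a) b (s≤s l) = ≡.cong (x ∷_) (swapAt-++ˡ d a b l)

swapAt-++ʳ : ∀ a e b → swapAt (length a ℕ.+ e) (a ++ b) ≡ a ++ swapAt e b
swapAt-++ʳ [] e b = ≡.refl
swapAt-++ʳ (x ∷ a) e b = ≡.cong (x ∷_) (swapAt-++ʳ a e b)

swapAt-map : ∀ (f : ℕ → ℕ) e b → swapAt e (map f b) ≡ map f (swapAt e b)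
swapAt-map f zero [] = ≡.refl
swapAt-map f zero (x ∷ []) = ≡.refl
swapAt-map f zero (x ∷ y ∷ b) = ≡.refl
swapAt-map f (suc e) [] = ≡.refl
swapAt-map f (suc e) (x ∷ b) = ≡.cong (f x ∷_) (swapAt-map f e b)

swapAt-×ˡ : ∀ d a b → suc d ℕ.< length a → swapAt d (a ×ₚ b) ≡ swapAt d a ×ₚ b
swapAt-×ˡ d a b l = ≡.trans (swapAt-++ˡ d a _ l) (≡.cong (λ k → swapAt d a ++ map (k ℕ.+_) b) (≡.sym (length-swapAt d a)))

swapAt-×ʳ : ∀ a e b → swapAt (length a ℕ.+ e) (a ×ₚ b) ≡ a ×ₚ swapAt e b
swapAt-×ʳ a e b = ≡.trans (swapAt-++ʳ a e _) (≡.cong (a ++_) (swapAt-map (length a ℕ.+_) e b))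

at-×ʳ : ∀ a b e → e ℕ.< length b → at (a ×ₚ b) (length a ℕ.+ e) ≡ length a ℕ.+ at b e
at-×ʳ a b e l = ≡.trans (at-++ʳ a _ e) (at-map (length a ℕ.+_) b e l)

length-×ₚ : ∀ a b → length (a ×ₚ b) ≡ length a ℕ.+ length b
length-×ₚ a b = ≡.trans (length-++ a) (≡.cong (length a ℕ.+_) (length-map _ b))

Bounded : List ℕ → Set
Bounded a = All (ℕ._< length a) a

Bounded-swapAt : ∀ d {a} → Bounded a → Bounded (swapAt d a)
Bounded-swapAt d {a} p = ≡.subst (λ k → All (ℕ._< k) (swapAt d a)) (≡.sym (length-swapAt d a)) (Permₚ.All-resp-↭ (Perm.↭-sym (swapAt-↭ d a)) p)

module ProductRule {r ℓ : Level} (S : CommutativeRing r ℓ) (q : CommutativeRing.Carrier S) (U : ℕ → CommutativeRing.Carrier S) where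
  open CommutativeRing S
  open RingTools S
  open Poly S using (pow)
  open Relation.Binary.Reasoning.Setoid setoid
  open WordSum S q U

  shifted : ℕ → ℕ → List ℕ → ℕ → Carrier
  shifted k = WordSum.wordSum S q (λ d → U (k ℕ.+ d))

  shiftedLast : ℕ → ℕ → List ℕ → ℕ → Carrier
  shiftedLast k = WordSum.wordSumLast S q (λ d → U (k ℕ.+ d))

  Q : ℕ → Carrier
  Q = qfac q

  wordSum-final : ∀ l w → wordSum l w (length w ℕ.∸ 1) ≈ pow q l * wordSum l w 0
  wordSum-final zero w = sym (*-identityˡ 1#)
  wordSum-final (suc l) w = trans (Sum.bigN-cong m (λ d d<m → *-congʳ (reflexive (≡.cong (if_then pow q (suc l) else 1#) (<ᵇ-true d<m)))))
    (trans (sym (sumN-*ˡ m (pow q (suc l)) (wordSumLast l w))) (*-congˡ (sym (wordSum-0 l w))))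
    where
    m : ℕ
    m = length w ℕ.∸ 1

  -- The word sums of a × b, for both ranges of the index i (compare the shuffle theorem: the
  -- reduced words of a × b are the shuffles of those of a and of b).
  Left Right : List ℕ → List ℕ → ℕ → ℕ → Set ℓ
  Left a b la lb = ∀ i → i ℕ.< length a → Q la * Q lb * wordSum (la ℕ.+ lb) (a ×ₚ b) i ≈ Q (la ℕ.+ lb) * (wordSum la a i * shifted (length a) lb b 0)
  Right a b la lb = ∀ j → j ℕ.< length b → Q la * Q lb * wordSum (la ℕ.+ lb) (a ×ₚ b) (length a ℕ.+ j) ≈ Q (la ℕ.+ lb) * (pow q la * wordSum la a 0 * shifted (length a) lb b j)

  module Step (t : ℕ) (a b : List ℕ) (bd : Bounded a) (a′ b′ : ℕ) (la≡ : length a ≡ suc a′) (lb≡ : length b ≡ suc b′)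
    (IH : ∀ a b → Bounded a → 0 ℕ.< length a → 0 ℕ.< length b → len a ℕ.+ len b ≡ t → Left a b (len a) (len b) × Right a b (len a) (len b))
    (t≡ : len a ℕ.+ len b ≡ suc t) where

    X : List ℕ
    X = a ×ₚ b
    k la lb : ℕ
    k = length a
    la = len a
    lb = len b
    Na Nb : Carrier
    Na = wordSum la a 0
    Nb = shifted k lb b 0

    lX : length X ℕ.∸ 1 ≡ suc a′ ℕ.+ b′
    lX = ≡.cong (ℕ._∸ 1) (≡.trans (length-×ₚ a b) (≡.trans (≡.cong₂ ℕ._+_ la≡ lb≡) (≡.cong suc (ℕₚ.+-suc a′ b′))))

    -- contribution of a descent of a; the case la = 0 is vacuous
    lastA : ℕ → Carrier
    lastA d = wordSumLast (la ℕ.∸ 1) a d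

    lastB : ℕ → Carrier
    lastB e = shiftedLast k (lb ℕ.∸ 1) b e

    left-last : ∀ d → suc d ℕ.< k → Q la * Q lb * wordSumLast t X d ≈ qnum q la * Q t * (lastA d * Nb)
    left-last d d<k = cases (ℕₚ.<-≤-connex (at a (suc d)) (at a d))
      where
      e₀ : at X d ≡ at a d
      e₀ = at-++ˡ a _ d (ℕₚ.<-trans ℕₚ.≤-refl d<k)
      e₁ : at X (suc d) ≡ at a (suc d)
      e₁ = at-++ˡ a _ (suc d) d<k
      cases : at a (suc d) ℕ.< at a d ⊎ at a d ℕ.≤ at a (suc d) → Q la * Q lb * wordSumLast t X d ≈ qnum q la * Q t * (lastA d * Nb)
      cases (inj₂ le) = begin
        Q la * Q lb * wordSumLast t X d ≈⟨ *-congˡ (reflexive (wordSumLast-ascent t X d (≡.subst₂ ℕ._≤_ (≡.sym e₀) (≡.sym e₁) le))) ⟩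
        Q la * Q lb * 0# ≈⟨ solve 3 (λ x y z → x :* :0 := y :* (:0 :* z)) refl (Q la * Q lb) (qnum q la * Q t) Nb ⟩
        qnum q la * Q t * (0# * Nb) ≈⟨ *-congˡ (*-congʳ (reflexive (wordSumLast-ascent (la ℕ.∸ 1) a d le))) ⟨
        qnum q la * Q t * (lastA d * Nb) ∎
      cases (inj₁ lt) = begin
        Q la * Q lb * wordSumLast t X d ≈⟨ *-cong (*-congʳ (reflexive (≡.cong Q la′))) (reflexive (≡.trans (wordSumLast-descent t X d (≡.subst₂ ℕ._<_ (≡.sym e₁) (≡.sym e₀) lt))
             (≡.cong₂ (λ z v → U d * wordSum z v (suc d)) (≡.sym s≡) (swapAt-×ˡ d a b d<k)))) ⟩
        qnum q (suc l) * Q l * Q lb * (U d * wordSum (l ℕ.+ lb) (v ×ₚ b) (suc d)) ≈⟨ solve 5 (λ n p r u w → n :* p :* r :* (u :* w) := n :* u :* (p :* r :* w)) refl _ _ _ _ _ ⟩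
        qnum q (suc l) * U d * (Q l * Q lb * wordSum (l ℕ.+ lb) (v ×ₚ b) (suc d))
          ≈⟨ *-congˡ (proj₁ (IH v b (Bounded-swapAt d bd) (≡.subst (0 ℕ.<_) (≡.sym lv) (ℕₚ.<-trans (s≤s z≤n) d<k)) (≡.subst (0 ℕ.<_) (≡.sym lb≡) (s≤s z≤n)) s≡) (suc d) (≡.subst (suc d ℕ.<_) (≡.sym lv) d<k)) ⟩
        qnum q (suc l) * U d * (Q (l ℕ.+ lb) * (wordSum l v (suc d) * shifted (length v) lb b 0))
          ≈⟨ *-congˡ (*-cong (reflexive (≡.cong Q s≡)) (*-congˡ (reflexive (≡.cong (λ z → shifted z lb b 0) lv)))) ⟩
        qnum q (suc l) * U d * (Q t * (wordSum l v (suc d) * Nb)) ≈⟨ solve 5 (λ n u p w z → n :* u :* (p :* (w :* z)) := n :* p :* (u :* w :* z)) refl _ _ _ _ _ ⟩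
        qnum q (suc l) * Q t * (U d * wordSum l v (suc d) * Nb)
          ≈⟨ *-cong (*-congʳ (reflexive (≡.cong (qnum q) (≡.sym la′)))) (*-congʳ (reflexive (≡.trans (≡.sym (wordSumLast-descent l a d lt)) (≡.cong (λ z → wordSumLast (z ℕ.∸ 1) a d) (≡.sym la′))))) ⟩
        qnum q la * Q t * (lastA d * Nb) ∎
        where
        v : List ℕ
        v = swapAt d a
        l : ℕ
        l = len v
        lv : length v ≡ k
        lv = length-swapAt d a
        la′ : la ≡ suc l
        la′ = len-swapAt-descent d a d<k lt
        s≡ : l ℕ.+ lb ≡ t
        s≡ = ℕₚ.suc-injective (≡.trans (≡.cong (ℕ._+ lb) (≡.sym la′)) t≡)

    middle-last : wordSumLast t X a′ ≈ 0#
    middle-last = reflexive (wordSumLast-ascent t X a′ (ℕₚ.≤-trans (ℕₚ.<⇒≤ (≡.subst (ℕ._< k) (≡.sym (at-++ˡ a _ a′ a′<k)) (at-All a′ a′<k bd)))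
        (≡.subst (k ℕ.≤_) (≡.sym (≡.trans (≡.cong (at X) (≡.trans (≡.sym la≡) (≡.sym (ℕₚ.+-identityʳ k)))) (at-×ʳ a b 0 (≡.subst (0 ℕ.<_) (≡.sym lb≡) (s≤s z≤n))))) (ℕₚ.m≤m+n k _))))
      where
      a′<k : a′ ℕ.< k
      a′<k = ≡.subst (a′ ℕ.<_) (≡.sym la≡) ℕₚ.≤-refl

    right-last : ∀ e → suc e ℕ.< length b → Q la * Q lb * wordSumLast t X (k ℕ.+ e) ≈ qnum q lb * Q t * (pow q la * Na * lastB e)
    right-last e e<b = cases (ℕₚ.<-≤-connex (at b (suc e)) (at b e))
      where
      d : ℕ
      d = k ℕ.+ e
      e₀ : at X d ≡ k ℕ.+ at b e
      e₀ = at-×ʳ a b e (ℕₚ.<-trans ℕₚ.≤-refl e<b)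
      e₁ : at X (suc d) ≡ k ℕ.+ at b (suc e)
      e₁ = ≡.trans (≡.cong (at X) (≡.sym (ℕₚ.+-suc k e))) (at-×ʳ a b (suc e) e<b)
      cases : at b (suc e) ℕ.< at b e ⊎ at b e ℕ.≤ at b (suc e) → Q la * Q lb * wordSumLast t X d ≈ qnum q lb * Q t * (pow q la * Na * lastB e)
      cases (inj₂ le) = begin
        Q la * Q lb * wordSumLast t X d ≈⟨ *-congˡ (reflexive (wordSumLast-ascent t X d (≡.subst₂ ℕ._≤_ (≡.sym e₀) (≡.sym e₁) (ℕₚ.+-monoʳ-≤ k le)))) ⟩
        Q la * Q lb * 0# ≈⟨ solve 3 (λ x y z → x :* :0 := y :* (z :* :0)) refl (Q la * Q lb) (qnum q lb * Q t) (pow q la * Na) ⟩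
        qnum q lb * Q t * (pow q la * Na * 0#) ≈⟨ *-congˡ (*-congˡ (reflexive (WordSum.wordSumLast-ascent S q _ (lb ℕ.∸ 1) b e le))) ⟨
        qnum q lb * Q t * (pow q la * Na * lastB e) ∎
      cases (inj₁ lt) = begin
        Q la * Q lb * wordSumLast t X d ≈⟨ *-cong (*-congˡ (reflexive (≡.cong Q lb′))) (reflexive (≡.trans (wordSumLast-descent t X d (≡.subst₂ ℕ._<_ (≡.sym e₁) (≡.sym e₀) (ℕₚ.+-monoʳ-< k lt)))
             (≡.trans (≡.cong₂ (λ z v → U d * wordSum z v (suc d)) (≡.sym s≡) (swapAt-×ʳ a e b)) (≡.cong (λ z → U d * wordSum (la ℕ.+ l) (a ×ₚ v) z) (≡.sym (ℕₚ.+-suc k e)))))) ⟩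
        Q la * (qnum q (suc l) * Q l) * (U d * wordSum (la ℕ.+ l) (a ×ₚ v) (k ℕ.+ suc e)) ≈⟨ solve 5 (λ r n p u w → r :* (n :* p) :* (u :* w) := n :* u :* (r :* p :* w)) refl _ _ _ _ _ ⟩
        qnum q (suc l) * U d * (Q la * Q l * wordSum (la ℕ.+ l) (a ×ₚ v) (k ℕ.+ suc e))
          ≈⟨ *-congˡ (proj₂ (IH a v bd (≡.subst (0 ℕ.<_) (≡.sym la≡) (s≤s z≤n)) (≡.subst (0 ℕ.<_) (≡.sym lv) (ℕₚ.<-trans (s≤s z≤n) e<b)) s≡) (suc e) (≡.subst (suc e ℕ.<_) (≡.sym lv) e<b)) ⟩
        qnum q (suc l) * U d * (Q (la ℕ.+ l) * (pow q la * Na * shifted k l v (suc e))) ≈⟨ *-congˡ (*-congʳ (reflexive (≡.cong Q s≡))) ⟩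
        qnum q (suc l) * U d * (Q t * (pow q la * Na * shifted k l v (suc e))) ≈⟨ solve 5 (λ n u p w z → n :* u :* (p :* (w :* z)) := n :* p :* (w :* (u :* z))) refl _ _ _ _ _ ⟩
        qnum q (suc l) * Q t * (pow q la * Na * (U d * shifted k l v (suc e)))
          ≈⟨ *-cong (*-congʳ (reflexive (≡.cong (qnum q) (≡.sym lb′)))) (*-congˡ (reflexive (≡.trans (≡.sym (WordSum.wordSumLast-descent S q (λ d → U (k ℕ.+ d)) l b e lt)) (≡.cong (λ z → shiftedLast k (z ℕ.∸ 1) b e) (≡.sym lb′))))) ⟩
        qnum q lb * Q t * (pow q la * Na * lastB e) ∎
        where
        v : List ℕ
        v = swapAt e b
        l : ℕ
        l = len v
        lv : length v ≡ length b
        lv = length-swapAt e b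
        lb′ : lb ≡ suc l
        lb′ = len-swapAt-descent e b e<b lt
        s≡ : la ℕ.+ l ≡ t
        s≡ = ℕₚ.suc-injective (≡.trans (≡.sym (ℕₚ.+-suc la l)) (≡.trans (≡.cong (la ℕ.+_) (≡.sym lb′)) t≡))

    total : ∀ l w (V : ℕ → Carrier) → len w ≡ l → qnum q l * sumN (length w ℕ.∸ 1) (WordSum.wordSumLast S q V (l ℕ.∸ 1) w) ≈ qnum q l * WordSum.wordSum S q V l w 0
    total zero w V e = trans (zeroˡ _) (sym (zeroˡ _))
    total (suc l) w V e = *-congˡ (sym (WordSum.wordSum-0 S q V l w))

    sumN-split : wordSum (suc t) X 0 ≈ sumN a′ (wordSumLast t X) + wordSumLast t X a′ + sumN b′ (λ e → wordSumLast t X (k ℕ.+ e))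
    sumN-split = trans (wordSum-0 t X) (trans (reflexive (≡.cong (λ z → sumN z (wordSumLast t X)) lX)) (trans (Sum.bigN-+ (suc a′) b′ (wordSumLast t X))
      (+-cong (Sum.bigN-snoc a′ (wordSumLast t X)) (Sum.bigN-cong b′ (λ e _ → reflexive (≡.cong (λ z → wordSumLast t X (z ℕ.+ e)) (≡.sym la≡)))))))

    <k : ∀ {d} → d ℕ.< a′ → suc d ℕ.< k
    <k d<a = ≡.subst (suc _ ℕ.<_) (≡.sym la≡) (s≤s d<a)

    <b : ∀ {e} → e ℕ.< b′ → suc e ℕ.< length b
    <b e<b = ≡.subst (suc _ ℕ.<_) (≡.sym lb≡) (s≤s e<b)

    base : Q la * Q lb * wordSum (suc t) X 0 ≈ Q (suc t) * (Na * Nb)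
    base = begin
      Q la * Q lb * wordSum (suc t) X 0 ≈⟨ *-congˡ (trans sumN-split (+-congʳ (trans (+-congˡ middle-last) (+-identityʳ _)))) ⟩
      Q la * Q lb * (sumN a′ (wordSumLast t X) + sumN b′ (λ e → wordSumLast t X (k ℕ.+ e)))
        ≈⟨ trans (distribˡ _ _ _) (+-cong (sumN-*ˡ a′ _ _) (sumN-*ˡ b′ _ _)) ⟩
      sumN a′ (λ d → Q la * Q lb * wordSumLast t X d) + sumN b′ (λ e → Q la * Q lb * wordSumLast t X (k ℕ.+ e))
        ≈⟨ +-cong (Sum.bigN-cong a′ (λ d d<a → trans (left-last d (<k d<a)) (solve 4 (λ n p w z → n :* p :* (w :* z) := p :* z :* (n :* w)) refl _ _ _ _)))
                  (Sum.bigN-cong b′ (λ e e<b → trans (right-last e (<b e<b)) (solve 5 (λ n p w z y → n :* p :* (w :* z :* y) := p :* w :* z :* (n :* y)) refl _ _ _ _ _))) ⟩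
      sumN a′ (λ d → Q t * Nb * (qnum q la * lastA d)) + sumN b′ (λ e → Q t * pow q la * Na * (qnum q lb * lastB e))
        ≈⟨ +-cong (trans (sym (sumN-*ˡ a′ _ _)) (*-congˡ (sym (sumN-*ˡ a′ _ _)))) (trans (sym (sumN-*ˡ b′ _ _)) (*-congˡ (sym (sumN-*ˡ b′ _ _)))) ⟩
      Q t * Nb * (qnum q la * sumN a′ lastA) + Q t * pow q la * Na * (qnum q lb * sumN b′ lastB)
        ≈⟨ +-cong (*-congˡ (trans (*-congˡ (reflexive (≡.cong (λ z → sumN z lastA) (≡.sym (≡.cong (ℕ._∸ 1) la≡))))) (total la a U ≡.refl)))
                  (*-congˡ (trans (*-congˡ (reflexive (≡.cong (λ z → sumN z lastB) (≡.sym (≡.cong (ℕ._∸ 1) lb≡))))) (total lb b (λ d → U (k ℕ.+ d)) ≡.refl))) ⟩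
      Q t * Nb * (qnum q la * Na) + Q t * pow q la * Na * (qnum q lb * Nb) ≈⟨ solve 6 (λ p n a m x b → p :* n :* (a :* m) :+ p :* x :* m :* (b :* n) := (a :+ x :* b) :* p :* (m :* n)) refl (Q t) Nb (qnum q la) Na (pow q la) (qnum q lb) ⟩
      (qnum q la + pow q la * qnum q lb) * Q t * (Na * Nb) ≈⟨ *-congʳ (*-congʳ (trans (sym (qnum-+ q la lb)) (reflexive (≡.cong (qnum q) t≡)))) ⟩
      Q (suc t) * (Na * Nb) ∎

    lower : ∀ (l : ℕ) Z W → (1# + - pow q (suc t)) * (qnum q l * Q t * (Z * W)) ≈ Q (suc t) * ((1# + - pow q l) * Z * W)
    lower l Z W = begin
      (1# + - pow q (suc t)) * (qnum q l * Q t * (Z * W)) ≈⟨ *-congʳ (1-q*qnum q (suc t)) ⟨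
      (1# + - q) * qnum q (suc t) * (qnum q l * Q t * (Z * W)) ≈⟨ solve 6 (λ h s n p z w → h :* s :* (n :* p :* (z :* w)) := s :* p :* ((h :* n) :* z :* w)) refl _ _ _ _ _ _ ⟩
      Q (suc t) * (((1# + - q) * qnum q l) * Z * W) ≈⟨ *-congˡ (*-congʳ (*-congʳ (1-q*qnum q l))) ⟩
      Q (suc t) * ((1# + - pow q l) * Z * W) ∎

    step-general : ∀ l w (V : ℕ → Carrier) i → i ℕ.< length w ℕ.∸ 1 → len w ≡ l →
      WordSum.wordSum S q V l w i + - ((1# + - pow q l) * WordSum.wordSumLast S q V (l ℕ.∸ 1) w i) ≈ WordSum.wordSum S q V l w (suc i)
    step-general zero w V i i<w e = solve 1 (λ x → :1 :- (:1 :- :1) :* x := :1) refl _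
    step-general (suc l) w V i i<w e = trans (+-congˡ (-‿cong (sym (WordSum.wordSum-step S q V l w i i<w)))) (solve 2 (λ a b → a :- (a :- b) := b) refl _ _)

    <X : ∀ {i} → i ℕ.< suc a′ ℕ.+ b′ → i ℕ.< length X ℕ.∸ 1
    <X {i} i< = ≡.subst (i ℕ.<_) (≡.sym lX) i<

    descend : ∀ i → i ℕ.< length X ℕ.∸ 1 → ∀ K {G} → K * wordSum (suc t) X i ≈ G →
      K * wordSum (suc t) X (suc i) ≈ G + - ((1# + - pow q (suc t)) * (K * wordSumLast t X i))
    descend i i<X K {G} e = begin
      K * wordSum (suc t) X (suc i) ≈⟨ solve 3 (λ k a b → k :* b := k :* a :- k :* (a :- b)) refl K (wordSum (suc t) X i) _ ⟩
      K * wordSum (suc t) X i + - (K * (wordSum (suc t) X i + - wordSum (suc t) X (suc i))) ≈⟨ +-cong e (-‿cong (trans (*-congˡ (wordSum-step t X i i<X)) (solve 3 (λ k p l → k :* (p :* l) := p :* (k :* l)) refl K _ _))) ⟩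
      G + - ((1# + - pow q (suc t)) * (K * wordSumLast t X i)) ∎

    left : ∀ i → i ℕ.< k → Q la * Q lb * wordSum (suc t) X i ≈ Q (suc t) * (wordSum la a i * Nb)
    left zero _ = base
    left (suc i) i<k = begin
      Q la * Q lb * wordSum (suc t) X (suc i) ≈⟨ descend i (<X (ℕₚ.<-≤-trans (ℕₚ.<-trans i<a′ ℕₚ.≤-refl) (ℕₚ.m≤m+n (suc a′) b′))) (Q la * Q lb) (left i (ℕₚ.<-trans ℕₚ.≤-refl i<k)) ⟩
      Q (suc t) * (wordSum la a i * Nb) + - ((1# + - pow q (suc t)) * (Q la * Q lb * wordSumLast t X i)) ≈⟨ +-congˡ (-‿cong (trans (*-congˡ (left-last i i<k)) (lower la (lastA i) Nb))) ⟩
      Q (suc t) * (wordSum la a i * Nb) + - (Q (suc t) * ((1# + - pow q la) * lastA i * Nb)) ≈⟨ solve 4 (λ p w n z → p :* (w :* n) :- p :* (z :* n) := p :* ((w :- z) :* n)) refl _ _ Nb _ ⟩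
      Q (suc t) * ((wordSum la a i + - ((1# + - pow q la) * lastA i)) * Nb) ≈⟨ *-congˡ (*-congʳ (step-general la a U i (≡.subst (i ℕ.<_) (≡.sym (≡.cong (ℕ._∸ 1) la≡)) i<a′) ≡.refl)) ⟩
      Q (suc t) * (wordSum la a (suc i) * Nb) ∎
      where
      i<a′ : i ℕ.< a′
      i<a′ = ℕₚ.≤-pred (≡.subst (suc i ℕ.<_) la≡ i<k)

    right : ∀ j → j ℕ.< length b → Q la * Q lb * wordSum (suc t) X (k ℕ.+ j) ≈ Q (suc t) * (pow q la * Na * shifted k lb b j)
    right zero _ = begin
      Q la * Q lb * wordSum (suc t) X (k ℕ.+ 0) ≈⟨ *-congˡ (reflexive (≡.cong (wordSum (suc t) X) (≡.trans (ℕₚ.+-identityʳ k) la≡))) ⟩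
      Q la * Q lb * wordSum (suc t) X (suc a′) ≈⟨ descend a′ (<X (s≤s (ℕₚ.m≤m+n a′ b′))) (Q la * Q lb) (left a′ (≡.subst (a′ ℕ.<_) (≡.sym la≡) ℕₚ.≤-refl)) ⟩
      Q (suc t) * (wordSum la a a′ * Nb) + - ((1# + - pow q (suc t)) * (Q la * Q lb * wordSumLast t X a′)) ≈⟨ +-congˡ (-‿cong (*-congˡ (*-congˡ middle-last))) ⟩
      Q (suc t) * (wordSum la a a′ * Nb) + - ((1# + - pow q (suc t)) * (Q la * Q lb * 0#)) ≈⟨ solve 3 (λ x y z → x :- y :* (z :* :0) := x) refl _ _ _ ⟩
      Q (suc t) * (wordSum la a a′ * Nb) ≈⟨ *-congˡ (*-congʳ (trans (reflexive (≡.cong (wordSum la a) (≡.sym (≡.cong (ℕ._∸ 1) la≡)))) (wordSum-final la a))) ⟩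
      Q (suc t) * (pow q la * Na * Nb) ∎
    right (suc j) j<b = begin
      Q la * Q lb * wordSum (suc t) X (k ℕ.+ suc j) ≈⟨ *-congˡ (reflexive (≡.cong (wordSum (suc t) X) (ℕₚ.+-suc k j))) ⟩
      Q la * Q lb * wordSum (suc t) X (suc (k ℕ.+ j)) ≈⟨ descend (k ℕ.+ j) (<X (≡.subst (λ z → k ℕ.+ j ℕ.< z ℕ.+ b′) la≡ (ℕₚ.+-monoʳ-< k j<b′))) (Q la * Q lb) (right j (ℕₚ.<-trans ℕₚ.≤-refl j<b)) ⟩
      Q (suc t) * (P * shifted k lb b j) + - ((1# + - pow q (suc t)) * (Q la * Q lb * wordSumLast t X (k ℕ.+ j)))
        ≈⟨ +-congˡ (-‿cong (trans (*-congˡ (trans (right-last j j<b) (*-congˡ (*-comm P (lastB j))))) (lower lb (lastB j) P))) ⟩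
      Q (suc t) * (P * shifted k lb b j) + - (Q (suc t) * ((1# + - pow q lb) * lastB j * P)) ≈⟨ solve 4 (λ p w n z → p :* (n :* w) :- p :* (z :* n) := p :* (n :* (w :- z))) refl _ _ P _ ⟩
      Q (suc t) * (P * (shifted k lb b j + - ((1# + - pow q lb) * lastB j))) ≈⟨ *-congˡ (*-congˡ (step-general lb b (λ d → U (k ℕ.+ d)) j (≡.subst (j ℕ.<_) (≡.sym (≡.cong (ℕ._∸ 1) lb≡)) j<b′) ≡.refl)) ⟩
      Q (suc t) * (P * shifted k lb b (suc j)) ∎
      where
      P : Carrier
      P = pow q la * Na
      j<b′ : j ℕ.< b′
      j<b′ = ℕₚ.≤-pred (≡.subst (suc j ℕ.<_) lb≡ j<b)

  product-rules : ∀ t a b → Bounded a → 0 ℕ.< length a → 0 ℕ.< length b → len a ℕ.+ len b ≡ t → Left a b (len a) (len b) × Right a b (len a) (len b)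
  product-rules zero a b bd _ _ e with len a | len b
  ... | zero | zero = (λ i _ → solve 0 (:1 :* :1 :* :1 := :1 :* (:1 :* :1)) refl) , (λ j _ → solve 0 (:1 :* :1 :* :1 := :1 :* (:1 :* :1 :* :1)) refl)
  product-rules (suc t) a b bd a>0 b>0 e = (λ i i<k → trans (*-congˡ (cast i)) (trans (St.left i i<k) (*-congʳ (reflexive (≡.cong Q (≡.sym e))))))
                                         , (λ j j<b → trans (*-congˡ (cast _)) (trans (St.right j j<b) (*-congʳ (reflexive (≡.cong Q (≡.sym e))))))
    where
    pred≡ : ∀ {m} → 0 ℕ.< m → m ≡ suc (m ℕ.∸ 1)
    pred≡ (s≤s _) = ≡.refl
    module St = Step t a b bd (length a ℕ.∸ 1) (length b ℕ.∸ 1) (pred≡ a>0) (pred≡ b>0) (product-rules t) e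
    cast : ∀ i → wordSum (len a ℕ.+ len b) (a ×ₚ b) i ≈ wordSum (suc t) (a ×ₚ b) i
    cast i = reflexive (≡.cong (λ z → wordSum z (a ×ₚ b) i) e)

  wordSum-×ₚ : ∀ a b → Bounded a → 0 ℕ.< length a → 0 ℕ.< length b →
    Q (len a) * Q (len b) * wordSum (len a ℕ.+ len b) (a ×ₚ b) 0 ≈ Q (len a ℕ.+ len b) * (wordSum (len a) a 0 * shifted (length a) (len b) b 0)
  wordSum-×ₚ a b bd a>0 b>0 = proj₁ (product-rules _ a b bd a>0 b>0 ≡.refl) 0 a>0

module BlockDecomposition where
  open import Data.Nat using (_+_; _*_; _∸_; _<_; _≤_)
  open ≡ using (refl; sym; trans; cong; cong₂; subst; subst₂; module ≡-Reasoning)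

  ×ₚ-identityˡ : ∀ b → [] ×ₚ b ≡ b
  ×ₚ-identityˡ b = map-id b

  ×ₚ-assoc : ∀ a b c → (a ×ₚ b) ×ₚ c ≡ a ×ₚ (b ×ₚ c)
  ×ₚ-assoc a b c = trans (++-assoc a _ _) (cong (a ++_) (trans (cong (map (length a +_) b ++_) shift-c) (sym (map-++ (length a +_) b _))))
    where
    shift-c : map (length (a ×ₚ b) +_) c ≡ map (length a +_) (map (length b +_) c)
    shift-c = trans (map-cong (λ x → trans (cong (_+ x) (length-×ₚ a b)) (ℕₚ.+-assoc (length a) (length b) x)) c) (map-∘ c)

  product : List (List ℕ) → List ℕ
  product = foldr _×ₚ_ []

  product-++ : ∀ us vs → product (us ++ vs) ≡ product us ×ₚ product vs
  product-++ [] vs = sym (×ₚ-identityˡ _)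
  product-++ (u ∷ us) vs = trans (cong (u ×ₚ_) (product-++ us vs)) (sym (×ₚ-assoc u (product us) (product vs)))

  countLess-shift : ∀ k x b → countLess (k + x) (map (k +_) b) ≡ countLess x b
  countLess-shift k x [] = refl
  countLess-shift k x (y ∷ b) = cong₂ _+_ (cong (if_then 1 else 0) (lt k)) (countLess-shift k x b)
    where
    lt : ∀ k → (k + y <ᵇ k + x) ≡ (y <ᵇ x)
    lt zero = refl
    lt (suc k) = lt k

  len-shift : ∀ k b → len (map (k +_) b) ≡ len b
  len-shift k [] = refl
  len-shift k (x ∷ b) = cong₂ _+_ (countLess-shift k x b) (len-shift k b)

  countLess-++ : ∀ x a b → countLess x (a ++ b) ≡ countLess x a + countLess x b
  countLess-++ x [] b = refl
  countLess-++ x (y ∷ a) b = trans (cong ((if y <ᵇ x then 1 else 0) +_) (countLess-++ x a b)) (sym (ℕₚ.+-assoc (if y <ᵇ x then 1 else 0) _ _))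

  len-×ₚ : ∀ a b → Bounded a → len (a ×ₚ b) ≡ len a + len b
  len-×ₚ a b bd = go a bd
    where
    go : ∀ a′ → All (_< length a) a′ → len (a′ ++ map (length a +_) b) ≡ len a′ + len b
    go [] _ = len-shift (length a) b
    go (x ∷ a′) (x< ∷ p) = trans (cong₂ _+_ (trans (countLess-++ x a′ _) (trans (cong (countLess x a′ +_) (countLess-≥ x _ (Allₚ.map⁺ (All.universal (λ y → ℕₚ.≤-trans (ℕₚ.<⇒≤ x<) (ℕₚ.m≤m+n _ y)) b)))) (ℕₚ.+-identityʳ _)))
      (go a′ p)) (sym (ℕₚ.+-assoc (countLess x a′) _ _))

  Standard : List ℕ → Set
  Standard w = Bounded w × Unique w

  Standard-×ₚ : ∀ a b → Standard a → Standard b → Standard (a ×ₚ b)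
  Standard-×ₚ a b (ba , ua) (bb , ub) =
    subst (λ k → All (_< k) (a ×ₚ b)) (sym (length-×ₚ a b)) (Allₚ.++⁺ (All.map (λ l → ℕₚ.<-≤-trans l (ℕₚ.m≤m+n _ _)) ba) (Allₚ.map⁺ (All.map (ℕₚ.+-monoʳ-< (length a)) bb)))
    , Uniqueₚ.++⁺ ua (Uniqueₚ.map⁺ (λ {x} {y} → ℕₚ.+-cancelˡ-≡ (length a) x y) ub) λ { (i , j) → disjoint i (Memₚ.∈-map⁻ (length a +_) j) }
    where
    disjoint : ∀ {v} → v ∈ a → (∃ λ y → y ∈ b × v ≡ length a + y) → ⊥
    disjoint i (y , _ , refl) = ℕₚ.<⇒≱ (All.lookup ba i) (ℕₚ.m≤m+n _ y)

  Standard-product : ∀ ws → All Standard ws → Standard (product ws)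
  Standard-product [] [] = [] , []
  Standard-product (w ∷ ws) (s ∷ ss) = Standard-×ₚ w (product ws) s (Standard-product ws ss)

  Standard⇒↭ : ∀ n w → Standard w → length w ≡ n → w ↭ upTo n
  Standard⇒↭ n w (bd , u) refl = go (unique-⊆ w (upTo n) u (All.map Memₚ.∈-upTo⁺ bd))
    where
    go : (∃ λ zs → upTo n ↭ w ++ zs) → w ↭ upTo n
    go ([] , p) = Perm.↭-sym (subst (upTo n ↭_) (++-identityʳ w) p)
    go (z ∷ zs , p) = ⊥-elim (ℕₚ.m+1+n≢m n (trans (sym (length-++ w)) (trans (sym (Permₚ.↭-length p)) (length-upTo n))))

  IsPerm⇒Standard : ∀ n w → IsPerm n w → Standard w
  IsPerm⇒Standard n w (refl , p) = Permₚ.All-resp-↭ (Perm.↭-sym p) (Allₚ.applyUpTo⁺₁ id n id) , Unique-resp-↭ (Perm.↭-sym p) (Uniqueₚ.upTo⁺ n)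

  CrossInversion : ℕ → List ℕ → Set
  CrossInversion c w = ∃ λ x → ∃ λ y → x ∈ take c w × y ∈ drop c w × y < x

  take-swapAt-↭ : ∀ c d w → suc d ≢ c → take c (swapAt d w) ↭ take c w
  take-swapAt-↭ zero d w ne = Perm.refl
  take-swapAt-↭ (suc zero) zero w ne = ⊥-elim (ne refl)
  take-swapAt-↭ (suc (suc c)) zero [] ne = Perm.refl
  take-swapAt-↭ (suc (suc c)) zero (a ∷ []) ne = Perm.refl
  take-swapAt-↭ (suc (suc c)) zero (a ∷ b ∷ w) ne = Perm.swap b a Perm.refl
  take-swapAt-↭ (suc c) (suc d) [] ne = Perm.refl
  take-swapAt-↭ (suc c) (suc d) (a ∷ w) ne = Perm.prep a (take-swapAt-↭ c d w (ne ∘ cong suc))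

  drop-swapAt-↭ : ∀ c d w → suc d ≢ c → drop c (swapAt d w) ↭ drop c w
  drop-swapAt-↭ zero d w ne = swapAt-↭ d w
  drop-swapAt-↭ (suc zero) zero w ne = ⊥-elim (ne refl)
  drop-swapAt-↭ (suc (suc c)) zero [] ne = Perm.refl
  drop-swapAt-↭ (suc (suc c)) zero (a ∷ []) ne = Perm.refl
  drop-swapAt-↭ (suc (suc c)) zero (a ∷ b ∷ w) ne = Perm.refl
  drop-swapAt-↭ (suc c) (suc d) [] ne = Perm.refl
  drop-swapAt-↭ (suc c) (suc d) (a ∷ w) ne = drop-swapAt-↭ c d w (ne ∘ cong suc)

  CrossInversion-swapAt : ∀ c d w → suc d ≢ c → CrossInversion c w → CrossInversion c (swapAt d w)
  CrossInversion-swapAt c d w ne (x , y , x∈ , y∈ , lt) = x , y , Permₚ.∈-resp-↭ (Perm.↭-sym (take-swapAt-↭ c d w ne)) x∈ , Permₚ.∈-resp-↭ (Perm.↭-sym (drop-swapAt-↭ c d w ne)) y∈ , lt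

  sorted⇒no-CrossInversion : ∀ c w → AllPairs _≤_ w → ¬ CrossInversion c w
  sorted⇒no-CrossInversion (suc c) (a ∷ w) (p ∷ s) (x , y , here refl , y∈ , lt) = ℕₚ.<⇒≱ lt (All.lookup p (drop-⊆ c w y∈))
    where
    drop-⊆ : ∀ c w {y} → y ∈ drop c w → y ∈ w
    drop-⊆ c w i = subst (_ ∈_) (take++drop≡id c w) (Memₚ.∈-++⁺ʳ (take c w) i)
  sorted⇒no-CrossInversion (suc c) (a ∷ w) (p ∷ s) (x , y , there x∈ , y∈ , lt) = sorted⇒no-CrossInversion c w s (x , y , x∈ , y∈ , lt)

  CrossInversion-×ʳ : ∀ c a b → CrossInversion c b → CrossInversion (length a + c) (a ×ₚ b)
  CrossInversion-×ʳ c a b (x , y , x∈ , y∈ , lt) = length a + x , length a + y , goT a , goD a , ℕₚ.+-monoʳ-< (length a) lt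
    where
    f : ℕ → ℕ
    f = length a +_
    take-map : ∀ c b → take c (map f b) ≡ map f (take c b)
    take-map zero b = refl
    take-map (suc c) [] = refl
    take-map (suc c) (z ∷ b) = cong (f z ∷_) (take-map c b)
    drop-map : ∀ c b → drop c (map f b) ≡ map f (drop c b)
    drop-map zero b = refl
    drop-map (suc c) [] = refl
    drop-map (suc c) (z ∷ b) = drop-map c b
    goT : ∀ a′ → f x ∈ take (length a′ + c) (a′ ++ map f b)
    goT [] = subst (f x ∈_) (sym (take-map c b)) (Memₚ.∈-map⁺ f x∈)
    goT (z ∷ a′) = there (goT a′)
    goD : ∀ a′ → f y ∈ drop (length a′ + c) (a′ ++ map f b)
    goD [] = subst (f y ∈_) (sym (drop-map c b)) (Memₚ.∈-map⁺ f y∈)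
    goD (z ∷ a′) = goD a′

  CrossInversion-×ˡ : ∀ c a b → CrossInversion c a → CrossInversion c (a ×ₚ b)
  CrossInversion-×ˡ c a b (x , y , x∈ , y∈ , lt) = x , y , goT c a x∈ , goD c a y∈ , lt
    where
    goT : ∀ c a′ → x ∈ take c a′ → x ∈ take c (a′ ++ map (length a +_) b)
    goT (suc c) (z ∷ a′) (here e) = here e
    goT (suc c) (z ∷ a′) (there i) = there (goT c a′ i)
    goD : ∀ c a′ → y ∈ drop c a′ → y ∈ drop c (a′ ++ map (length a +_) b)
    goD zero a′ i = Memₚ.∈-++⁺ˡ i
    goD (suc c) (z ∷ a′) i = goD c a′ i

  upTo-+ : ∀ r s → upTo (r + s) ≡ upTo r ++ map (r +_) (upTo s)
  upTo-+ r s = go r id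
    where
    go : ∀ r (f : ℕ → ℕ) → applyUpTo f (r + s) ≡ applyUpTo f r ++ map (f ∘ (r +_)) (upTo s)
    go zero f = sym (map-upTo f s)
    go (suc r) f = cong (f 0 ∷_) (go r (f ∘ suc))

  ++-cancel : ∀ (a b c d : List ℕ) → length a ≡ length c → a ++ b ≡ c ++ d → a ≡ c × b ≡ d
  ++-cancel [] b [] d _ e = refl , e
  ++-cancel (x ∷ a) b (y ∷ c) d l e with ∷-injective e
  ... | refl , e′ with ++-cancel a b c d (ℕₚ.suc-injective l) e′
  ... | refl , e″ = refl , e″

  indecomposable⇒CrossInversion : ∀ w r → Indecomposable w → 1 ≤ r → r < length w → CrossInversion r w
  indecomposable⇒CrossInversion w r (isp , _ , indec) 1≤r r<n with all? (λ x → all? (x ℕ.≤?_) (drop r w)) (take r w)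
  ... | no ¬all with find (take r w) ¬all
    where
    find : ∀ u → ¬ All (λ x → All (x ≤_) (drop r w)) u → ∃ λ x → x ∈ u × ¬ All (x ≤_) (drop r w)
    find u na with Allₚ.¬All⇒Any¬ (λ x → all? (x ℕ.≤?_) (drop r w)) u na
    ... | any = Data.List.Membership.Propositional.find any
  ... | x , x∈ , ¬x with Data.List.Membership.Propositional.find (Allₚ.¬All⇒Any¬ (x ℕ.≤?_) (drop r w) ¬x)
  ... | y , y∈ , y≱x = x , y , x∈ , y∈ , ℕₚ.≰⇒> y≱x
  indecomposable⇒CrossInversion w r (isp , _ , indec) 1≤r r<n | yes cross = ⊥-elim (indec u v′ (refl , u↭) (refl , v′↭) 1≤u 1≤v′ w≡)
    where
    u v v′ : List ℕ
    u = take r w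
    v = drop r w
    v′ = map (_∸ r) v
    s : ℕ
    s = length w ∸ r
    lu : length u ≡ r
    lu = trans (length-take r w) (ℕₚ.m≤n⇒m⊓n≡m (ℕₚ.<⇒≤ r<n))
    lv : length v ≡ s
    lv = length-drop r w
    rs : r + s ≡ length w
    rs = ℕₚ.m+[n∸m]≡n (ℕₚ.<⇒≤ r<n)
    sorted : AllPairs _≤_ (sort u ++ sort v)
    sorted = AllPairsₚ.++⁺ (Linked⇒AllPairs ℕₚ.≤-trans (sort-↗ u)) (Linked⇒AllPairs ℕₚ.≤-trans (sort-↗ v))
      (Permₚ.All-resp-↭ (Perm.↭-sym (sort-↭ u)) (All.map (Permₚ.All-resp-↭ (Perm.↭-sym (sort-↭ v))) cross))
    sorted≡ : sort u ++ sort v ≡ upTo r ++ map (r +_) (upTo s)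
    sorted≡ = trans (sorted-unique sorted (upTo-sorted (length w)) (Perm.trans (Permₚ.++⁺ (sort-↭ u) (sort-↭ v)) (subst (_↭ upTo (length w)) (sym (take++drop≡id r w)) (proj₂ isp))))
      (trans (cong upTo (sym rs)) (upTo-+ r s))
    parts : sort u ≡ upTo r × sort v ≡ map (r +_) (upTo s)
    parts = ++-cancel _ _ _ _ (trans (Permₚ.↭-length (sort-↭ u)) (trans lu (sym (length-upTo r)))) sorted≡
    v↭ : v ↭ map (r +_) (upTo s)
    v↭ = Perm.trans (Perm.↭-sym (sort-↭ v)) (Perm.↭-reflexive (proj₂ parts))
    u↭ : u ↭ upTo (length u)
    u↭ = Perm.trans (Perm.↭-sym (sort-↭ u)) (Perm.↭-reflexive (trans (proj₁ parts) (cong upTo (sym lu))))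
    lv′ : length v′ ≡ s
    lv′ = trans (length-map _ v) lv
    v′↭ : v′ ↭ upTo (length v′)
    v′↭ = Perm.trans (Permₚ.map⁺ (_∸ r) v↭) (Perm.↭-reflexive (trans (sym (map-∘ (upTo s))) (trans (map-cong (λ x → ℕₚ.m+n∸m≡n r x) (upTo s)) (trans (map-id (upTo s)) (cong upTo (sym lv′))))))
    1≤u : 1 ≤ length u
    1≤u = subst (1 ≤_) (sym lu) 1≤r
    1≤v′ : 1 ≤ length v′
    1≤v′ = subst (1 ≤_) (sym lv′) (ℕₚ.m<n⇒0<n∸m r<n)
    r≤v : All (r ≤_) v
    r≤v = Permₚ.All-resp-↭ (Perm.↭-sym v↭) (Allₚ.map⁺ (All.universal (λ x → ℕₚ.m≤m+n r x) (upTo s)))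
    w≡ : w ≡ u ×ₚ v′
    w≡ = trans (sym (take++drop≡id r w)) (cong (u ++_) (sym (trans (sym (map-∘ v)) (trans (map-cong-local (All.map (λ {x} r≤x → trans (cong (_+ (x ∸ r)) lu) (ℕₚ.m+[n∸m]≡n r≤x)) r≤v)) (map-id v)))))

open BlockDecomposition

comaj-∷ʳ : ∀ k b x y → comajFrom k (b ∷ʳ x ∷ʳ y) ≡ comajFrom k (b ∷ʳ x) ℕ.+ (if x <ᵇ y then k ℕ.+ length b else 0)
comaj-∷ʳ k [] x y = ≡.trans (ℕₚ.+-identityʳ _) (≡.cong (λ z → if x <ᵇ y then z else 0) (≡.sym (ℕₚ.+-identityʳ k)))
comaj-∷ʳ k (a ∷ []) x y = ≡.trans (≡.cong ((if a <ᵇ x then k else 0) ℕ.+_) (comaj-∷ʳ (suc k) [] x y))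
  (≡.trans (≡.cong ((if a <ᵇ x then k else 0) ℕ.+_) (≡.cong (λ z → if x <ᵇ y then z else 0) (≡.sym (ℕₚ.+-suc k 0))))
    (≡.cong (ℕ._+ (if x <ᵇ y then k ℕ.+ 1 else 0)) (≡.sym (ℕₚ.+-identityʳ (if a <ᵇ x then k else 0)))))
comaj-∷ʳ k (a ∷ b ∷ c) x y = ≡.trans (≡.cong ((if a <ᵇ b then k else 0) ℕ.+_) (comaj-∷ʳ (suc k) (b ∷ c) x y))
  (≡.trans (≡.sym (ℕₚ.+-assoc (if a <ᵇ b then k else 0) _ _)) (≡.cong (λ z → (if a <ᵇ b then k else 0) ℕ.+ comajFrom (suc k) (b ∷ c ∷ʳ x) ℕ.+ (if x <ᵇ y then z else 0)) (≡.sym (ℕₚ.+-suc k _))))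

comaj-∷ʳ-1 : ∀ k a → All (1 ℕ.≤_) a → comajFrom k (a ∷ʳ 1) ≡ comajFrom k a
comaj-∷ʳ-1 k [] _ = ≡.refl
comaj-∷ʳ-1 k (suc x ∷ []) _ = ≡.refl
comaj-∷ʳ-1 k (x ∷ y ∷ a) (_ ∷ p) = ≡.cong ((if x <ᵇ y then k else 0) ℕ.+_) (comaj-∷ʳ-1 (suc k) (y ∷ a) p)

wordProd-∷ʳ : ∀ n b d → wordProd n (b ∷ʳ suc d) ≡ swapAt d (wordProd n b)
wordProd-∷ʳ n b d = ≡.trans (wordProd≡ n (b ∷ʳ suc d)) (≡.trans (go (upTo n) b) (≡.cong (swapAt d) (≡.sym (wordProd≡ n b))))
  where
  go : ∀ w b → wordProdFrom w (b ∷ʳ suc d) ≡ swapAt d (wordProdFrom w b)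
  go w [] = ≡.refl
  go w (i ∷ b) = go (swapAt (i ℕ.∸ 1) w) b

swapAt-short : ∀ d w → length w ℕ.≤ suc d → swapAt d w ≡ w
swapAt-short zero [] _ = ≡.refl
swapAt-short zero (a ∷ []) _ = ≡.refl
swapAt-short zero (a ∷ b ∷ w) (s≤s ())
swapAt-short (suc d) [] _ = ≡.refl
swapAt-short (suc d) (a ∷ w) (s≤s l) = ≡.cong (a ∷_) (swapAt-short d w l)

swapAt-equal : ∀ d w → at w d ≡ at w (suc d) → swapAt d w ≡ w
swapAt-equal zero [] _ = ≡.refl
swapAt-equal zero (a ∷ []) _ = ≡.refl
swapAt-equal zero (a ∷ b ∷ w) ≡.refl = ≡.refl
swapAt-equal (suc d) [] _ = ≡.refl
swapAt-equal (suc d) (a ∷ w) e = ≡.cong (a ∷_) (swapAt-equal d w e)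

len-swapAt≤ : ∀ d w → len (swapAt d w) ℕ.≤ suc (len w)
len-swapAt≤ d w with suc d ℕ.<? length w
... | no short = ℕₚ.≤-trans (ℕₚ.≤-reflexive (≡.cong len (swapAt-short d w (ℕₚ.≮⇒≥ short)))) (ℕₚ.n≤1+n _)
... | yes l with ℕₚ.<-cmp (at w d) (at w (suc d))
... | tri< lt _ _ = ℕₚ.≤-reflexive (len-swapAt-ascent d w l lt)
... | tri≈ _ e _ = ℕₚ.≤-trans (ℕₚ.≤-reflexive (≡.cong len (swapAt-equal d w e))) (ℕₚ.n≤1+n _)
... | tri> _ _ gt = ℕₚ.≤-trans (ℕₚ.n≤1+n _) (ℕₚ.≤-trans (ℕₚ.≤-reflexive (≡.sym (len-swapAt-descent d w l gt))) (ℕₚ.n≤1+n _))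

len-wordProdFrom≤ : ∀ w a → len (wordProdFrom w a) ℕ.≤ length a ℕ.+ len w
len-wordProdFrom≤ w [] = ℕₚ.≤-refl
len-wordProdFrom≤ w (i ∷ a) = ℕₚ.≤-trans (len-wordProdFrom≤ (swapAt (i ℕ.∸ 1) w) a)
  (ℕₚ.≤-trans (ℕₚ.+-monoʳ-≤ (length a) (len-swapAt≤ (i ℕ.∸ 1) w)) (ℕₚ.≤-reflexive (ℕₚ.+-suc (length a) (len w))))

InWords : ℕ → ℕ → List ℕ → Set
InWords n l a = length a ≡ l × All (λ x → 1 ℕ.≤ x × x ℕ.≤ n ℕ.∸ 1) a

allWords-InWords : ∀ n l → All (InWords n l) (allWords n l)
allWords-InWords n zero = (≡.refl , []) ∷ []
allWords-InWords n (suc l) = Allₚ.concat⁺ (Allₚ.map⁺ (All.map (λ {a} a<n → Allₚ.map⁺ (All.map (λ (e , p) → ≡.cong suc e , (s≤s z≤n , a<n) ∷ p) (allWords-InWords n l)))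
  (Allₚ.applyUpTo⁺₁ id (n ℕ.∸ 1) id)))

module ReducedWords {r ℓ : Level} (S : CommutativeRing r ℓ) (q : CommutativeRing.Carrier S) (U : ℕ → CommutativeRing.Carrier S) (n : ℕ) (len-id : len (upTo n) ≡ 0) where
  open CommutativeRing S
  open RingTools S
  open Poly S using (pow)
  open WordSum S q U
  open Relation.Binary.Reasoning.Setoid setoid

  letters : List ℕ → Carrier
  letters a = prodL a (λ x → U (x ℕ.∸ 1))

  letters-∷ʳ : ∀ b d → letters (b ∷ʳ suc d) ≈ letters b * U d
  letters-∷ʳ b d = trans (Prod.big-++ b (suc d ∷ []) _) (*-congˡ (*-identityʳ _))

  sumL-filter : ∀ {P : List ℕ → Set} (P? : Decidable P) xs (f : List ℕ → Carrier) → sumL (filter P? xs) f ≈ sumL xs (λ a → if does (P? a) then f a else 0#)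
  sumL-filter P? [] f = refl
  sumL-filter P? (x ∷ xs) f with does (P? x)
  ... | true = +-congˡ (sumL-filter P? xs f)
  ... | false = trans (sumL-filter P? xs f) (sym (+-identityˡ _))

  sumL-allWords-suc : ∀ l (f : List ℕ → Carrier) → sumL (allWords n (suc l)) f ≈ sumN (n ℕ.∸ 1) (λ d → sumL (allWords n l) (λ a → f (suc d ∷ a)))
  sumL-allWords-suc l f = trans (Sum.big-concatMap (λ a → map (λ ws → suc a ∷ ws) (allWords n l)) (upTo (n ℕ.∸ 1)) f)
    (trans (Sum.big-upTo (n ℕ.∸ 1) _) (Sum.bigN-cong (n ℕ.∸ 1) (λ d _ → Sum.big-map (suc d ∷_) (allWords n l) f)))

  sumL-allWords-∷ʳ : ∀ l (f : List ℕ → Carrier) → sumL (allWords n (suc l)) f ≈ sumN (n ℕ.∸ 1) (λ d → sumL (allWords n l) (λ b → f (b ∷ʳ suc d)))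
  sumL-allWords-∷ʳ zero f = sumL-allWords-suc 0 f
  sumL-allWords-∷ʳ (suc l) f = begin
    sumL (allWords n (suc (suc l))) f ≈⟨ sumL-allWords-suc (suc l) f ⟩
    sumN m (λ a → sumL (allWords n (suc l)) (λ ws → f (suc a ∷ ws))) ≈⟨ Sum.bigN-cong m (λ a _ → sumL-allWords-∷ʳ l (λ ws → f (suc a ∷ ws))) ⟩
    sumN m (λ a → sumN m (λ d → sumL (allWords n l) (λ b → f (suc a ∷ b ∷ʳ suc d)))) ≈⟨ Sum.bigN-swap m m _ ⟩
    sumN m (λ d → sumN m (λ a → sumL (allWords n l) (λ b → f (suc a ∷ b ∷ʳ suc d)))) ≈⟨ Sum.bigN-cong m (λ d _ → sumL-allWords-suc l (λ b → f (b ∷ʳ suc d))) ⟨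
    sumN m (λ d → sumL (allWords n (suc l)) (λ b → f (b ∷ʳ suc d))) ∎
    where
    m : ℕ
    m = n ℕ.∸ 1

  when : ∀ {P : Set} → Dec P → Carrier → Carrier
  when d x = if does d then x else 0#

  when-⇔ : ∀ {P Q : Set} (p : Dec P) (q : Dec Q) → (P → Q) → (Q → P) → ∀ {x y} → x ≈ y → when p x ≈ when q y
  when-⇔ (yes p) (yes q) f g e = e
  when-⇔ (yes p) (no ¬q) f g e = ⊥-elim (¬q (f p))
  when-⇔ (no ¬p) (yes q) f g e = ⊥-elim (¬p (g q))
  when-⇔ (no ¬p) (no ¬q) f g e = refl

  when-* : ∀ {P : Set} (p : Dec P) y x → when p (y * x) ≈ y * when p x
  when-* (yes p) y x = refl
  when-* (no ¬p) y x = sym (zeroʳ y)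

  when-no : ∀ {P : Set} (p : Dec P) → ¬ P → ∀ x → when p x ≈ 0#
  when-no (yes p) ¬p x = ⊥-elim (¬p p)
  when-no (no _) ¬p x = refl

  when-yes : ∀ {P : Set} (p : Dec P) → P → ∀ x → when p x ≈ x
  when-yes (yes p) _ x = refl
  when-yes (no ¬p) p x = ⊥-elim (¬p p)

  isWord : ∀ w a → Dec (wordProd n a ≡ w)
  isWord w a = ≡-dec ℕ._≟_ (wordProd n a) w

  words : ℕ → List ℕ → ℕ → Carrier
  words l w i = sumL (allWords n l) (λ a → when (isWord w a) (pow q (comajFrom 1 (a ∷ʳ suc i)) * letters a))

  wordSum-ascent-step : ∀ l w d → suc d ℕ.< length w → at w (suc d) ℕ.< at w d → wordSum l (swapAt d w) d ≈ wordSum l (swapAt d w) (suc d)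
  wordSum-ascent-step zero w d _ _ = refl
  wordSum-ascent-step (suc l) w d d<w lt = begin
    wordSum (suc l) v d ≈⟨ solve 2 (λ a b → a := (a :- b) :+ b) refl _ (wordSum (suc l) v (suc d)) ⟩
    wordSum (suc l) v d + - wordSum (suc l) v (suc d) + wordSum (suc l) v (suc d)
      ≈⟨ +-congʳ (trans (wordSum-step l v d (≡.subst (λ z → d ℕ.< z ℕ.∸ 1) (≡.sym (length-swapAt d w)) (pred-< d<w)))
          (trans (*-congˡ (reflexive (wordSumLast-ascent l v d (≡.subst₂ ℕ._≤_ (≡.sym (at-swapAt-fst d w d<w)) (≡.sym (at-swapAt-snd d w d<w)) (ℕₚ.<⇒≤ lt))))) (zeroʳ _))) ⟩
    0# + wordSum (suc l) v (suc d) ≈⟨ +-identityˡ _ ⟩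
    wordSum (suc l) v (suc d) ∎
    where
    v : List ℕ
    v = swapAt d w
    pred-< : ∀ {m} → suc d ℕ.< m → d ℕ.< m ℕ.∸ 1
    pred-< (s≤s l) = l

  words≈wordSum : ∀ l w i → w ↭ upTo n → len w ≡ l → words l w i ≈ wordSum l w i
  words≈wordSum zero w i p e = trans (+-identityʳ _) (trans (when-yes (isWord w []) (≡.sym (len-0⇒upTo n w p e)) _) (*-identityˡ 1#))
  words≈wordSum (suc l) w i p e = begin
    words (suc l) w i ≈⟨ sumL-allWords-∷ʳ l _ ⟩
    sumN m (λ d → sumL (allWords n l) (λ b → when (isWord w (b ∷ʳ suc d)) (pow q (comajFrom 1 (b ∷ʳ suc d ∷ʳ suc i)) * letters (b ∷ʳ suc d))))
      ≈⟨ Sum.bigN-cong m (λ d _ → Sum.big-cong-All {xs = allWords n l} (All.map (λ {b} (lb , _) → regroup d b lb) (allWords-InWords n l))) ⟩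
    sumN m (λ d → sumL (allWords n l) (λ b → weight (suc l) d i * U d * when (isWord (swapAt d w) b) (pow q (comajFrom 1 (b ∷ʳ suc d)) * letters b)))
      ≈⟨ Sum.bigN-cong m (λ d _ → sym (sumL-*ˡ (allWords n l) _ _)) ⟩
    sumN m (λ d → weight (suc l) d i * U d * words l (swapAt d w) d) ≈⟨ Sum.bigN-cong m (λ d d<m → trans (*-assoc _ _ _) (*-congˡ (last d d<m (ℕₚ.<-cmp (at w (suc d)) (at w d))))) ⟩
    sumN m (λ d → weight (suc l) d i * wordSumLast l w d) ≈⟨ reflexive (≡.cong (λ z → sumN (z ℕ.∸ 1) (λ d → weight (suc l) d i * wordSumLast l w d)) lw) ⟨
    wordSum (suc l) w i ∎
    where
    m : ℕ
    m = n ℕ.∸ 1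
    lw : length w ≡ n
    lw = ≡.trans (Permₚ.↭-length p) (length-upTo n)
    split-pow : ∀ d a → pow q (a ℕ.+ (if suc d <ᵇ suc i then suc l else 0)) ≈ pow q a * weight (suc l) d i
    split-pow d a with d <ᵇ i
    ... | true = pow-+ q a (suc l)
    ... | false = pow-+ q a 0
    regroup : ∀ d b → length b ≡ l → when (isWord w (b ∷ʳ suc d)) (pow q (comajFrom 1 (b ∷ʳ suc d ∷ʳ suc i)) * letters (b ∷ʳ suc d))
      ≈ weight (suc l) d i * U d * when (isWord (swapAt d w) b) (pow q (comajFrom 1 (b ∷ʳ suc d)) * letters b)
    regroup d b lb = trans (when-⇔ (isWord w (b ∷ʳ suc d)) (isWord (swapAt d w) b)
        (λ e → ≡.trans (≡.sym (swapAt-involutive d (wordProd n b))) (≡.cong (swapAt d) (≡.trans (≡.sym (wordProd-∷ʳ n b d)) e)))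
        (λ e → ≡.trans (wordProd-∷ʳ n b d) (≡.trans (≡.cong (swapAt d) e) (swapAt-involutive d w)))
        (trans (*-cong (trans (reflexive (≡.cong (pow q) (≡.trans (comaj-∷ʳ 1 b (suc d) (suc i)) (≡.cong (λ z → comajFrom 1 (b ∷ʳ suc d) ℕ.+ (if suc d <ᵇ suc i then suc z else 0)) lb))))
             (split-pow d (comajFrom 1 (b ∷ʳ suc d)))) (letters-∷ʳ b d)) (solve 4 (λ p w x u → p :* w :* (x :* u) := w :* u :* (p :* x)) refl _ _ _ _)))
      (when-* (isWord (swapAt d w) b) _ _)
    noWords : ∀ d → suc l ℕ.≤ len (swapAt d w) → words l (swapAt d w) d ≈ 0#
    noWords d b = trans (Sum.big-cong-All {xs = allWords n l} (All.map (λ {a} (la , _) → when-no (isWord (swapAt d w) a)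
        (λ e′ → ℕₚ.<⇒≱ b (ℕₚ.≤-trans (ℕₚ.≤-reflexive (≡.cong len (≡.trans (≡.sym e′) (wordProd≡ n a)))) (ℕₚ.≤-trans (len-wordProdFrom≤ (upTo n) a) (ℕₚ.≤-reflexive (≡.trans (≡.cong₂ ℕ._+_ la len-id) (ℕₚ.+-identityʳ l)))))) _)
        (allWords-InWords n l))) (Sum.big-ε (allWords n l) (λ _ → refl))
    <w : ∀ {d} → d ℕ.< m → suc d ℕ.< length w
    <w {d} d<m = ≡.subst (suc d ℕ.<_) (≡.sym lw) (shift n d<m)
      where
      shift : ∀ n → d ℕ.< n ℕ.∸ 1 → suc d ℕ.< n
      shift (suc n) l = s≤s l
    no-last : ∀ d → suc l ℕ.≤ len (swapAt d w) → at w d ℕ.≤ at w (suc d) → U d * words l (swapAt d w) d ≈ wordSumLast l w d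
    no-last d b le = trans (*-congˡ (noWords d b)) (trans (zeroʳ _) (reflexive (≡.sym (wordSumLast-ascent l w d le))))
    last : ∀ d → d ℕ.< m → Tri (at w (suc d) ℕ.< at w d) (at w (suc d) ≡ at w d) (at w d ℕ.< at w (suc d)) → U d * words l (swapAt d w) d ≈ wordSumLast l w d
    last d d<m (tri< lt _ _) = trans (*-congˡ (trans (words≈wordSum l (swapAt d w) d (Perm.trans (swapAt-↭ d w) p) (ℕₚ.suc-injective (≡.trans (≡.sym (len-swapAt-descent d w (<w d<m) lt)) e)))
        (wordSum-ascent-step l w d (<w d<m) lt))) (reflexive (≡.sym (wordSumLast-descent l w d lt)))
    last d d<m (tri≈ _ eq _) = no-last d (ℕₚ.≤-reflexive (≡.trans (≡.sym e) (≡.cong len (≡.sym (swapAt-equal d w (≡.sym eq)))))) (ℕₚ.≤-reflexive (≡.sym eq))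
    last d d<m (tri> _ _ gt) = no-last d (ℕₚ.≤-trans (ℕₚ.≤-reflexive (≡.sym e)) (ℕₚ.≤-trans (ℕₚ.n≤1+n _) (ℕₚ.≤-reflexive (≡.sym (len-swapAt-ascent d w (<w d<m) gt))))) (ℕₚ.<⇒≤ gt)

  wordSum≈Red : ∀ w → w ↭ upTo n → wordSum (len w) w 0 ≈ sumL (Red n w) (λ a → pow q (comaj a) * letters a)
  wordSum≈Red w p = begin
    wordSum (len w) w 0 ≈⟨ words≈wordSum (len w) w 0 p ≡.refl ⟨
    words (len w) w 0 ≈⟨ Sum.big-cong-All {xs = allWords n (len w)} (All.map (λ {a} (_ , b) → when-⇔ (isWord w a) (isWord w a) id id
        (*-congʳ (reflexive (≡.cong (pow q) (≡.trans (comaj-∷ʳ-1 1 a (All.map proj₁ b)) (≡.sym (comaj≡ a))))))) (allWords-InWords n (len w))) ⟩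
    sumL (allWords n (len w)) (λ a → when (isWord w a) (pow q (comaj a) * letters a)) ≈⟨ sumL-filter (isWord w) (allWords n (len w)) _ ⟨
    sumL (Red n w) (λ a → pow q (comaj a) * letters a) ∎

module GeometricSequence {c ℓ : Level} (R : CommutativeRing c ℓ) (q : CommutativeRing.Carrier R)
  (cancel : ∀ k d → CommutativeRing._≈_ R (CommutativeRing._*_ R (RingTools.qnum R q (suc k)) d) (CommutativeRing.0# R) → CommutativeRing._≈_ R d (CommutativeRing.0# R)) where
  open CommutativeRing R
  open RingTools R
  open Relation.Binary.Reasoning.Setoid setoid

  -- While the recurrence holds, the increments are geometric with ratio q, so two equal values
  -- force the sequence to be constant in between.
  module _ (g : ℕ → Carrier) (N : Carrier)
    (step : ∀ s → g (suc s) ≈ N ⊎ (1# + q) * g (suc s) ≈ q * g s + g (suc (suc s))) where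

    increment-0 : ∀ L s k d → g s ≈ N + qnum q k * d → g (suc s) ≈ N + qnum q (suc k) * d → g (suc s ℕ.+ L) ≈ N → d ≈ 0#
    increment-0 L s k d e e′ end with step s
    ... | inj₁ h = cancel k d (begin
      qnum q (suc k) * d ≈⟨ solve 2 (λ n x → x := (n :+ x) :- n) refl N _ ⟩
      N + qnum q (suc k) * d + - N ≈⟨ +-congʳ (trans (sym e′) h) ⟩
      N + - N ≈⟨ -‿inverseʳ N ⟩
      0# ∎)
    increment-0 zero s k d e e′ end | inj₂ r = cancel k d (begin
      qnum q (suc k) * d ≈⟨ solve 2 (λ n x → x := (n :+ x) :- n) refl N _ ⟩
      N + qnum q (suc k) * d + - N ≈⟨ +-congʳ (trans (sym e′) (trans (reflexive (≡.cong g (≡.sym (ℕₚ.+-identityʳ (suc s))))) end)) ⟩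
      N + - N ≈⟨ -‿inverseʳ N ⟩
      0# ∎)
    increment-0 (suc L) s k d e e′ end | inj₂ r = increment-0 L (suc s) (suc k) d e′ (begin
      g (suc (suc s)) ≈⟨ solve 2 (λ a b → b := (a :+ b) :- a) refl (q * g s) _ ⟩
      q * g s + g (suc (suc s)) + - (q * g s) ≈⟨ +-cong (trans (sym r) (*-congˡ e′)) (-‿cong (*-congˡ e)) ⟩
      (1# + q) * (N + (1# + q * qnum q k) * d) + - (q * (N + qnum q k * d))
        ≈⟨ solve 4 (λ q n k d → (:1 :+ q) :* (n :+ (:1 :+ q :* k) :* d) :- q :* (n :+ k :* d) := n :+ (:1 :+ q :* (:1 :+ q :* k)) :* d) refl q N (qnum q k) d ⟩
      N + qnum q (suc (suc k)) * d ∎) (trans (reflexive (≡.cong g (≡.sym (ℕₚ.+-suc (suc s) L)))) end)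

    constant : ∀ n → g 0 ≈ N → g n ≈ N → ∀ t → t ℕ.≤ n → g t ≈ N
    constant n e₀ eₙ zero _ = e₀
    constant n e₀ eₙ (suc t) t<n = begin
      g (suc t) ≈⟨ solve 2 (λ n x → x := n :+ (x :- n)) refl N _ ⟩
      N + (g (suc t) + - N) ≈⟨ +-congˡ (increment-0 (n ℕ.∸ suc t) t 0 (g (suc t) + - N) (trans (constant n e₀ eₙ t (ℕₚ.<⇒≤ t<n)) (solve 2 (λ n d → n := n :+ :0 :* d) refl N _))
          (solve 3 (λ n x q → x := n :+ (:1 :+ q :* :0) :* (x :- n)) refl N _ q) (trans (reflexive (≡.cong g (ℕₚ.m+[n∸m]≡n t<n))) eₙ)) ⟩
      N + 0# ≈⟨ +-identityʳ N ⟩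
      N ∎

module CyclicRule {s ℓs r ℓr : Level} (S : CommutativeRing s ℓs) (R : CommutativeRing r ℓr)
  (qS : CommutativeRing.Carrier S) (q : CommutativeRing.Carrier R) (x : ℕ → CommutativeRing.Carrier S) (m : ℕ)
  (rel : ∀ k → suc k ℕ.< suc m → CommutativeRing._≈_ S (CommutativeRing._*_ S (Points.u S qS x (suc k))
     (CommutativeRing._+_ S (CommutativeRing._*_ S qS (x k)) (CommutativeRing.-_ S (x (suc k))))) (CommutativeRing.0# S))
  (top : CommutativeRing._≈_ S (Points.u S qS x (suc m)) (CommutativeRing.0# S))
  (Λ : CommutativeRing.Carrier S → CommutativeRing.Carrier R)
  (Λ-cong : ∀ {a b} → CommutativeRing._≈_ S a b → CommutativeRing._≈_ R (Λ a) (Λ b))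
  (Λ-+ : ∀ a b → CommutativeRing._≈_ R (Λ (CommutativeRing._+_ S a b)) (CommutativeRing._+_ R (Λ a) (Λ b)))
  (Λ-q : ∀ a → CommutativeRing._≈_ R (Λ (CommutativeRing._*_ S qS a)) (CommutativeRing._*_ R q (Λ a)))
  (Λ-0 : CommutativeRing._≈_ R (Λ (CommutativeRing.0# S)) (CommutativeRing.0# R))
  (cancel : ∀ k d → CommutativeRing._≈_ R (CommutativeRing._*_ R (RingTools.qnum R q (suc k)) d) (CommutativeRing.0# R) → CommutativeRing._≈_ R d (CommutativeRing.0# R)) where
  private module S = CommutativeRing S
  private module SS = RingTools S
  open CommutativeRing R
  open RingTools R
  open Points S qS x using (u; u-suc)
  open Residues m
  open Relation.Binary.Reasoning.Setoid setoid

  U Uc : ℕ → S.Carrier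
  U d = u (suc d)
  Uc k = U (k % n)

  Uc-top : ∀ k → k % n ≡ m → Uc k S.≈ S.0#
  Uc-top k e = S.trans (S.reflexive (≡.cong U e)) top

  recurrence : ∀ k → Uc (suc k) S.* ((S.1# S.+ qS) S.* Uc (suc k)) S.≈ Uc (suc k) S.* (qS S.* Uc k S.+ Uc (suc (suc k)))
  recurrence k with suc-% (suc k)
  ... | inj₁ (e , _) = S.trans (S.*-congʳ (Uc-top (suc k) e)) (S.trans (S.zeroˡ _) (S.sym (S.trans (S.*-congʳ (Uc-top (suc k) e)) (S.zeroˡ _))))
  ... | inj₂ (lt , e₂) = go (suc k % n) ≡.refl
    where
    prev : ∀ r → suc k % n ≡ r → Uc k S.≈ u r
    prev r e with suc-% k
    ... | inj₁ (e₀ , e₁) = S.trans (Uc-top k e₀) (S.reflexive (≡.cong u (≡.trans (≡.sym e₁) e)))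
    ... | inj₂ (_ , e₁) = S.reflexive (≡.cong u (≡.trans (≡.sym e₁) e))
    go : ∀ r → suc k % n ≡ r → Uc (suc k) S.* ((S.1# S.+ qS) S.* Uc (suc k)) S.≈ Uc (suc k) S.* (qS S.* Uc k S.+ Uc (suc (suc k)))
    go r e = S.trans (S.*-cong here′ (S.*-congˡ (S.trans here′ (u-suc r)))) (S.trans
        (SS.solve 5 (λ q u x y v → v SS.:* ((SS.:1 SS.:+ q) SS.:* (u SS.:+ x)) SS.:= v SS.:* (q SS.:* x SS.:- y) SS.:+ v SS.:* (q SS.:* u SS.:+ ((u SS.:+ x) SS.:+ y))) S.refl qS (u r) (x r) (x (suc r)) (u (suc r)))
      (S.trans (S.+-congʳ (rel r (s≤s (≡.subst (ℕ._< m) e lt)))) (S.trans (S.+-identityˡ _)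
        (S.*-cong (S.sym here′) (S.+-cong (S.*-congˡ (S.sym (prev r e))) (S.trans (S.+-congʳ (S.sym (u-suc r))) (S.trans (S.sym (u-suc (suc r))) (S.reflexive (≡.cong U (≡.sym (≡.trans e₂ (≡.cong suc e)))))))))))) 
      where
      here′ : Uc (suc k) S.≈ u (suc r)
      here′ = S.reflexive (≡.cong U e)

  Φ : List ℕ → Carrier
  Φ a = sumN n (λ p → Λ (SS.prodL a (λ d → Uc (d ℕ.+ p))))

  N : Carrier
  N = Λ (SS.prodN m U)

  Φ-↭ : ∀ {a b} → a ↭ b → Φ a ≈ Φ b
  Φ-↭ p = Sum.bigN-cong n (λ k _ → Λ-cong (SS.Prod.big-↭ (λ d → Uc (d ℕ.+ k)) p))

  prodL-0 : ∀ {a} (f : ℕ → S.Carrier) d → d ∈ a → f d S.≈ S.0# → SS.prodL a f S.≈ S.0#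
  prodL-0 f d (here ≡.refl) e = S.trans (S.*-congʳ e) (S.zeroˡ _)
  prodL-0 f d (there i) e = S.trans (S.*-congˡ (prodL-0 f d i e)) (S.zeroʳ _)

  Φ-unique : ∀ D → Unique D → All (ℕ._< n) D → length D ≡ m → Φ D ≈ N
  Φ-unique D uD bD lD = trans (Sum.bigN-single n (m ℕ.∸ z) _ (s≤s (ℕₚ.m∸n≤m m z)) (λ p p<n ne → trans (Λ-cong (miss p (λ e → ne (hits-top z p z<n p<n e)))) Λ-0)) (Λ-cong hit)
    where
    z : ℕ
    z = proj₁ (missing-residue m D uD bD lD)
    zD : z ∷ D ↭ upTo n
    zD = proj₂ (missing-residue m D uD bD lD)
    z<n : z ℕ.< n
    z<n = Memₚ.∈-upTo⁻ (Permₚ.∈-resp-↭ zD (here ≡.refl))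
    rotated : ∀ p → (z ℕ.+ p) % n ∷ map (λ d → (d ℕ.+ p) % n) D ↭ m ∷ upTo m
    rotated p = Perm.trans (Permₚ.map⁺ (λ d → (d ℕ.+ p) % n) zD) (Perm.trans (rotate-↭ p) (Perm.trans (Perm.↭-reflexive (≡.sym (applyUpTo-∷ʳ id m))) (Perm.↭-sym (Permₚ.∷↭∷ʳ m (upTo m)))))
    miss : ∀ p → (z ℕ.+ p) % n ≢ m → SS.prodL D (λ d → Uc (d ℕ.+ p)) S.≈ S.0#
    miss p ne with Memₚ.∈-map⁻ (λ d → (d ℕ.+ p) % n) (tail (Permₚ.∈-resp-↭ (Perm.↭-sym (rotated p)) (here ≡.refl)))
      where
      tail : m ∈ (z ℕ.+ p) % n ∷ map (λ d → (d ℕ.+ p) % n) D → m ∈ map (λ d → (d ℕ.+ p) % n) D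
      tail (here e) = ⊥-elim (ne (≡.sym e))
      tail (there i) = i
    ... | d , d∈ , e = prodL-0 (λ d → Uc (d ℕ.+ p)) d d∈ (Uc-top (d ℕ.+ p) (≡.sym e))
    hit : SS.prodL D (λ d → Uc (d ℕ.+ (m ℕ.∸ z))) S.≈ SS.prodN m U
    hit = S.trans (S.sym (SS.Prod.big-map (λ d → (d ℕ.+ (m ℕ.∸ z)) % n) D U))
      (S.trans (SS.Prod.big-↭ U (Permₚ.drop-∷ (≡.subst (λ v → v ∷ map (λ d → (d ℕ.+ (m ℕ.∸ z)) % n) D ↭ m ∷ upTo m) (top-hit z z<n) (rotated (m ℕ.∸ z))))) (SS.Prod.big-upTo m U))

  open GeometricSequence R q cancel

  -- Induction on E: the letters outside D may be moved freely, by the recurrence at letters of D.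
  Φ-split : ∀ E D → Unique D → All (ℕ._< n) D → All (ℕ._< n) E → length D ℕ.+ length E ≡ m → Φ (D ++ E) ≈ N
  Φ-split [] D uD bD bE l = trans (reflexive (≡.cong Φ (Data.List.Properties.++-identityʳ D))) (Φ-unique D uD bD (≡.trans (≡.sym (ℕₚ.+-identityʳ _)) l))
  Φ-split (e ∷ E) D uD bD (e<n ∷ bE) l = trans (Φ-↭ (Permₚ.shift e D E)) (at-e (ℕₚ.≤-total j₀ e))
    where
    missing : ∃ λ j → j ℕ.< n × j ∉ D
    missing = exists-missing n D (s≤s (ℕₚ.≤-trans (ℕₚ.m≤m+n _ _) (ℕₚ.≤-reflexive l)))
    j₀ : ℕ
    j₀ = proj₁ missing
    f : ℕ → Carrier
    f j = Φ (j ∷ D ++ E)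
    term : ℕ → ℕ → Carrier
    term j p = Λ (Uc (j ℕ.+ p) S.* SS.prodL (D ++ E) (λ d → Uc (d ℕ.+ p)))
    f-% : ∀ j → f (j % n) ≈ f j
    f-% j = Sum.bigN-cong n (λ p _ → Λ-cong (S.*-congʳ {SS.prodL (D ++ E) (λ d → Uc (d ℕ.+ p))} (S.reflexive (≡.cong U (%-+ j p)))))
    f-missing : ∀ j → (j % n) ∉ D → f j ≈ N
    f-missing j j∉ = trans (sym (f-% j)) (Φ-split E (j % n ∷ D) (All.tabulate (λ i e → j∉ (≡.subst (_∈ D) (≡.sym e) i)) ∷ uD) (m%n<n j n ∷ bD) bE (≡.trans (≡.sym (ℕₚ.+-suc _ _)) l))
    f-step : ∀ j → f (suc j) ≈ N ⊎ (1# + q) * f (suc j) ≈ q * f j + f (suc (suc j))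
    f-step j with suc j % n ∈? D
    ... | no j∉ = inj₁ (f-missing (suc j) j∉)
    ... | yes j∈ = inj₂ (trans (sumN-*ˡ n (1# + q) (term (suc j))) (trans (Sum.bigN-cong n (λ p _ → termwise p)) (trans (Sum.bigN-∙ n (λ p → q * term j p) (term (suc (suc j)))) (+-congʳ (sym (sumN-*ˡ n q (term j)))))))
      where
      factor : ∀ {a} → (d : ℕ) → d ∈ a → (h : ℕ → S.Carrier) → ∃ λ w → SS.prodL a h S.≈ h d S.* w
      factor {_ ∷ a} d (here ≡.refl) h = SS.prodL a h , S.refl
      factor {b ∷ a} d (there i) h with factor d i h
      ... | w , e = h b S.* w , S.trans (S.*-congˡ e) (SS.solve 3 (λ b d w → b SS.:* (d SS.:* w) SS.:= d SS.:* (b SS.:* w)) S.refl (h b) (h d) w)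
      termwise : ∀ p → (1# + q) * Λ (Uc (suc j ℕ.+ p) S.* SS.prodL (D ++ E) (λ d → Uc (d ℕ.+ p)))
        ≈ q * Λ (Uc (j ℕ.+ p) S.* SS.prodL (D ++ E) (λ d → Uc (d ℕ.+ p))) + Λ (Uc (suc (suc j) ℕ.+ p) S.* SS.prodL (D ++ E) (λ d → Uc (d ℕ.+ p)))
      termwise p = begin
        (1# + q) * Λ (b S.* X) ≈⟨ solve 2 (λ q y → (:1 :+ q) :* y := y :+ q :* y) refl q _ ⟩
        Λ (b S.* X) + q * Λ (b S.* X) ≈⟨ +-congˡ (Λ-q _) ⟨
        Λ (b S.* X) + Λ (qS S.* (b S.* X)) ≈⟨ Λ-+ _ _ ⟨
        Λ (b S.* X S.+ qS S.* (b S.* X)) ≈⟨ Λ-cong (S.trans (S.+-cong (S.*-congˡ X≈) (S.*-congˡ (S.*-congˡ X≈))) (S.trans (SS.solve 3 (λ b q w → b SS.:* (b SS.:* w) SS.:+ q SS.:* (b SS.:* (b SS.:* w)) SS.:= (b SS.:* ((SS.:1 SS.:+ q) SS.:* b)) SS.:* w) S.refl b qS w)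
             (S.trans (S.*-congʳ (recurrence (j ℕ.+ p))) (S.trans (SS.solve 5 (λ a b c q w → (b SS.:* (q SS.:* a SS.:+ c)) SS.:* w SS.:= q SS.:* (a SS.:* (b SS.:* w)) SS.:+ c SS.:* (b SS.:* w)) S.refl a b c qS w)
               (S.sym (S.+-cong (S.*-congˡ (S.*-congˡ X≈)) (S.*-congˡ X≈))))))) ⟩
        Λ (qS S.* (a S.* X) S.+ c S.* X) ≈⟨ trans (Λ-+ _ _) (+-congʳ (Λ-q _)) ⟩
        q * Λ (a S.* X) + Λ (c S.* X) ∎
        where
        a b c X w : S.Carrier
        a = Uc (j ℕ.+ p)
        b = Uc (suc j ℕ.+ p)
        c = Uc (suc (suc j) ℕ.+ p)
        X = SS.prodL (D ++ E) (λ d → Uc (d ℕ.+ p))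
        fac : ∃ λ w → X S.≈ Uc (suc j % n ℕ.+ p) S.* w
        fac = factor (suc j % n) (Memₚ.∈-++⁺ˡ j∈) (λ d → Uc (d ℕ.+ p))
        w = proj₁ fac
        X≈ : X S.≈ b S.* w
        X≈ = S.trans (proj₂ fac) (S.*-congʳ (S.reflexive (≡.cong U (%-+ (suc j) p))))
    j₀%n : j₀ % n ≡ j₀
    j₀%n = m<n⇒m%n≡m (proj₁ (proj₂ missing))
    g : ℕ → Carrier
    g t = f (t ℕ.+ j₀)
    g₀ : g 0 ≈ N
    g₀ = f-missing j₀ (≡.subst (_∉ D) (≡.sym j₀%n) (proj₂ (proj₂ missing)))
    gₙ : g n ≈ N
    gₙ = f-missing (n ℕ.+ j₀) (≡.subst (_∉ D) (≡.sym (≡.trans (≡.trans (≡.cong (_% n) (ℕₚ.+-comm n j₀)) ([m+n]%n≡m%n j₀ n)) j₀%n)) (proj₂ (proj₂ missing)))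
    g-constant : ∀ t → t ℕ.≤ n → g t ≈ N
    g-constant = constant g N (λ s → f-step (s ℕ.+ j₀)) n g₀ gₙ
    at-e : j₀ ℕ.≤ e ⊎ e ℕ.≤ j₀ → f e ≈ N
    at-e (inj₁ le) = trans (reflexive (≡.cong f (≡.sym (ℕₚ.m∸n+n≡m le)))) (g-constant (e ℕ.∸ j₀) (ℕₚ.≤-trans (ℕₚ.m∸n≤m e j₀) (ℕₚ.<⇒≤ e<n)))
    at-e (inj₂ le) = trans (sym (f-% e)) (trans (reflexive (≡.cong f (≡.sym ([m+n]%n≡m%n e n)))) (trans (f-% (e ℕ.+ n))
      (trans (reflexive (≡.cong f (≡.sym (ℕₚ.m∸n+n≡m (ℕₚ.≤-trans (ℕₚ.<⇒≤ (proj₁ (proj₂ missing))) (ℕₚ.m≤n+m n e)))))) (g-constant (e ℕ.+ n ℕ.∸ j₀)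
        (ℕₚ.≤-trans (ℕₚ.∸-monoʳ-≤ (e ℕ.+ n) le) (ℕₚ.≤-reflexive (ℕₚ.m+n∸m≡n e n)))))))

  cyclic-rule : ∀ a → All (ℕ._< n) a → length a ≡ m → Φ a ≈ N
  cyclic-rule a b l = Φ-split a [] [] [] b l

module WordSumLemmas {s ℓs : Level} (S : CommutativeRing s ℓs) (q : CommutativeRing.Carrier S) where
  open CommutativeRing S
  open RingTools S

  sum-of : (ℕ → Carrier) → ℕ → List ℕ → ℕ → Carrier
  sum-of U = WordSum.wordSum S q U

  wordSum-cong : ∀ (U V : ℕ → Carrier) l w i → (∀ d → suc d ℕ.< length w → U d ≈ V d) → sum-of U l w i ≈ sum-of V l w i
  wordSum-cong U V zero w i e = refl
  wordSum-cong U V (suc l) w i e = Sum.bigN-cong (length w ℕ.∸ 1) λ d d<m → *-congˡ (cong-if (at w (suc d) <ᵇ at w d)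
      (*-cong (e d (shift (length w) d d<m)) (wordSum-cong U V l (swapAt d w) (suc d) (λ d′ l → e d′ (≡.subst (suc d′ ℕ.<_) (length-swapAt d w) l)))))
    where
    shift : ∀ n d → d ℕ.< n ℕ.∸ 1 → suc d ℕ.< n
    shift (suc n) d l = s≤s l
    cong-if : ∀ b {x y} → x ≈ y → (if b then x else 0#) ≈ (if b then y else 0#)
    cong-if true e = e
    cong-if false e = refl

  -- every reduced word of w contains the letter at the cut
  wordSum-vanishes : ∀ (U : ℕ → Carrier) c′ → U c′ ≈ 0# → ∀ l w i → len w ≡ l → CrossInversion (suc c′) w → sum-of U l w i ≈ 0#
  wordSum-vanishes U c′ z zero w i e inv = ⊥-elim (sorted⇒no-CrossInversion (suc c′) w (len-0 w e) inv)
  wordSum-vanishes U c′ z (suc l) w i e inv = Sum.bigN-ε (length w ℕ.∸ 1) λ d d<m → trans (*-congˡ (last d (shift (length w) d d<m) (ℕₚ.<-≤-connex (at w (suc d)) (at w d)) (d ℕ.≟ c′))) (zeroʳ _)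
    where
    shift : ∀ n d → d ℕ.< n ℕ.∸ 1 → suc d ℕ.< n
    shift (suc n) d l = s≤s l
    last : ∀ d → suc d ℕ.< length w → at w (suc d) ℕ.< at w d ⊎ at w d ℕ.≤ at w (suc d) → Dec (d ≡ c′) → WordSum.wordSumLast S q U l w d ≈ 0#
    last d d<w (inj₂ le) _ = reflexive (WordSum.wordSumLast-ascent S q U l w d le)
    last d d<w (inj₁ lt) (yes ≡.refl) = trans (reflexive (WordSum.wordSumLast-descent S q U l w d lt)) (trans (*-congʳ z) (zeroˡ _))
    last d d<w (inj₁ lt) (no ne) = trans (reflexive (WordSum.wordSumLast-descent S q U l w d lt)) (trans (*-congˡ (wordSum-vanishes U c′ z l (swapAt d w) (suc d)
        (ℕₚ.suc-injective (≡.trans (≡.sym (len-swapAt-descent d w d<w lt)) e)) (CrossInversion-swapAt (suc c′) d w (ne ∘ ℕₚ.suc-injective) inv))) (zeroʳ _))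

module FieldFacts {r ℓ : Level} (R : CommutativeRing r ℓ) (isField : Poly.IsField R) (charZero : Poly.CharZero R)
  (q : CommutativeRing.Carrier R) (nr : Poly.NotNontrivialRootOfUnity R q) where
  open CommutativeRing R
  open RingTools R
  open Poly R using (pow; fromℕ)
  open Relation.Binary.Reasoning.Setoid setoid

  cancel-≉0 : ∀ a → ¬ (a ≈ 0#) → ∀ x y → a * x ≈ a * y → x ≈ y
  cancel-≉0 a a≉0 x y e = begin
    x ≈⟨ undo x ⟨
    b * (a * x) ≈⟨ *-congˡ e ⟩
    b * (a * y) ≈⟨ undo y ⟩
    y ∎
    where
    b : Carrier
    b = proj₁ (proj₂ isField a a≉0)
    undo : ∀ x → b * (a * x) ≈ x
    undo x = trans (sym (*-assoc b a x)) (trans (*-congʳ (trans (*-comm b a) (proj₂ (proj₂ isField a a≉0)))) (*-identityˡ x))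

  halve : ∀ x → x ≈ - x → x ≈ 0#
  halve x e = cancel-≉0 (fromℕ 2) (charZero 1) x 0# (begin
    (1# + (1# + 0#)) * x ≈⟨ solve 1 (λ x → (:1 :+ (:1 :+ :0)) :* x := x :+ x) refl x ⟩
    x + x ≈⟨ +-congˡ e ⟩
    x + - x ≈⟨ -‿inverseʳ x ⟩
    0# ≈⟨ zeroʳ _ ⟨
    (1# + (1# + 0#)) * 0# ∎)

  qnum-≈1 : q ≈ 1# → ∀ k → qnum q k ≈ fromℕ k
  qnum-≈1 e zero = refl
  qnum-≈1 e (suc k) = +-congˡ (trans (*-cong e (qnum-≈1 e k)) (*-identityˡ _))

  qnum-≉0 : ∀ k → ¬ (qnum q (suc k) ≈ 0#)
  qnum-≉0 k z = charZero k (trans (sym (qnum-≈1 q≈1 (suc k))) z)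
    where
    q≈1 : q ≈ 1#
    q≈1 = nr k (begin
      pow q (suc k) ≈⟨ solve 1 (λ p → p := :1 :- (:1 :- p)) refl _ ⟩
      1# + - (1# + - pow q (suc k)) ≈⟨ +-congˡ (-‿cong (trans (sym (1-q*qnum q (suc k))) (trans (*-congˡ z) (zeroʳ _)))) ⟩
      1# + - 0# ≈⟨ solve 0 (:1 :- :0 := :1) refl ⟩
      1# ∎)

  cancel-qnum : ∀ k d → qnum q (suc k) * d ≈ 0# → d ≈ 0#
  cancel-qnum k d e = cancel-≉0 _ (qnum-≉0 k) d 0# (trans e (sym (zeroʳ _)))

  cancel-qfac : ∀ k x y → qfac q k * x ≈ qfac q k * y → x ≈ y
  cancel-qfac zero x y e = trans (sym (*-identityˡ x)) (trans e (*-identityˡ y))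
  cancel-qfac (suc k) x y e = cancel-qfac k x y (cancel-≉0 _ (qnum-≉0 k) _ _ (trans (sym (*-assoc _ _ _)) (trans e (*-assoc _ _ _))))

module LinearForm {s ℓs r ℓr : Level} (S : CommutativeRing s ℓs) (R : CommutativeRing r ℓr)
  (qS : CommutativeRing.Carrier S) (q : CommutativeRing.Carrier R)
  (Λ : CommutativeRing.Carrier S → CommutativeRing.Carrier R)
  (Λ-cong : ∀ {a b} → CommutativeRing._≈_ S a b → CommutativeRing._≈_ R (Λ a) (Λ b))
  (Λ-+ : ∀ a b → CommutativeRing._≈_ R (Λ (CommutativeRing._+_ S a b)) (CommutativeRing._+_ R (Λ a) (Λ b)))
  (Λ-q : ∀ a → CommutativeRing._≈_ R (Λ (CommutativeRing._*_ S qS a)) (CommutativeRing._*_ R q (Λ a)))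
  (Λ-0 : CommutativeRing._≈_ R (Λ (CommutativeRing.0# S)) (CommutativeRing.0# R)) where
  private module S = CommutativeRing S
  private module SS = RingTools S
  open CommutativeRing R
  open RingTools R
  open Poly R using (pow)
  open Relation.Binary.Reasoning.Setoid setoid

  Λ-qnum : ∀ k a → Λ (SS.qnum qS k S.* a) ≈ qnum q k * Λ a
  Λ-qnum zero a = trans (trans (Λ-cong (S.zeroˡ a)) Λ-0) (sym (zeroˡ _))
  Λ-qnum (suc k) a = begin
    Λ ((S.1# S.+ (qS S.* SS.qnum qS k)) S.* a) ≈⟨ Λ-cong (SS.solve 3 (λ q n a → (SS.:1 SS.:+ q SS.:* n) SS.:* a SS.:= a SS.:+ q SS.:* (n SS.:* a)) S.refl qS (SS.qnum qS k) a) ⟩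
    Λ (a S.+ (qS S.* (SS.qnum qS k S.* a))) ≈⟨ trans (Λ-+ a _) (+-congˡ (trans (Λ-q _) (*-congˡ (Λ-qnum k a)))) ⟩
    Λ a + q * (qnum q k * Λ a) ≈⟨ solve 3 (λ q n a → a :+ q :* (n :* a) := (:1 :+ q :* n) :* a) refl q _ _ ⟩
    qnum q (suc k) * Λ a ∎

  Λ-qfac : ∀ k a → Λ (SS.qfac qS k S.* a) ≈ qfac q k * Λ a
  Λ-qfac zero a = trans (Λ-cong (S.*-identityˡ a)) (sym (*-identityˡ _))
  Λ-qfac (suc k) a = trans (Λ-cong (S.*-assoc (SS.qnum qS (suc k)) (SS.qfac qS k) a)) (trans (Λ-qnum (suc k) _) (trans (*-congˡ (Λ-qfac k a)) (sym (*-assoc _ _ _))))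

  Λ-pow : ∀ k a → Λ (Poly.pow S qS k S.* a) ≈ pow q k * Λ a
  Λ-pow zero a = trans (Λ-cong (S.*-identityˡ a)) (sym (*-identityˡ _))
  Λ-pow (suc k) a = trans (Λ-cong (S.*-assoc qS (Poly.pow S qS k) a)) (trans (Λ-q _) (trans (*-congˡ (Λ-pow k a)) (sym (*-assoc _ _ _))))

  Λ-neg : ∀ a → Λ (S.- a) ≈ - Λ a
  Λ-neg a = begin
    Λ (S.- a) ≈⟨ solve 2 (λ x y → x := (y :+ x) :- y) refl (Λ (S.- a)) (Λ a) ⟩
    Λ a + Λ (S.- a) + - Λ a ≈⟨ +-congʳ (trans (sym (Λ-+ a (S.- a))) (trans (Λ-cong (S.-‿inverseʳ a)) Λ-0)) ⟩
    0# + - Λ a ≈⟨ +-identityˡ _ ⟩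
    - Λ a ∎

  Λ-sign : ∀ k a → Λ (Poly.pow S (S.- S.1#) k S.* a) ≈ pow (- 1#) k * Λ a
  Λ-sign zero a = trans (Λ-cong (S.*-identityˡ a)) (sym (*-identityˡ _))
  Λ-sign (suc k) a = trans (Λ-cong (SS.solve 2 (λ e a → ((SS.:- SS.:1) SS.:* e) SS.:* a SS.:= SS.:- (e SS.:* a)) S.refl (Poly.pow S (S.- S.1#) k) a))
    (trans (Λ-neg _) (trans (-‿cong (Λ-sign k a)) (solve 2 (λ e a → :- (e :* a) := (:- :1) :* e :* a) refl _ _)))

  Λ-sumL : ∀ {A : Set} (xs : List A) (f : A → S.Carrier) → Λ (SS.sumL xs f) ≈ sumL xs (Λ ∘ f)
  Λ-sumL [] f = Λ-0
  Λ-sumL (x ∷ xs) f = trans (Λ-+ (f x) _) (+-congˡ (Λ-sumL xs f))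

module RotationSum {s ℓs r ℓr : Level} (S : CommutativeRing s ℓs) (R : CommutativeRing r ℓr)
  (isField : Poly.IsField R) (charZero : Poly.CharZero R)
  (qS : CommutativeRing.Carrier S) (q : CommutativeRing.Carrier R) (nr : Poly.NotNontrivialRootOfUnity R q)
  (x : ℕ → CommutativeRing.Carrier S) (m : ℕ)
  (rel : ∀ k → suc k ℕ.< suc m → CommutativeRing._≈_ S (CommutativeRing._*_ S (Points.u S qS x (suc k))
     (CommutativeRing._+_ S (CommutativeRing._*_ S qS (x k)) (CommutativeRing.-_ S (x (suc k))))) (CommutativeRing.0# S))
  (top : CommutativeRing._≈_ S (Points.u S qS x (suc m)) (CommutativeRing.0# S))
  (Λ : CommutativeRing.Carrier S → CommutativeRing.Carrier R)
  (Λ-cong : ∀ {a b} → CommutativeRing._≈_ S a b → CommutativeRing._≈_ R (Λ a) (Λ b))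
  (Λ-+ : ∀ a b → CommutativeRing._≈_ R (Λ (CommutativeRing._+_ S a b)) (CommutativeRing._+_ R (Λ a) (Λ b)))
  (Λ-q : ∀ a → CommutativeRing._≈_ R (Λ (CommutativeRing._*_ S qS a)) (CommutativeRing._*_ R q (Λ a)))
  (Λ-0 : CommutativeRing._≈_ R (Λ (CommutativeRing.0# S)) (CommutativeRing.0# R))
  (Λ-top : CommutativeRing._≈_ R (Λ (RingTools.prodN S m (λ d → Points.u S qS x (suc d)))) (RingTools.qfac R q m))
  (ws : List (List ℕ)) (indec : All Indecomposable ws) (isp : IsPerm (suc m) (product ws)) (len≡m : len (product ws) ≡ m) where
  private module S = CommutativeRing S
  private module SS = RingTools S
  open CommutativeRing R
  open RingTools R
  open Poly R using (pow)
  open Relation.Binary.Reasoning.Setoid setoid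
  open FieldFacts R isField charZero q nr
  open LinearForm S R qS q Λ Λ-cong Λ-+ Λ-q Λ-0
  private module WL = WordSumLemmas S qS
  private module C = CyclicRule S R qS q x m rel top Λ Λ-cong Λ-+ Λ-q Λ-0 cancel-qnum
  open C using (U; Uc)

  n : ℕ
  n = suc m

  w : List ℕ
  w = product ws

  V : ℕ → ℕ → S.Carrier
  V p d = Uc (d ℕ.+ p)

  ws↭ : w ↭ upTo n
  ws↭ = proj₂ isp

  standard : All Standard ws
  standard = All.map (λ (isp , _) → IsPerm⇒Standard _ _ isp) indec

  length-w : length w ≡ n
  length-w = proj₁ isp

  G : ℕ → Carrier
  G p = Λ (WL.sum-of (V p) m w 0)

  G-Red : ∀ p → G p ≈ sumL (Red n w) (λ a → pow q (comaj a) * Λ (SS.prodL (map (ℕ._∸ 1) a) (λ d → Uc (d ℕ.+ p))))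
  G-Red p = begin
    Λ (WL.sum-of (V p) m w 0) ≈⟨ Λ-cong (S.trans (S.reflexive (≡.cong (λ l → WL.sum-of (V p) l w 0) (≡.sym len≡m))) (ReducedWords.wordSum≈Red S qS (V p) n (len-upTo n) w ws↭)) ⟩
    Λ (SS.sumL (Red n w) (λ a → Poly.pow S qS (comaj a) S.* SS.prodL a (λ x → V p (x ℕ.∸ 1)))) ≈⟨ Λ-sumL (Red n w) _ ⟩
    sumL (Red n w) (λ a → Λ (Poly.pow S qS (comaj a) S.* SS.prodL a (λ x → V p (x ℕ.∸ 1))))
      ≈⟨ Sum.big-cong (Red n w) (λ a → trans (Λ-pow (comaj a) _) (*-congˡ (Λ-cong (S.sym (SS.Prod.big-map (ℕ._∸ 1) a (λ d → Uc (d ℕ.+ p))))))) ⟩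
    sumL (Red n w) (λ a → pow q (comaj a) * Λ (SS.prodL (map (ℕ._∸ 1) a) (λ d → Uc (d ℕ.+ p)))) ∎

  swap-sums : ∀ k (xs : List (List ℕ)) (F : ℕ → List ℕ → Carrier) → sumN k (λ p → sumL xs (F p)) ≈ sumL xs (λ a → sumN k (λ p → F p a))
  swap-sums zero xs F = sym (Sum.big-ε xs (λ _ → refl))
  swap-sums (suc k) xs F = trans (+-congˡ (swap-sums k xs (F ∘ suc))) (sym (Sum.big-∙ xs _ _))

  Red-InWords : All (InWords n m) (Red n w)
  Red-InWords = ≡.subst (λ l → All (InWords n l) (Red n w)) len≡m (Allₚ.filter⁺ _ (allWords-InWords n (len w)))

  cycle : ℕ → List ℕ → Carrier
  cycle p a = Λ (SS.prodL (map (ℕ._∸ 1) a) (λ d → Uc (d ℕ.+ p)))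

  cycle-total : ∀ a → length a ≡ m → All (λ x → 1 ℕ.≤ x × x ℕ.≤ m) a → sumN n (λ p → cycle p a) ≈ qfac q m
  cycle-total a la ba = trans (C.cyclic-rule (map (ℕ._∸ 1) a)
    (Allₚ.map⁺ (All.map (λ {x} (_ , x≤m) → s≤s (ℕₚ.≤-trans (ℕₚ.m∸n≤m x 1) x≤m)) ba)) (≡.trans (length-map _ a) la)) Λ-top

  G-total : sumN n G ≈ qfac q m * Poly.redSum R q n w
  G-total = begin
    sumN n G ≈⟨ trans (Sum.bigN-cong n (λ p _ → G-Red p)) (swap-sums n (Red n w) (λ p a → pow q (comaj a) * cycle p a)) ⟩
    sumL (Red n w) (λ a → sumN n (λ p → pow q (comaj a) * cycle p a))
      ≈⟨ Sum.big-cong-All {xs = Red n w} (All.map (λ {a} (la , ba) → trans (sym (sumN-*ˡ n (pow q (comaj a)) (λ p → cycle p a))) (trans (*-congˡ (cycle-total a la ba)) (*-comm _ _))) Red-InWords) ⟩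
    sumL (Red n w) (λ a → qfac q m * pow q (comaj a)) ≈⟨ sumL-*ˡ (Red n w) (qfac q m) (λ a → pow q (comaj a)) ⟨
    qfac q m * sumL (Red n w) (λ a → pow q (comaj a)) ≈⟨ *-congˡ (reflexive (sumR-map (Red n w))) ⟩
    qfac q m * Poly.redSum R q n w ∎
    where
    sumR-map : ∀ xs → sumL xs (λ a → pow q (comaj a)) ≡ Poly.sumR R (map (λ a → pow q (comaj a)) xs)
    sumR-map [] = ≡.refl
    sumR-map (x ∷ xs) = ≡.cong (pow q (comaj x) +_) (sumR-map xs)

  Uc-period : ∀ k → Uc (k ℕ.+ n) ≡ Uc k
  Uc-period k = ≡.cong U ([m+n]%n≡m%n k n)

  Uc-small : ∀ k → k ℕ.< n → Uc k ≡ U k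
  Uc-small k k<n = ≡.cong U (m<n⇒m%n≡m k<n)

  G-period : G n ≈ G 0
  G-period = Λ-cong (WL.wordSum-cong (V n) (V 0) m w 0 (λ d _ → S.reflexive (≡.trans (Uc-period d) (≡.cong Uc (≡.sym (ℕₚ.+-identityʳ d))))))

  cutTerm : ℕ → Carrier
  cutTerm c = G (n ℕ.∸ c)

  sum-cutTerm : sumN n cutTerm ≈ sumN n G
  sum-cutTerm = begin
    sumN n cutTerm ≈⟨ Sum.bigN-cong n (λ i i<n → reflexive (≡.cong G (ℕₚ.+-∸-assoc 1 i<n))) ⟩
    sumN n (λ i → G (suc (n ℕ.∸ suc i))) ≈⟨ Sum.bigN-reverse n (G ∘ suc) ⟩
    sumN n (G ∘ suc) ≈⟨ Sum.bigN-snoc m (G ∘ suc) ⟩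
    sumN m (G ∘ suc) + G n ≈⟨ trans (+-congˡ G-period) (+-comm _ _) ⟩
    sumN n G ∎

  cutTerm-interior : ∀ c → CrossInversion c w → cutTerm c ≈ 0#
  cutTerm-interior zero (x , y , () , _)
  cutTerm-interior (suc c′) inv = trans (Λ-cong (WL.wordSum-vanishes (V (n ℕ.∸ suc c′)) c′ (C.Uc-top (c′ ℕ.+ (m ℕ.∸ c′)) (≡.trans (≡.cong (_% n) (ℕₚ.m+[n∸m]≡n c′≤m)) (m<n⇒m%n≡m ℕₚ.≤-refl))) m w 0 len≡m inv)) Λ-0
    where
    c′≤m : c′ ℕ.≤ m
    c′≤m = bound w inv length-w
      where
      drop-nonempty : ∀ k (v : List ℕ) {y} → y ∈ drop k v → k ℕ.< length v
      drop-nonempty zero (_ ∷ v) _ = s≤s z≤n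
      drop-nonempty (suc k) (_ ∷ v) i = s≤s (drop-nonempty k v i)
      bound : ∀ v → CrossInversion (suc c′) v → length v ≡ n → c′ ℕ.≤ m
      bound v (x , y , _ , y∈ , _) e = ℕₚ.≤-pred (ℕₚ.<⇒≤ (≡.subst (suc c′ ℕ.<_) e (drop-nonempty (suc c′) v y∈)))

  sum-at-cuts : ∀ us → All Indecomposable us → (F : ℕ → Carrier) → (∀ c → CrossInversion c (product us) → F c ≈ 0#) →
    sumN (length (product us)) F ≈ sumN (length us) (λ j → F (length (product (take j us))))
  sum-at-cuts [] [] F z = refl
  sum-at-cuts (b ∷ us) (ib ∷ is) F z = begin
    sumN (length (b ×ₚ product us)) F ≈⟨ trans (reflexive (≡.cong (λ k → sumN k F) (length-×ₚ b (product us)))) (Sum.bigN-+ (length b) (length (product us)) F) ⟩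
    sumN (length b) F + sumN (length (product us)) (λ i → F (length b ℕ.+ i))
      ≈⟨ +-cong (block (length b) (proj₁ (proj₂ ib)) ≡.refl) (sum-at-cuts us is (λ i → F (length b ℕ.+ i)) (λ c inv → z (length b ℕ.+ c) (CrossInversion-×ʳ c b (product us) inv))) ⟩
    F 0 + sumN (length us) (λ j → F (length b ℕ.+ length (product (take j us))))
      ≈⟨ +-congˡ (Sum.bigN-cong (length us) (λ j _ → reflexive (≡.cong F (≡.sym (length-×ₚ b (product (take j us))))))) ⟩
    F 0 + sumN (length us) (λ j → F (length (b ×ₚ product (take j us)))) ∎
    where
    block : ∀ k → 1 ℕ.≤ k → length b ≡ k → sumN k F ≈ F 0
    block (suc k) _ e = trans (+-congˡ (Sum.bigN-ε k (λ i i<k → z (suc i) (CrossInversion-×ˡ (suc i) b (product us)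
      (indecomposable⇒CrossInversion b (suc i) ib (s≤s z≤n) (≡.subst (suc i ℕ.<_) (≡.sym e) (s≤s i<k))))))) (+-identityʳ _)

  length-product>0 : ∀ us → All Indecomposable us → 0 ℕ.< length us → 0 ℕ.< length (product us)
  length-product>0 (u ∷ us) (iu ∷ _) _ = ≡.subst (0 ℕ.<_) (≡.sym (length-×ₚ u (product us))) (ℕₚ.<-≤-trans (proj₁ (proj₂ iu)) (ℕₚ.m≤m+n _ _))

  length-drop>0 : ∀ j (us : List (List ℕ)) → j ℕ.< length us → 0 ℕ.< length (drop j us)
  length-drop>0 zero (_ ∷ us) _ = s≤s z≤n
  length-drop>0 (suc j) (_ ∷ us) (s≤s l) = length-drop>0 j us l

  rot-product : ∀ j → Poly.rot R j ws ≡ product (drop j ws) ×ₚ product (take j ws)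
  rot-product j = product-++ (drop j ws) (take j ws)

  w-product : ∀ j → w ≡ product (take j ws) ×ₚ product (drop j ws)
  w-product j = ≡.trans (≡.cong product (≡.sym (take++drop≡id j ws))) (product-++ (take j ws) (drop j ws))

  module At (j : ℕ) where
    A B : List ℕ
    A = product (take j ws)
    B = product (drop j ws)
    sA : Standard A
    sA = Standard-product (take j ws) (Allₚ.take⁺ j standard)
    sB : Standard B
    sB = Standard-product (drop j ws) (Allₚ.drop⁺ j standard)
    lengths : length A ℕ.+ length B ≡ n
    lengths = ≡.trans (≡.sym (length-×ₚ A B)) (≡.trans (≡.cong length (≡.sym (w-product j))) length-w)
    lens : len A ℕ.+ len B ≡ m
    lens = ≡.trans (≡.sym (len-×ₚ A B (proj₁ sA))) (≡.trans (≡.cong len (≡.sym (w-product j))) len≡m)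
    rot-length : length (Poly.rot R j ws) ≡ n
    rot-length = ≡.trans (≡.cong length (rot-product j)) (≡.trans (length-×ₚ B A) (≡.trans (ℕₚ.+-comm (length B) (length A)) lengths))
    rot-len : len (Poly.rot R j ws) ≡ m
    rot-len = ≡.trans (≡.cong len (rot-product j)) (≡.trans (len-×ₚ B A (proj₁ sB)) (≡.trans (ℕₚ.+-comm (len B) (len A)) lens))
    rot-standard : Standard (Poly.rot R j ws)
    rot-standard = ≡.subst Standard (≡.sym (rot-product j)) (Standard-×ₚ B A sB sA)
    rot↭ : Poly.rot R j ws ↭ upTo n
    rot↭ = Standard⇒↭ n (Poly.rot R j ws) rot-standard rot-length

  cutTerm-boundary : ∀ j → j ℕ.< length ws → cutTerm (length (product (take j ws))) ≈ Λ (WL.sum-of U m (Poly.rot R j ws) 0)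
  cutTerm-boundary zero _ = trans G-period (Λ-cong (S.trans (WL.wordSum-cong (V 0) U m w 0 (λ d d<w → S.reflexive (≡.trans (≡.cong Uc (ℕₚ.+-identityʳ d)) (Uc-small d (ℕₚ.<-trans ℕₚ.≤-refl (≡.subst (suc d ℕ.<_) length-w d<w))))))
    (S.reflexive (≡.cong (λ us → WL.sum-of U m (product us) 0) (≡.sym (++-identityʳ ws))))))
  cutTerm-boundary (suc j′) j<k = cancel-qfac (len A) _ _ (cancel-qfac (len B) _ _ (begin
    qfac q (len B) * (qfac q (len A) * cutTerm (length A)) ≈⟨ *-congˡ (*-congˡ (reflexive (≡.cong G n∸A))) ⟩
    qfac q (len B) * (qfac q (len A) * Λ (WL.sum-of Vp m w 0)) ≈⟨ scaled (WL.sum-of Vp m w 0) ⟨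
    Λ ((SS.qfac qS (len A) S.* SS.qfac qS (len B)) S.* WL.sum-of Vp m w 0) ≈⟨ Λ-cong both ⟩
    Λ ((SS.qfac qS (len A) S.* SS.qfac qS (len B)) S.* WL.sum-of U m (Poly.rot R j ws) 0) ≈⟨ scaled (WL.sum-of U m (Poly.rot R j ws) 0) ⟩
    qfac q (len B) * (qfac q (len A) * Λ (WL.sum-of U m (Poly.rot R j ws) 0)) ∎))
    where
    j : ℕ
    j = suc j′
    open At j
    Vp : ℕ → S.Carrier
    Vp = V (length B)
    n∸A : n ℕ.∸ length A ≡ length B
    n∸A = ≡.trans (≡.cong (ℕ._∸ length A) (≡.sym lengths)) (ℕₚ.m+n∸m≡n (length A) (length B))
    scaled : ∀ x → Λ ((SS.qfac qS (len A) S.* SS.qfac qS (len B)) S.* x) ≈ qfac q (len B) * (qfac q (len A) * Λ x)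
    scaled x = trans (Λ-cong (S.trans (S.*-congʳ {x} (S.*-comm (SS.qfac qS (len A)) (SS.qfac qS (len B)))) (S.*-assoc (SS.qfac qS (len B)) (SS.qfac qS (len A)) x)))
      (trans (Λ-qfac (len B) _) (*-congˡ (Λ-qfac (len A) x)))
    take-nonempty : ∀ (us : List (List ℕ)) → j ℕ.< length us → 0 ℕ.< length (take j us)
    take-nonempty (_ ∷ us) _ = s≤s z≤n
    A>0 : 0 ℕ.< length A
    A>0 = length-product>0 (take j ws) (Allₚ.take⁺ j indec) (take-nonempty ws j<k)
    B>0 : 0 ℕ.< length B
    B>0 = length-product>0 (drop j ws) (Allₚ.drop⁺ j indec) (length-drop>0 j ws j<k)
    shiftedSum : (ℕ → S.Carrier) → ℕ → ℕ → List ℕ → ℕ → S.Carrier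
    shiftedSum W k = WL.sum-of (λ d → W (k ℕ.+ d))
    splitSum : ∀ (W : ℕ → S.Carrier) a b → Standard a → 0 ℕ.< length a → 0 ℕ.< length b → len a ℕ.+ len b ≡ m →
      ((SS.qfac qS (len a) S.* SS.qfac qS (len b)) S.* WL.sum-of W m (a ×ₚ b) 0) S.≈ (SS.qfac qS m S.* (WL.sum-of W (len a) a 0 S.* shiftedSum W (length a) (len b) b 0))
    splitSum W a b sa a>0 b>0 ≡.refl = ProductRule.wordSum-×ₚ S qS W a b (proj₁ sa) a>0 b>0
    AV : WL.sum-of Vp (len A) A 0 S.≈ shiftedSum U (length B) (len A) A 0
    AV = WL.wordSum-cong Vp (λ d → U (length B ℕ.+ d)) (len A) A 0 λ d d<A → S.reflexive (≡.trans (≡.cong Uc (ℕₚ.+-comm d (length B)))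
      (Uc-small (length B ℕ.+ d) (≡.subst (length B ℕ.+ d ℕ.<_) (≡.trans (ℕₚ.+-comm (length B) (length A)) lengths) (ℕₚ.+-monoʳ-< (length B) (ℕₚ.<-trans ℕₚ.≤-refl d<A)))))
    BV : shiftedSum Vp (length A) (len B) B 0 S.≈ WL.sum-of U (len B) B 0
    BV = WL.wordSum-cong (λ d → Vp (length A ℕ.+ d)) U (len B) B 0 λ d d<B → S.reflexive (≡.trans (≡.cong Uc (≡.trans (≡.cong (ℕ._+ length B) (ℕₚ.+-comm (length A) d)) (≡.trans (ℕₚ.+-assoc d _ _) (≡.cong (d ℕ.+_) lengths))))
      (≡.trans (Uc-period d) (Uc-small d (ℕₚ.<-≤-trans (ℕₚ.<-trans ℕₚ.≤-refl d<B) (≡.subst (length B ℕ.≤_) lengths (ℕₚ.m≤n+m _ _))))))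
    both : ((SS.qfac qS (len A) S.* SS.qfac qS (len B)) S.* WL.sum-of Vp m w 0) S.≈ ((SS.qfac qS (len A) S.* SS.qfac qS (len B)) S.* WL.sum-of U m (Poly.rot R j ws) 0)
    both = S.trans (S.reflexive (≡.cong (λ v → (SS.qfac qS (len A) S.* SS.qfac qS (len B)) S.* WL.sum-of Vp m v 0) (w-product j)))
      (S.trans (splitSum Vp A B sA A>0 B>0 lens)
      (S.trans (S.*-congˡ {SS.qfac qS m} (S.trans (S.*-cong {WL.sum-of Vp (len A) A 0} {shiftedSum U (length B) (len A) A 0} {shiftedSum Vp (length A) (len B) B 0} {WL.sum-of U (len B) B 0} AV BV)
          (S.*-comm (shiftedSum U (length B) (len A) A 0) (WL.sum-of U (len B) B 0))))
      (S.trans (S.sym (splitSum U B A sB B>0 A>0 (≡.trans (ℕₚ.+-comm (len B) (len A)) lens)))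
      (S.*-cong {SS.qfac qS (len B) S.* SS.qfac qS (len A)} {SS.qfac qS (len A) S.* SS.qfac qS (len B)} (S.*-comm (SS.qfac qS (len B)) (SS.qfac qS (len A)))
        (S.reflexive (≡.cong (λ v → WL.sum-of U m v 0) (≡.sym (rot-product j))))))))

  sum-rotations : (value : ℕ → Carrier) → (∀ j → qfac q m * value j ≈ Λ (WL.sum-of U m (Poly.rot R j ws) 0)) → sumN (length ws) value ≈ Poly.redSum R q n w
  sum-rotations value value-Λ = cancel-qfac m _ _ (begin
    qfac q m * sumN (length ws) value ≈⟨ trans (sumN-*ˡ (length ws) _ _) (Sum.bigN-cong (length ws) (λ j j<k → trans (value-Λ j) (sym (cutTerm-boundary j j<k)))) ⟩
    sumN (length ws) (λ j → cutTerm (length (product (take j ws)))) ≈⟨ sum-at-cuts ws indec cutTerm cutTerm-interior ⟨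
    sumN (length w) cutTerm ≡⟨ ≡.cong (λ k → sumN k cutTerm) length-w ⟩
    sumN n cutTerm ≈⟨ trans sum-cutTerm G-total ⟩
    qfac q m * Poly.redSum R q n w ∎)

module PolynomialSide {c ℓ : Level} (R : CommutativeRing c ℓ) where
  module Functionals where
    open CommutativeRing R
    open RingTools R
    open Poly R
    open Relation.Binary.Reasoning.Setoid setoid

    infixl 6 _⊕_
    _⊕_ : List ℕ → List ℕ → List ℕ
    _⊕_ = zipWith ℕ._+_

    ⊕-comm : ∀ α β → α ⊕ β ≡ β ⊕ α
    ⊕-comm [] [] = ≡.refl
    ⊕-comm [] (b ∷ β) = ≡.refl
    ⊕-comm (a ∷ α) [] = ≡.refl
    ⊕-comm (a ∷ α) (b ∷ β) = ≡.cong₂ _∷_ (ℕₚ.+-comm a b) (⊕-comm α β)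

    ⊕-assoc : ∀ α β γ → (α ⊕ β) ⊕ γ ≡ α ⊕ (β ⊕ γ)
    ⊕-assoc [] β γ = ≡.refl
    ⊕-assoc (a ∷ α) [] γ = ≡.refl
    ⊕-assoc (a ∷ α) (b ∷ β) [] = ≡.refl
    ⊕-assoc (a ∷ α) (b ∷ β) (c ∷ γ) = ≡.cong₂ _∷_ (ℕₚ.+-assoc a b c) (⊕-assoc α β γ)

    replicate-⊕ : ∀ n α → replicate n 0 ⊕ α ≡ take n α
    replicate-⊕ zero α = ≡.refl
    replicate-⊕ (suc n) [] = ≡.refl
    replicate-⊕ (suc n) (a ∷ α) = ≡.cong (a ∷_) (replicate-⊕ n α)

    take-⊕ : ∀ n α β → take n (α ⊕ β) ≡ take n α ⊕ take n β
    take-⊕ zero α β = ≡.refl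
    take-⊕ (suc n) [] β = ≡.refl
    take-⊕ (suc n) (a ∷ α) [] = ≡.refl
    take-⊕ (suc n) (a ∷ α) (b ∷ β) = ≡.cong (a ℕ.+ b ∷_) (take-⊕ n α β)

    take-idem : ∀ n (α : List ℕ) → take n (take n α) ≡ take n α
    take-idem zero α = ≡.refl
    take-idem (suc n) [] = ≡.refl
    take-idem (suc n) (a ∷ α) = ≡.cong (a ∷_) (take-idem n α)

    take-⊕ˡ : ∀ n α β → take n (α ⊕ take n β) ≡ take n (α ⊕ β)
    take-⊕ˡ n α β = ≡.trans (take-⊕ n α (take n β)) (≡.trans (≡.cong (take n α ⊕_) (take-idem n β)) (≡.sym (take-⊕ n α β)))

    at-⊕ : ∀ α β k → k ℕ.< length α → k ℕ.< length β → at (α ⊕ β) k ≡ at α k ℕ.+ at β k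
    at-⊕ (a ∷ α) (b ∷ β) zero _ _ = ≡.refl
    at-⊕ (a ∷ α) (b ∷ β) (suc k) (s≤s l) (s≤s l′) = at-⊕ α β k l l′

    Functional : Set c
    Functional = List ℕ → Carrier

    pair : Pol → Functional → Carrier
    pair [] ψ = 0#
    pair ((a , α) ∷ p) ψ = a * ψ α + pair p ψ

    Terms : (List ℕ → Set) → Pol → Set c
    Terms P = All (λ t → P (proj₂ t))

    pair-cong : ∀ p {ψ φ : Functional} → (∀ α → ψ α ≈ φ α) → pair p ψ ≈ pair p φ
    pair-cong [] e = refl
    pair-cong ((a , α) ∷ p) e = +-cong (*-congˡ (e α)) (pair-cong p e)

    pair-congᵀ : ∀ {P p} {ψ φ : Functional} → Terms P p → (∀ α → P α → ψ α ≈ φ α) → pair p ψ ≈ pair p φ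
    pair-congᵀ [] e = refl
    pair-congᵀ (w ∷ ws) e = +-cong (*-congˡ (e _ w)) (pair-congᵀ ws e)

    pair-0ᵀ : ∀ {P p} {ψ : Functional} → Terms P p → (∀ α → P α → ψ α ≈ 0#) → pair p ψ ≈ 0#
    pair-0ᵀ [] e = refl
    pair-0ᵀ (w ∷ ws) e = trans (+-cong (trans (*-congˡ (e _ w)) (zeroʳ _)) (pair-0ᵀ ws e)) (+-identityˡ _)

    pair-0 : ∀ p {ψ : Functional} → (∀ α → ψ α ≈ 0#) → pair p ψ ≈ 0#
    pair-0 [] e = refl
    pair-0 ((a , α) ∷ p) e = trans (+-cong (trans (*-congˡ (e _)) (zeroʳ _)) (pair-0 p e)) (+-identityˡ _)

    pair-++ : ∀ p r ψ → pair (p ++ r) ψ ≈ pair p ψ + pair r ψ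
    pair-++ [] r ψ = sym (+-identityˡ _)
    pair-++ ((a , α) ∷ p) r ψ = trans (+-congˡ (pair-++ p r ψ)) (sym (+-assoc _ _ _))

    pair-scale : ∀ a p ψ → pair (scaleP a p) ψ ≈ a * pair p ψ
    pair-scale a [] ψ = sym (zeroʳ a)
    pair-scale a ((b , β) ∷ p) ψ = trans (+-cong (*-assoc _ _ _) (pair-scale a p ψ)) (sym (distribˡ a _ _))

    pair-neg : ∀ p ψ → pair (-P p) ψ ≈ - pair p ψ
    pair-neg [] ψ = sym -0#≈0#
    pair-neg ((b , β) ∷ p) ψ = trans (+-cong (sym (-‿distribˡ-* _ _)) (pair-neg p ψ)) (-‿+-comm _ _)

    pair-+ʳ : ∀ p (ψ φ : Functional) → pair p (λ α → ψ α + φ α) ≈ pair p ψ + pair p φ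
    pair-+ʳ [] ψ φ = sym (+-identityˡ _)
    pair-+ʳ ((b , β) ∷ p) ψ φ = trans (+-cong (distribˡ _ _ _) (pair-+ʳ p ψ φ)) (Sum.interchange _ _ _ _)

    pair-*ʳ : ∀ p a (ψ : Functional) → pair p (λ α → a * ψ α) ≈ a * pair p ψ
    pair-*ʳ [] a ψ = sym (zeroʳ a)
    pair-*ʳ ((b , β) ∷ p) a ψ = trans (+-cong (solve 3 (λ a b x → b :* (a :* x) := a :* (b :* x)) refl a b _) (pair-*ʳ p a ψ)) (sym (distribˡ a _ _))

    pair--ʳ : ∀ p (ψ : Functional) → pair p (λ α → - ψ α) ≈ - pair p ψ
    pair--ʳ [] ψ = sym -0#≈0#
    pair--ʳ ((b , β) ∷ p) ψ = trans (+-cong (sym (-‿distribʳ-* _ _)) (pair--ʳ p ψ)) (-‿+-comm _ _)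

    pair-sumL : ∀ {A : Set} p (xs : List A) (ψ : A → Functional) → pair p (λ α → sumL xs (λ x → ψ x α)) ≈ sumL xs (λ x → pair p (ψ x))
    pair-sumL p [] ψ = pair-0 p (λ _ → refl)
    pair-sumL p (x ∷ xs) ψ = trans (pair-+ʳ p (ψ x) _) (+-congˡ (pair-sumL p xs ψ))

    pair-* : ∀ p r ψ → pair (p *P r) ψ ≈ pair p (λ α → pair r (λ β → ψ (α ⊕ β)))
    pair-* [] r ψ = refl
    pair-* ((a , α) ∷ p) r ψ = go r
      where
      go : ∀ s → pair (map (λ { (b , β) → (a * b , zipWith ℕ._+_ α β) }) s ++ (p *P r)) ψ
          ≈ a * pair s (λ β → ψ (α ⊕ β)) + pair p (λ α → pair r (λ β → ψ (α ⊕ β)))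
      go [] = trans (pair-* p r ψ) (trans (sym (+-identityˡ _)) (+-congʳ (sym (zeroʳ a))))
      go ((b , β) ∷ s) = trans (+-cong (*-assoc _ _ _) (go s)) (trans (sym (+-assoc _ _ _)) (+-congʳ (sym (distribˡ a _ _))))

    pair-swap : ∀ p r (F : List ℕ → List ℕ → Carrier) → pair p (λ α → pair r (F α)) ≈ pair r (λ β → pair p (λ α → F α β))
    pair-swap [] r F = sym (pair-0 r (λ _ → refl))
    pair-swap ((a , α) ∷ p) r F = trans (+-cong (sym (pair-*ʳ r a _)) (pair-swap p r F)) (sym (pair-+ʳ r _ _))

    pair-1 : ∀ n ψ → pair (constP n 1#) ψ ≈ ψ (replicate n 0)
    pair-1 n ψ = trans (+-identityʳ _) (*-identityˡ _)

    module DualRing (n : ℕ) {i : Level} (I : Set i) (Ψ : I → Functional) (act : I → List ℕ → I)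
                    (act-law : ∀ j β α → Ψ (act j β) α ≈ Ψ j (β ⊕ α))
                    (unit-law : ∀ j α → Ψ j (replicate n 0 ⊕ α) ≈ Ψ j α) where

      infix 4 _≋_
      record _≋_ (p r : Pol) : Set (i ⊔ ℓ) where
        constructor mk≋
        field at≋ : ∀ j → pair p (Ψ j) ≈ pair r (Ψ j)
      open _≋_ public

      private
        *-congʳ′ : ∀ {p p′} r → p ≋ p′ → (p *P r) ≋ (p′ *P r)
        *-congʳ′ {p} {p′} r e = mk≋ λ j → begin
          pair (p *P r) (Ψ j) ≈⟨ lem p j ⟩
          pair r (λ β → pair p (Ψ (act j β))) ≈⟨ pair-cong r (λ β → at≋ e (act j β)) ⟩
          pair r (λ β → pair p′ (Ψ (act j β))) ≈⟨ lem p′ j ⟨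
          pair (p′ *P r) (Ψ j) ∎
          where
          lem : ∀ p j → pair (p *P r) (Ψ j) ≈ pair r (λ β → pair p (Ψ (act j β)))
          lem p j = trans (pair-* p r (Ψ j)) (trans (pair-swap p r _)
            (pair-cong r (λ β → pair-cong p (λ α → trans (reflexive (≡.cong (Ψ j) (⊕-comm α β))) (sym (act-law j β α))))))

        *-comm′ : ∀ p r → (p *P r) ≋ (r *P p)
        *-comm′ p r = mk≋ λ j → trans (pair-* p r (Ψ j)) (trans (pair-swap p r _)
          (trans (pair-cong r (λ β → pair-cong p (λ α → reflexive (≡.cong (Ψ j) (⊕-comm α β))))) (sym (pair-* r p (Ψ j)))))

        ≋-trans : ∀ {p r s} → p ≋ r → r ≋ s → p ≋ s
        ≋-trans e f = mk≋ λ j → trans (at≋ e j) (at≋ f j)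

        *-assoc′ : ∀ p r s → ((p *P r) *P s) ≋ (p *P (r *P s))
        *-assoc′ p r s = mk≋ λ j → begin
          pair ((p *P r) *P s) (Ψ j) ≈⟨ trans (pair-* (p *P r) s _) (pair-* p r _) ⟩
          pair p (λ α → pair r (λ β → pair s (λ γ → Ψ j (α ⊕ β ⊕ γ))))
            ≈⟨ pair-cong p (λ α → pair-cong r (λ β → pair-cong s (λ γ → reflexive (≡.cong (Ψ j) (⊕-assoc α β γ))))) ⟩
          pair p (λ α → pair r (λ β → pair s (λ γ → Ψ j (α ⊕ (β ⊕ γ)))))
            ≈⟨ trans (pair-* p (r *P s) _) (pair-cong p (λ α → pair-* r s _)) ⟨
          pair (p *P (r *P s)) (Ψ j) ∎

        *-identityˡ′ : ∀ p → (constP n 1# *P p) ≋ p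
        *-identityˡ′ p = mk≋ λ j → trans (pair-* (constP n 1#) p (Ψ j)) (trans (pair-1 n (λ α → pair p (λ β → Ψ j (α ⊕ β)))) (pair-cong p (unit-law j)))

        distribʳ′ : ∀ s p r → ((p ++ r) *P s) ≋ ((p *P s) ++ (r *P s))
        distribʳ′ s p r = mk≋ λ j → trans (pair-* (p ++ r) s _) (trans (pair-++ p r _)
          (sym (trans (pair-++ (p *P s) _ _) (+-cong (pair-* p s _) (pair-* r s _)))))

      -- Opaque, since terms over this ring would otherwise unfold to these proofs.
      abstract
        isCommutativeRing′ : IsCommutativeRing _≋_ _++_ _*P_ -P_ [] (constP n 1#)
        isCommutativeRing′ = record
          { isRing = record
            { +-isAbelianGroup = record
              { isGroup = record
                { isMonoid = record
                  { isSemigroup = record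
                    { isMagma = record
                      { isEquivalence = record { refl = mk≋ λ j → refl ; sym = λ e → mk≋ λ j → sym (at≋ e j) ; trans = ≋-trans }
                      ; ∙-cong = λ {p} {p′} {r} {r′} e f → mk≋ λ j → trans (pair-++ p r _) (trans (+-cong (at≋ e j) (at≋ f j)) (sym (pair-++ p′ r′ _)))
                      }
                    ; assoc = λ p r s → mk≋ λ j → trans (pair-++ (p ++ r) s _) (trans (+-congʳ (pair-++ p r _))
                        (trans (+-assoc _ _ _) (sym (trans (pair-++ p (r ++ s) _) (+-congˡ (pair-++ r s _))))))
                    }
                  ; identity = (λ p → mk≋ λ j → refl) , (λ p → mk≋ λ j → trans (pair-++ p [] _) (+-identityʳ _))
                  }
                ; inverse = (λ p → mk≋ λ j → trans (pair-++ (-P p) p _) (trans (+-congʳ (pair-neg p _)) (-‿inverseˡ _)))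
                          , (λ p → mk≋ λ j → trans (pair-++ p (-P p) _) (trans (+-congˡ (pair-neg p _)) (-‿inverseʳ _)))
                ; ⁻¹-cong = λ {p} {r} e → mk≋ λ j → trans (pair-neg p _) (trans (-‿cong (at≋ e j)) (sym (pair-neg r _)))
                }
              ; comm = λ p r → mk≋ λ j → trans (pair-++ p r _) (trans (+-comm _ _) (sym (pair-++ r p _)))
              }
            ; *-cong = λ {p} {p′} {r} {r′} e f → ≋-trans (*-congʳ′ r e) (≋-trans (*-comm′ p′ r) (≋-trans (*-congʳ′ p′ f) (*-comm′ r′ p′)))
            ; *-assoc = *-assoc′
            ; *-identity = *-identityˡ′ , (λ p → ≋-trans (*-comm′ p _) (*-identityˡ′ p))
            ; distrib = (λ s p r → ≋-trans (*-comm′ s (p ++ r)) (≋-trans (distribʳ′ s p r)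
                  (mk≋ λ j → trans (pair-++ (p *P s) _ _) (trans (+-cong (at≋ (*-comm′ p s) j) (at≋ (*-comm′ r s) j)) (sym (pair-++ (s *P p) _ _))))))
                , distribʳ′
            }
          ; *-comm = *-comm′
          }

      dualRing : CommutativeRing c (i ⊔ ℓ)
      dualRing = record
        { Carrier = Pol
        ; _≈_ = _≋_
        ; _+_ = _++_
        ; _*_ = _*P_
        ; -_ = -P_
        ; 0# = []
        ; 1# = constP n 1#
        ; isCommutativeRing = isCommutativeRing′
        }

    ind : List ℕ → Functional
    ind γ α with ≡-dec ℕ._≟_ γ α
    ... | yes _ = 1#
    ... | no _ = 0#

    ind-≡ : ∀ {γ α} → γ ≡ α → ind γ α ≈ 1#
    ind-≡ {γ} {α} e with ≡-dec ℕ._≟_ γ α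
    ... | yes _ = refl
    ... | no ne = ⊥-elim (ne e)

    ind-≢ : ∀ {γ α} → γ ≢ α → ind γ α ≈ 0#
    ind-≢ {γ} {α} ne with ≡-dec ℕ._≟_ γ α
    ... | yes e = ⊥-elim (ne e)
    ... | no _ = refl

    coeff-pair : ∀ γ p → coeff γ p ≈ pair p (ind γ)
    coeff-pair γ [] = refl
    coeff-pair γ ((a , α) ∷ p) with ≡-dec ℕ._≟_ γ α
    ... | yes _ = +-cong (sym (*-identityʳ a)) (coeff-pair γ p)
    ... | no _ = trans (coeff-pair γ p) (trans (sym (+-identityˡ _)) (+-congʳ (sym (zeroʳ a))))

    sumL-insertions : ∀ a σ (H : List ℕ → Carrier) → sumL (insertions a σ) H ≈ sumN (suc (length σ)) (λ j → H (insAt j a σ))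
    sumL-insertions a [] H = refl
    sumL-insertions a (b ∷ σ) H = +-congˡ (trans (Sum.big-map (b ∷_) (insertions a σ) H) (sumL-insertions a σ (H ∘ (b ∷_))))

    insertions-↭ : ∀ a σ → All (_↭ a ∷ σ) (insertions a σ)
    insertions-↭ a [] = Perm.refl ∷ []
    insertions-↭ a (b ∷ σ) = Perm.refl ∷ Allₚ.map⁺ (All.map (λ p → Perm.trans (Perm.prep b p) (Perm.swap b a Perm.refl)) (insertions-↭ a σ))

    concatMap⁺ : ∀ {A B : Set} {P : B → Set} (f : A → List B) {xs} → All (All P ∘ f) xs → All P (concatMap f xs)
    concatMap⁺ f ps = Allₚ.concat⁺ (Allₚ.map⁺ ps)

    perms-↭ : ∀ xs → All (_↭ xs) (perms xs)
    perms-↭ [] = Perm.refl ∷ []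
    perms-↭ (a ∷ xs) = concatMap⁺ (insertions a) (All.map (λ {σ} p → All.map (λ q → Perm.trans q (Perm.prep a p)) (insertions-↭ a σ)) (perms-↭ xs))

    sumL-perms : ∀ a xs (H : List ℕ → Carrier) → sumL (perms (a ∷ xs)) H ≈ sumN (suc (length xs)) (λ j → sumL (perms xs) (λ σ → H (insAt j a σ)))
    sumL-perms a xs H = trans (Sum.big-concatMap (insertions a) (perms xs) H)
      (trans (Sum.big-cong-All {xs = perms xs} (All.map (λ {σ} p → trans (sumL-insertions a σ H)
          (reflexive (≡.cong (λ m → sumN (suc m) (λ j → H (insAt j a σ))) (Permₚ.↭-length p)))) (perms-↭ xs)))
      (sw (suc (length xs)) λ j σ → H (insAt j a σ)))
      where
      sw : ∀ m (F : ℕ → List ℕ → Carrier) → sumL (perms xs) (λ σ → sumN m (λ j → F j σ)) ≈ sumN m (λ j → sumL (perms xs) (F j))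
      sw zero F = Sum.big-ε (perms xs) (λ _ → refl)
      sw (suc m) F = trans (Sum.big-∙ (perms xs) _ _) (+-congˡ (sw m (F ∘ suc)))

    sumL-perms-swapAt : ∀ xs k (H : List ℕ → Carrier) → suc k ℕ.< length xs → sumL (perms xs) (H ∘ swapAt k) ≈ sumL (perms xs) H
    sumL-perms-swapAt (a ∷ xs) k H (s≤s l) = trans (sumL-perms a xs (H ∘ swapAt k))
      (trans (Sum.bigN-transpose (suc (length xs)) k _ _ (s≤s l) eq≡ eqsuc other) (sym (sumL-perms a xs H)))
      where
      onPerms : ∀ {F G : List ℕ → List ℕ} → (∀ σ → length σ ≡ length xs → F σ ≡ G σ) →
        sumL (perms xs) (H ∘ F) ≈ sumL (perms xs) (H ∘ G)
      onPerms e = Sum.big-cong-All {xs = perms xs} (All.map (λ {σ} p → reflexive (≡.cong H (e σ (Permₚ.↭-length p)))) (perms-↭ xs))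
      eq≡ : sumL (perms xs) (H ∘ swapAt k ∘ insAt k a) ≈ sumL (perms xs) (H ∘ insAt (suc k) a)
      eq≡ = onPerms {swapAt k ∘ insAt k a} {insAt (suc k) a} λ σ e → swapAt-insAt-≡ k a σ (≡.subst (k ℕ.<_) (≡.sym e) l)
      eqsuc : sumL (perms xs) (H ∘ swapAt k ∘ insAt (suc k) a) ≈ sumL (perms xs) (H ∘ insAt k a)
      eqsuc = onPerms {swapAt k ∘ insAt (suc k) a} {insAt k a} λ σ e → swapAt-insAt-suc k a σ (≡.subst (k ℕ.<_) (≡.sym e) l)
      above : ∀ k j → j ≢ suc k → k ℕ.< j → suc k ℕ.< j
      above k j ne l = ℕₚ.≤∧≢⇒< l (ne ∘ ≡.sym)
      below : ∀ k j → suc k ℕ.< suc (length xs) → j ℕ.< k →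
        sumL (perms xs) (H ∘ swapAt k ∘ insAt j a) ≈ sumL (perms xs) (H ∘ insAt j a)
      below (suc k) j (s≤s l) (s≤s j≤k) = trans (onPerms {swapAt (suc k) ∘ insAt j a} {insAt j a ∘ swapAt k} λ σ e → swapAt-insAt-< j k a σ j≤k)
        (sumL-perms-swapAt xs k (H ∘ insAt j a) l)
      other : ∀ j → j ≢ k → j ≢ suc k → j ℕ.< suc (length xs) →
        sumL (perms xs) (H ∘ swapAt k ∘ insAt j a) ≈ sumL (perms xs) (H ∘ insAt j a)
      other j n1 n2 (s≤s j≤m) with ℕₚ.<-cmp j k
      ... | tri≈ _ e _ = ⊥-elim (n1 e)
      ... | tri< j<k _ _ = below k j (s≤s l) j<k
      ... | tri> _ _ k<j = trans (onPerms {swapAt k ∘ insAt j a} {insAt j a ∘ swapAt k} λ σ e →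
          swapAt-insAt-> j k a σ (above k j n2 k<j) (≡.subst (suc k ℕ.<_) (≡.sym e) (ℕₚ.<-≤-trans (above k j n2 k<j) j≤m)))
          (sumL-perms-swapAt xs k (H ∘ insAt j a) (ℕₚ.<-≤-trans (above k j n2 k<j) j≤m))

    -- alt n p is the coefficient of x₁^{n-1}⋯x_{n-1} in the antisymmetrisation of p.

    altM : ℕ → Functional
    altM n α = sumL (perms (upTo n)) (λ σ → sgn σ * ind (downFrom n) (actL n σ α))

    Unique⇒at≢ : ∀ k σ → Unique σ → suc k ℕ.< length σ → at σ k ≢ at σ (suc k)
    Unique⇒at≢ zero (a ∷ b ∷ σ) ((ne ∷ _) ∷ _) _ = ne
    Unique⇒at≢ zero (a ∷ []) _ (s≤s ())
    Unique⇒at≢ (suc k) (a ∷ σ) (_ ∷ u) (s≤s l) = Unique⇒at≢ k σ u l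

    upTo-unique : ∀ n → Unique (upTo n)
    upTo-unique n = Uniqueₚ.upTo⁺ n

    sgn-swapAt : ∀ k σ → Unique σ → suc k ℕ.< length σ → sgn (swapAt k σ) ≈ - sgn σ
    sgn-swapAt k σ u l with ℕₚ.<-cmp (at σ k) (at σ (suc k))
    ... | tri≈ _ e _ = ⊥-elim (Unique⇒at≢ k σ u l e)
    ... | tri< lt _ _ = trans (reflexive (≡.cong (pow (- 1#)) (len-swapAt-ascent k σ l lt)))
          (solve 1 (λ x → (:- :1) :* x := :- x) refl _)
    ... | tri> _ _ gt = trans (solve 1 (λ x → x := :- ((:- :1) :* x)) refl _)
          (-‿cong (reflexive (≡.cong (pow (- 1#)) (≡.sym (len-swapAt-descent k σ l gt)))))

    altM-swapAt : ∀ n k α → length α ≡ n → suc k ℕ.< n → altM n (swapAt k α) ≈ - altM n α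
    altM-swapAt n k α e l = begin
      sumL (perms (upTo n)) (λ σ → sgn σ * ind δ (actL n σ (swapAt k α)))
        ≈⟨ Sum.big-cong-All {xs = perms (upTo n)} (All.map (λ {σ} p → termwise σ p) (perms-↭ (upTo n))) ⟩
      sumL (perms (upTo n)) (λ σ → - (sgn (swapAt k σ) * ind δ (actL n (swapAt k σ) α)))
        ≈⟨ sumL-- (perms (upTo n)) _ ⟨
      - sumL (perms (upTo n)) (λ σ → sgn (swapAt k σ) * ind δ (actL n (swapAt k σ) α))
        ≈⟨ -‿cong (sumL-perms-swapAt (upTo n) k (λ σ → sgn σ * ind δ (actL n σ α)) (≡.subst (suc k ℕ.<_) (≡.sym (length-upTo n)) l)) ⟩
      - altM n α ∎
      where
      δ : List ℕ
      δ = downFrom n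
      termwise : ∀ σ → σ ↭ upTo n → sgn σ * ind δ (actL n σ (swapAt k α)) ≈ - (sgn (swapAt k σ) * ind δ (actL n (swapAt k σ) α))
      termwise σ p = trans (*-cong (trans (sym (-‿involutive _)) (-‿cong (sym (sgn-swapAt k σ uσ lσ))))
          (reflexive (≡.cong (ind δ) (map-cong (λ v → at-swap-indexOf k v σ α (≡.trans eσ (≡.sym e)) (Unique⇒at≢ k σ uσ lσ) lσ) (upTo n)))))
          (sym (-‿distribˡ-* _ _))
        where
        eσ : length σ ≡ n
        eσ = ≡.trans (Permₚ.↭-length p) (length-upTo n)
        uσ : Unique σ
        uσ = Unique-resp-↭ (Perm.↭-sym p) (upTo-unique n)
        lσ : suc k ℕ.< length σ
        lσ = ≡.subst (suc k ℕ.<_) (≡.sym eσ) l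

    pair-actP : ∀ n σ p ψ → pair (actP n σ p) ψ ≈ pair p (ψ ∘ actL n σ)
    pair-actP n σ [] ψ = refl
    pair-actP n σ ((a , α) ∷ p) ψ = +-congˡ (pair-actP n σ p ψ)

    pair-sumP : ∀ ps ψ → pair (sumP ps) ψ ≈ sumL ps (λ p → pair p ψ)
    pair-sumP [] ψ = refl
    pair-sumP (p ∷ ps) ψ = trans (pair-++ p _ ψ) (+-congˡ (pair-sumP ps ψ))

    pair-antisym : ∀ n g → pair (antisym n g) (ind (downFrom n)) ≈ pair g (altM n)
    pair-antisym n g = begin
      pair (antisym n g) ψ ≈⟨ trans (pair-sumP (map F (perms (upTo n))) ψ) (Sum.big-map F (perms (upTo n)) (λ p → pair p ψ)) ⟩
      sumL (perms (upTo n)) (λ σ → pair (scaleP (sgn σ) (actP n σ g)) ψ)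
        ≈⟨ Sum.big-cong (perms (upTo n)) (λ σ → trans (pair-scale (sgn σ) (actP n σ g) ψ) (trans (*-congˡ (pair-actP n σ g ψ)) (sym (pair-*ʳ g _ _)))) ⟩
      sumL (perms (upTo n)) (λ σ → pair g (λ α → sgn σ * ψ (actL n σ α))) ≈⟨ pair-sumL g (perms (upTo n)) _ ⟨
      pair g (altM n) ∎
      where
      ψ : Functional
      ψ = ind (downFrom n)
      F : List ℕ → Pol
      F σ = scaleP (sgn σ) (actP n σ g)

    pair-quoP : ∀ i j p ψ → pair (quoP i j p) ψ ≈ pair p (λ α → sumN (at α i) (λ m → ψ (quoM i j α m)))
    pair-quoP i j [] ψ = refl
    pair-quoP i j ((a , α) ∷ p) ψ = trans (go (at α i) id) (+-congˡ (pair-quoP i j p ψ))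
      where
      go : ∀ k (h : ℕ → ℕ) → pair (map (λ m → (a , setAt i m (setAt j (at α j ℕ.+ (at α i ℕ.∸ 1 ℕ.∸ m)) α))) (applyUpTo h k) ++ quoP i j p) ψ
         ≈ a * sumN k (λ m → ψ (quoM i j α (h m))) + pair (quoP i j p) ψ
      go zero h = sym (trans (+-congʳ (zeroʳ a)) (+-identityˡ _))
      go (suc k) h = trans (+-congˡ (go k (h ∘ suc))) (trans (sym (+-assoc _ _ _)) (+-congʳ (sym (distribˡ a _ _))))

    quoP-coeff : ∀ i j n β p → Terms (λ α → length α ≡ n) p → i ≢ j → i ℕ.< n → j ℕ.< n → length β ≡ n → at β j ≡ 0 →
      pair (quoP i j p) (ind β) ≈ pair p (ind (suc-setAt i β))
    quoP-coeff i j n β p w i≢j i<n j<n lβ βj = trans (pair-quoP i j p (ind β)) (pair-congᵀ w term)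
      where
      term : ∀ α → length α ≡ n → sumN (at α i) (λ m → ind β (quoM i j α m)) ≈ ind (suc-setAt i β) α
      term α lα with ≡-dec ℕ._≟_ (suc-setAt i β) α
      ... | yes ≡.refl = trans (Sum.bigN-single (at α′ i) (at β i) (λ m → ind β (quoM i j α′ m))
              (≡.subst (at β i ℕ.<_) (≡.sym ai) ℕₚ.≤-refl)
              (λ m _ ne → ind-≢ {β} {quoM i j α′ m} λ e → ne (≡.trans (≡.sym (at-setAt i m (γ m) (≡.subst (i ℕ.<_) (≡.sym (≡.trans (length-setAt j _ α′) lα)) i<n))) (≡.cong (λ z → at z i) (≡.sym e)))))
            (ind-≡ {β} (≡.sym (quoM-top i j β i≢j βj (≡.subst (i ℕ.<_) (≡.sym lβ) i<n))))
        where
        α′ : List ℕ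
        α′ = suc-setAt i β
        γ : ℕ → List ℕ
        γ m = setAt j (at α′ j ℕ.+ (at α′ i ℕ.∸ 1 ℕ.∸ m)) α′
        ai : at α′ i ≡ suc (at β i)
        ai = at-setAt i _ β (≡.subst (i ℕ.<_) (≡.sym lβ) i<n)
      ... | no ne = Sum.bigN-ε (at α i) λ m m<a → ind-≢ {β} {quoM i j α m} λ e → ne (≡.sym (quoM-inv i j α β m i≢j (≡.subst (i ℕ.<_) (≡.sym lα) i<n) (≡.subst (j ℕ.<_) (≡.sym lα) j<n) m<a βj e))

    Homog : ℕ → ℕ → Pol → Set c
    Homog n d = Terms (λ α → length α ≡ n × sum α ≡ d)

    Homog-quoP : ∀ i j n d p → i ≢ j → i ℕ.< n → j ℕ.< n → Homog n (suc d) p → Homog n d (quoP i j p)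
    Homog-quoP i j n d [] i≢j i<n j<n [] = []
    Homog-quoP i j n d ((a , α) ∷ p) i≢j i<n j<n ((lα , sα) ∷ w) = Allₚ.++⁺ (go (at α i) id (λ m l → l)) (Homog-quoP i j n d p i≢j i<n j<n w)
      where
      go : ∀ k (h : ℕ → ℕ) → (∀ m → m ℕ.< k → h m ℕ.< at α i) →
        Homog n d (map (λ m → (a , setAt i m (setAt j (at α j ℕ.+ (at α i ℕ.∸ 1 ℕ.∸ m)) α))) (applyUpTo h k))
      go zero h b = []
      go (suc k) h b = (≡.trans (length-quoM i j α (h 0)) lα
          , ℕₚ.suc-injective (≡.trans (sum-quoM i j α (h 0) i≢j (≡.subst (i ℕ.<_) (≡.sym lα) i<n) (≡.subst (j ℕ.<_) (≡.sym lα) j<n) (b 0 (s≤s z≤n))) sα))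
        ∷ go k (h ∘ suc) (λ m l → b (suc m) (s≤s l))

    map-at-indexOf : ∀ σ α → Unique σ → length σ ≡ length α → map (λ k → at α (indexOf k σ)) σ ≡ α
    map-at-indexOf [] [] _ _ = ≡.refl
    map-at-indexOf (a ∷ σ) (x ∷ α) (ne ∷ u) e rewrite ≡ᵇ-true a =
      ≡.cong (x ∷_) (≡.trans (map-cong-local (All.map (λ {k} n → ≡.cong (λ b → at (x ∷ α) (if b then 0 else suc (indexOf k σ))) (≡ᵇ-false (n ∘ ≡.sym))) ne))
        (map-at-indexOf σ α u (ℕₚ.suc-injective e)))

    actL-↭ : ∀ n σ α → σ ↭ upTo n → length α ≡ n → actL n σ α ↭ α
    actL-↭ n σ α p lα = Perm.trans (Permₚ.map⁺ (λ k → at α (indexOf k σ)) (Perm.↭-sym p))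
      (Perm.↭-reflexive (map-at-indexOf σ α (Unique-resp-↭ (Perm.↭-sym p) (upTo-unique n))
        (≡.trans (Permₚ.↭-length p) (≡.trans (length-upTo n) (≡.sym lα)))))

    sum-⊕ : ∀ α β → length α ≡ length β → sum (α ⊕ β) ≡ sum α ℕ.+ sum β
    sum-⊕ [] [] _ = ≡.refl
    sum-⊕ (a ∷ α) (b ∷ β) e = ≡.trans (≡.cong (a ℕ.+ b ℕ.+_) (sum-⊕ α β (ℕₚ.suc-injective e))) (Nat.interchange a b (sum α) (sum β))

    length-⊕ : ∀ {n} α β → length α ≡ n → length β ≡ n → length (α ⊕ β) ≡ n
    length-⊕ α β ≡.refl e = ≡.trans (length-zipWith ℕ._+_ α β) (≡.trans (≡.cong (length α ℕ.⊓_) e) (ℕₚ.⊓-idem _))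

    Homog-*P : ∀ {n d e} p r → Homog n d p → Homog n e r → Homog n (d ℕ.+ e) (p *P r)
    Homog-*P [] r [] hr = []
    Homog-*P {n} {d} {e} ((a , α) ∷ p) r ((lα , sα) ∷ hp) hr = Allₚ.++⁺ (go r hr) (Homog-*P p r hp hr)
      where
      go : ∀ s → Homog n e s → Homog n (d ℕ.+ e) (map (λ { (b , β) → (a * b , zipWith ℕ._+_ α β) }) s)
      go [] [] = []
      go ((b , β) ∷ s) ((lβ , sβ) ∷ hs) = (length-⊕ α β lα lβ , ≡.trans (sum-⊕ α β (≡.trans lα (≡.sym lβ))) (≡.cong₂ ℕ._+_ sα sβ)) ∷ go s hs

    Terms-scaleP : ∀ {P a p} → Terms P p → Terms P (scaleP a p)
    Terms-scaleP {p = []} [] = []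
    Terms-scaleP {p = (b , β) ∷ p} (w ∷ ws) = w ∷ Terms-scaleP ws

    Terms--P : ∀ {P p} → Terms P p → Terms P (-P p)
    Terms--P {p = []} [] = []
    Terms--P {p = (b , β) ∷ p} (w ∷ ws) = w ∷ Terms--P ws

    sum-varP : ∀ n i → i ℕ.< n → sum (map (λ k → if k ≡ᵇ i then 1 else 0) (upTo n)) ≡ 1
    sum-varP n i i<n = ≡.trans (sum-map-upTo n _) (≡.trans (Nat.bigN-single n i _ i<n (λ k _ ne → ≡.cong (if_then 1 else 0) (≡ᵇ-false ne)))
      (≡.cong (if_then 1 else 0) (≡ᵇ-true i)))

    Homog-varP : ∀ n i → i ℕ.< n → Homog n 1 (varP n i)
    Homog-varP n i i<n = (≡.trans (length-map _ (upTo n)) (length-upTo n) , sum-varP n i i<n) ∷ []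

    sum-replicate-0 : ∀ n → sum (replicate n 0) ≡ 0
    sum-replicate-0 zero = ≡.refl
    sum-replicate-0 (suc n) = sum-replicate-0 n

    farFactor : ℕ → Carrier → ℕ → ℕ → Pol
    farFactor n q i j = scaleP q (varP n i) +P (-P varP n j)

    Homog-farFactor : ∀ n q i j → i ℕ.< n → j ℕ.< n → Homog n 1 (farFactor n q i j)
    Homog-farFactor n q i j i<n j<n = Allₚ.++⁺ (Terms-scaleP (Homog-varP n i i<n)) (Terms--P (Homog-varP n j j<n))

    farProd : ℕ → Carrier → Pol
    farProd n q = prodP n (map (λ { (i , j) → scaleP q (varP n i) +P (-P varP n j) }) (farPairs n))

    Homog-prodP : ∀ n ps → All (Homog n 1) ps → Homog n (length ps) (prodP n ps)
    Homog-prodP n [] [] = (length-replicate n , sum-replicate-0 n) ∷ []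
    Homog-prodP n (p ∷ ps) (h ∷ hs) = Homog-*P p (prodP n ps) h (Homog-prodP n ps hs)

    InRange : ℕ → ℕ × ℕ → Set
    InRange n (i , j) = i ℕ.< j × j ℕ.< n

    upTo-< : ∀ n → All (ℕ._< n) (upTo n)
    upTo-< n = Allₚ.applyUpTo⁺₁ id n id

    pairs-InRange : ∀ n → All (InRange n) (pairs n)
    pairs-InRange n = concatMap⁺ (λ j → map (λ i → (i , j)) (upTo j)) (All.map (λ {j} j<n → Allₚ.map⁺ (All.map (λ i<j → i<j , j<n) (upTo-< j))) (upTo-< n))

    farPairs-InRange : ∀ n → All (InRange n) (farPairs n)
    farPairs-InRange n = concatMap⁺ (λ j → map (λ i → (i , j)) (upTo (j ℕ.∸ 1)))
      (All.map (λ {j} j<n → Allₚ.map⁺ (All.map (λ i<j → ℕₚ.<-≤-trans i<j (ℕₚ.m∸n≤m j 1) , j<n) (upTo-< (j ℕ.∸ 1)))) (upTo-< n))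

    Homog-farProd : ∀ n q → Homog n (length (farPairs n)) (farProd n q)
    Homog-farProd n q = ≡.subst (λ k → Homog n k (farProd n q)) (length-map _ (farPairs n))
      (Homog-prodP n _ (Allₚ.map⁺ (All.map (λ {ij} (i<j , j<n) → Homog-farFactor n q (proj₁ ij) (proj₂ ij) (ℕₚ.<-trans i<j j<n) j<n) (farPairs-InRange n))))

    Homog-antisym : ∀ n d g → Homog n d g → Homog n d (antisym n g)
    Homog-antisym n d g hg = go (perms (upTo n)) (perms-↭ (upTo n))
      where
      act : ∀ σ → σ ↭ upTo n → ∀ g → Homog n d g → Homog n d (actP n σ g)
      act σ p [] [] = []
      act σ p ((a , α) ∷ g) ((lα , sα) ∷ h) = (≡.trans (length-map _ (upTo n)) (length-upTo n) , ≡.trans (sum-↭ (actL-↭ n σ α p lα)) sα) ∷ act σ p g h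
      go : ∀ σs → All (_↭ upTo n) σs → Homog n d (sumP (map (λ σ → scaleP (sgn σ) (actP n σ g)) σs))
      go [] [] = []
      go (σ ∷ σs) (p ∷ ps) = Allₚ.++⁺ (Terms-scaleP (act σ p g hg)) (go σs ps)

    quoStep : ℕ × ℕ → Pol → Pol
    quoStep (i , j) p = quoP i j p

    WF : ℕ → Pol → Set c
    WF n = Terms (λ α → length α ≡ n)

    Homog⇒WF : ∀ {n d p} → Homog n d p → WF n p
    Homog⇒WF = All.map proj₁

    WF-quoP : ∀ i j n p → WF n p → WF n (quoP i j p)
    WF-quoP i j n [] [] = []
    WF-quoP i j n ((a , α) ∷ p) (lα ∷ w) = Allₚ.++⁺ (Allₚ.map⁺ (All.universal (λ m → ≡.trans (length-quoM i j α m) lα) (upTo (at α i)))) (WF-quoP i j n p w)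

    WF-quoSteps : ∀ n L G → WF n G → WF n (foldr quoStep G L)
    WF-quoSteps n [] G w = w
    WF-quoSteps n ((i , j) ∷ L) G w = WF-quoP i j n _ (WF-quoSteps n L G w)

    Homog-quoSteps : ∀ n d L G → All (InRange n) L → Homog n (length L ℕ.+ d) G → Homog n d (foldr quoStep G L)
    Homog-quoSteps n d [] G [] h = h
    Homog-quoSteps n d ((i , j) ∷ L) G ((i<j , j<n) ∷ r) h = Homog-quoP i j n d _ (ℕₚ.<⇒≢ i<j) (ℕₚ.<-trans i<j j<n) j<n
      (Homog-quoSteps n (suc d) L G r (≡.subst (λ k → Homog n k G) (≡.sym (ℕₚ.+-suc (length L) d)) h))

    block-coeff : ∀ n j r s f P M Z G → WF n G → (∀ i → f i ≡ s ℕ.+ i) → length P ≡ s → length M ≡ r → s ℕ.+ r ≡ j →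
      length (P ++ M ++ 0 ∷ Z) ≡ n →
      pair (foldr quoStep G (map (λ i → (i , j)) (applyUpTo f r))) (ind (P ++ M ++ 0 ∷ Z)) ≈ pair G (ind (P ++ map suc M ++ 0 ∷ Z))
    block-coeff n j zero s f P [] Z G w fe ≡.refl lM e lβ = refl
    block-coeff n j (suc r) s f P (m ∷ M) Z G w fe ≡.refl lM ≡.refl lβ = begin
      pair (quoP (f 0) j rest) (ind β) ≈⟨ reflexive (≡.cong (λ i → pair (quoP i j rest) (ind β)) (≡.trans (fe 0) (ℕₚ.+-identityʳ s))) ⟩
      pair (quoP s j rest) (ind β) ≈⟨ quoP-coeff s j n β rest (WF-quoSteps n (map (λ i → (i , j)) (applyUpTo (f ∘ suc) r)) G w) (ℕₚ.<⇒≢ s<j) (ℕₚ.<-trans s<j j<n) j<n lβ βj ⟩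
      pair rest (ind (suc-setAt s β)) ≈⟨ reflexive (≡.cong (pair rest ∘ ind) β′) ⟩
      pair rest (ind ((P ++ suc m ∷ []) ++ M ++ 0 ∷ Z))
        ≈⟨ block-coeff n j r (suc s) (f ∘ suc) (P ++ suc m ∷ []) M Z G w (λ i → ≡.trans (fe (suc i)) (ℕₚ.+-suc s i))
            (≡.trans (length-++ P) (ℕₚ.+-comm s 1)) (ℕₚ.suc-injective lM) (≡.sym (ℕₚ.+-suc s r))
            (≡.trans (≡.cong length (≡.sym β′)) (≡.trans (length-setAt s _ β) lβ)) ⟩
      pair G (ind ((P ++ suc m ∷ []) ++ map suc M ++ 0 ∷ Z)) ≈⟨ reflexive (≡.cong (pair G ∘ ind) (++-assoc P (suc m ∷ []) _)) ⟩
      pair G (ind (P ++ suc m ∷ map suc M ++ 0 ∷ Z)) ∎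
      where
      rest : Pol
      rest = foldr quoStep G (map (λ i → (i , j)) (applyUpTo (f ∘ suc) r))
      β : List ℕ
      β = P ++ m ∷ M ++ 0 ∷ Z
      s<j : s ℕ.< j
      s<j = ℕₚ.m<m+n s (s≤s z≤n)
      splitβ : (P ++ m ∷ M) ++ 0 ∷ Z ≡ β
      splitβ = ++-assoc P (m ∷ M) (0 ∷ Z)
      lPM : length (P ++ m ∷ M) ≡ j
      lPM = ≡.trans (length-++ P) (≡.cong (s ℕ.+_) lM)
      j<n : j ℕ.< n
      j<n = ≡.subst₂ ℕ._<_ lPM (≡.trans (≡.sym (length-++ (P ++ m ∷ M))) (≡.trans (≡.cong length splitβ) lβ)) (ℕₚ.m<m+n _ (s≤s z≤n))
      βj : at β j ≡ 0
      βj = ≡.subst₂ (λ z k → at z k ≡ 0) splitβ lPM (at-++ (P ++ m ∷ M) 0 Z)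
      β′ : suc-setAt s β ≡ (P ++ suc m ∷ []) ++ M ++ 0 ∷ Z
      β′ = ≡.trans (≡.cong (λ z → setAt s (suc z) β) (at-++ P m _)) (≡.trans (setAt-++ P m _ (suc m)) (≡.sym (++-assoc P (suc m ∷ []) _)))

    blocks-coeff : ∀ n k j f G → WF n G → (∀ i → f i ≡ j ℕ.+ i) → j ℕ.+ k ≡ n →
      pair (foldr quoStep G (concatMap (λ j → map (λ i → (i , j)) (upTo j)) (applyUpTo f k))) (ind (downFrom j ++ replicate k 0)) ≈ pair G (ind (downFrom n))
    blocks-coeff n zero j f G w fe e = reflexive (≡.cong (pair G ∘ ind) (≡.trans (++-identityʳ _) (≡.cong downFrom (≡.trans (≡.sym (ℕₚ.+-identityʳ j)) e))))
    blocks-coeff n (suc k) j f G w fe e = begin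
      pair (foldr quoStep G (blk (f 0) ++ rest)) (ind β)
        ≈⟨ reflexive (≡.cong (λ z → pair z (ind β)) (≡.trans (≡.cong (λ i → foldr quoStep G (blk i ++ rest)) (≡.trans (fe 0) (ℕₚ.+-identityʳ j))) (foldr-++ quoStep G (blk j) rest))) ⟩
      pair (foldr quoStep (foldr quoStep G rest) (blk j)) (ind β)
        ≈⟨ block-coeff n j j 0 id [] (downFrom j) (replicate k 0) _ (WF-quoSteps n rest G w) (λ i → ≡.refl) ≡.refl (length-downFrom j) ≡.refl
            (≡.trans (length-++ (downFrom j)) (≡.trans (≡.cong₂ ℕ._+_ (length-downFrom j) (length-replicate (suc k))) e)) ⟩
      pair (foldr quoStep G rest) (ind (map suc (downFrom j) ++ 0 ∷ replicate k 0))
        ≈⟨ reflexive (≡.cong (pair (foldr quoStep G rest) ∘ ind) (≡.trans (≡.sym (++-assoc (map suc (downFrom j)) (0 ∷ []) _)) (≡.cong (_++ replicate k 0) (map-suc-downFrom j)))) ⟩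
      pair (foldr quoStep G rest) (ind (downFrom (suc j) ++ replicate k 0))
        ≈⟨ blocks-coeff n k (suc j) (f ∘ suc) G w (λ i → ≡.trans (fe (suc i)) (ℕₚ.+-suc j i)) (≡.trans (≡.sym (ℕₚ.+-suc j k)) e) ⟩
      pair G (ind (downFrom n)) ∎
      where
      blk : ℕ → List (ℕ × ℕ)
      blk j = map (λ i → (i , j)) (upTo j)
      rest : List (ℕ × ℕ)
      rest = concatMap blk (applyUpTo (f ∘ suc) k)
      β : List ℕ
      β = downFrom j ++ replicate (suc k) 0

    foldr-quoStep : ∀ (f : ℕ × ℕ → Pol → Pol) → (∀ i j p → f (i , j) p ≡ quoP i j p) → ∀ G L → foldr f G L ≡ foldr quoStep G L
    foldr-quoStep f e G [] = ≡.refl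
    foldr-quoStep f e G ((i , j) ∷ L) = ≡.trans (e i j _) (≡.cong (quoP i j) (foldr-quoStep f e G L))

    sum≡0⇒replicate : ∀ n α → length α ≡ n → sum α ≡ 0 → α ≡ replicate n 0
    sum≡0⇒replicate zero [] _ _ = ≡.refl
    sum≡0⇒replicate (suc n) (zero ∷ α) l s = ≡.cong (0 ∷_) (sum≡0⇒replicate n α (ℕₚ.suc-injective l) s)

    bracket-const : ∀ m q f → Homog (suc m) m f →
      bracket (suc m) q f ≈P constP (suc m) (pair (f *P farProd (suc m) q) (altM (suc m)))
    bracket-const m q f hf γ = trans (coeff-pair γ (∂w₀ n g)) (trans (trans (reflexive (≡.cong (λ z → pair z (ind γ)) (foldr-quoStep _ (λ i j p → ≡.refl) (antisym n g) (pairs n))))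
      (main (≡-dec ℕ._≟_ γ (replicate n 0)))) (sym (coeff-pair γ (constP n (pair g (altM n))))))
      where
      n : ℕ
      n = suc m
      g C : Pol
      g = f *P farProd n q
      C = foldr quoStep (antisym n g) (pairs n)
      hA : Homog n (length (pairs n) ℕ.+ 0) (antisym n g)
      hA = ≡.subst (λ k → Homog n k (antisym n g)) (≡.trans (≡.sym (length-pairs m)) (≡.sym (ℕₚ.+-identityʳ _)))
        (Homog-antisym n _ g (Homog-*P f (farProd n q) hf (Homog-farProd n q)))
      hC : Homog n 0 C
      hC = Homog-quoSteps n 0 (pairs n) _ (pairs-InRange n) hA
      main : Dec (γ ≡ replicate n 0) → pair C (ind γ) ≈ pair (constP n (pair g (altM n))) (ind γ)
      main (yes ≡.refl) = trans (blocks-coeff n n 0 id (antisym n g) (Homog⇒WF hA) (λ i → ≡.refl) ≡.refl)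
            (trans (pair-antisym n g) (sym (trans (+-identityʳ _) (trans (*-congˡ (ind-≡ {γ} ≡.refl)) (*-identityʳ _)))))
      main (no ne) = trans (pair-0ᵀ hC λ α (l , s) → ind-≢ λ e → ne (≡.trans e (sum≡0⇒replicate n α l s)))
            (sym (trans (+-identityʳ _) (trans (*-congˡ (ind-≢ ne)) (zeroʳ _))))

  open Functionals

  module Universal (n : ℕ) where
    open CommutativeRing R
    open Poly R

    Ψᵀ : Functional → Functional
    Ψᵀ ψ α = ψ (take n α)

    actᵀ : Functional → List ℕ → Functional
    actᵀ ψ β α = ψ (take n (β ⊕ α))

    abstract
      act-lawᵀ : ∀ ψ β α → Ψᵀ (actᵀ ψ β) α ≈ Ψᵀ ψ (β ⊕ α)
      act-lawᵀ ψ β α = reflexive (≡.cong ψ (take-⊕ˡ n β α))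

      unit-lawᵀ : ∀ ψ α → Ψᵀ ψ (replicate n 0 ⊕ α) ≈ Ψᵀ ψ α
      unit-lawᵀ ψ α = reflexive (≡.cong ψ (≡.trans (≡.cong (take n) (replicate-⊕ n α)) (take-idem n α)))

    open DualRing n Functional Ψᵀ actᵀ act-lawᵀ unit-lawᵀ public
      renaming (dualRing to T)

    -- T identifies two polynomials iff they agree under every functional that reads n exponents.
    module T = CommutativeRing T
    module TT = RingTools T

    ≋⇒pair : ∀ {p r} (ψ : Functional) → (∀ α → ψ α ≈ ψ (take n α)) → p ≋ r → pair p ψ ≈ pair r ψ
    ≋⇒pair {p} {r} ψ e p≋r = trans (pair-cong p e) (trans (at≋ p≋r ψ) (sym (pair-cong r e)))

    ≋⇒pairᵂ : ∀ {p r} (ψ : Functional) → WF n p → WF n r → p ≋ r → pair p ψ ≈ pair r ψ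
    ≋⇒pairᵂ {p} {r} ψ wp wr p≋r = trans (pair-congᵀ wp e) (trans (at≋ p≋r ψ) (sym (pair-congᵀ wr e)))
      where
      e : ∀ α → length α ≡ n → ψ α ≈ ψ (take n α)
      e α l = reflexive (≡.cong ψ (≡.sym (take-all n α (ℕₚ.≤-reflexive l))))

    pair-swapVars : ∀ k p ψ → pair (swapVars k p) ψ ≈ pair p (ψ ∘ swapAt k)
    pair-swapVars k [] ψ = refl
    pair-swapVars k ((a , α) ∷ p) ψ = +-congˡ (pair-swapVars k p ψ)

    WF-swapVars : ∀ k p → WF n p → WF n (swapVars k p)
    WF-swapVars k [] [] = []
    WF-swapVars k ((a , α) ∷ p) (e ∷ w) = ≡.trans (length-swapAt k α) e ∷ WF-swapVars k p w

    WF-* : ∀ p r → WF n p → WF n r → WF n (p *P r)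
    WF-* [] r [] wr = []
    WF-* ((a , α) ∷ p) r (lα ∷ wp) wr = Allₚ.++⁺ (go r wr) (WF-* p r wp wr)
      where
      go : ∀ s → WF n s → WF n (map (λ { (b , β) → (a * b , zipWith ℕ._+_ α β) }) s)
      go [] [] = []
      go ((b , β) ∷ s) (lβ ∷ ws) = length-⊕ α β lα lβ ∷ go s ws

    WF-1 : WF n (constP n 1#)
    WF-1 = length-replicate n ∷ []

    WF-var : ∀ i → WF n (varP n i)
    WF-var i = length-unitVec n i ∷ []

    WF-prodN : ∀ m (f : ℕ → Pol) → (∀ i → WF n (f i)) → WF n (TT.prodN m f)
    WF-prodN zero f w = WF-1
    WF-prodN (suc m) f w = WF-* (f 0) _ (w 0) (WF-prodN m (f ∘ suc) (w ∘ suc))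

    WF-sumN : ∀ m (f : ℕ → Pol) → (∀ i → WF n (f i)) → WF n (TT.sumN m f)
    WF-sumN zero f w = []
    WF-sumN (suc m) f w = Allₚ.++⁺ (w 0) (WF-sumN m (f ∘ suc) (w ∘ suc))

    module _ (k : ℕ) (k<n : suc k ℕ.< n) where
      swapVars-cong : ∀ {p r} → p ≋ r → swapVars k p ≋ swapVars k r
      swapVars-cong {p} {r} p≋r = mk≋ λ ψ → trans (pair-swapVars k p _) (trans (≋⇒pair (λ α → ψ (take n (swapAt k α)))
          (λ α → reflexive (≡.cong ψ (≡.trans (take-swapAt k n α k<n) (≡.trans (≡.cong (swapAt k) (≡.sym (take-idem n α)))
             (≡.trans (≡.sym (take-swapAt k n (take n α) k<n)) ≡.refl))))) p≋r) (sym (pair-swapVars k r _)))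

      swapVars-* : ∀ p r → WF n p → WF n r → swapVars k (p *P r) ≋ swapVars k p *P swapVars k r
      swapVars-* p r wp wr = mk≋ λ ψ → trans (pair-swapVars k (p *P r) (Ψᵀ ψ)) (trans (pair-* p r _)
        (trans (pair-congᵀ wp (λ α lα → pair-congᵀ wr (λ β lβ → reflexive (≡.cong (Ψᵀ ψ) (swapAt-⊕ k α β (≡.trans lα (≡.sym lβ)))))))
        (sym (trans (pair-* (swapVars k p) (swapVars k r) (Ψᵀ ψ)) (trans (pair-swapVars k p _) (pair-cong p (λ α → pair-swapVars k r _)))))))

      swapVars-++ : ∀ p r → swapVars k (p ++ r) ≡ swapVars k p ++ swapVars k r
      swapVars-++ p r = map-++ _ p r

      swapVars-neg : ∀ p → swapVars k (-P p) ≡ -P (swapVars k p)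
      swapVars-neg [] = ≡.refl
      swapVars-neg ((a , α) ∷ p) = ≡.cong (_ ∷_) (swapVars-neg p)

      swapVars-scale : ∀ a p → swapVars k (scaleP a p) ≡ scaleP a (swapVars k p)
      swapVars-scale a [] = ≡.refl
      swapVars-scale a ((b , β) ∷ p) = ≡.cong (_ ∷_) (swapVars-scale a p)

      swapVars-var : ∀ i → swapVars k (varP n i) ≡ varP n (transpose k i)
      swapVars-var i = ≡.cong (λ z → (1# , z) ∷ []) (swapAt-unitVec n k i k<n)

      swapVars-1 : swapVars k (constP n 1#) ≡ constP n 1#
      swapVars-1 = ≡.cong (λ z → (1# , z) ∷ []) (swapAt-replicate k n)

      swapVars-involutive : ∀ p → swapVars k (swapVars k p) ≡ p
      swapVars-involutive [] = ≡.refl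
      swapVars-involutive ((a , α) ∷ p) = ≡.cong₂ _∷_ (≡.cong (a ,_) (swapAt-involutive k α)) (swapVars-involutive p)

      swapVars-prodN : ∀ m (f : ℕ → Pol) → (∀ i → WF n (f i)) → swapVars k (TT.prodN m f) ≋ TT.prodN m (swapVars k ∘ f)
      swapVars-prodN zero f w = T.reflexive swapVars-1
      swapVars-prodN (suc m) f w = T.trans (swapVars-* (f 0) _ (w 0) (WF-prodN m (f ∘ suc) (w ∘ suc))) (T.*-congˡ {swapVars k (f 0)} (swapVars-prodN m (f ∘ suc) (w ∘ suc)))

      swapVars-sumN : ∀ m (f : ℕ → Pol) → swapVars k (TT.sumN m f) ≡ TT.sumN m (swapVars k ∘ f)
      swapVars-sumN zero f = ≡.refl
      swapVars-sumN (suc m) f = ≡.trans (swapVars-++ (f 0) _) (≡.cong (swapVars k (f 0) ++_) (swapVars-sumN m (f ∘ suc)))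

    u : ℕ → Pol
    u i = TT.sumN i (varP n)

    module Cut (q : Carrier) where
      F : ℕ → ℕ → Pol
      F = farFactor n q

      WF-F : ∀ i j → WF n (F i j)
      WF-F i j = Allₚ.++⁺ (Terms-scaleP (WF-var i)) (Terms--P (WF-var j))

      cross : ℕ → ℕ → Pol
      cross i m = TT.prodN i (λ a → TT.prodN m (λ b → F a (i ℕ.+ b)))

      cutPoly : ℕ → ℕ → Pol
      cutPoly i m = u i *P cross i m

      WF-u : ∀ i → WF n (u i)
      WF-u i = WF-sumN i (varP n) WF-var

      WF-row : ∀ i m a → WF n (TT.prodN m (λ b → F a (i ℕ.+ b)))
      WF-row i m a = WF-prodN m _ (λ b → WF-F a (i ℕ.+ b))

      WF-cross : ∀ i m → WF n (cross i m)
      WF-cross i m = WF-prodN i _ (WF-row i m)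

      WF-cutPoly : ∀ i m → WF n (cutPoly i m)
      WF-cutPoly i m = WF-* (u i) (cross i m) (WF-u i) (WF-cross i m)

      module _ (k : ℕ) (k<n : suc k ℕ.< n) where
        swapVars-F : ∀ i j → swapVars k (F i j) ≡ F (transpose k i) (transpose k j)
        swapVars-F i j = ≡.trans (swapVars-++ k k<n (scaleP q (varP n i)) (-P varP n j)) (≡.cong₂ _++_
          (≡.trans (swapVars-scale k k<n q (varP n i)) (≡.cong (scaleP q) (swapVars-var k k<n i)))
          (≡.trans (swapVars-neg k k<n (varP n j)) (≡.cong -P_ (swapVars-var k k<n j))))

        swapVars-cutPoly : ∀ i m → (∀ {f g : ℕ → Pol} → (∀ a → f a ≋ g (transpose k a)) → TT.prodN i f ≋ TT.prodN i g) →
          (∀ {f g : ℕ → Pol} → (∀ a → f a ≋ g (transpose k a)) → TT.sumN i f ≋ TT.sumN i g) →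
          (∀ a → TT.prodN m (λ b → F a (transpose k (i ℕ.+ b))) ≋ TT.prodN m (λ b → F a (i ℕ.+ b))) →
          swapVars k (cutPoly i m) ≋ cutPoly i m
        swapVars-cutPoly i m permProd permSum permRow = T.trans (swapVars-* k k<n (u i) (cross i m) (WF-u i) (WF-cross i m))
          (T.*-cong {swapVars k (u i)} {u i} {swapVars k (cross i m)} {cross i m}
            (T.trans (T.reflexive (swapVars-sumN k k<n i (varP n))) (permSum (λ a → T.reflexive (swapVars-var k k<n a))))
            (T.trans (swapVars-prodN k k<n i _ (WF-row i m)) (permProd λ a →
              T.trans (swapVars-prodN k k<n m _ (λ b → WF-F a (i ℕ.+ b)))
              (T.trans (TT.Prod.bigN-cong m (λ b _ → T.reflexive (swapVars-F a (i ℕ.+ b)))) (permRow (transpose k a))))))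

        swapVars-cutPoly-left : ∀ i m → suc k ℕ.< i → swapVars k (cutPoly i m) ≋ cutPoly i m
        swapVars-cutPoly-left i m k<i = swapVars-cutPoly i m
          (λ {f} {g} e → TT.Prod.bigN-transpose i k f g k<i (eqf {f} {g} e) (eqs {f} {g} e) (eqo {f} {g} e))
          (λ {f} {g} e → TT.Sum.bigN-transpose i k f g k<i (eqf {f} {g} e) (eqs {f} {g} e) (eqo {f} {g} e))
          (λ a → TT.Prod.bigN-cong m (λ b _ → T.reflexive (≡.cong (F a) (transpose-other k (i ℕ.+ b)
            (λ e → ℕₚ.<⇒≢ (ℕₚ.<-≤-trans (ℕₚ.<-trans ℕₚ.≤-refl k<i) (ℕₚ.m≤m+n i b)) (≡.sym e))
            (λ e → ℕₚ.<⇒≢ (ℕₚ.<-≤-trans k<i (ℕₚ.m≤m+n i b)) (≡.sym e))))))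
          where
          eqf : ∀ {f g : ℕ → Pol} → (∀ a → f a ≋ g (transpose k a)) → f k ≋ g (suc k)
          eqf {f} {g} e = T.trans (e k) (T.reflexive (≡.cong g (transpose-fst k)))
          eqs : ∀ {f g : ℕ → Pol} → (∀ a → f a ≋ g (transpose k a)) → f (suc k) ≋ g k
          eqs {f} {g} e = T.trans (e (suc k)) (T.reflexive (≡.cong g (transpose-snd k)))
          eqo : ∀ {f g : ℕ → Pol} → (∀ a → f a ≋ g (transpose k a)) → ∀ j → j ≢ k → j ≢ suc k → j ℕ.< i → f j ≋ g j
          eqo {f} {g} e j n1 n2 _ = T.trans (e j) (T.reflexive (≡.cong g (transpose-other k j n1 n2)))

      swapVars-cutPoly-right : ∀ i m k′ (k<n : suc (i ℕ.+ k′) ℕ.< n) → suc k′ ℕ.< m → swapVars (i ℕ.+ k′) (cutPoly i m) ≋ cutPoly i m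
      swapVars-cutPoly-right i m k′ k<n k<m = swapVars-cutPoly k k<n i m
          (λ {f} {g} e → TT.Prod.bigN-cong i (λ a a<i → T.trans (e a) (T.reflexive (≡.cong g (fix a a<i)))))
          (λ {f} {g} e → TT.Sum.bigN-cong i (λ a a<i → T.trans (e a) (T.reflexive (≡.cong g (fix a a<i)))))
          (λ a → T.trans (TT.Prod.bigN-cong m (λ b _ → T.reflexive (≡.cong (F a) (transpose-+ i k′ b))))
            (TT.Prod.bigN-transpose m k′ _ (λ b → F a (i ℕ.+ b)) k<m (T.reflexive (≡.cong (λ z → F a (i ℕ.+ z)) (transpose-fst k′)))
              (T.reflexive (≡.cong (λ z → F a (i ℕ.+ z)) (transpose-snd k′)))
              (λ j n1 n2 _ → T.reflexive (≡.cong (λ z → F a (i ℕ.+ z)) (transpose-other k′ j n1 n2)))))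
        where
        k : ℕ
        k = i ℕ.+ k′
        fix : ∀ a → a ℕ.< i → transpose k a ≡ a
        fix a a<i = transpose-other k a (ℕₚ.<⇒≢ (ℕₚ.<-≤-trans a<i (ℕₚ.m≤m+n i k′))) (ℕₚ.<⇒≢ (ℕₚ.<-≤-trans a<i (ℕₚ.≤-trans (ℕₚ.m≤m+n i k′) (ℕₚ.n≤1+n k))))

  module Klyachko (n : ℕ) (q : CommutativeRing.Carrier R) where
    open CommutativeRing R
    open RingTools R
    open Poly R
    open Universal n
    open Cut q
    open Relation.Binary.Reasoning.Setoid setoid

    altG : Functional
    altG β = if length β ≡ᵇ n then altM n β else 0#

    -- Extending altM by 0 to shorter vectors makes the relations of the Klyachko algebra hold for every γ.
    altV : Functional
    altV α = altG (take n α)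

    altV-take : ∀ α → altV (take n α) ≡ altV α
    altV-take α = ≡.cong altG (take-idem n α)

    altV-WF : ∀ α → length α ≡ n → altV α ≡ altM n α
    altV-WF α e rewrite take-all n α (ℕₚ.≤-reflexive e) | e | ≡ᵇ-true n = ≡.refl

    altV-short : ∀ α → length α ℕ.< n → altV α ≡ 0#
    altV-short α l rewrite take-all n α (ℕₚ.<⇒≤ l) | ≡ᵇ-false (ℕₚ.<⇒≢ l) = ≡.refl

    altV-⊕ : ∀ γ α → altV (γ ⊕ take n α) ≡ altV (γ ⊕ α)
    altV-⊕ γ α = ≡.cong altG (take-⊕ˡ n γ α)

    altM-0 : ∀ α → length α ≡ n → ¬ (α ↭ downFrom n) → altM n α ≈ 0#
    altM-0 α lα ne = trans (Sum.big-cong-All {xs = perms (upTo n)} (All.map (λ {σ} p → trans (*-congˡ (ind-≢ λ e →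
        ne (Perm.trans (Perm.↭-sym (actL-↭ n σ α p lα)) (Perm.↭-reflexive (≡.sym e))))) (zeroʳ _)) (perms-↭ (upTo n))))
      (Sum.big-ε (perms (upTo n)) (λ _ → refl))

    module Vanish (halve : ∀ x → x ≈ - x → x ≈ 0#) where

      module Alternating (B : Functional) (lo hi : ℕ)
        (alt : ∀ γ k → length γ ≡ n → lo ℕ.≤ k → suc k ℕ.< hi → B (swapAt k γ) ≈ - B γ) where

        alt-++ : ∀ pre a b post → length (pre ++ a ∷ b ∷ post) ≡ n → lo ℕ.≤ length pre → suc (length pre) ℕ.< hi →
          B (pre ++ b ∷ a ∷ post) ≈ - B (pre ++ a ∷ b ∷ post)
        alt-++ pre a b post e l h = trans (reflexive (≡.cong B (≡.sym (swapAt-++ pre a b post)))) (alt _ (length pre) e l h)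

        zero-↭ : ∀ {xs ys} → xs ↭ ys → ∀ pre post → lo ℕ.≤ length pre → length pre ℕ.+ length xs ℕ.≤ hi →
          length (pre ++ xs ++ post) ≡ n → B (pre ++ xs ++ post) ≈ 0# → B (pre ++ ys ++ post) ≈ 0#
        zero-↭ Perm.refl pre post l h e z = z
        zero-↭ {_ ∷ xs} {_ ∷ ys} (Perm.prep x p) pre post l h e z = ≡.subst (λ v → B v ≈ 0#) (++-assoc pre (x ∷ []) (ys ++ post))
          (zero-↭ p (pre ++ x ∷ []) post (ℕₚ.≤-trans l (≡.subst (length pre ℕ.≤_) (≡.sym lp) (ℕₚ.n≤1+n _)))
            (≡.subst (ℕ._≤ hi) (≡.trans (ℕₚ.+-suc _ _) (≡.cong (ℕ._+ length xs) (≡.sym lp))) h)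
            (≡.subst (λ v → length v ≡ n) (≡.sym (++-assoc pre (x ∷ []) (xs ++ post))) e)
            (≡.subst (λ v → B v ≈ 0#) (≡.sym (++-assoc pre (x ∷ []) (xs ++ post))) z))
          where
          lp : length (pre ++ x ∷ []) ≡ suc (length pre)
          lp = ≡.trans (length-++ pre) (ℕₚ.+-comm (length pre) 1)
        zero-↭ {_ ∷ _ ∷ xs} {_ ∷ _ ∷ ys} (Perm.swap x y p) pre post l h e z =
          trans (alt-++ pre x y (ys ++ post) (≡.trans (≡.trans (length-++ pre) (≡.trans (≡.cong (λ k → length pre ℕ.+ suc (suc k)) (≡.trans (length-++ ys) (≡.trans (≡.cong (ℕ._+ length post) (≡.sym (Permₚ.↭-length p))) (≡.sym (length-++ xs))))) (≡.sym (length-++ pre)))) e)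
              l (ℕₚ.≤-trans (≡.subst (suc (suc (length pre)) ℕ.≤_) (≡.sym eh) (s≤s (s≤s (ℕₚ.m≤m+n _ _)))) h))
            (trans (-‿cong (≡.subst (λ v → B v ≈ 0#) (++-assoc pre (x ∷ y ∷ []) (ys ++ post))
              (zero-↭ p (pre ++ x ∷ y ∷ []) post (ℕₚ.≤-trans l (≡.subst (length pre ℕ.≤_) (≡.sym lp) (ℕₚ.≤-trans (ℕₚ.n≤1+n _) (ℕₚ.n≤1+n _))))
                (≡.subst (ℕ._≤ hi) (≡.trans eh (≡.cong (ℕ._+ length xs) (≡.sym lp))) h)
                (≡.subst (λ v → length v ≡ n) (≡.sym (++-assoc pre (x ∷ y ∷ []) (xs ++ post))) e)
                (≡.subst (λ v → B v ≈ 0#) (≡.sym (++-assoc pre (x ∷ y ∷ []) (xs ++ post))) z)))) -0#≈0#)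
          where
          lp : length (pre ++ x ∷ y ∷ []) ≡ suc (suc (length pre))
          lp = ≡.trans (length-++ pre) (ℕₚ.+-comm (length pre) 2)
          eh : length pre ℕ.+ suc (suc (length xs)) ≡ suc (suc (length pre ℕ.+ length xs))
          eh = ≡.trans (ℕₚ.+-suc (length pre) _) (≡.cong suc (ℕₚ.+-suc (length pre) _))
        zero-↭ {xs} {ys} (Perm.trans {ys = ms} p r) pre post l h e z = zero-↭ r pre post l (≡.subst (λ k → length pre ℕ.+ k ℕ.≤ hi) (Permₚ.↭-length p) h)
          (≡.trans (≡.trans (length-++ pre) (≡.trans (≡.cong (length pre ℕ.+_) (≡.trans (length-++ ms) (≡.trans (≡.cong (ℕ._+ length post) (≡.sym (Permₚ.↭-length p))) (≡.sym (length-++ xs))))) (≡.sym (length-++ pre)))) e)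
          (zero-↭ p pre post l h e z)

        zero-block : ∀ pre xs post → lo ≡ length pre → length pre ℕ.+ length xs ≡ hi → length (pre ++ xs ++ post) ≡ n →
          sum xs ℕ.< tri (length xs) → B (pre ++ xs ++ post) ≈ 0#
        zero-block pre xs post l h e lt with sorted-dup (sort xs) (sort-↗ xs)
            (≡.subst₂ ℕ._<_ (≡.sym (sum-↭ (sort-↭ xs))) (≡.cong tri (≡.sym (Permₚ.↭-length (sort-↭ xs)))) lt)
        ... | ys , a , zs , se = zero-↭ (sort-↭ xs) pre post (ℕₚ.≤-reflexive l) (ℕₚ.≤-reflexive h′) e′
              (≡.subst (λ v → B v ≈ 0#) (≡.sym γ≡) (halve _ (alt-++ (pre ++ ys) a a (zs ++ post) (≡.trans (≡.cong length (≡.sym γ≡)) e′)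
                (ℕₚ.≤-trans (ℕₚ.≤-reflexive l) (≡.subst (length pre ℕ.≤_) (≡.sym (length-++ pre)) (ℕₚ.m≤m+n _ _))) bound)))
          where
          lens : length (sort xs) ≡ length xs
          lens = Permₚ.↭-length (sort-↭ xs)
          h′ : length pre ℕ.+ length (sort xs) ≡ hi
          h′ = ≡.trans (≡.cong (length pre ℕ.+_) lens) h
          e′ : length (pre ++ sort xs ++ post) ≡ n
          e′ = ≡.trans (≡.trans (length-++ pre) (≡.trans (≡.cong (length pre ℕ.+_) (≡.trans (length-++ (sort xs)) (≡.trans (≡.cong (ℕ._+ length post) lens) (≡.sym (length-++ xs))))) (≡.sym (length-++ pre)))) e
          γ≡ : pre ++ sort xs ++ post ≡ (pre ++ ys) ++ a ∷ a ∷ zs ++ post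
          γ≡ = ≡.trans (≡.cong (λ v → pre ++ v ++ post) se) (≡.trans (≡.cong (pre ++_) (++-assoc ys (a ∷ a ∷ zs) post)) (≡.sym (++-assoc pre ys _)))
          bound : suc (length (pre ++ ys)) ℕ.< hi
          bound = ≡.subst (suc (length (pre ++ ys)) ℕ.<_) (≡.sym (≡.trans (≡.sym h′) (≡.trans (≡.cong (λ v → length pre ℕ.+ length v) se)
            (≡.trans (≡.cong (length pre ℕ.+_) (length-++ ys)) (≡.trans (≡.sym (ℕₚ.+-assoc (length pre) (length ys) _)) (≡.trans (≡.cong (ℕ._+ suc (suc (length zs))) (≡.sym (length-++ pre)))
            (≡.trans (ℕₚ.+-suc _ _) (≡.cong suc (ℕₚ.+-suc _ _)))))))))
            (s≤s (s≤s (ℕₚ.m≤m+n _ _)))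

      alternating-pair : ∀ S k → suc k ℕ.< n → WF n S → swapVars k S ≋ S → ∀ γ → length γ ≡ n →
        pair S (λ α → altM n (swapAt k γ ⊕ α)) ≈ - pair S (λ α → altM n (γ ⊕ α))
      alternating-pair S k k<n wS sS γ lγ = begin
        pair S (λ α → altM n (swapAt k γ ⊕ α)) ≈⟨ ≋⇒pairᵂ _ wS (WF-swapVars k S wS) (T.sym sS) ⟩
        pair (swapVars k S) (λ α → altM n (swapAt k γ ⊕ α)) ≈⟨ pair-swapVars k S _ ⟩
        pair S (λ α → altM n (swapAt k γ ⊕ swapAt k α))
          ≈⟨ pair-congᵀ wS (λ α lα → trans (reflexive (≡.cong (altM n) (≡.sym (swapAt-⊕ k γ α (≡.trans lγ (≡.sym lα)))))) (altM-swapAt n k (γ ⊕ α) (length-⊕ γ α lγ lα) k<n)) ⟩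
        pair S (λ α → - altM n (γ ⊕ α)) ≈⟨ pair--ʳ S _ ⟩
        - pair S (λ α → altM n (γ ⊕ α)) ∎

      Homog-sumN : ∀ d m (f : ℕ → Pol) → (∀ i → i ℕ.< m → Homog n d (f i)) → Homog n d (TT.sumN m f)
      Homog-sumN d zero f h = []
      Homog-sumN d (suc m) f h = Allₚ.++⁺ (h 0 (s≤s z≤n)) (Homog-sumN d m (f ∘ suc) (λ i i<m → h (suc i) (s≤s i<m)))

      Homog-prodN : ∀ d m (f : ℕ → Pol) → (∀ i → i ℕ.< m → Homog n d (f i)) → Homog n (m ℕ.* d) (TT.prodN m f)
      Homog-prodN d zero f h = (length-replicate n , sum-replicate-0 n) ∷ []
      Homog-prodN d (suc m) f h = Homog-*P (f 0) _ (h 0 (s≤s z≤n)) (Homog-prodN d m (f ∘ suc) (λ i i<m → h (suc i) (s≤s i<m)))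

      Homog-cutPoly : ∀ i m → i ℕ.+ m ≡ n → Homog n (suc (i ℕ.* m)) (cutPoly i m)
      Homog-cutPoly i m ≡.refl = Homog-*P (u i) (cross i m) (Homog-sumN 1 i _ λ a a<i → Homog-varP n a (ℕₚ.<-≤-trans a<i (ℕₚ.m≤m+n i m)))
        (≡.subst (λ z → Homog n (i ℕ.* z) (cross i m)) (ℕₚ.*-identityʳ m) (Homog-prodN (m ℕ.* 1) i _ λ a a<i → Homog-prodN 1 m _ λ b b<m →
          Homog-farFactor n q a (i ℕ.+ b) (ℕₚ.<-≤-trans a<i (ℕₚ.m≤m+n i m)) (ℕₚ.+-monoʳ-< i b<m)))

      -- For γ of the only relevant degree, one of its two blocks is too small to have distinct entries.
      cutPoly-vanishes : ∀ i m → i ℕ.+ m ≡ n → ∀ γ → pair (cutPoly i m) (λ α → altV (γ ⊕ α)) ≈ 0#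
      cutPoly-vanishes i m im γ = go (ℕₚ.<-≤-connex (length γ) n)
        where
        open import Data.Sum using (_⊎_; inj₁; inj₂)
        S : Pol
        S = cutPoly i m
        γ′ β₁ β₂ : List ℕ
        γ′ = take n γ
        β₁ = take i γ′
        β₂ = drop i γ′
        B : Functional
        B γ = pair S (λ α → altM n (γ ⊕ α))
        γ≡ : β₁ ++ β₂ ≡ γ′
        γ≡ = take++drop≡id i γ′
        long : length γ′ ≡ n → B γ′ ≈ 0#
        long lγ = cases (sum γ′ ℕ.+ suc (i ℕ.* m) ℕ.≟ tri n)
          where
          l₁ : length β₁ ≡ i
          l₁ = ≡.trans (length-take i γ′) (≡.trans (≡.cong (i ℕ.⊓_) (≡.trans lγ (≡.sym im))) (ℕₚ.m≤n⇒m⊓n≡m (ℕₚ.m≤m+n i m)))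
          l₂ : length β₂ ≡ m
          l₂ = ≡.trans (length-drop i γ′) (≡.trans (≡.cong (ℕ._∸ i) (≡.trans lγ (≡.sym im))) (ℕₚ.m+n∸m≡n i m))
          module L = Alternating B 0 i (λ γ k lγ _ k<i → alternating-pair S k (ℕₚ.<-≤-trans k<i (≡.subst (i ℕ.≤_) im (ℕₚ.m≤m+n i m)))
            (WF-cutPoly i m) (swapVars-cutPoly-left k (ℕₚ.<-≤-trans k<i (≡.subst (i ℕ.≤_) im (ℕₚ.m≤m+n i m))) i m k<i) γ lγ)
          altR : ∀ γ k′ → length γ ≡ n → suc (i ℕ.+ k′) ℕ.< n → B (swapAt (i ℕ.+ k′) γ) ≈ - B γ
          altR γ k′ lγ k<n = alternating-pair S (i ℕ.+ k′) k<n (WF-cutPoly i m) (swapVars-cutPoly-right i m k′ k<n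
            (ℕₚ.+-cancelˡ-< i _ _ (≡.subst₂ ℕ._<_ (≡.sym (ℕₚ.+-suc i k′)) (≡.sym im) k<n))) γ lγ
          module Rt = Alternating B i n (λ γ k lγ i≤k k<n → ≡.subst (λ k → B (swapAt k γ) ≈ - B γ) (ℕₚ.m+[n∸m]≡n i≤k)
            (altR γ (k ℕ.∸ i) lγ (≡.subst (λ k → suc k ℕ.< n) (≡.sym (ℕₚ.m+[n∸m]≡n i≤k)) k<n)))
          cases : Dec (sum γ′ ℕ.+ suc (i ℕ.* m) ≡ tri n) → B γ′ ≈ 0#
          cases (no ne) = pair-0ᵀ (Homog-cutPoly i m im) λ α (lα , sα) → altM-0 (γ′ ⊕ α) (length-⊕ γ′ α lγ lα) λ p →
            ne (≡.trans (≡.cong (sum γ′ ℕ.+_) (≡.sym sα)) (≡.trans (≡.sym (sum-⊕ γ′ α (≡.trans lγ (≡.sym lα)))) (sum-↭ p)))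
          cases (yes eq) = sel (ℕₚ.<-≤-connex (sum β₁) (tri i))
            where
            total : sum β₁ ℕ.+ sum β₂ ℕ.< tri i ℕ.+ tri m
            total = ℕₚ.+-cancelʳ-< (i ℕ.* m) _ _ (ℕₚ.≤-reflexive (≡.trans (≡.sym (ℕₚ.+-suc _ _))
              (≡.trans (≡.cong (ℕ._+ suc (i ℕ.* m)) (≡.trans (≡.sym (sum-++ β₁ β₂)) (≡.cong sum γ≡))) (≡.trans eq (≡.trans (≡.cong tri (≡.sym im)) (tri-+ i m))))))
            sel : sum β₁ ℕ.< tri i ⊎ tri i ℕ.≤ sum β₁ → B γ′ ≈ 0#
            sel (inj₁ lt) = ≡.subst (λ v → B v ≈ 0#) γ≡ (L.zero-block [] β₁ β₂ ≡.refl l₁ (≡.trans (≡.cong length γ≡) lγ)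
              (≡.subst (λ z → sum β₁ ℕ.< tri z) (≡.sym l₁) lt))
            sel (inj₂ ge) = ≡.subst (λ v → B v ≈ 0#) (≡.trans (≡.cong (β₁ ++_) (++-identityʳ β₂)) γ≡)
              (Rt.zero-block β₁ β₂ [] (≡.sym l₁) (≡.trans (≡.cong₂ ℕ._+_ l₁ l₂) im)
                (≡.trans (≡.cong length (≡.trans (≡.cong (β₁ ++_) (++-identityʳ β₂)) γ≡)) lγ)
                (≡.subst (λ z → sum β₂ ℕ.< tri z) (≡.sym l₂) (ℕₚ.+-cancelˡ-< (tri i) _ _ (ℕₚ.≤-<-trans (ℕₚ.+-monoˡ-≤ (sum β₂) ge) total))))
        go : length γ ℕ.< n ⊎ n ℕ.≤ length γ → pair S (λ α → altV (γ ⊕ α)) ≈ 0#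
        go (inj₁ short) = pair-0 S λ α → reflexive (altV-short (γ ⊕ α) (ℕₚ.≤-<-trans (≡.subst (ℕ._≤ length γ) (≡.sym (length-zipWith ℕ._+_ γ α)) (ℕₚ.m⊓n≤m _ _)) short))
        go (inj₂ ge) = trans (pair-congᵀ (WF-cutPoly i m) λ α lα → reflexive (≡.trans (≡.sym (altV-take (γ ⊕ α)))
            (≡.trans (≡.cong altV (≡.trans (take-⊕ n γ α) (≡.cong (γ′ ⊕_) (take-all n α (ℕₚ.≤-reflexive lα))))) (altV-WF (γ′ ⊕ α) (length-⊕ γ′ α lγ′ lα)))))
          (long lγ′)
          where
          lγ′ : length γ′ ≡ n
          lγ′ = ≡.trans (length-take n γ) (ℕₚ.m≤n⇒m⊓n≡m ge)

  module KlyachkoRing (n : ℕ) (q : CommutativeRing.Carrier R)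
    (halve : ∀ x → CommutativeRing._≈_ R x (CommutativeRing.-_ R x) → CommutativeRing._≈_ R x (CommutativeRing.0# R)) where
    open CommutativeRing R
    open RingTools R
    open Poly R
    open Universal n
    open Cut q
    open Klyachko n q
    open Vanish halve
    open Relation.Binary.Reasoning.Setoid setoid

    module Triangular = TriangularProducts T F

    farProd≋columns : farProd n q ≋ Triangular.columns n
    farProd≋columns = T.trans (T.reflexive (prodP-big (map f (farPairs n))))
      (T.trans (TT.Prod.big-map f (farPairs n) id)
      (T.trans (TT.Prod.big-concatMap (λ j → map (λ i → (i , j)) (upTo (j ℕ.∸ 1))) (upTo n) f)
      (T.trans (TT.Prod.big-upTo n (λ j → TT.prodL (map (λ i → (i , j)) (upTo (j ℕ.∸ 1))) f))
        (TT.Prod.bigN-cong n (λ j _ → T.trans (TT.Prod.big-map (λ i → (i , j)) (upTo (j ℕ.∸ 1)) f) (TT.Prod.big-upTo (j ℕ.∸ 1) (λ a → F a j)))))))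
      where
      f : ℕ × ℕ → Pol
      f (i , j) = F i j
      prodP-big : ∀ ps → prodP n ps ≡ TT.prodL ps id
      prodP-big [] = ≡.refl
      prodP-big (p ∷ ps) = ≡.cong (p *P_) (prodP-big ps)

    P : Pol
    P = farProd n q

    WF-P : WF n P
    WF-P = Homog⇒WF (Homog-farProd n q)

    Ψˢ : List ℕ → Functional
    Ψˢ γ α = pair P (λ β → altV (γ ⊕ α ⊕ β))

    Ψˢ-take : ∀ γ α → Ψˢ γ (take n α) ≈ Ψˢ γ α
    Ψˢ-take γ α = pair-cong P λ β → reflexive (≡.trans (≡.sym (altV-take _)) (≡.trans (≡.cong altV (≡.trans (take-⊕ n (γ ⊕ take n α) β)
      (≡.trans (≡.cong (_⊕ take n β) (take-⊕ˡ n γ α)) (≡.sym (take-⊕ n (γ ⊕ α) β))))) (altV-take _)))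

    abstract
      act-lawˢ : ∀ γ β α → Ψˢ (γ ⊕ β) α ≈ Ψˢ γ (β ⊕ α)
      act-lawˢ γ β α = pair-cong P λ δ → reflexive (≡.cong (λ z → altV (z ⊕ δ)) (⊕-assoc γ β α))

      unit-lawˢ : ∀ γ α → Ψˢ γ (replicate n 0 ⊕ α) ≈ Ψˢ γ α
      unit-lawˢ γ α = trans (reflexive (≡.cong (Ψˢ γ) (replicate-⊕ n α))) (Ψˢ-take γ α)

    module DS = DualRing n (List ℕ) Ψˢ _⊕_ act-lawˢ unit-lawˢ

    -- the Klyachko algebra, as the Gorenstein quotient dual to the functional f ↦ A(f P)
    S : CommutativeRing c ℓ
    S = DS.dualRing
    module S = CommutativeRing S
    module SS = RingTools S

    T⇒S : ∀ {p r} → p ≋ r → p S.≈ r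
    T⇒S p≋r = DS.mk≋ λ γ → ≋⇒pair (Ψˢ γ) (λ α → sym (Ψˢ-take γ α)) p≋r

    pair-Ψˢ : ∀ p γ → pair p (Ψˢ γ) ≈ pair (p *P P) (λ α → altV (γ ⊕ α))
    pair-Ψˢ p γ = trans (pair-cong p λ α → pair-cong P λ β → reflexive (≡.cong altV (⊕-assoc γ α β))) (sym (pair-* p P _))

    multiple-vanishes : ∀ i m → i ℕ.+ m ≡ n → ∀ p r → (p *P P) ≋ (r *P cutPoly i m) → p S.≈ []
    multiple-vanishes i m im p r e = DS.mk≋ λ γ → begin
      pair p (Ψˢ γ) ≈⟨ pair-Ψˢ p γ ⟩
      pair (p *P P) (λ α → altV (γ ⊕ α)) ≈⟨ ≋⇒pair (λ α → altV (γ ⊕ α)) (λ α → reflexive (≡.sym (altV-⊕ γ α))) e ⟩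
      pair (r *P cutPoly i m) (λ α → altV (γ ⊕ α)) ≈⟨ pair-* r (cutPoly i m) _ ⟩
      pair r (λ α → pair (cutPoly i m) (λ β → altV (γ ⊕ (α ⊕ β))))
        ≈⟨ pair-0 r (λ α → trans (pair-cong (cutPoly i m) (λ β → reflexive (≡.cong altV (≡.sym (⊕-assoc γ α β))))) (cutPoly-vanishes i m im (γ ⊕ α))) ⟩
      0# ∎

    relation : ∀ i′ → suc i′ ℕ.< n → (u (suc i′) *P F i′ (suc i′)) S.≈ []
    relation i′ i<n = multiple-vanishes (suc i′) (suc m) im _ (proj₁ cut) (T.trans (T.*-assoc U (F i′ (suc i′)) P)
        (T.trans (T.*-congˡ {U} (T.trans (T.*-congˡ {F i′ (suc i′)} farProd≋columns)
           (T.trans (T.reflexive (≡.cong (λ z → F i′ (suc i′) *P Triangular.columns z) (≡.sym im))) (proj₂ cut))))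
        (TT.solve 3 (λ a b c → a TT.:* (b TT.:* c) TT.:= b TT.:* (a TT.:* c)) T.refl U (proj₁ cut) (cross (suc i′) (suc m)))))
      where
      U : Pol
      U = u (suc i′)
      m : ℕ
      m = n ℕ.∸ suc (suc i′)
      im : suc i′ ℕ.+ suc m ≡ n
      im = ≡.trans (ℕₚ.+-suc (suc i′) m) (ℕₚ.m+[n∸m]≡n i<n)
      cut : ∃ λ r → (F i′ (suc i′) *P Triangular.columns (suc i′ ℕ.+ suc m)) ≋ (r *P cross (suc i′) (suc m))
      cut = Triangular.columns-cut i′ m

    u-top : u n S.≈ []
    u-top = multiple-vanishes n 0 (ℕₚ.+-identityʳ n) (u n) P (T.trans (T.*-comm (u n) P)
      (T.*-congˡ {P} (T.trans (T.sym (T.*-identityʳ (u n))) (T.*-congˡ {u n} (T.sym (TT.Prod.bigN-ε n (λ _ _ → T.refl)))))))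

    constP-*P : ∀ a p → (constP n a *P p) S.≈ scaleP a p
    constP-*P a p = T⇒S (mk≋ λ ψ → trans (pair-* (constP n a) p _) (trans (+-identityʳ _) (trans (*-congˡ (pair-cong p λ α →
      reflexive (≡.cong ψ (≡.trans (≡.cong (take n) (replicate-⊕ n α)) (take-idem n α))))) (sym (pair-scale a p _)))))

    Λ : Pol → Carrier
    Λ p = pair p (Ψˢ (replicate n 0))

    ev : List ℕ → Pol → Carrier
    ev α Z = pair Z (λ β → altM n (α ⊕ β))

    ev-cong : ∀ α {Z Z′} → WF n Z → WF n Z′ → Z ≋ Z′ → ev α Z ≈ ev α Z′
    ev-cong α w w′ e = ≋⇒pairᵂ _ w w′ e

    ev-var : ∀ α j Z → ev α (varP n j *P Z) ≈ ev (α ⊕ unitVec n j) Z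
    ev-var α j Z = trans (pair-* (varP n j) Z _) (trans (+-identityʳ _) (trans (*-identityˡ _) (pair-cong Z λ β → reflexive (≡.cong (altM n) (≡.sym (⊕-assoc α _ β))))))

    addUnits : List ℕ → ℕ → ℕ → List ℕ
    addUnits α s zero = α
    addUnits α s (suc r) = addUnits (α ⊕ unitVec n s) (suc s) r

    length-addUnits : ∀ α s r → length α ≡ n → length (addUnits α s r) ≡ n
    length-addUnits α s zero e = e
    length-addUnits α s (suc r) e = length-addUnits _ (suc s) r (length-⊕ α _ e (length-unitVec n s))

    at-+unit : ∀ α j k → length α ≡ n → k ℕ.< n → at (α ⊕ unitVec n j) k ≡ at α k ℕ.+ (if k ≡ᵇ j then 1 else 0)
    at-+unit α j k lα k<n = ≡.trans (at-⊕ α (unitVec n j) k (≡.subst (k ℕ.<_) (≡.sym lα) k<n) (≡.subst (k ℕ.<_) (≡.sym (length-unitVec n j)) k<n))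
      (≡.cong (at α k ℕ.+_) (at-map-upTo n _ k k<n))

    at-+unit-≢ : ∀ α j k → length α ≡ n → k ℕ.< n → k ≢ j → at (α ⊕ unitVec n j) k ≡ at α k
    at-+unit-≢ α j k lα k<n ne = ≡.trans (at-+unit α j k lα k<n) (≡.trans (≡.cong (λ b → at α k ℕ.+ (if b then 1 else 0)) (≡ᵇ-false ne)) (ℕₚ.+-identityʳ _))

    at-+unit-≡ : ∀ α k → length α ≡ n → k ℕ.< n → at (α ⊕ unitVec n k) k ≡ suc (at α k)
    at-+unit-≡ α k lα k<n = ≡.trans (at-+unit α k k lα k<n) (≡.trans (≡.cong (λ b → at α k ℕ.+ (if b then 1 else 0)) (≡ᵇ-true k)) (ℕₚ.+-comm _ 1))

    at-addUnits-< : ∀ α s r k → length α ≡ n → k ℕ.< n → k ℕ.< s → at (addUnits α s r) k ≡ at α k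
    at-addUnits-< α s zero k lα k<n k<s = ≡.refl
    at-addUnits-< α s (suc r) k lα k<n k<s = ≡.trans (at-addUnits-< _ (suc s) r k (length-⊕ α _ lα (length-unitVec n s)) k<n (ℕₚ.m<n⇒m<1+n k<s))
      (at-+unit-≢ α s k lα k<n (ℕₚ.<⇒≢ k<s))

    at-addUnits-≥ : ∀ α s r k → length α ≡ n → k ℕ.< n → s ℕ.≤ k → k ℕ.< s ℕ.+ r → at (addUnits α s r) k ≡ suc (at α k)
    at-addUnits-≥ α s zero k lα k<n s≤k k<sr = ⊥-elim (ℕₚ.<⇒≱ k<sr (≡.subst (ℕ._≤ k) (≡.sym (ℕₚ.+-identityʳ s)) s≤k))
    at-addUnits-≥ α s (suc r) k lα k<n s≤k k<sr with s ℕ.≟ k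
    ... | yes ≡.refl = ≡.trans (at-addUnits-< _ (suc s) r s (length-⊕ α _ lα (length-unitVec n s)) k<n ℕₚ.≤-refl) (at-+unit-≡ α s lα k<n)
    ... | no ne = ≡.trans (at-addUnits-≥ _ (suc s) r k (length-⊕ α _ lα (length-unitVec n s)) k<n (ℕₚ.≤∧≢⇒< s≤k ne) (≡.subst (k ℕ.<_) (ℕₚ.+-suc s r) k<sr))
          (≡.cong suc (at-+unit-≢ α s k lα k<n (ne ∘ ≡.sym)))

    Pinned : ℕ → List ℕ → Set
    Pinned i α = length α ≡ n × i ℕ.≤ at α i × (∀ k → i ℕ.< k → k ℕ.< n → i ℕ.< at α k)

    Pinned-+unit : ∀ i α j → i ℕ.< n → Pinned i α → Pinned i (α ⊕ unitVec n j)
    Pinned-+unit i α j i<n (lα , ai , h) = length-⊕ α _ lα (length-unitVec n j)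
      , ≡.subst (i ℕ.≤_) (≡.sym (at-+unit α j i lα i<n)) (ℕₚ.≤-trans ai (ℕₚ.m≤m+n _ _))
      , λ k i<k k<n → ≡.subst (i ℕ.<_) (≡.sym (at-+unit α j k lα k<n)) (ℕₚ.<-≤-trans (h k i<k k<n) (ℕₚ.m≤m+n _ _))

    -- Choosing q xᵢ in a factor leaves no exponent equal to i, so only −xⱼ contributes.
    ev-factor : ∀ i j α Z → i ℕ.< n → Pinned i α → WF n Z → ev α (F i j *P Z) ≈ - ev (α ⊕ unitVec n j) Z
    ev-factor i j α Z i<n (lα , ai , h) wZ = begin
      ev α (F i j *P Z) ≈⟨ pair-* (F i j) Z _ ⟩
      q * 1# * pair Z (λ β → altM n (α ⊕ (unitVec n i ⊕ β))) + (- 1# * pair Z (λ β → altM n (α ⊕ (unitVec n j ⊕ β))) + 0#)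
        ≈⟨ +-cong (*-congˡ (pair-0ᵀ wZ λ β lβ → trans (reflexive (≡.cong (altM n) (≡.sym (⊕-assoc α _ β)))) (vanish β lβ)))
             (+-congʳ (*-congˡ (pair-cong Z λ β → reflexive (≡.cong (altM n) (≡.sym (⊕-assoc α _ β)))))) ⟩
      q * 1# * 0# + (- 1# * ev (α ⊕ unitVec n j) Z + 0#) ≈⟨ solve 2 (λ q e → q :* :1 :* :0 :+ ((:- :1) :* e :+ :0) := :- e) refl q _ ⟩
      - ev (α ⊕ unitVec n j) Z ∎
      where
      α′ : List ℕ
      α′ = α ⊕ unitVec n i
      lα′ : length α′ ≡ n
      lα′ = length-⊕ α _ lα (length-unitVec n i)
      big : ∀ k → i ℕ.≤ k → k ℕ.< n → suc i ℕ.≤ at α′ k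
      big k i≤k k<n with i ℕ.≟ k
      ... | yes ≡.refl = ≡.subst (suc i ℕ.≤_) (≡.sym (at-+unit-≡ α i lα k<n)) (s≤s ai)
      ... | no ne = ≡.subst (suc i ℕ.≤_) (≡.sym (at-+unit-≢ α i k lα k<n (ne ∘ ≡.sym))) (h k (ℕₚ.≤∧≢⇒< i≤k ne) k<n)
      vanish : ∀ β → length β ≡ n → altM n (α′ ⊕ β) ≈ 0#
      vanish β lβ = altM-0 (α′ ⊕ β) (length-⊕ α′ β lα′ lβ) (missing-value n i (α′ ⊕ β) (length-⊕ α′ β lα′ lβ) i<n λ k i≤k k<n →
        ≡.subst (suc i ℕ.≤_) (≡.sym (at-⊕ α′ β k (≡.subst (k ℕ.<_) (≡.sym lα′) k<n) (≡.subst (k ℕ.<_) (≡.sym lβ) k<n)))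
          (ℕₚ.≤-trans (big k i≤k k<n) (ℕₚ.m≤m+n _ _)))

    ε : ℕ → Carrier
    ε = pow (- 1#)

    ev-row : ∀ i s r α Z → i ℕ.< n → Pinned i α → WF n Z →
      ev α (TT.prodN r (λ b → F i (s ℕ.+ b)) *P Z) ≈ ε r * ev (addUnits α s r) Z
    ev-row i s zero α Z i<n pin wZ = trans (ev-cong α (WF-* _ Z WF-1 wZ) wZ (T.*-identityˡ Z)) (sym (*-identityˡ _))
    ev-row i s (suc r) α Z i<n pin wZ = begin
      ev α ((F i (s ℕ.+ 0) *P X) *P Z)
        ≈⟨ ev-cong α (WF-* _ Z (WF-* _ X (WF-F i _) wX) wZ) (WF-* _ _ (WF-F i s) (WF-* _ Z wX′ wZ))
            (T.trans (T.*-assoc (F i (s ℕ.+ 0)) X Z) (T.*-cong {F i (s ℕ.+ 0)} {F i s} {X *P Z} {X′ *P Z} (T.reflexive (≡.cong (F i) (ℕₚ.+-identityʳ s)))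
              (T.*-congʳ {Z} (TT.Prod.bigN-cong r (λ b _ → T.reflexive (≡.cong (F i) (ℕₚ.+-suc s b))))))) ⟩
      ev α (F i s *P (X′ *P Z)) ≈⟨ ev-factor i s α (X′ *P Z) i<n pin (WF-* _ Z wX′ wZ) ⟩
      - ev (α ⊕ unitVec n s) (X′ *P Z) ≈⟨ -‿cong (ev-row i (suc s) r _ Z i<n (Pinned-+unit i α s i<n pin) wZ) ⟩
      - (ε r * ev (addUnits α s (suc r)) Z) ≈⟨ solve 2 (λ a b → :- (a :* b) := (:- :1) :* a :* b) refl _ _ ⟩
      ε (suc r) * ev (addUnits α s (suc r)) Z ∎
      where
      X X′ : Pol
      X = TT.prodN r (λ b → F i (s ℕ.+ suc b))
      X′ = TT.prodN r (λ b → F i (suc s ℕ.+ b))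
      wX : WF n X
      wX = WF-prodN r _ (λ b → WF-F i (s ℕ.+ suc b))
      wX′ : WF n X′
      wX′ = WF-prodN r _ (λ b → WF-F i (suc s ℕ.+ b))

    minVec : ℕ → List ℕ
    minVec i = map (ℕ._⊓ i) (upTo n)

    length-minVec : ∀ i → length (minVec i) ≡ n
    length-minVec i = ≡.trans (length-map _ (upTo n)) (length-upTo n)

    at-minVec : ∀ i k → k ℕ.< n → at (minVec i) k ≡ k ℕ.⊓ i
    at-minVec i k k<n = at-map-upTo n (ℕ._⊓ i) k k<n

    addUnits-minVec : ∀ i r → suc i ℕ.+ r ≡ n → addUnits (minVec i) (suc i) r ≡ minVec (suc i)
    addUnits-minVec i r e = at-ext _ _ (≡.trans la (≡.sym (length-minVec (suc i)))) λ k k<′ → pointwise k (≡.subst (k ℕ.<_) la k<′)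
      where
      la : length (addUnits (minVec i) (suc i) r) ≡ n
      la = length-addUnits _ (suc i) r (length-minVec i)
      pointwise : ∀ k → k ℕ.< n → at (addUnits (minVec i) (suc i) r) k ≡ at (minVec (suc i)) k
      pointwise k k<n with suc i ℕ.≤? k
      ... | yes i<k = ≡.trans (at-addUnits-≥ (minVec i) (suc i) r k (length-minVec i) k<n i<k (≡.subst (k ℕ.<_) (≡.sym e) k<n))
            (≡.trans (≡.cong suc (≡.trans (at-minVec i k k<n) (ℕₚ.m≥n⇒m⊓n≡n (ℕₚ.<⇒≤ i<k)))) (≡.sym (≡.trans (at-minVec (suc i) k k<n) (ℕₚ.m≥n⇒m⊓n≡n i<k))))
      ... | no i≮k = ≡.trans (at-addUnits-< (minVec i) (suc i) r k (length-minVec i) k<n (ℕₚ.≰⇒> i≮k))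
            (≡.trans (at-minVec i k k<n) (≡.trans (ℕₚ.m≤n⇒m⊓n≡m (ℕₚ.≤-pred (ℕₚ.≰⇒> i≮k))) (≡.sym (≡.trans (at-minVec (suc i) k k<n) (ℕₚ.m≤n⇒m⊓n≡m (ℕₚ.m≤n⇒m≤1+n (ℕₚ.≤-pred (ℕₚ.≰⇒> i≮k))))))))

    minVec-top : ∀ i → n ℕ.≤ suc i → minVec i ≡ upTo n
    minVec-top i n≤i = at-ext _ _ (≡.trans (length-minVec i) (≡.sym (length-upTo n))) λ k k<′ →
      let k<n = ≡.subst (k ℕ.<_) (length-minVec i) k<′
      in ≡.trans (at-minVec i k k<n) (≡.trans (ℕₚ.m≤n⇒m⊓n≡m (ℕₚ.≤-pred (ℕₚ.≤-trans k<n n≤i))) (≡.sym (at-applyUpTo n id k k<n)))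

    minVec-Pinned : ∀ i → i ℕ.< n → Pinned i (minVec (suc i))
    minVec-Pinned i i<n = length-minVec (suc i)
      , ≡.subst (i ℕ.≤_) (≡.sym (≡.trans (at-minVec (suc i) i i<n) (ℕₚ.m≤n⇒m⊓n≡m (ℕₚ.n≤1+n i)))) ℕₚ.≤-refl
      , λ k i<k k<n → ≡.subst (i ℕ.<_) (≡.sym (≡.trans (at-minVec (suc i) k k<n) (ℕₚ.m≥n⇒m⊓n≡n i<k))) ℕₚ.≤-refl

    row : ℕ → Pol
    row a = TT.prodN (n ℕ.∸ (2 ℕ.+ a)) (λ b → F a (2 ℕ.+ a ℕ.+ b))

    WF-row′ : ∀ a → WF n (row a)
    WF-row′ a = WF-prodN (n ℕ.∸ (2 ℕ.+ a)) _ (λ b → WF-F a (2 ℕ.+ a ℕ.+ b))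

    row-end : ∀ i → i ℕ.< n → addUnits (minVec (suc i)) (2 ℕ.+ i) (n ℕ.∸ (2 ℕ.+ i)) ≡ minVec (2 ℕ.+ i)
    row-end i i<n with suc i ℕ.≟ n
    ... | yes e = ≡.trans (≡.cong (addUnits (minVec (suc i)) (2 ℕ.+ i)) (ℕₚ.m≤n⇒m∸n≡0 {n} {2 ℕ.+ i} (≡.subst (ℕ._≤ 2 ℕ.+ i) e (ℕₚ.n≤1+n _))))
          (≡.trans (minVec-top (suc i) (≡.subst (ℕ._≤ 2 ℕ.+ i) e (ℕₚ.n≤1+n _))) (≡.sym (minVec-top (2 ℕ.+ i) (≡.subst (ℕ._≤ 3 ℕ.+ i) e (ℕₚ.m≤n+m _ 2)))))
    ... | no ne = addUnits-minVec (suc i) _ (ℕₚ.m+[n∸m]≡n (ℕₚ.≤∧≢⇒< i<n ne))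

    ev-rows : ∀ r i → i ℕ.+ r ≡ n → ev (minVec (suc i)) (TT.prodN r (λ a → row (i ℕ.+ a))) ≈ prodN r (λ a → ε (n ℕ.∸ (2 ℕ.+ (i ℕ.+ a)))) * altM n (upTo n)
    ev-rows zero i e = begin
      1# * altM n (minVec (suc i) ⊕ replicate n 0) + 0# ≈⟨ +-identityʳ _ ⟩
      1# * altM n (minVec (suc i) ⊕ replicate n 0) ≈⟨ *-congˡ (reflexive (≡.cong (altM n) (≡.trans (⊕-comm _ (replicate n 0)) (≡.trans (replicate-⊕ n _)
          (≡.trans (take-all n _ (ℕₚ.≤-reflexive (length-minVec (suc i)))) (minVec-top (suc i) (ℕₚ.≤-trans (ℕₚ.≤-reflexive (≡.trans (≡.sym e) (ℕₚ.+-identityʳ i))) (ℕₚ.m≤n+m i 2)))))))) ⟩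
      1# * altM n (upTo n) ∎
    ev-rows (suc r) i e = begin
      ev (minVec (suc i)) (row (i ℕ.+ 0) *P Z) ≈⟨ ev-cong (minVec (suc i)) (WF-* _ Z (WF-row′ _) wZ) (WF-* _ Z′ (WF-row′ i) wZ′)
          (T.*-cong {row (i ℕ.+ 0)} {row i} {Z} {Z′} (T.reflexive (≡.cong row (ℕₚ.+-identityʳ i))) (TT.Prod.bigN-cong r (λ a _ → T.reflexive (≡.cong row (ℕₚ.+-suc i a))))) ⟩
      ev (minVec (suc i)) (row i *P Z′) ≈⟨ ev-row i (2 ℕ.+ i) (n ℕ.∸ (2 ℕ.+ i)) _ Z′ i<n (minVec-Pinned i i<n) wZ′ ⟩
      ε (n ℕ.∸ (2 ℕ.+ i)) * ev (addUnits (minVec (suc i)) (2 ℕ.+ i) (n ℕ.∸ (2 ℕ.+ i))) Z′ ≈⟨ *-congˡ (reflexive (≡.cong (λ v → ev v Z′) (row-end i i<n))) ⟩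
      ε (n ℕ.∸ (2 ℕ.+ i)) * ev (minVec (2 ℕ.+ i)) Z′ ≈⟨ *-cong (reflexive (≡.cong (λ z → ε (n ℕ.∸ (2 ℕ.+ z))) (≡.sym (ℕₚ.+-identityʳ i)))) (ev-rows r (suc i) (≡.trans (≡.sym (ℕₚ.+-suc i r)) e)) ⟩
      ε (n ℕ.∸ (2 ℕ.+ (i ℕ.+ 0))) * (prodN r (λ a → ε (n ℕ.∸ (2 ℕ.+ (suc i ℕ.+ a)))) * altM n (upTo n)) ≈⟨ *-assoc _ _ _ ⟨
      ε (n ℕ.∸ (2 ℕ.+ (i ℕ.+ 0))) * prodN r (λ a → ε (n ℕ.∸ (2 ℕ.+ (suc i ℕ.+ a)))) * altM n (upTo n)
        ≈⟨ *-congʳ (*-congˡ (Prod.bigN-cong r (λ a _ → reflexive (≡.cong (λ z → ε (n ℕ.∸ (2 ℕ.+ z))) (≡.sym (ℕₚ.+-suc i a)))))) ⟩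
      prodN (suc r) (λ a → ε (n ℕ.∸ (2 ℕ.+ (i ℕ.+ a)))) * altM n (upTo n) ∎
      where
      Z Z′ : Pol
      Z = TT.prodN r (λ a → row (i ℕ.+ suc a))
      Z′ = TT.prodN r (λ a → row (suc i ℕ.+ a))
      wZ : WF n Z
      wZ = WF-prodN r _ (λ a → WF-row′ (i ℕ.+ suc a))
      wZ′ : WF n Z′
      wZ′ = WF-prodN r _ (λ a → WF-row′ (suc i ℕ.+ a))
      i<n : i ℕ.< n
      i<n = ≡.subst (i ℕ.<_) e (ℕₚ.m<m+n i (s≤s z≤n))

    ev-vars : ∀ r s α Z → WF n Z → ev α (TT.prodN r (λ i → varP n (s ℕ.+ i)) *P Z) ≈ ev (addUnits α s r) Z
    ev-vars zero s α Z wZ = ev-cong α (WF-* _ Z WF-1 wZ) wZ (T.*-identityˡ Z)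
    ev-vars (suc r) s α Z wZ = begin
      ev α ((varP n (s ℕ.+ 0) *P X) *P Z)
        ≈⟨ ev-cong α (WF-* _ Z (WF-* _ X (WF-var (s ℕ.+ 0)) wX) wZ) (WF-* _ _ (WF-var s) (WF-* _ Z wX′ wZ))
            (T.trans (T.*-assoc (varP n (s ℕ.+ 0)) X Z) (T.*-cong {varP n (s ℕ.+ 0)} {varP n s} {X *P Z} {X′ *P Z} (T.reflexive (≡.cong (varP n) (ℕₚ.+-identityʳ s)))
              (T.*-congʳ {Z} (TT.Prod.bigN-cong r (λ b _ → T.reflexive (≡.cong (varP n) (ℕₚ.+-suc s b))))))) ⟩
      ev α (varP n s *P (X′ *P Z)) ≈⟨ ev-var α s (X′ *P Z) ⟩
      ev (α ⊕ unitVec n s) (X′ *P Z) ≈⟨ ev-vars r (suc s) _ Z wZ ⟩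
      ev (addUnits α s (suc r)) Z ∎
      where
      X X′ : Pol
      X = TT.prodN r (λ b → varP n (s ℕ.+ suc b))
      X′ = TT.prodN r (λ b → varP n (suc s ℕ.+ b))
      wX : WF n X
      wX = WF-prodN r _ (λ b → WF-var (s ℕ.+ suc b))
      wX′ : WF n X′
      wX′ = WF-prodN r _ (λ b → WF-var (suc s ℕ.+ b))

    module AltM = Alternating (altM n) 0 n (λ γ k lγ _ k<n → altM-swapAt n k γ lγ k<n)

    altM-rotate : ∀ pre xs x post → length (pre ++ xs ++ x ∷ post) ≡ n → altM n (pre ++ xs ++ x ∷ post) ≈ ε (length xs) * altM n (pre ++ x ∷ xs ++ post)
    altM-rotate pre [] x post e = sym (*-identityˡ _)
    altM-rotate pre (y ∷ xs) x post e = begin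
      altM n (pre ++ y ∷ xs ++ x ∷ post) ≈⟨ reflexive (≡.cong (altM n) (++-assoc pre (y ∷ []) _)) ⟨
      altM n ((pre ++ y ∷ []) ++ xs ++ x ∷ post) ≈⟨ altM-rotate (pre ++ y ∷ []) xs x post (≡.trans (≡.cong length (++-assoc pre (y ∷ []) _)) e) ⟩
      ε (length xs) * altM n ((pre ++ y ∷ []) ++ x ∷ xs ++ post) ≈⟨ *-congˡ (reflexive (≡.cong (altM n) (++-assoc pre (y ∷ []) _))) ⟩
      ε (length xs) * altM n (pre ++ y ∷ x ∷ xs ++ post) ≈⟨ *-congˡ (AltM.alt-++ pre x y (xs ++ post) lx z≤n (≡.subst (suc (length pre) ℕ.<_) (≡.trans (≡.sym lpre) lx) (s≤s (s≤s (ℕₚ.m≤m+n _ _))))) ⟩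
      ε (length xs) * - altM n (pre ++ x ∷ y ∷ xs ++ post) ≈⟨ solve 2 (λ a b → a :* (:- b) := (:- :1) :* a :* b) refl _ _ ⟩
      ε (suc (length xs)) * altM n (pre ++ x ∷ y ∷ xs ++ post) ∎
      where
      lpre : length (pre ++ x ∷ y ∷ xs ++ post) ≡ suc (suc (length pre ℕ.+ length (xs ++ post)))
      lpre = ≡.trans (length-++ pre) (≡.trans (ℕₚ.+-suc _ _) (≡.cong suc (ℕₚ.+-suc _ _)))
      lx : length (pre ++ x ∷ y ∷ xs ++ post) ≡ n
      lx = ≡.trans (≡.trans (length-++ pre) (≡.trans (≡.cong (λ z → length pre ℕ.+ suc z) (≡.trans (≡.cong suc (length-++ xs)) (≡.trans (≡.sym (ℕₚ.+-suc (length xs) _)) (≡.sym (length-++ xs))))) (≡.sym (length-++ pre)))) e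

    altM-reverse : ∀ k pre → length pre ℕ.+ k ≡ n → altM n (pre ++ upTo k) ≈ prodN k ε * altM n (pre ++ downFrom k)
    altM-reverse zero pre e = sym (*-identityˡ _)
    altM-reverse (suc k) pre e = begin
      altM n (pre ++ upTo (suc k)) ≈⟨ reflexive (≡.cong (λ z → altM n (pre ++ z)) (≡.sym (applyUpTo-∷ʳ id k))) ⟩
      altM n (pre ++ upTo k ++ k ∷ []) ≈⟨ altM-rotate pre (upTo k) k [] (≡.trans (length-++ pre) (≡.trans (≡.cong (length pre ℕ.+_) (≡.trans (length-++ (upTo k)) (≡.trans (≡.cong (ℕ._+ 1) (length-upTo k)) (ℕₚ.+-comm k 1)))) e)) ⟩
      ε (length (upTo k)) * altM n (pre ++ k ∷ upTo k ++ []) ≈⟨ *-cong (reflexive (≡.cong ε (length-upTo k))) (reflexive (≡.cong (altM n) (≡.trans (≡.cong (λ z → pre ++ k ∷ z) (++-identityʳ (upTo k))) (≡.sym (++-assoc pre (k ∷ []) _))))) ⟩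
      ε k * altM n ((pre ++ k ∷ []) ++ upTo k) ≈⟨ *-congˡ (altM-reverse k (pre ++ k ∷ []) (≡.trans (≡.cong (ℕ._+ k) (≡.trans (length-++ pre) (ℕₚ.+-comm _ 1))) (≡.trans (≡.sym (ℕₚ.+-suc (length pre) k)) e))) ⟩
      ε k * (prodN k ε * altM n ((pre ++ k ∷ []) ++ downFrom k)) ≈⟨ *-congˡ (*-congˡ (reflexive (≡.cong (altM n) (++-assoc pre (k ∷ []) _)))) ⟩
      ε k * (prodN k ε * altM n (pre ++ downFrom (suc k))) ≈⟨ solve 3 (λ a b c → a :* (b :* c) := b :* a :* c) refl _ _ _ ⟩
      prodN k ε * ε k * altM n (pre ++ downFrom (suc k)) ≈⟨ *-congʳ (Prod.bigN-snoc k ε) ⟨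
      prodN (suc k) ε * altM n (pre ++ downFrom (suc k)) ∎

    sumL-perms-ind : ∀ xs (H : List ℕ → Carrier) → Unique xs → sumL (perms xs) (λ σ → H σ * ind xs σ) ≈ H xs
    sumL-perms-ind [] H _ = trans (+-identityʳ _) (trans (*-congˡ (ind-≡ {[]} ≡.refl)) (*-identityʳ _))
    sumL-perms-ind (a ∷ xs) H (a∉ ∷ uxs) = begin
      sumL (perms (a ∷ xs)) G ≈⟨ sumL-perms a xs G ⟩
      sumL (perms xs) (λ σ → G (a ∷ σ)) + sumN (length xs) (λ j → sumL (perms xs) (λ σ → G (insAt (suc j) a σ)))
        ≈⟨ +-cong (Sum.big-cong (perms xs) (λ σ → *-congˡ (ind-∷ σ)))
            (Sum.bigN-ε (length xs) λ j j<m → trans (Sum.big-cong-All {xs = perms xs} (All.map (λ {σ} p → later j σ j<m p) (perms-↭ xs))) (Sum.big-ε (perms xs) (λ _ → refl))) ⟩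
      sumL (perms xs) (λ σ → H (a ∷ σ) * ind xs σ) + 0# ≈⟨ trans (+-identityʳ _) (sumL-perms-ind xs (H ∘ (a ∷_)) uxs) ⟩
      H (a ∷ xs) ∎
      where
      open import Data.List.Properties using (≡-dec; ∷-injectiveˡ; ∷-injectiveʳ)
      G : List ℕ → Carrier
      G σ = H σ * ind (a ∷ xs) σ
      ind-∷ : ∀ σ → ind (a ∷ xs) (a ∷ σ) ≈ ind xs σ
      ind-∷ σ = byDec (≡-dec ℕ._≟_ xs σ)
        where
        byDec : Dec (xs ≡ σ) → ind (a ∷ xs) (a ∷ σ) ≈ ind xs σ
        byDec (yes e) = trans (ind-≡ (≡.cong (a ∷_) e)) (sym (ind-≡ e))
        byDec (no ne) = trans (ind-≢ {a ∷ xs} {a ∷ σ} (ne ∘ ∷-injectiveʳ)) (sym (ind-≢ ne))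
      later : ∀ j σ → j ℕ.< length xs → σ ↭ xs → G (insAt (suc j) a σ) ≈ 0#
      later j [] j<m p = ⊥-elim (ℕₚ.n≮0 (≡.subst (j ℕ.<_) (≡.sym (Permₚ.↭-length p)) j<m))
      later j (b ∷ σ) _ p = trans (*-congˡ (ind-≢ λ e → All.lookup a∉ (Permₚ.∈-resp-↭ p (here ≡.refl)) (∷-injectiveˡ e))) (zeroʳ _)
        where open import Data.List.Relation.Unary.Any using (here)

    altM-downFrom : altM n (downFrom n) ≈ 1#
    altM-downFrom = begin
      sumL (perms (upTo n)) (λ σ → sgn σ * ind (downFrom n) (actL n σ (downFrom n)))
        ≈⟨ Sum.big-cong-All {xs = perms (upTo n)} (All.map (λ {σ} p → *-congˡ (byDec σ p (≡-dec ℕ._≟_ (upTo n) σ))) (perms-↭ (upTo n))) ⟩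
      sumL (perms (upTo n)) (λ σ → sgn σ * ind (upTo n) σ) ≈⟨ sumL-perms-ind (upTo n) sgn (upTo-unique n) ⟩
      sgn (upTo n) ≈⟨ reflexive (≡.cong ε (len-upTo n)) ⟩
      1# ∎
      where
      open import Data.List.Properties using (≡-dec)
      byDec : ∀ σ → σ ↭ upTo n → Dec (upTo n ≡ σ) → ind (downFrom n) (actL n σ (downFrom n)) ≈ ind (upTo n) σ
      byDec σ p (yes ≡.refl) = trans (ind-≡ {downFrom n} (≡.sym (actL-upTo n (downFrom n) (length-downFrom n)))) (sym (ind-≡ {upTo n} ≡.refl))
      byDec σ p (no ne) = trans (ind-≢ λ e → ne (≡.sym (actL-fixes n σ p (≡.sym e)))) (sym (ind-≢ ne))

    Λ≈ev : ∀ p → WF n p → Λ p ≈ ev (replicate n 0) (p *P P)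
    Λ≈ev p wp = trans (pair-Ψˢ p (replicate n 0)) (pair-congᵀ (WF-* p P wp WF-P) λ α lα → reflexive (altV-WF (replicate n 0 ⊕ α) (length-⊕ (replicate n 0) α (length-replicate n) lα)))

    ε² : ∀ k → ε k * ε k ≈ 1#
    ε² k = trans (sym (pow-* (- 1#) (- 1#) k)) (trans (pow-cong k (solve 0 ((:- :1) :* (:- :1) := :1) refl)) (pow-1 k))

    Λ-vars : ∀ m → n ≡ suc m → ε m * Λ (TT.prodN m (λ i → varP n (suc i))) ≈ 1#
    Λ-vars m e = begin
      ε m * Λ V ≈⟨ *-congˡ (trans (Λ≈ev V wV) (ev-cong 0s (WF-* V P wV WF-P) (WF-* V (Triangular.rows n) wV wR) (T.*-congˡ {V} (T.trans farProd≋columns (Triangular.columns≈rows n))))) ⟩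
      ε m * ev 0s (V *P Triangular.rows n) ≈⟨ *-congˡ (ev-vars m 1 0s (Triangular.rows n) wR) ⟩
      ε m * ev (addUnits 0s 1 m) (Triangular.rows n) ≈⟨ *-congˡ (reflexive (≡.cong (λ v → ev v (Triangular.rows n)) (≡.trans (≡.cong (λ v → addUnits v 1 m) 0s≡) (addUnits-minVec 0 m (≡.sym e))))) ⟩
      ε m * ev (minVec 1) (Triangular.rows n) ≈⟨ *-congˡ (ev-rows n 0 ≡.refl) ⟩
      ε m * (prodN n (λ a → ε (n ℕ.∸ (2 ℕ.+ a))) * altM n (upTo n)) ≈⟨ *-congˡ (*-cong signs (trans (altM-reverse n [] ≡.refl) (trans (*-congˡ altM-downFrom) (*-identityʳ _)))) ⟩
      ε m * (prodN m ε * prodN n ε) ≈⟨ *-congˡ (*-congˡ (trans (reflexive (≡.cong (λ z → prodN z ε) e)) (Prod.bigN-snoc m ε))) ⟩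
      ε m * (prodN m ε * (prodN m ε * ε m)) ≈⟨ solve 2 (λ a b → a :* (b :* (b :* a)) := (b :* b) :* (a :* a)) refl (ε m) (prodN m ε) ⟩
      (prodN m ε * prodN m ε) * (ε m * ε m) ≈⟨ *-cong (trans (sym (Prod.bigN-∙ m ε ε)) (Prod.bigN-ε m (λ i _ → ε² i))) (ε² m) ⟩
      1# * 1# ≈⟨ *-identityˡ 1# ⟩
      1# ∎
      where
      V : Pol
      V = TT.prodN m (λ i → varP n (suc i))
      wV : WF n V
      wV = WF-prodN m _ (λ i → WF-var (suc i))
      wR : WF n (Triangular.rows n)
      wR = WF-prodN n _ WF-row′
      0s : List ℕ
      0s = replicate n 0
      0s≡ : 0s ≡ minVec 0
      0s≡ = at-ext _ _ (≡.trans (length-replicate n) (≡.sym (length-minVec 0))) λ k k<′ → let k<n = ≡.subst (k ℕ.<_) (length-replicate n) k<′ in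
        ≡.trans (at-replicate n k) (≡.sym (≡.trans (at-minVec 0 k k<n) (ℕₚ.⊓-zeroʳ k)))
        where
        at-replicate : ∀ n k → at (replicate n 0) k ≡ 0
        at-replicate zero k = ≡.refl
        at-replicate (suc n) zero = ≡.refl
        at-replicate (suc n) (suc k) = at-replicate n k
      signs : prodN n (λ a → ε (n ℕ.∸ (2 ℕ.+ a))) ≈ prodN m ε
      signs = begin
        prodN n (λ a → ε (n ℕ.∸ (2 ℕ.+ a))) ≈⟨ reflexive (≡.cong (λ z → prodN z (λ a → ε (z ℕ.∸ (2 ℕ.+ a)))) e) ⟩
        prodN (suc m) (λ a → ε (m ℕ.∸ suc a)) ≈⟨ Prod.bigN-snoc m (λ a → ε (m ℕ.∸ suc a)) ⟩
        prodN m (λ a → ε (m ℕ.∸ suc a)) * ε (m ℕ.∸ suc m) ≈⟨ *-cong (Prod.bigN-reverse m ε) (reflexive (≡.cong ε (ℕₚ.m≤n⇒m∸n≡0 (ℕₚ.n≤1+n m)))) ⟩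
        prodN m ε * 1# ≈⟨ *-identityʳ _ ⟩
        prodN m ε ∎

  module DividedDifferences (n : ℕ) where
    open CommutativeRing R
    open RingTools R
    open Poly R
    open Universal n
    open Relation.Binary.Reasoning.Setoid setoid

    at-unit⊕ : ∀ i α k → length α ≡ n → k ℕ.< n → at (unitVec n i ⊕ α) k ≡ (if k ≡ᵇ i then 1 else 0) ℕ.+ at α k
    at-unit⊕ i α k lα k<n = ≡.trans (at-⊕ (unitVec n i) α k (≡.subst (k ℕ.<_) (≡.sym (length-unitVec n i)) k<n) (≡.subst (k ℕ.<_) (≡.sym lα) k<n))
      (≡.cong (ℕ._+ at α k) (at-map-upTo n _ k k<n))

    unit⊕ : ∀ i α → length α ≡ n → i ℕ.< n → unitVec n i ⊕ α ≡ suc-setAt i α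
    unit⊕ i α lα i<n = at-ext _ _ (≡.trans lu (≡.sym (≡.trans (length-setAt i _ α) lα))) λ k k<′ → pointwise k (≡.subst (k ℕ.<_) lu k<′)
      where
      lu : length (unitVec n i ⊕ α) ≡ n
      lu = length-⊕ (unitVec n i) α (length-unitVec n i) lα
      pointwise : ∀ k → k ℕ.< n → at (unitVec n i ⊕ α) k ≡ at (suc-setAt i α) k
      pointwise k k<n with k ℕ.≟ i
      ... | yes ≡.refl = ≡.trans (at-unit⊕ i α k lα k<n) (≡.trans (≡.cong (λ b → (if b then 1 else 0) ℕ.+ at α k) (≡ᵇ-true k)) (≡.sym (at-setAt k _ α (≡.subst (k ℕ.<_) (≡.sym lα) k<n))))
      ... | no ne = ≡.trans (at-unit⊕ i α k lα k<n) (≡.trans (≡.cong (λ b → (if b then 1 else 0) ℕ.+ at α k) (≡ᵇ-false ne)) (≡.sym (at-setAt-≢ i k _ α (ne ∘ ≡.sym))))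

    setAt-comm : ∀ i j v w α → i ≢ j → setAt i v (setAt j w α) ≡ setAt j w (setAt i v α)
    setAt-comm i j v w [] ne = ≡.refl
    setAt-comm zero zero v w (a ∷ α) ne = ⊥-elim (ne ≡.refl)
    setAt-comm zero (suc j) v w (a ∷ α) ne = ≡.refl
    setAt-comm (suc i) zero v w (a ∷ α) ne = ≡.refl
    setAt-comm (suc i) (suc j) v w (a ∷ α) ne = ≡.cong (a ∷_) (setAt-comm i j v w α (ne ∘ ≡.cong suc))

    module TwoVars (i j : ℕ) (i≢j : i ≢ j) (i<n : i ℕ.< n) (j<n : j ℕ.< n) where

      Dif : Pol
      Dif = varP n i ++ (-P varP n j)

      WF-Dif : WF n Dif
      WF-Dif = Allₚ.++⁺ (WF-var i) (Terms--P (WF-var j))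

      pair-Dif : ∀ p ψ → pair (Dif *P p) ψ ≈ pair p (λ α → ψ (unitVec n i ⊕ α) + - ψ (unitVec n j ⊕ α))
      pair-Dif p ψ = begin
        pair (Dif *P p) ψ ≈⟨ pair-* Dif p ψ ⟩
        1# * pair p (λ α → ψ (unitVec n i ⊕ α)) + (- 1# * pair p (λ α → ψ (unitVec n j ⊕ α)) + 0#)
          ≈⟨ solve 2 (λ a b → :1 :* a :+ ((:- :1) :* b :+ :0) := a :- b) refl _ _ ⟩
        pair p (λ α → ψ (unitVec n i ⊕ α)) + - pair p (λ α → ψ (unitVec n j ⊕ α)) ≈⟨ +-congˡ (pair--ʳ p _) ⟨
        pair p (λ α → ψ (unitVec n i ⊕ α)) + pair p (λ α → - ψ (unitVec n j ⊕ α)) ≈⟨ pair-+ʳ p _ _ ⟨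
        pair p (λ α → ψ (unitVec n i ⊕ α) + - ψ (unitVec n j ⊕ α)) ∎

      spread : List ℕ → ℕ → List ℕ
      spread α m = setAt i m (setAt j (at α j ℕ.+ (at α i ℕ.∸ m)) α)

      len-spread : ∀ α m → length (spread α m) ≡ length α
      len-spread α m = ≡.trans (length-setAt i m (setAt j (at α j ℕ.+ (at α i ℕ.∸ m)) α)) (length-setAt j _ α)

      module _ (α : List ℕ) (lα : length α ≡ n) where
        i<α : i ℕ.< length α
        i<α = ≡.subst (i ℕ.<_) (≡.sym lα) i<n
        j<α : j ℕ.< length α
        j<α = ≡.subst (j ℕ.<_) (≡.sym lα) j<n

        spread-top : spread α (at α i) ≡ α
        spread-top = ≡.trans (≡.cong (λ z → setAt i (at α i) (setAt j z α)) (≡.trans (≡.cong (at α j ℕ.+_) (ℕₚ.n∸n≡0 (at α i))) (ℕₚ.+-identityʳ _)))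
          (≡.trans (≡.cong (setAt i (at α i)) (setAt-at j α)) (setAt-at i α))

        unit-i⊕quoM : ∀ m → m ℕ.< at α i → unitVec n i ⊕ quoM i j α m ≡ spread α (suc m)
        unit-i⊕quoM m m<a = ≡.trans (unit⊕ i _ (≡.trans (length-quoM i j α m) lα) i<n)
          (≡.trans (≡.cong (λ z → setAt i (suc z) (quoM i j α m)) (at-setAt i m β i<β)) (≡.trans (setAt-setAt i (suc m) m β)
            (≡.cong (λ z → setAt i (suc m) (setAt j (at α j ℕ.+ z) α)) (ℕₚ.∸-+-assoc (at α i) 1 m))))
          where
          β : List ℕ
          β = setAt j (at α j ℕ.+ (at α i ℕ.∸ 1 ℕ.∸ m)) α
          i<β : i ℕ.< length β
          i<β = ≡.subst (i ℕ.<_) (≡.sym (length-setAt j _ α)) i<α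

        unit-j⊕quoM : ∀ m → m ℕ.< at α i → unitVec n j ⊕ quoM i j α m ≡ spread α m
        unit-j⊕quoM m m<a = ≡.trans (unit⊕ j _ (≡.trans (length-quoM i j α m) lα) j<n)
          (≡.trans (≡.cong (λ z → setAt j (suc z) (quoM i j α m)) (≡.trans (at-setAt-≢ i j m β i≢j) (at-setAt j v α j<α)))
          (≡.trans (≡.sym (setAt-comm i j m (suc v) β i≢j)) (≡.cong (setAt i m) (≡.trans (setAt-setAt j (suc v) v α)
            (≡.cong (λ z → setAt j z α) (≡.trans (≡.sym (ℕₚ.+-suc (at α j) _)) (≡.cong (at α j ℕ.+_) (e (at α i) m<a))))))))
          where
          v : ℕ
          v = at α j ℕ.+ (at α i ℕ.∸ 1 ℕ.∸ m)
          β : List ℕ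
          β = setAt j v α
          e : ∀ a → m ℕ.< a → suc (a ℕ.∸ 1 ℕ.∸ m) ≡ a ℕ.∸ m
          e (suc a) (s≤s m≤a) = ≡.sym (ℕₚ.+-∸-assoc 1 m≤a)

        quoM-unit-i : ∀ m → quoM i j (unitVec n i ⊕ α) m ≡ spread α m
        quoM-unit-i m = ≡.trans (≡.cong (λ z → quoM i j z m) (unit⊕ i α lα i<n))
          (≡.trans (≡.cong₂ (λ z w → setAt i m (setAt j (z ℕ.+ (w ℕ.∸ 1 ℕ.∸ m)) (suc-setAt i α))) (at-setAt-≢ i j _ α i≢j) (at-setAt i _ α i<α))
          (≡.trans (≡.cong (setAt i m) (≡.sym (setAt-comm i j _ _ α i≢j))) (setAt-setAt i m _ _)))

        quoM-unit-j : ∀ m → m ℕ.< at α i → quoM i j (unitVec n j ⊕ α) m ≡ spread α m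
        quoM-unit-j m m<a = ≡.trans (≡.cong (λ z → quoM i j z m) (unit⊕ j α lα j<n))
          (≡.trans (≡.cong₂ (λ z w → setAt i m (setAt j (z ℕ.+ (w ℕ.∸ 1 ℕ.∸ m)) (suc-setAt j α))) (at-setAt j _ α j<α) (at-setAt-≢ j i _ α (i≢j ∘ ≡.sym)))
          (≡.cong (setAt i m) (≡.trans (setAt-setAt j _ _ α) (≡.cong (λ z → setAt j z α) (≡.trans (≡.sym (ℕₚ.+-suc (at α j) _)) (≡.cong (at α j ℕ.+_) (e (at α i) m<a)))))))
          where
          e : ∀ a → m ℕ.< a → suc (a ℕ.∸ 1 ℕ.∸ m) ≡ a ℕ.∸ m
          e (suc a) (s≤s m≤a) = ≡.sym (ℕₚ.+-∸-assoc 1 m≤a)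

      telescope : ∀ a (g : ℕ → Carrier) → sumN a (λ m → g (suc m) + - g m) ≈ g a + - g 0
      telescope zero g = sym (-‿inverseʳ _)
      telescope (suc a) g = trans (+-congˡ (telescope a (g ∘ suc))) (solve 3 (λ x y z → x :- y :+ (z :- x) := z :- y) refl _ _ _)

      pair-Dif-quoP : ∀ p ψ → WF n p → pair (Dif *P quoP i j p) ψ ≈ pair p (λ α → ψ α + - ψ (spread α 0))
      pair-Dif-quoP p ψ wp = trans (pair-Dif (quoP i j p) ψ) (trans (pair-quoP i j p _) (pair-congᵀ wp λ α lα →
        trans (Sum.bigN-cong (at α i) (λ m m<a → +-cong (reflexive (≡.cong ψ (unit-i⊕quoM α lα m m<a))) (-‿cong (reflexive (≡.cong ψ (unit-j⊕quoM α lα m m<a))))))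
        (trans (telescope (at α i) (ψ ∘ spread α)) (+-congʳ (reflexive (≡.cong ψ (spread-top α lα)))))))

      quoP-Dif : ∀ p → WF n p → quoP i j (Dif *P p) ≋ p
      quoP-Dif p wp = mk≋ λ ψ → trans (pair-quoP i j (Dif *P p) (Ψᵀ ψ)) (trans (pair-Dif p _) (pair-congᵀ wp λ α lα → term (Ψᵀ ψ) α lα))
        where
        term : ∀ (ψ : Functional) α → length α ≡ n → sumN (at (unitVec n i ⊕ α) i) (λ m → ψ (quoM i j (unitVec n i ⊕ α) m))
          + - sumN (at (unitVec n j ⊕ α) i) (λ m → ψ (quoM i j (unitVec n j ⊕ α) m)) ≈ ψ α
        term ψ α lα = begin
          sumN (at (unitVec n i ⊕ α) i) (λ m → ψ (quoM i j (unitVec n i ⊕ α) m)) + - sumN (at (unitVec n j ⊕ α) i) (λ m → ψ (quoM i j (unitVec n j ⊕ α) m))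
            ≈⟨ +-cong (reflexive (≡.cong (λ z → sumN z (λ m → ψ (quoM i j (unitVec n i ⊕ α) m))) (≡.trans (≡.cong (λ v → at v i) (unit⊕ i α lα i<n)) (at-setAt i _ α (i<α α lα)))))
                 (-‿cong (reflexive (≡.cong (λ z → sumN z (λ m → ψ (quoM i j (unitVec n j ⊕ α) m))) (≡.trans (≡.cong (λ v → at v i) (unit⊕ j α lα j<n)) (at-setAt-≢ j i _ α (i≢j ∘ ≡.sym)))))) ⟩
          sumN (suc a) (λ m → ψ (quoM i j (unitVec n i ⊕ α) m)) + - sumN a (λ m → ψ (quoM i j (unitVec n j ⊕ α) m))
            ≈⟨ +-cong (Sum.bigN-cong (suc a) (λ m _ → reflexive (≡.cong ψ (quoM-unit-i α lα m)))) (-‿cong (Sum.bigN-cong a (λ m m<a → reflexive (≡.cong ψ (quoM-unit-j α lα m m<a))))) ⟩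
          sumN (suc a) (ψ ∘ spread α) + - sumN a (ψ ∘ spread α) ≈⟨ +-congʳ (Sum.bigN-snoc a (ψ ∘ spread α)) ⟩
          sumN a (ψ ∘ spread α) + ψ (spread α a) + - sumN a (ψ ∘ spread α) ≈⟨ solve 2 (λ x y → x :+ y :- x := y) refl _ _ ⟩
          ψ (spread α a) ≈⟨ reflexive (≡.cong ψ (spread-top α lα)) ⟩
          ψ α ∎
          where
          a : ℕ
          a = at α i

      quoP-cong : ∀ {p r} → WF n p → WF n r → p ≋ r → quoP i j p ≋ quoP i j r
      quoP-cong {p} {r} wp wr e = mk≋ λ ψ → trans (pair-quoP i j p _) (trans (≋⇒pairᵂ _ wp wr e) (sym (pair-quoP i j r _)))

      Dif-cancel : ∀ {p r} → WF n p → WF n r → (Dif *P p) ≋ (Dif *P r) → p ≋ r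
      Dif-cancel {p} {r} wp wr e = T.trans (T.sym (quoP-Dif p wp)) (T.trans (quoP-cong (WF-* Dif p WF-Dif wp) (WF-* Dif r WF-Dif wr) e) (quoP-Dif r wr))

    Dif : ℕ → ℕ → Pol
    Dif i j = varP n i ++ (-P varP n j)

    swapVars-Dif : ∀ k (k<n : suc k ℕ.< n) i j → swapVars k (Dif i j) ≡ Dif (transpose k i) (transpose k j)
    swapVars-Dif k k<n i j = ≡.trans (swapVars-++ k k<n (varP n i) (-P varP n j)) (≡.cong₂ _++_ (swapVars-var k k<n i)
      (≡.trans (swapVars-neg k k<n (varP n j)) (≡.cong -P_ (swapVars-var k k<n j))))

    WF--P : ∀ {p} → WF n p → WF n (-P p)
    WF--P w = Terms--P w

    WF-++ : ∀ {p r} → WF n p → WF n r → WF n (p ++ r)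
    WF-++ = Allₚ.++⁺

    WF-∂ : ∀ i f → WF n f → WF n (∂ i f)
    WF-∂ i f wf = WF-quoP i (suc i) n _ (WF-++ wf (WF--P (WF-swapVars i f wf)))

    module _ (i : ℕ) (i<n : suc i ℕ.< n) where
      private
        module TV = TwoVars i (suc i) (λ e → ℕₚ.1+n≢n (≡.sym e)) (ℕₚ.<-trans ℕₚ.≤-refl i<n) i<n

      ∂-cong : ∀ {f g} → WF n f → WF n g → f ≋ g → ∂ i f ≋ ∂ i g
      ∂-cong {f} {g} wf wg e = TV.quoP-cong (WF-++ wf (WF--P (WF-swapVars i f wf))) (WF-++ wg (WF--P (WF-swapVars i g wg)))
        (T.+-cong {f} {g} e (T.-‿cong (swapVars-cong i i<n e)))

      Dif-∂ : ∀ f → WF n f → (Dif i (suc i) *P ∂ i f) ≋ (f ++ (-P swapVars i f))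
      Dif-∂ f wf = mk≋ λ ψ → let φ = Ψᵀ ψ in begin
        pair (Dif i (suc i) *P ∂ i f) φ ≈⟨ TV.pair-Dif-quoP _ φ (WF-++ wf (WF--P (WF-swapVars i f wf))) ⟩
        pair (f ++ (-P swapVars i f)) (λ α → φ α + - φ (TV.spread α 0)) ≈⟨ pair-+ʳ (f ++ (-P swapVars i f)) φ _ ⟩
        pair (f ++ (-P swapVars i f)) φ + pair (f ++ (-P swapVars i f)) (λ α → - φ (TV.spread α 0))
          ≈⟨ +-congˡ (trans (pair-++ f _ _) (trans (+-congˡ (trans (pair-neg (swapVars i f) _) (-‿cong (trans (pair-swapVars i f _)
              (pair-congᵀ wf λ α lα → -‿cong (reflexive (≡.cong φ (spread-swap α lα)))))))) (-‿inverseʳ _))) ⟩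
        pair (f ++ (-P swapVars i f)) φ + 0# ≈⟨ +-identityʳ _ ⟩
        pair (f ++ (-P swapVars i f)) φ ∎
        where
        spread-swap : ∀ α → length α ≡ n → TV.spread (swapAt i α) 0 ≡ TV.spread α 0
        spread-swap α lα = at-ext _ _ (≡.trans (TV.len-spread (swapAt i α) 0) (≡.trans (length-swapAt i α) (≡.sym (TV.len-spread α 0)))) λ k _ → pointwise k
          where
          i<α : suc i ℕ.< length α
          i<α = ≡.subst (suc i ℕ.<_) (≡.sym lα) i<n
          v : List ℕ → ℕ
          v β = at β (suc i) ℕ.+ (at β i ℕ.∸ 0)
          lowered : List ℕ → List ℕ
          lowered β = setAt (suc i) (v β) β
          at-i : ∀ β → length β ≡ length α → at (TV.spread β 0) i ≡ 0
          at-i β e = at-setAt i 0 (lowered β) (≡.subst (i ℕ.<_) (≡.sym (≡.trans (length-setAt (suc i) (v β) β) e)) (ℕₚ.<-trans ℕₚ.≤-refl i<α))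
          at-j : ∀ β → length β ≡ length α → at (TV.spread β 0) (suc i) ≡ v β
          at-j β e = ≡.trans (at-setAt-≢ i (suc i) 0 (lowered β) (λ e → ℕₚ.1+n≢n (≡.sym e))) (at-setAt (suc i) (v β) β (≡.subst (suc i ℕ.<_) (≡.sym e) i<α))
          at-k : ∀ β k → k ≢ i → k ≢ suc i → at (TV.spread β 0) k ≡ at β k
          at-k β k n1 n2 = ≡.trans (at-setAt-≢ i k 0 (lowered β) (n1 ∘ ≡.sym)) (at-setAt-≢ (suc i) k (v β) β (n2 ∘ ≡.sym))
          pointwise : ∀ k → at (TV.spread (swapAt i α) 0) k ≡ at (TV.spread α 0) k
          pointwise k with k ℕ.≟ i | k ℕ.≟ suc i
          ... | yes ≡.refl | _ = ≡.trans (at-i (swapAt i α) (length-swapAt i α)) (≡.sym (at-i α ≡.refl))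
          ... | no _ | yes ≡.refl = ≡.trans (at-j (swapAt i α) (length-swapAt i α)) (≡.trans (≡.trans (≡.cong₂ ℕ._+_ (at-swapAt-snd i α i<α) (at-swapAt-fst i α i<α)) (ℕₚ.+-comm (at α i) _)) (≡.sym (at-j α ≡.refl)))
          ... | no n1 | no n2 = ≡.trans (at-k (swapAt i α) k n1 n2) (≡.trans (at-swapAt-other i k α n1 n2) (≡.sym (at-k α k n1 n2)))

      ∂-Dif : ∀ p f → WF n p → WF n f → (f ++ (-P swapVars i f)) ≋ (Dif i (suc i) *P p) → ∂ i f ≋ p
      ∂-Dif p f wp wf e = T.trans (TV.quoP-cong (WF-++ wf (WF--P (WF-swapVars i f wf))) (WF-* _ p TV.WF-Dif wp) e) (TV.quoP-Dif p wp)

      Dif-cancel-adj : ∀ {p r} → WF n p → WF n r → (Dif i (suc i) *P p) ≋ (Dif i (suc i) *P r) → p ≋ r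
      Dif-cancel-adj = TV.Dif-cancel

  module Braid (n : ℕ) where
    open Poly R
    open Universal n
    open DividedDifferences n
    open TwistedDerivations T (WF n) WF-* WF-++ WF--P

    WF-Dif : ∀ i j → WF n (Dif i j)
    WF-Dif i j = WF-++ (WF-var i) (WF--P (WF-var j))

    Dif-+ : ∀ i j k → Dif i k ≋ Dif i j ++ Dif j k
    Dif-+ i j k = telescope (varP n i) (varP n j) (varP n k)

    transposed-Dif : ∀ k (k<n : suc k ℕ.< n) i j {i′ j′} → transpose k i ≡ i′ → transpose k j ≡ j′ → swapVars k (Dif i j) ≋ Dif i′ j′
    transposed-Dif k k<n i j ≡.refl ≡.refl = T.reflexive (swapVars-Dif k k<n i j)

    twisted : ∀ i → suc i ℕ.< n → Twisted (swapVars i) (∂ i) (Dif i (suc i))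
    twisted i i<n = record
      { W-s = λ {f} → WF-swapVars i f
      ; W-∂ = λ {f} → WF-∂ i f
      ; W-a = WF-Dif i (suc i)
      ; s-cong = swapVars-cong i i<n
      ; s-- = λ f g → T.reflexive (≡.trans (swapVars-++ i i<n f (-P g)) (≡.cong (swapVars i f ++_) (swapVars-neg i i<n g)))
      ; s-* = swapVars-* i i<n
      ; s-involutive = λ f → T.reflexive (swapVars-involutive i i<n f)
      ; s-a = T.trans (transposed-Dif i i<n i (suc i) (transpose-fst i) (transpose-snd i)) (anticommute (varP n i) (varP n (suc i)))
      ; a-∂ = Dif-∂ i i<n
      ; cancel = Dif-cancel-adj i i<n
      }

    transpose-far : ∀ i → transpose i (suc (suc i)) ≡ suc (suc i)
    transpose-far i = transpose-other i _ (λ e → ℕₚ.<⇒≢ (ℕₚ.m≤n⇒m≤1+n ℕₚ.≤-refl) (≡.sym e)) (λ e → ℕₚ.1+n≢n (ℕₚ.suc-injective e))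

    transpose-near : ∀ i → transpose (suc i) i ≡ i
    transpose-near i = transpose-other (suc i) i (λ e → ℕₚ.1+n≢n (≡.sym e)) (λ e → ℕₚ.<⇒≢ (ℕₚ.m≤n⇒m≤1+n ℕₚ.≤-refl) e)

    swapVars-braid : ∀ i f → suc (suc i) ℕ.< n → WF n f →
      swapVars i (swapVars (suc i) (swapVars i f)) ≡ swapVars (suc i) (swapVars i (swapVars (suc i) f))
    swapVars-braid i [] l [] = ≡.refl
    swapVars-braid i ((a , α) ∷ f) l (lα ∷ w) = ≡.cong₂ _∷_ (≡.cong (a ,_) (swapAt-braid i α (≡.subst (suc (suc i) ℕ.<_) (≡.sym lα) l))) (swapVars-braid i f l w)

    swapVars-comm : ∀ i j f → suc i ℕ.< j → swapVars i (swapVars j f) ≡ swapVars j (swapVars i f)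
    swapVars-comm i j [] l = ≡.refl
    swapVars-comm i j ((a , α) ∷ f) l = ≡.cong₂ _∷_ (≡.cong (a ,_) (swapAt-comm i j α l)) (swapVars-comm i j f l)

    ∂-braid : ∀ i → suc (suc i) ℕ.< n → ∀ f → WF n f → ∂ i (∂ (suc i) (∂ i f)) ≋ ∂ (suc i) (∂ i (∂ (suc i) f))
    ∂-braid i j<n f wf = braid (twisted i i<n) (twisted (suc i) j<n) (Dif i (suc (suc i))) (WF-Dif i (suc (suc i)))
      (TwoVars.Dif-cancel i (suc (suc i)) (ℕₚ.<⇒≢ (ℕₚ.m≤n⇒m≤1+n ℕₚ.≤-refl)) i<n′ j<n)
      (transposed-Dif (suc i) j<n i (suc i) (transpose-near i) (transpose-fst (suc i)))
      (transposed-Dif i i<n (suc i) (suc (suc i)) (transpose-snd i) (transpose-far i))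
      (transposed-Dif i i<n i (suc (suc i)) (transpose-fst i) (transpose-far i))
      (transposed-Dif (suc i) j<n i (suc (suc i)) (transpose-near i) (transpose-snd (suc i)))
      (Dif-+ i (suc i) (suc (suc i))) wf (T.reflexive (swapVars-braid i f j<n wf))
      where
      i<n : suc i ℕ.< n
      i<n = ℕₚ.<-trans ℕₚ.≤-refl j<n
      i<n′ : i ℕ.< n
      i<n′ = ℕₚ.<-trans ℕₚ.≤-refl i<n

    ∂-comm : ∀ i j → suc i ℕ.< j → suc j ℕ.< n → ∀ f → WF n f → ∂ i (∂ j f) ≋ ∂ j (∂ i f)
    ∂-comm i j i<j j<n f wf = commute (twisted i i<n) (twisted j j<n)
      (transposed-Dif j j<n i (suc i) (transpose-other j i (ℕₚ.<⇒≢ i<j′) (ℕₚ.<⇒≢ (ℕₚ.m<n⇒m<1+n i<j′)))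
        (transpose-other j (suc i) (ℕₚ.<⇒≢ i<j) (ℕₚ.<⇒≢ (ℕₚ.m<n⇒m<1+n i<j))))
      (transposed-Dif i i<n j (suc j) (transpose-other i j (λ e → ℕₚ.<⇒≢ i<j′ (≡.sym e)) (λ e → ℕₚ.<⇒≢ i<j (≡.sym e)))
        (transpose-other i (suc j) (λ e → ℕₚ.<⇒≢ (ℕₚ.m<n⇒m<1+n i<j′) (≡.sym e)) (λ e → ℕₚ.<⇒≢ (ℕₚ.m<n⇒m<1+n i<j) (≡.sym e))))
      wf (T.reflexive (swapVars-comm i j f i<j))
      where
      i<j′ : i ℕ.< j
      i<j′ = ℕₚ.<-trans ℕₚ.≤-refl i<j
      i<n : suc i ℕ.< n
      i<n = ℕₚ.<-trans i<j (ℕₚ.<-trans ℕₚ.≤-refl j<n)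

    ∂-square-zero : ∀ i → suc i ℕ.< n → ∀ f → WF n f → ∂ i (∂ i f) ≋ []
    ∂-square-zero i i<n f wf = Twisted.∂-square (twisted i i<n) [] wf

  module Schubert (n : ℕ) where
    open Poly R
    open Universal n
    open DividedDifferences n
    open Braid n
    open Relation.Binary.Reasoning.Setoid T.setoid

    swapAt-Unique : ∀ i {w} → Unique w → Unique (swapAt i w)
    swapAt-Unique i {w} u = Unique-resp-↭ (Perm.↭-sym (swapAt-↭ i w)) u

    schubF-just : ∀ f w i → firstAscent w ≡ just i → schubF (suc f) n w ≡ ∂ i (schubF f n (swapAt i w))
    schubF-just f w i e with firstAscent w
    schubF-just f w i ≡.refl | just .i = ≡.refl

    schubF-nothing : ∀ f w → firstAscent w ≡ nothing → schubF f n w ≡ schubW₀ n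
    schubF-nothing f w e with firstAscent w
    schubF-nothing f w ≡.refl | nothing = ≡.refl

    ascent-< : ∀ {w i} → length w ≡ n → Ascent i w → suc i ℕ.< n
    ascent-< e (l , _) = ≡.subst (suc _ ℕ.<_) e l

    len-ascent : ∀ {w i} → Ascent i w → len (swapAt i w) ≡ suc (len w)
    len-ascent {w} {i} (l , lt) = len-swapAt-ascent i w l lt

    ascent-bound : ∀ {w i} → length w ≡ n → Ascent i w → suc (len w) ℕ.≤ tri n
    ascent-bound {w} {i} e a = ≡.subst₂ ℕ._≤_ (len-ascent {w} a) (≡.cong tri (≡.trans (length-swapAt i w) e)) (len≤tri (swapAt i w))

    schubF-stable : ∀ f f′ w → length w ≡ n → tri n ℕ.≤ f ℕ.+ len w → tri n ℕ.≤ f′ ℕ.+ len w → schubF f n w ≡ schubF f′ n w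
    schubF-stable f f′ w lw b b′ = go f f′ b b′ (firstAscent w) ≡.refl
      where
      go : ∀ f f′ → tri n ℕ.≤ f ℕ.+ len w → tri n ℕ.≤ f′ ℕ.+ len w → ∀ m → firstAscent w ≡ m → schubF f n w ≡ schubF f′ n w
      go f f′ b b′ nothing e = ≡.trans (schubF-nothing f w e) (≡.sym (schubF-nothing f′ w e))
      go zero f′ b b′ (just i) e = ⊥-elim (ℕₚ.<⇒≱ (ascent-bound {w} {i} lw (firstAscent-just w i e)) b)
      go (suc f) zero b b′ (just i) e = ⊥-elim (ℕₚ.<⇒≱ (ascent-bound {w} {i} lw (firstAscent-just w i e)) b′)
      go (suc f) (suc f′) b b′ (just i) e = ≡.trans (schubF-just f w i e) (≡.trans (≡.cong (∂ i)
          (schubF-stable f f′ (swapAt i w) (≡.trans (length-swapAt i w) lw) (shift b) (shift b′))) (≡.sym (schubF-just f′ w i e)))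
        where
        shift : ∀ {f} → tri n ℕ.≤ suc f ℕ.+ len w → tri n ℕ.≤ f ℕ.+ len (swapAt i w)
        shift {f} b = ≡.subst (tri n ℕ.≤_) (≡.trans (≡.sym (ℕₚ.+-suc f (len w))) (≡.cong (f ℕ.+_) (≡.sym (len-ascent {w} (firstAscent-just w i e))))) b

    schubert-just : ∀ w i → length w ≡ n → firstAscent w ≡ just i → schubert w ≡ ∂ i (schubert (swapAt i w))
    schubert-just w i ≡.refl e = ≡.trans (schubF-stable (n ℕ.* n) (suc (n ℕ.* n)) w ≡.refl (ℕₚ.≤-trans (tri≤square n) (ℕₚ.m≤m+n _ _)) (ℕₚ.≤-trans (tri≤square n) (ℕₚ.m≤n⇒m≤1+n (ℕₚ.m≤m+n _ _))))
      (≡.trans (schubF-just (n ℕ.* n) w i e) (≡.cong (λ k → ∂ i (schubF (k ℕ.* k) k (swapAt i w))) (≡.sym (length-swapAt i w))))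

    schubert-nothing : ∀ w → length w ≡ n → firstAscent w ≡ nothing → schubert w ≡ schubW₀ n
    schubert-nothing w ≡.refl e = schubF-nothing (n ℕ.* n) w e

    Homog-∂ : ∀ i d f → suc i ℕ.< n → Homog n (suc d) f → Homog n d (∂ i f)
    Homog-∂ i d f i<n h = Homog-quoP i (suc i) n d _ (λ e → ℕₚ.1+n≢n (≡.sym e)) (ℕₚ.<-trans ℕₚ.≤-refl i<n) i<n (Allₚ.++⁺ h (Terms--P (swp f h)))
      where
      swp : ∀ f → Homog n (suc d) f → Homog n (suc d) (swapVars i f)
      swp [] [] = []
      swp ((a , α) ∷ f) ((lα , sα) ∷ h) = (≡.trans (length-swapAt i α) lα , ≡.trans (sum-swapAt i α) sα) ∷ swp f h

    Homog-schubF : ∀ f w → length w ≡ n → Unique w → Homog n (len w) (schubF f n w)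
    Homog-schubF f w lw u = go f (firstAscent w) ≡.refl
      where
      go : ∀ f m → firstAscent w ≡ m → Homog n (len w) (schubF f n w)
      go f nothing e = ≡.subst (Homog n (len w)) (≡.sym (schubF-nothing f w e))
        ((≡.trans (length-map _ (upTo n)) (length-upTo n) , ≡.trans (≡.cong sum (map-∸-upTo n)) (≡.sym (≡.trans (len-decreasing w u e) (≡.cong tri lw)))) ∷ [])
      go zero (just i) e with firstAscent w
      go zero (just i) ≡.refl | just .i = []
      go (suc f) (just i) e = ≡.subst (Homog n (len w)) (≡.sym (schubF-just f w i e)) (Homog-∂ i (len w) _ (ascent-< {w} lw (firstAscent-just w i e))
        (≡.subst (λ k → Homog n k (schubF f n (swapAt i w))) (len-ascent {w} (firstAscent-just w i e)) (Homog-schubF f (swapAt i w) (≡.trans (length-swapAt i w) lw) (swapAt-Unique i u))))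

    Homog-schubert : ∀ w → length w ≡ n → Unique w → Homog n (len w) (schubert w)
    Homog-schubert w ≡.refl u = Homog-schubF (n ℕ.* n) w ≡.refl u

    WF-schubert : ∀ w → length w ≡ n → Unique w → WF n (schubert w)
    WF-schubert w e u = Homog⇒WF (Homog-schubert w e u)

    record Arrangement (w : List ℕ) : Set where
      constructor mkArrangement
      field
        len≡ : length w ≡ n
        uniq : Unique w
    open Arrangement

    Arrangement-swapAt : ∀ i {w} → Arrangement w → Arrangement (swapAt i w)
    Arrangement-swapAt i {w} p = mkArrangement (≡.trans (length-swapAt i w) (len≡ p)) (swapAt-Unique i (uniq p))

    WFs : ∀ {w} → Arrangement w → WF n (schubert w)
    WFs {w} p = WF-schubert w (len≡ p) (uniq p)

    Good : List ℕ → Set (c ⊔ ℓ)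
    Good w = ∀ i → Ascent i w → schubert w ≋ ∂ i (schubert (swapAt i w))

    ascent-swapAt : ∀ i j w → transpose i j ≡ j → transpose i (suc j) ≡ suc j → suc i ℕ.< length w → Ascent j w → Ascent j (swapAt i w)
    ascent-swapAt i j w e e′ i<n (l , lt) = ≡.subst (suc j ℕ.<_) (≡.sym (length-swapAt i w)) l
      , ≡.subst₂ ℕ._<_ (≡.sym (≡.trans (at-swapAt i w j i<n) (≡.cong (at w) e))) (≡.sym (≡.trans (at-swapAt i w (suc j) i<n) (≡.cong (at w) e′))) lt

    far-fix : ∀ i j → suc i ℕ.< j → transpose i j ≡ j × transpose i (suc j) ≡ suc j
    far-fix i j l = transpose-other i j (λ e → ℕₚ.<⇒≢ (ℕₚ.<-trans ℕₚ.≤-refl l) (≡.sym e)) (λ e → ℕₚ.<⇒≢ l (≡.sym e))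
      , transpose-other i (suc j) (λ e → ℕₚ.<⇒≢ (ℕₚ.<-trans ℕₚ.≤-refl (ℕₚ.m<n⇒m<1+n l)) (≡.sym e)) (λ e → ℕₚ.<⇒≢ (ℕₚ.m<n⇒m<1+n l) (≡.sym e))

    far-fix′ : ∀ i j → suc i ℕ.< j → transpose j i ≡ i × transpose j (suc i) ≡ suc i
    far-fix′ i j l = transpose-other j i (ℕₚ.<⇒≢ (ℕₚ.<-trans ℕₚ.≤-refl l)) (ℕₚ.<⇒≢ (ℕₚ.<-trans ℕₚ.≤-refl (ℕₚ.m<n⇒m<1+n l)))
      , transpose-other j (suc i) (ℕₚ.<⇒≢ l) (ℕₚ.<⇒≢ (ℕₚ.m<n⇒m<1+n l))

    -- Both ways down from w s_i s_j to w agree, given the claim for longer permutations.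
    diamond-far : ∀ i j w → Arrangement w → suc i ℕ.< j → Ascent i w → Ascent j w → Good (swapAt i w) → Good (swapAt j w) →
      ∂ i (schubert (swapAt i w)) ≋ ∂ j (schubert (swapAt j w))
    diamond-far i j w p l ai aj gi gj = begin
      ∂ i (schubert (swapAt i w)) ≈⟨ ∂-cong i i<n (WFs pi) (WF-∂ j _ (WFs pij)) (gi j (ascent-swapAt i j w (proj₁ (far-fix i j l)) (proj₂ (far-fix i j l)) (proj₁ ai) aj)) ⟩
      ∂ i (∂ j (schubert (swapAt j (swapAt i w)))) ≈⟨ ∂-comm i j l j<n _ (WFs pij) ⟩
      ∂ j (∂ i (schubert (swapAt j (swapAt i w)))) ≡⟨ ≡.cong (λ z → ∂ j (∂ i (schubert z))) (swapAt-comm i j w l) ⟨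
      ∂ j (∂ i (schubert (swapAt i (swapAt j w)))) ≈⟨ ∂-cong j j<n (WFs pj) (WF-∂ i _ (WFs pji)) (gj i (ascent-swapAt j i w (proj₁ (far-fix′ i j l)) (proj₂ (far-fix′ i j l)) (proj₁ aj) ai)) ⟨
      ∂ j (schubert (swapAt j w)) ∎
      where
      i<n = ascent-< {w} (len≡ p) ai
      j<n = ascent-< {w} (len≡ p) aj
      pi = Arrangement-swapAt i p
      pj = Arrangement-swapAt j p
      pij = Arrangement-swapAt j pi
      pji = Arrangement-swapAt i pj

    diamond-near : ∀ i w → Arrangement w → Ascent i w → Ascent (suc i) w → (∀ v → Arrangement v → len w ℕ.< len v → Good v) →
      ∂ i (schubert (swapAt i w)) ≋ ∂ (suc i) (schubert (swapAt (suc i) w))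
    diamond-near i w p ai aj good = begin
      ∂ i (schubert wi) ≈⟨ ∂-cong i i<n (WFs pi) (WF-∂ j _ (WFs pij)) (good wi pi (longer {w} ai ℕₚ.≤-refl) j aj′) ⟩
      ∂ i (∂ j (schubert wij)) ≈⟨ ∂-cong i i<n (WF-∂ j _ (WFs pij)) (WF-∂ j _ (WF-∂ i _ (WFs piji))) (∂-cong j j<n (WFs pij) (WF-∂ i _ (WFs piji)) (good wij pij (longer {wi} aj′ (ℕₚ.<⇒≤ (longer {w} ai ℕₚ.≤-refl))) i ai″)) ⟩
      ∂ i (∂ j (∂ i (schubert wiji))) ≈⟨ ∂-braid i j<n _ (WFs piji) ⟩
      ∂ j (∂ i (∂ j (schubert wiji))) ≡⟨ ≡.cong (λ z → ∂ j (∂ i (∂ j (schubert z)))) (swapAt-braid i w (proj₁ aj)) ⟩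
      ∂ j (∂ i (∂ j (schubert wjij))) ≈⟨ ∂-cong j j<n (WF-∂ i _ (WFs pji)) (WF-∂ i _ (WF-∂ j _ (WFs pjij))) (∂-cong i i<n (WFs pji) (WF-∂ j _ (WFs pjij)) (good wji pji (longer {wj} ai′ (ℕₚ.<⇒≤ (longer {w} aj ℕₚ.≤-refl))) j aj″)) ⟨
      ∂ j (∂ i (schubert wji)) ≈⟨ ∂-cong j j<n (WFs pj) (WF-∂ i _ (WFs pji)) (good wj pj (longer {w} aj ℕₚ.≤-refl) i ai′) ⟨
      ∂ j (schubert wj) ∎
      where
      j : ℕ
      j = suc i
      wi wj wij wji wiji wjij : List ℕ
      wi = swapAt i w
      wj = swapAt j w
      wij = swapAt j wi
      wji = swapAt i wj
      wiji = swapAt i wij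
      wjij = swapAt j wji
      i<n = ascent-< {w} (len≡ p) ai
      j<n = ascent-< {w} (len≡ p) aj
      pi = Arrangement-swapAt i p
      pj = Arrangement-swapAt j p
      pij = Arrangement-swapAt j pi
      pji = Arrangement-swapAt i pj
      piji = Arrangement-swapAt i pij
      pjij = Arrangement-swapAt j pji
      longer : ∀ {v k} → Ascent k v → len w ℕ.≤ len v → len w ℕ.< len (swapAt k v)
      longer {v} a le = ≡.subst (len w ℕ.<_) (≡.sym (len-ascent {v} a)) (s≤s le)
      lw : ∀ {v} → Arrangement v → length v ≡ length w
      lw q = ≡.trans (len≡ q) (≡.sym (len≡ p))
      bi : ∀ {v} → Arrangement v → suc i ℕ.< length v
      bi q = ≡.subst (suc i ℕ.<_) (≡.sym (lw q)) (proj₁ ai)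
      bj : ∀ {v} → Arrangement v → suc j ℕ.< length v
      bj q = ≡.subst (suc j ℕ.<_) (≡.sym (lw q)) (proj₁ aj)
      atᵢ : ∀ {v} → Arrangement v → ∀ {k m} → transpose i k ≡ m → at (swapAt i v) k ≡ at v m
      atᵢ {v} q {k} e = ≡.trans (at-swapAt i v k (bi q)) (≡.cong (at v) e)
      atⱼ : ∀ {v} → Arrangement v → ∀ {k m} → transpose j k ≡ m → at (swapAt j v) k ≡ at v m
      atⱼ {v} q {k} e = ≡.trans (at-swapAt j v k (bj q)) (≡.cong (at v) e)
      aj′ : Ascent j wi
      aj′ = bj pi , ≡.subst₂ ℕ._<_ (≡.sym (atᵢ p (transpose-snd i))) (≡.sym (atᵢ p (transpose-far i))) (ℕₚ.<-trans (proj₂ ai) (proj₂ aj))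
      ai′ : Ascent i wj
      ai′ = bi pj , ≡.subst₂ ℕ._<_ (≡.sym (atⱼ p (transpose-near i))) (≡.sym (atⱼ p (transpose-fst j))) (ℕₚ.<-trans (proj₂ ai) (proj₂ aj))
      ai″ : Ascent i wij
      ai″ = bi pij , ≡.subst₂ ℕ._<_ (≡.sym (≡.trans (atⱼ pi (transpose-near i)) (atᵢ p (transpose-fst i)))) (≡.sym (≡.trans (atⱼ pi (transpose-fst j)) (atᵢ p (transpose-far i)))) (proj₂ aj)
      aj″ : Ascent j wji
      aj″ = bj pji , ≡.subst₂ ℕ._<_ (≡.sym (≡.trans (atᵢ pj (transpose-snd i)) (atⱼ p (transpose-near i)))) (≡.sym (≡.trans (atᵢ pj (transpose-far i)) (atⱼ p (transpose-snd j)))) (proj₂ ai)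

    all-good : ∀ d w → Arrangement w → tri n ℕ.≤ d ℕ.+ len w → Good w
    all-good zero w p b i a = ⊥-elim (ℕₚ.<⇒≱ (ascent-bound {w} (len≡ p) a) b)
    all-good (suc d) w p b i a = go (firstAscent w) ≡.refl
      where
      good : ∀ v → Arrangement v → len w ℕ.< len v → Good v
      good v q l = all-good d v q (ℕₚ.≤-trans b (≡.subst (ℕ._≤ d ℕ.+ len v) (ℕₚ.+-suc d (len w)) (ℕₚ.+-monoʳ-≤ d l)))
      longer : ∀ {k} → Ascent k w → len w ℕ.< len (swapAt k w)
      longer ak = ≡.subst (len w ℕ.<_) (≡.sym (len-ascent {w} ak)) ℕₚ.≤-refl
      good1 : ∀ {k} → Ascent k w → Good (swapAt k w)
      good1 {k} ak = good (swapAt k w) (Arrangement-swapAt k p) (longer ak)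
      compare : ∀ j → Ascent j w → ∂ j (schubert (swapAt j w)) ≋ ∂ i (schubert (swapAt i w))
      compare j aj with ℕₚ.<-cmp j i
      ... | tri≈ _ ≡.refl _ = T.refl
      ... | tri< j<i _ _ with suc j ℕ.≟ i
      ... | yes ≡.refl = diamond-near j w p aj a good
      ... | no ne = diamond-far j i w p (ℕₚ.≤∧≢⇒< j<i ne) aj a (good1 aj) (good1 a)
      compare j aj | tri> _ _ i<j with suc i ℕ.≟ j
      ... | yes ≡.refl = T.sym (diamond-near i w p a aj good)
      ... | no ne = T.sym (diamond-far i j w p (ℕₚ.≤∧≢⇒< i<j ne) a aj (good1 a) (good1 aj))
      go : ∀ m → firstAscent w ≡ m → schubert w ≋ ∂ i (schubert (swapAt i w))
      go nothing e = ⊥-elim (ℕₚ.<⇒≢ (ascent-bound {w} (len≡ p) a) (≡.trans (len-decreasing w (uniq p) e) (≡.cong tri (len≡ p))))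
      go (just j) e = T.trans (T.reflexive (schubert-just w j (len≡ p) e)) (compare j (firstAscent-just w j e))

    ∂-schubert-ascent-step : ∀ w → Arrangement w → Good w
    ∂-schubert-ascent-step w p = all-good (tri n) w p (ℕₚ.m≤m+n _ _)

    ∂-schubert-descent : ∀ w i → Arrangement w → suc i ℕ.< n → at w (suc i) ℕ.< at w i → ∂ i (schubert w) ≋ schubert (swapAt i w)
    ∂-schubert-descent w i p i<n lt = T.sym (T.trans (∂-schubert-ascent-step (swapAt i w) (Arrangement-swapAt i p) i
        (≡.subst (suc i ℕ.<_) (≡.sym (len≡ (Arrangement-swapAt i p))) i<n
        , ≡.subst₂ ℕ._<_ (≡.sym (at-swapAt-fst i w i<w)) (≡.sym (at-swapAt-snd i w i<w)) lt))
      (T.reflexive (≡.cong (∂ i ∘ schubert) (swapAt-involutive i w))))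
      where
      i<w : suc i ℕ.< length w
      i<w = ≡.subst (suc i ℕ.<_) (≡.sym (len≡ p)) i<n

    ∂-schubert-ascent : ∀ w i → Arrangement w → suc i ℕ.< n → at w i ℕ.< at w (suc i) → ∂ i (schubert w) ≋ []
    ∂-schubert-ascent w i p i<n lt = T.trans (∂-cong i i<n (WFs p) (WF-∂ i _ (WFs (Arrangement-swapAt i p)))
        (∂-schubert-ascent-step w p i (≡.subst (suc i ℕ.<_) (≡.sym (len≡ p)) i<n , lt))) (∂-square-zero i i<n _ (WFs (Arrangement-swapAt i p)))

    -- The Schubert polynomial of the identity is reached from x₁^{n-1}⋯x_{n-1} through monomials,
    -- by moving the largest remaining value to the right one step at a time.

    mono : List ℕ → Pol
    mono α = (CommutativeRing.1# R , α) ∷ []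

    ∂-mono : ∀ A a B → length (A ++ suc a ∷ a ∷ B) ≡ n → ∂ (length A) (mono (A ++ suc a ∷ a ∷ B)) ≋ mono (A ++ a ∷ a ∷ B)
    ∂-mono A a B e = ∂-Dif i i<n (mono β) (mono α) (lβ ∷ []) (e ∷ []) (mk≋ λ ψ →
        trans (+-congˡ (trans (+-identityʳ _) (*-congˡ {x = - 1#} (reflexive (≡.cong (ψ ∘ take n) sα)))))
          (trans (solve 2 (λ x y → :1 :* x :+ (:- :1) :* y := :1 :* :1 :* x :+ ((:- :1) :* :1 :* y :+ :0)) refl _ _)
            (+-cong (*-congˡ (reflexive (≡.cong (ψ ∘ take n) (≡.sym ei)))) (+-congʳ (*-congˡ (reflexive (≡.cong (ψ ∘ take n) (≡.sym ej))))))))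
      where
      open CommutativeRing R
      open RingTools R
      i : ℕ
      i = length A
      α β : List ℕ
      α = A ++ suc a ∷ a ∷ B
      β = A ++ a ∷ a ∷ B
      lβ : length β ≡ n
      lβ = ≡.trans (≡.trans (length-++ A) (≡.sym (length-++ A))) e
      i<n : suc i ℕ.< n
      i<n = ≡.subst (suc i ℕ.<_) (≡.trans (≡.sym (≡.trans (length-++ A) (≡.trans (ℕₚ.+-suc i _) (≡.cong suc (ℕₚ.+-suc i _))))) e) (s≤s (s≤s (ℕₚ.m≤m+n _ _)))
      sα : swapAt i α ≡ A ++ a ∷ suc a ∷ B
      sα = swapAt-++ A (suc a) a B
      ei : unitVec n i ⊕ β ≡ α
      ei = ≡.trans (unit⊕ i β lβ (ℕₚ.<-trans ℕₚ.≤-refl i<n)) (≡.trans (≡.cong (λ z → setAt i (suc z) β) (at-++ A a _)) (setAt-++ A a _ (suc a)))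
      ej : unitVec n (suc i) ⊕ β ≡ A ++ a ∷ suc a ∷ B
      ej = ≡.trans (unit⊕ (suc i) β lβ i<n) (≡.trans (≡.cong₂ (λ z v → setAt z (suc (at v z)) v) li (≡.sym (++-assoc A (a ∷ []) (a ∷ B))))
        (≡.trans (≡.cong (λ z → setAt (length (A ++ a ∷ [])) (suc z) ((A ++ a ∷ []) ++ a ∷ B)) (at-++ (A ++ a ∷ []) a B))
        (≡.trans (setAt-++ (A ++ a ∷ []) a B (suc a)) (++-assoc A (a ∷ []) (suc a ∷ B)))))
        where
        li : suc i ≡ length (A ++ a ∷ [])
        li = ≡.sym (≡.trans (length-++ A) (ℕₚ.+-comm i 1))

    move-right : ∀ b m A C Z → b ℕ.≤ m → Arrangement (A ++ m ∷ downFrom b ++ C) → length (A ++ b ∷ downFrom b ++ Z) ≡ n →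
      schubert (A ++ m ∷ downFrom b ++ C) ≋ mono (A ++ b ∷ downFrom b ++ Z) → schubert (A ++ downFrom b ++ m ∷ C) ≋ mono (A ++ downFrom b ++ 0 ∷ Z)
    move-right zero m A C Z b≤m p lz e = e
    move-right (suc b) m A C Z b<m p lz e = ≡.subst₂ (λ v α → schubert v ≋ mono α) (++-assoc A (b ∷ []) (downFrom b ++ m ∷ C)) (++-assoc A (b ∷ []) (downFrom b ++ 0 ∷ Z))
        (move-right b m (A ++ b ∷ []) C Z (ℕₚ.<⇒≤ b<m) p′ lz′ (begin
      schubert ((A ++ b ∷ []) ++ m ∷ downFrom b ++ C) ≡⟨ ≡.cong schubert e′ ⟩
      schubert (swapAt i w) ≈⟨ ∂-schubert-descent w i p i<n (≡.subst₂ ℕ._<_ (≡.sym at-snd) (≡.sym at-fst) b<m) ⟨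
      ∂ i (schubert w) ≈⟨ ∂-cong i i<n (WFs p) (lz ∷ []) e ⟩
      ∂ i (mono (A ++ suc b ∷ b ∷ downFrom b ++ Z)) ≈⟨ ∂-mono A b (downFrom b ++ Z) lz ⟩
      mono (A ++ b ∷ b ∷ downFrom b ++ Z) ≡⟨ ≡.cong mono (++-assoc A (b ∷ []) _) ⟨
      mono ((A ++ b ∷ []) ++ b ∷ downFrom b ++ Z) ∎))
      where
      i : ℕ
      i = length A
      w : List ℕ
      w = A ++ m ∷ b ∷ downFrom b ++ C
      e′ : (A ++ b ∷ []) ++ m ∷ downFrom b ++ C ≡ swapAt i w
      e′ = ≡.trans (++-assoc A (b ∷ []) _) (≡.sym (swapAt-++ A m b _))
      p′ : Arrangement ((A ++ b ∷ []) ++ m ∷ downFrom b ++ C)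
      p′ = ≡.subst Arrangement (≡.sym e′) (Arrangement-swapAt i p)
      i<n : suc i ℕ.< n
      i<n = ≡.subst (suc i ℕ.<_) (≡.trans (≡.sym (≡.trans (length-++ A) (≡.trans (ℕₚ.+-suc i _) (≡.cong suc (ℕₚ.+-suc i _))))) (len≡ p)) (s≤s (s≤s (ℕₚ.m≤m+n _ _)))
      at-fst : at w i ≡ m
      at-fst = at-++ A m _
      at-snd : at w (suc i) ≡ b
      at-snd = ≡.trans (≡.cong₂ at (≡.sym (++-assoc A (m ∷ []) _)) (≡.sym (≡.trans (length-++ A) (ℕₚ.+-comm i 1)))) (at-++ (A ++ m ∷ []) b _)
      lz′ : length ((A ++ b ∷ []) ++ b ∷ downFrom b ++ Z) ≡ n
      lz′ = ≡.trans (≡.cong length (++-assoc A (b ∷ []) _)) (≡.trans (≡.trans (length-++ A) (≡.sym (length-++ A))) lz)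

    upFrom : ℕ → ℕ → List ℕ
    upFrom k zero = []
    upFrom k (suc r) = k ∷ upFrom (suc k) r

    upFrom≡ : ∀ k r (f : ℕ → ℕ) → (∀ i → f i ≡ k ℕ.+ i) → upFrom k r ≡ applyUpTo f r
    upFrom≡ k zero f e = ≡.refl
    upFrom≡ k (suc r) f e = ≡.cong₂ _∷_ (≡.sym (≡.trans (e 0) (ℕₚ.+-identityʳ k))) (upFrom≡ (suc k) r (f ∘ suc) (λ i → ≡.trans (e (suc i)) (ℕₚ.+-suc k i)))

    front-↭ : ∀ m (xs ys : List ℕ) → xs ++ m ∷ ys ↭ m ∷ xs ++ ys
    front-↭ m xs ys = Permₚ.shift m xs ys

    schubert-partial : ∀ k r → k ℕ.+ r ≡ n → Arrangement (downFrom k ++ upFrom k r) × schubert (downFrom k ++ upFrom k r) ≋ mono (downFrom k ++ replicate r 0)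
    schubert-partial k zero e = mkArrangement lw uw , ≡.subst₂ (λ v α → schubert v ≋ mono α) (≡.sym (++-identityʳ (downFrom k))) (≡.sym (++-identityʳ (downFrom k)))
        (T.reflexive (≡.trans (schubert-nothing (downFrom k) (≡.trans (length-downFrom k) k≡n) (firstAscent-decreasing k)) (≡.cong mono (≡.trans (map-∸-upTo n) (≡.cong downFrom (≡.sym k≡n))))))
      where
      k≡n : k ≡ n
      k≡n = ≡.trans (≡.sym (ℕₚ.+-identityʳ k)) e
      lw : length (downFrom k ++ []) ≡ n
      lw = ≡.trans (≡.cong length (++-identityʳ (downFrom k))) (≡.trans (length-downFrom k) k≡n)
      downFrom-unique : ∀ k → Unique (downFrom k)
      downFrom-unique zero = []
      downFrom-unique (suc k) = All.map (λ l e → ℕₚ.<⇒≢ l (≡.sym e)) (downFrom-< k) ∷ downFrom-unique k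
      uw : Unique (downFrom k ++ [])
      uw = ≡.subst Unique (≡.sym (++-identityʳ _)) (downFrom-unique k)
    schubert-partial k (suc r) e with schubert-partial (suc k) r (≡.trans (≡.sym (ℕₚ.+-suc k r)) e)
    ... | p , s = mkArrangement (≡.trans (Permₚ.↭-length (front-↭ k (downFrom k) (upFrom (suc k) r))) (len≡ p)) (Unique-resp-↭ (Perm.↭-sym (front-↭ k (downFrom k) _)) (uniq p))
        , move-right k k [] (upFrom (suc k) r) (replicate r 0) ℕₚ.≤-refl p (≡.trans (≡.cong suc (≡.trans (length-++ (downFrom k)) (≡.cong₂ ℕ._+_ (length-downFrom k) (length-replicate r)))) (≡.trans (≡.sym (ℕₚ.+-suc k r)) e)) s

    schubert-id : schubert (upTo n) ≋ constP n (CommutativeRing.1# R)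
    schubert-id = T.trans (T.reflexive (≡.cong schubert (≡.sym (upFrom≡ 0 n id (λ _ → ≡.refl))))) (proj₂ (schubert-partial 0 n ≡.refl))

  module Macdonald (n : ℕ) (q : CommutativeRing.Carrier R)
    (halve : ∀ x → CommutativeRing._≈_ R x (CommutativeRing.-_ R x) → CommutativeRing._≈_ R x (CommutativeRing.0# R)) where
    open CommutativeRing R using (Carrier; 1#; 0#)
    private module R = CommutativeRing R
    private module RT = RingTools R
    open Poly R hiding (pow)
    open Universal n hiding (u; mk≋; at≋; _≋_)
    open Universal n using (_≋_) renaming (u to uT)
    open Cut q using (F)
    open Klyachko n q
    open KlyachkoRing n q halve
    open DividedDifferences n using (WF-∂; WF--P)
    open Schubert n
    open Relation.Binary.Reasoning.Setoid S.setoid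

    qS : Pol
    qS = constP n q

    module Pt = Points S qS (varP n)
    open Pt using (u; h; y; evP; evD; evX)

    sumN-S≡T : ∀ m (f : ℕ → Pol) → SS.sumN m f ≡ TT.sumN m f
    sumN-S≡T zero f = ≡.refl
    sumN-S≡T (suc m) f = ≡.cong (f 0 ++_) (sumN-S≡T m (f ∘ suc))

    prodN-S≡T : ∀ m (f : ℕ → Pol) → SS.prodN m f ≡ TT.prodN m f
    prodN-S≡T zero f = ≡.refl
    prodN-S≡T (suc m) f = ≡.cong (f 0 *P_) (prodN-S≡T m (f ∘ suc))

    relS : ∀ k → suc k ℕ.< n → (u (suc k) *P ((qS *P varP n k) ++ (-P varP n (suc k)))) S.≈ []
    relS k k<n = S.trans (S.*-cong (S.reflexive (sumN-S≡T (suc k) (varP n))) (S.+-congʳ (constP-*P q (varP n k)))) (relation k k<n)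

    topS : u n S.≈ []
    topS = S.trans (S.reflexive (sumN-S≡T n (varP n))) u-top

    open Pt.Relations n relS topS

    eval : (List ℕ → Pol) → Pol → Pol
    eval ψ [] = []
    eval ψ ((a , α) ∷ p) = (constP n a *P ψ α) ++ eval ψ p

    eval-pair : ∀ ψ p γ → pair (eval ψ p) (Ψˢ γ) R.≈ pair p (λ α → pair (ψ α) (Ψˢ γ))
    eval-pair ψ [] γ = R.refl
    eval-pair ψ ((a , α) ∷ p) γ = R.trans (pair-++ (constP n a *P ψ α) (eval ψ p) (Ψˢ γ))
      (R.+-cong (R.trans (DS.at≋ (constP-*P a (ψ α)) γ) (pair-scale a (ψ α) (Ψˢ γ))) (eval-pair ψ p γ))

    eval-≋ : ∀ ψ {p r} → WF n p → WF n r → p ≋ r → eval ψ p S.≈ eval ψ r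
    eval-≋ ψ {p} {r} wp wr e = DS.mk≋ λ γ → R.trans (eval-pair ψ p γ) (R.trans (≋⇒pairᵂ _ wp wr e) (R.sym (eval-pair ψ r γ)))

    eval-congᵀ : ∀ {Q ψ φ p} → Terms Q p → (∀ α → Q α → ψ α S.≈ φ α) → eval ψ p S.≈ eval φ p
    eval-congᵀ [] e = S.refl
    eval-congᵀ {p = (a , α) ∷ p} (w ∷ ws) e = S.+-cong (S.*-congˡ {constP n a} (e _ w)) (eval-congᵀ ws e)

    eval-* : ∀ C ψ p → eval (λ α → C *P ψ α) p S.≈ (C *P eval ψ p)
    eval-* C ψ [] = S.sym (S.zeroʳ C)
    eval-* C ψ ((a , α) ∷ p) = S.trans (S.+-cong (SS.solve 3 (λ a c x → a SS.:* (c SS.:* x) SS.:= c SS.:* (a SS.:* x)) S.refl (constP n a) C (ψ α)) (eval-* C ψ p))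
      (S.sym (S.distribˡ C (constP n a *P ψ α) (eval ψ p)))

    eval-+ : ∀ ψ φ p → eval (λ α → ψ α ++ φ α) p S.≈ (eval ψ p ++ eval φ p)
    eval-+ ψ φ [] = S.refl
    eval-+ ψ φ ((a , α) ∷ p) = S.trans (S.+-cong (S.distribˡ (constP n a) (ψ α) (φ α)) (eval-+ ψ φ p)) (SS.Sum.interchange (constP n a *P ψ α) (constP n a *P φ α) (eval ψ p) (eval φ p))

    eval-neg : ∀ ψ p → eval (λ α → -P ψ α) p S.≈ (-P eval ψ p)
    eval-neg ψ [] = S.refl
    eval-neg ψ ((a , α) ∷ p) = S.trans (S.+-cong (S.sym (SS.-‿distribʳ-* (constP n a) (ψ α))) (eval-neg ψ p)) (SS.-‿+-comm (constP n a *P ψ α) (eval ψ p))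

    eval-0 : ∀ ψ p → (∀ α → ψ α S.≈ []) → eval ψ p S.≈ []
    eval-0 ψ [] e = S.refl
    eval-0 ψ ((a , α) ∷ p) e = S.trans (S.+-cong (S.trans (S.*-congˡ {constP n a} (e α)) (S.zeroʳ (constP n a))) (eval-0 ψ p e)) S.refl

    eval-sumN : ∀ m (ψ : ℕ → List ℕ → Pol) p → eval (λ α → SS.sumN m (λ i → ψ i α)) p S.≈ SS.sumN m (λ i → eval (ψ i) p)
    eval-sumN zero ψ p = eval-0 (λ _ → []) p (λ _ → S.refl)
    eval-sumN (suc m) ψ p = S.trans (eval-+ (ψ 0) _ p) (S.+-congˡ {eval (ψ 0) p} (eval-sumN m (ψ ∘ suc) p))

    pair-sumN : ∀ m (f : ℕ → Pol) φ → pair (SS.sumN m f) φ R.≈ RT.sumN m (λ i → pair (f i) φ)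
    pair-sumN zero f φ = R.refl
    pair-sumN (suc m) f φ = R.trans (pair-++ (f 0) _ φ) (R.+-congˡ (pair-sumN m (f ∘ suc) φ))

    eval-∂ : ∀ i f → eval (evP (suc i) 0) (∂ i f) S.≈ eval (evD i 0) f
    eval-∂ i f = DS.mk≋ λ γ → let φ = φ′ γ ; θ = θ′ γ in
      R.trans (eval-pair ψ (∂ i f) γ) (R.trans (pair-quoP i (suc i) (f ++ (-P sf)) φ)
      (R.trans (pair-++ f (-P sf) θ) (R.trans (R.+-congˡ (R.trans (pair-neg sf θ) (R.trans (R.-‿cong (pair-swapVars i f θ)) (R.sym (pair--ʳ f (θ ∘ swapAt i))))))
      (R.trans (R.sym (pair-+ʳ f θ (λ α → R.- θ (swapAt i α)))) (R.sym (R.trans (eval-pair (evD i 0) f γ) (pair-cong f (evD-pair γ))))))))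
      where
      sf : Pol
      sf = swapVars i f
      ψ : List ℕ → Pol
      ψ = evP (suc i) 0
      φ′ θ′ : List ℕ → Functional
      φ′ γ β = pair (ψ β) (Ψˢ γ)
      θ′ γ α = RT.sumN (at α i) (λ m → φ′ γ (quoM i (suc i) α m))
      terms : List ℕ → Pol
      terms α = SS.sumN (at α i) (λ m → ψ (quoM i (suc i) α m))
      terms-pair : ∀ γ α → pair (terms α) (Ψˢ γ) R.≈ θ′ γ α
      terms-pair γ α = pair-sumN (at α i) (λ m → ψ (quoM i (suc i) α m)) (Ψˢ γ)
      evD-pair : ∀ γ α → pair (evD i 0 α) (Ψˢ γ) R.≈ θ′ γ α R.+ (R.- θ′ γ (swapAt i α))
      evD-pair γ α = R.trans (pair-++ (terms α) (-P terms (swapAt i α)) (Ψˢ γ)) (R.+-cong (terms-pair γ α)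
        (R.trans (pair-neg (terms (swapAt i α)) (Ψˢ γ)) (R.-‿cong (terms-pair γ (swapAt i α)))))

    eval-step : ∀ i f → WF n f → suc i ℕ.< n →
      (eval (evP i 0) f ++ (-P eval (evP (suc i) 0) f)) S.≈ (h *P (u (suc i) *P eval (evP (suc i) 0) (∂ i f)))
    eval-step i f wf i<n = begin
      eval (evP i 0) f ++ (-P eval (evP (suc i) 0) f) ≈⟨ S.trans (eval-+ (evP i 0) _ f) (S.+-congˡ {eval (evP i 0) f} (eval-neg (evP (suc i) 0) f)) ⟨
      eval (λ α → evP i 0 α ++ (-P evP (suc i) 0 α)) f ≈⟨ eval-congᵀ wf (λ α lα → step-monomial i 0 α lα i<n) ⟩
      eval (λ α → h *P (u (suc i) *P evD i 0 α)) f ≈⟨ S.trans (eval-* h _ f) (S.*-congˡ {h} (eval-* (u (suc i)) (evD i 0) f)) ⟩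
      h *P (u (suc i) *P eval (evD i 0) f) ≈⟨ S.*-congˡ {h} (S.*-congˡ {u (suc i)} (eval-∂ i f)) ⟨
      h *P (u (suc i) *P eval (evP (suc i) 0) (∂ i f)) ∎

    eval-total : ∀ d f → Homog n d f → SS.sumN (n ℕ.∸ 1) (λ i → u (suc i) *P eval (evP (suc i) 0) (∂ i f)) S.≈ (SS.qnum qS d *P eval (evP 0 0) f)
    eval-total d f hf = begin
      SS.sumN (n ℕ.∸ 1) (λ i → u (suc i) *P eval (evP (suc i) 0) (∂ i f))
        ≈⟨ SS.Sum.bigN-cong (n ℕ.∸ 1) (λ i _ → S.trans (S.*-congˡ {u (suc i)} (eval-∂ i f)) (S.sym (eval-* (u (suc i)) (evD i 0) f))) ⟩
      SS.sumN (n ℕ.∸ 1) (λ i → eval (λ α → u (suc i) *P evD i 0 α) f) ≈⟨ eval-sumN (n ℕ.∸ 1) (λ i α → u (suc i) *P evD i 0 α) f ⟨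
      eval (λ α → SS.sumN (n ℕ.∸ 1) (λ i → u (suc i) *P evD i 0 α)) f
        ≈⟨ eval-congᵀ hf (λ α (lα , sα) → S.trans (sum-monomial α lα) (S.*-congʳ {evP 0 0 α} (S.reflexive (≡.cong (SS.qnum qS) sα)))) ⟩
      eval (λ α → SS.qnum qS d *P evP 0 0 α) f ≈⟨ eval-* (SS.qnum qS d) (evP 0 0) f ⟩
      SS.qnum qS d *P eval (evP 0 0) f ∎

    power-mono : ∀ k a β → k ℕ.+ suc (length β) ≡ n → (Poly.pow S (varP n k) a *P mono (replicate k 0 ++ 0 ∷ β)) S.≈ mono (replicate k 0 ++ a ∷ β)
    power-mono k zero β e = S.*-identityˡ _
    power-mono k (suc a) β e = S.trans (S.*-assoc (varP n k) (Poly.pow S (varP n k) a) _) (S.trans (S.*-congˡ {varP n k} (power-mono k a β e))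
      (S.trans (T⇒S (TT-mk λ ψ → R.+-congʳ (R.trans (R.*-congʳ (R.*-identityˡ 1#)) (R.*-congˡ (R.reflexive (≡.cong ψ (unit-at)))))))  S.refl))
      where
      open Universal n using () renaming (mk≋ to mk≋ᵀ)
      lγ : length (replicate k 0 ++ a ∷ β) ≡ n
      lγ = ≡.trans (length-++ (replicate k 0)) (≡.trans (≡.cong (ℕ._+ suc (length β)) (length-replicate k)) e)
      k<n : k ℕ.< n
      k<n = ≡.subst (k ℕ.<_) e (ℕₚ.m<m+n k (s≤s z≤n))
      unit-at : unitVec n k ⊕ (replicate k 0 ++ a ∷ β) ≡ replicate k 0 ++ suc a ∷ β
      unit-at = ≡.trans (DividedDifferences.unit⊕ n k _ lγ k<n) (≡.trans (≡.cong (λ z → setAt z (suc (at (replicate k 0 ++ a ∷ β) z)) (replicate k 0 ++ a ∷ β)) (≡.sym (length-replicate k)))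
        (≡.trans (≡.cong (λ z → setAt (length (replicate k 0)) (suc z) (replicate k 0 ++ a ∷ β)) (at-++ (replicate k 0) a β)) (setAt-++ (replicate k 0) a β (suc a))))
      TT-mk : ∀ {p r} → (∀ ψ → pair p ψ R.≈ pair r ψ) → p ≋ r
      TT-mk f = mk≋ᵀ λ ψ → f (Ψᵀ ψ)

    evX-mono : ∀ k β → k ℕ.+ length β ≡ n → evX k β S.≈ mono (replicate k 0 ++ β)
    evX-mono k [] e = S.reflexive (≡.cong mono (≡.trans (≡.cong (λ z → replicate z 0) (≡.trans (≡.sym e) (ℕₚ.+-identityʳ k))) (≡.sym (Data.List.Properties.++-identityʳ _))))
    evX-mono k (a ∷ β) e = S.trans (S.*-congˡ {Poly.pow S (varP n k) a} (S.trans (evX-mono (suc k) β (≡.trans (≡.sym (ℕₚ.+-suc k _)) e))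
        (S.reflexive (≡.cong mono (replicate-snoc k β))))) (power-mono k a β e)
      where
      replicate-snoc : ∀ k (β : List ℕ) → replicate (suc k) 0 ++ β ≡ replicate k 0 ++ 0 ∷ β
      replicate-snoc zero β = ≡.refl
      replicate-snoc (suc k) β = ≡.cong (0 ∷_) (replicate-snoc k β)

    eval-id : ∀ f → WF n f → eval (evP 0 0) f S.≈ f
    eval-id f wf = DS.mk≋ λ γ → R.trans (eval-pair (evP 0 0) f γ) (pair-congᵀ wf λ α lα →
      R.trans (DS.at≋ (S.trans (evP-0 α) (evX-mono 0 α lα)) γ) (R.trans (R.+-identityʳ _) (R.*-identityˡ _)))

    U : ℕ → Pol
    U d = u (suc d)

    open WordSum S qS U

    evP-replicate : ∀ i k r → evP i k (replicate r 0) S.≈ constP n 1#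
    evX-replicate : ∀ k r → evX k (replicate r 0) S.≈ constP n 1#
    evX-replicate k zero = S.refl
    evX-replicate k (suc r) = S.trans (S.*-identityˡ _) (evX-replicate (suc k) r)
    evP-replicate i k zero = S.refl
    evP-replicate zero k (suc r) = S.trans (S.*-identityˡ _) (evX-replicate (suc k) r)
    evP-replicate (suc i) k (suc r) = S.trans (S.*-identityˡ _) (evP-replicate i (suc k) r)

    arr : ∀ {w} → w ↭ upTo n → Arrangement w
    arr p = mkArrangement (≡.trans (Permₚ.↭-length p) (length-upTo n)) (Unique-resp-↭ (Perm.↭-sym p) (upTo-unique n))

    macdonald : ∀ l w i → w ↭ upTo n → len w ≡ l → i ℕ.≤ n ℕ.∸ 1 → (SS.qfac qS l *P eval (evP i 0) (schubert w)) S.≈ wordSum l w i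
    macdonald zero w i p lw i≤n = S.trans (S.*-identityˡ _) (S.trans (eval-≋ (evP i 0) (WF-schubert w (Arrangement.len≡ (arr p)) (Arrangement.uniq (arr p))) WF-1
        (T.trans (T.reflexive (≡.cong schubert (len-0⇒upTo n w p lw))) schubert-id))
      (S.trans (S.+-congʳ {[]} (S.*-congˡ {constP n 1#} (evP-replicate i 0 n))) (S.trans (S.+-identityʳ _) (S.*-identityˡ _))))
    macdonald (suc l) w i p lw = go i
      where
      pw : Arrangement w
      pw = arr p
      Q : ℕ → Pol
      Q = SS.qfac qS
      e : ℕ → Pol
      e i = eval (evP i 0) (schubert w)
      t : ℕ → Pol
      t d = u (suc d) *P eval (evP (suc d) 0) (∂ d (schubert w))
      wS : WF n (schubert w)
      wS = WF-schubert w (Arrangement.len≡ pw) (Arrangement.uniq pw)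
      last : ∀ d → d ℕ.< n ℕ.∸ 1 → (Q l *P t d) S.≈ wordSumLast l w d
      last d d<n = S.trans (SS.solve 3 (λ q u e → q SS.:* (u SS.:* e) SS.:= u SS.:* (q SS.:* e)) S.refl (Q l) (u (suc d)) (eval (evP (suc d) 0) (∂ d (schubert w)))) (cases (ℕₚ.<-cmp (at w (suc d)) (at w d)))
        where
        sd<n : suc d ℕ.< n
        sd<n = shift n d<n
          where
          shift : ∀ n → d ℕ.< n ℕ.∸ 1 → suc d ℕ.< n
          shift (suc n) l = s≤s l
        sd<w : suc d ℕ.< length w
        sd<w = ≡.subst (suc d ℕ.<_) (≡.sym (Arrangement.len≡ pw)) sd<n
        E : Pol → Pol
        E = eval (evP (suc d) 0)
        cases : Tri (at w (suc d) ℕ.< at w d) (at w (suc d) ≡ at w d) (at w d ℕ.< at w (suc d)) → (u (suc d) *P (Q l *P E (∂ d (schubert w)))) S.≈ wordSumLast l w d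
        cases (tri< lt _ _) = S.trans (S.*-congˡ {u (suc d)} (S.trans (S.*-congˡ {Q l} (eval-≋ (evP (suc d) 0) (WF-∂ d _ wS) (WFs (Arrangement-swapAt d pw)) (∂-schubert-descent w d pw sd<n lt)))
              (macdonald l (swapAt d w) (suc d) (Perm.trans (swapAt-↭ d w) p) (ℕₚ.suc-injective (≡.trans (≡.sym (len-swapAt-descent d w sd<w lt)) lw)) d<n)))
              (S.reflexive (≡.sym (wordSumLast-descent l w d lt)))
        cases (tri≈ _ eq _) = ⊥-elim (Unique⇒at≢ d w (Arrangement.uniq pw) sd<w (≡.sym eq))
        cases (tri> _ _ gt) = S.trans (S.*-congˡ {u (suc d)} (S.trans (S.*-congˡ {Q l} (eval-≋ (evP (suc d) 0) (WF-∂ d _ wS) [] (∂-schubert-ascent w d pw sd<n gt))) (S.zeroʳ (Q l))))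
              (S.trans (S.zeroʳ (u (suc d))) (S.reflexive (≡.sym (wordSumLast-ascent l w d (ℕₚ.<⇒≤ gt)))))
      lw∸1 : length w ℕ.∸ 1 ≡ n ℕ.∸ 1
      lw∸1 = ≡.cong (ℕ._∸ 1) (Arrangement.len≡ pw)
      go : ∀ i → i ℕ.≤ n ℕ.∸ 1 → (Q (suc l) *P e i) S.≈ wordSum (suc l) w i
      go zero _ = begin
        (SS.qnum qS (suc l) *P Q l) *P e 0 ≈⟨ SS.solve 3 (λ a b c → (a SS.:* b) SS.:* c SS.:= b SS.:* (a SS.:* c)) S.refl (SS.qnum qS (suc l)) (Q l) (e 0) ⟩
        Q l *P (SS.qnum qS (suc l) *P e 0) ≈⟨ S.*-congˡ {Q l} (eval-total (suc l) (schubert w) (≡.subst (λ k → Homog n k (schubert w)) lw (Homog-schubert w (Arrangement.len≡ pw) (Arrangement.uniq pw)))) ⟨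
        Q l *P SS.sumN (n ℕ.∸ 1) t ≈⟨ S.trans (SS.sumN-*ˡ (n ℕ.∸ 1) (Q l) t) (SS.Sum.bigN-cong (n ℕ.∸ 1) last) ⟩
        SS.sumN (n ℕ.∸ 1) (wordSumLast l w) ≡⟨ ≡.cong (λ m → SS.sumN m (wordSumLast l w)) lw∸1 ⟨
        SS.sumN (length w ℕ.∸ 1) (wordSumLast l w) ≈⟨ wordSum-0 l w ⟨
        wordSum (suc l) w 0 ∎
      go (suc i) i<n = begin
        Q (suc l) *P e (suc i) ≈⟨ SS.solve 3 (λ q a b → q SS.:* b SS.:= q SS.:* a SS.:- q SS.:* (a SS.:- b)) S.refl (Q (suc l)) (e i) (e (suc i)) ⟩
        (Q (suc l) *P e i) ++ (-P (Q (suc l) *P (e i ++ (-P e (suc i))))) ≈⟨ S.+-cong (go i (ℕₚ.<⇒≤ i<n)) (S.-‿cong (S.*-congˡ {Q (suc l)} (eval-step i (schubert w) wS si<n))) ⟩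
        wordSum (suc l) w i ++ (-P (Q (suc l) *P (h *P t i)))
          ≈⟨ S.+-congˡ {wordSum (suc l) w i} (S.-‿cong (S.trans (SS.solve 4 (λ n q h t → (n SS.:* q) SS.:* (h SS.:* t) SS.:= (h SS.:* n) SS.:* (q SS.:* t)) S.refl (SS.qnum qS (suc l)) (Q l) h (t i))
               (S.*-cong (SS.1-q*qnum qS (suc l)) (last i i<n)))) ⟩
        wordSum (suc l) w i ++ (-P ((constP n 1# ++ (-P Poly.pow S qS (suc l))) *P wordSumLast l w i))
          ≈⟨ S.+-congˡ {wordSum (suc l) w i} (S.-‿cong (wordSum-step l w i (≡.subst (i ℕ.<_) (≡.sym lw∸1) i<n))) ⟨
        wordSum (suc l) w i ++ (-P (wordSum (suc l) w i ++ (-P wordSum (suc l) w (suc i)))) ≈⟨ SS.solve 2 (λ a b → a SS.:- (a SS.:- b) SS.:= b) S.refl (wordSum (suc l) w i) (wordSum (suc l) w (suc i)) ⟩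
        wordSum (suc l) w (suc i) ∎
        where
        si<n : suc i ℕ.< n
        si<n = shift n i<n
          where
          shift : ∀ n → i ℕ.< n ℕ.∸ 1 → suc i ℕ.< n
          shift (suc n) l = s≤s l

    macdonald-0 : ∀ w → w ↭ upTo n → (SS.qfac qS (len w) *P schubert w) S.≈ wordSum (len w) w 0
    macdonald-0 w p = S.trans (S.*-congˡ {SS.qfac qS (len w)} (S.sym (eval-id (schubert w) (WFs (arr p))))) (macdonald (len w) w 0 p ≡.refl z≤n)

    -- u₁⋯u_{n-1} = (-1)^{n-1} [n-1]! x₂⋯xₙ (1-based) in S

    module TopProduct (m : ℕ) (n≡ : n ≡ suc m) where
      W : ℕ → Pol
      W k = SS.prodN k (λ j → u (m ℕ.∸ j))

      W-suc : ∀ k → W (suc k) S.≈ (W k *P u (m ℕ.∸ k))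
      W-suc k = SS.Prod.bigN-snoc k (λ j → u (m ℕ.∸ j))

      W-relation : ∀ k → k ℕ.≤ m → (W k *P (u (m ℕ.∸ k) ++ (SS.qnum qS (suc k) *P varP n (m ℕ.∸ k)))) S.≈ []
      W-relation zero _ = S.trans (S.*-identityˡ _) (S.trans (S.+-congˡ {u m} (S.trans (S.*-congʳ {varP n m} (SS.solve 1 (λ q → SS.:1 SS.:+ q SS.:* SS.:0 SS.:= SS.:1) S.refl qS)) (S.*-identityˡ (varP n m))))
        (S.trans (S.sym (Pt.u-suc m)) (S.trans (S.reflexive (≡.cong u (≡.sym n≡))) topS)))
      W-relation (suc k) k<m = begin
        W (suc k) *P (u j ++ ((constP n 1# ++ (qS *P qk)) *P X)) ≈⟨ S.*-congʳ {u j ++ ((constP n 1# ++ (qS *P qk)) *P X)} (W-suc k) ⟩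
        (W k *P u (m ℕ.∸ k)) *P (u j ++ ((constP n 1# ++ (qS *P qk)) *P X)) ≡⟨ ≡.cong (λ z → (W k *P u z) *P (u j ++ ((constP n 1# ++ (qS *P qk)) *P X))) i≡ ⟩
        (W k *P u (suc j)) *P (u j ++ ((constP n 1# ++ (qS *P qk)) *P X))
          ≈⟨ SS.solve 7 (λ w v u q k x y → (w SS.:* v) SS.:* (u SS.:+ (SS.:1 SS.:+ q SS.:* k) SS.:* x) SS.:= (w SS.:* k) SS.:* (v SS.:* (q SS.:* x SS.:- y)) SS.:+ v SS.:* (w SS.:* ((u SS.:+ x) SS.:+ k SS.:* y))) S.refl (W k) (u (suc j)) (u j) qS qk X X′ ⟩
        ((W k *P qk) *P (u (suc j) *P ((qS *P X) ++ (-P X′)))) ++ (u (suc j) *P (W k *P ((u j ++ X) ++ (qk *P X′))))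
          ≈⟨ S.+-cong (S.trans (S.*-congˡ {W k *P qk} (relS j j<n)) (S.zeroʳ (W k *P qk)))
               (S.trans (S.*-congˡ {u (suc j)} (S.trans (S.*-congˡ {W k} (S.trans (S.+-congʳ {qk *P X′} (S.sym (Pt.u-suc j))) (S.reflexive (≡.cong (λ z → u z ++ (qk *P varP n z)) (≡.sym i≡))))) (W-relation k (ℕₚ.<⇒≤ k<m)))) (S.zeroʳ (u (suc j)))) ⟩
        [] ∎
        where
        j : ℕ
        j = m ℕ.∸ suc k
        i≡ : m ℕ.∸ k ≡ suc j
        i≡ = ℕₚ.+-∸-assoc 1 k<m
        qk X X′ : Pol
        qk = SS.qnum qS (suc k)
        X = varP n j
        X′ = varP n (suc j)
        j<n : suc j ℕ.< n
        j<n = ≡.subst₂ ℕ._<_ i≡ (≡.sym n≡) (s≤s (ℕₚ.m∸n≤m m k))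

      εS : ℕ → Pol
      εS = Poly.pow S (-P constP n 1#)

      W-product : ∀ k → k ℕ.≤ m → W k S.≈ ((εS k *P SS.qfac qS k) *P SS.prodN k (λ j → varP n (m ℕ.∸ j)))
      W-product zero _ = SS.solve 0 (SS.:1 SS.:= (SS.:1 SS.:* SS.:1) SS.:* SS.:1) S.refl
      W-product (suc k) k<m = begin
        W (suc k) ≈⟨ W-suc k ⟩
        W k *P u (m ℕ.∸ k) ≈⟨ SS.solve 4 (λ w u q x → w SS.:* u SS.:= w SS.:* (u SS.:+ q SS.:* x) SS.:+ (SS.:- q) SS.:* x SS.:* w) S.refl (W k) (u (m ℕ.∸ k)) qk X ⟩
        (W k *P (u (m ℕ.∸ k) ++ (qk *P X))) ++ (((-P qk) *P X) *P W k) ≈⟨ S.+-cong (W-relation k (ℕₚ.<⇒≤ k<m)) (S.*-congˡ {(-P qk) *P X} (W-product k (ℕₚ.<⇒≤ k<m))) ⟩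
        ((-P qk) *P X) *P ((εS k *P SS.qfac qS k) *P V) ≈⟨ SS.solve 5 (λ q x e f v → ((SS.:- q) SS.:* x) SS.:* ((e SS.:* f) SS.:* v) SS.:= (((SS.:- SS.:1) SS.:* e) SS.:* (q SS.:* f)) SS.:* (v SS.:* x)) S.refl qk X (εS k) (SS.qfac qS k) V ⟩
        (εS (suc k) *P SS.qfac qS (suc k)) *P (V *P X) ≈⟨ S.*-congˡ {εS (suc k) *P SS.qfac qS (suc k)} (SS.Prod.bigN-snoc k (λ j → varP n (m ℕ.∸ j))) ⟨
        (εS (suc k) *P SS.qfac qS (suc k)) *P SS.prodN (suc k) (λ j → varP n (m ℕ.∸ j)) ∎
        where
        qk X V : Pol
        qk = SS.qnum qS (suc k)
        X = varP n (m ℕ.∸ k)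
        V = SS.prodN k (λ j → varP n (m ℕ.∸ j))

      reversed : ∀ (f : ℕ → Pol) → SS.prodN m (λ j → f (m ℕ.∸ j)) S.≈ SS.prodN m (f ∘ suc)
      reversed f = S.trans (SS.Prod.bigN-cong m (λ j j<m → S.reflexive (≡.cong f (ℕₚ.+-∸-assoc 1 j<m)))) (SS.Prod.bigN-reverse m (f ∘ suc))

      top-product : SS.prodN m U S.≈ ((εS m *P SS.qfac qS m) *P SS.prodN m (λ i → varP n (suc i)))
      top-product = S.trans (S.sym (reversed u)) (S.trans (W-product m ℕₚ.≤-refl) (S.*-congˡ {εS m *P SS.qfac qS m} (reversed (varP n))))

  module Conclusion where
    open CommutativeRing R
    open RingTools R
    open Poly R

    sumP-constP : ∀ n k (F : ℕ → Pol) (v : ℕ → Carrier) → (∀ j → F j ≈P constP n (v j)) → sumP (map F (upTo k)) ≈P constP n (sumN k v)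
    sumP-constP n k F v e γ = begin
      coeff γ (sumP (map F (upTo k))) ≈⟨ trans (coeff-pair γ (sumP (map F (upTo k)))) (trans (pair-sumP (map F (upTo k)) (ind γ)) (trans (Sum.big-map F (upTo k) (λ p → pair p (ind γ))) (Sum.big-upTo k (λ j → pair (F j) (ind γ))))) ⟩
      sumN k (λ j → pair (F j) (ind γ)) ≈⟨ Sum.bigN-cong k (λ j _ → trans (sym (coeff-pair γ (F j))) (trans (e j γ) (trans (coeff-pair γ (constP n (v j))) (trans (+-identityʳ _) (*-comm _ _))))) ⟩
      sumN k (λ j → I * v j) ≈⟨ sumN-*ˡ k I v ⟨
      I * sumN k v ≈⟨ *-comm _ _ ⟩
      sumN k v * I ≈⟨ trans (coeff-pair γ (constP n (sumN k v))) (+-identityʳ _) ⟨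
      coeff γ (constP n (sumN k v)) ∎
      where
      open Relation.Binary.Reasoning.Setoid setoid
      I : Carrier
      I = ind γ (replicate n 0)

    constP-cong : ∀ n {a b} → a ≈ b → constP n a ≈P constP n b
    constP-cong n {a} {b} e γ = trans (coeff-pair γ (constP n a)) (trans (+-congʳ (*-congʳ e)) (sym (coeff-pair γ (constP n b))))

    module Assembly (isField : IsField) (charZero : CharZero) (q : Carrier) (nr : NotNontrivialRootOfUnity q)
      (m : ℕ) (ws : List (List ℕ)) (indec : All Indecomposable ws) (isp : IsPerm (suc m) (product ws)) (len≡m : len (product ws) ≡ m) where
      open FieldFacts R isField charZero q nr using (halve)
      open Relation.Binary.Reasoning.Setoid setoid

      n : ℕ
      n = suc m

      open KlyachkoRing n q halve
      open Macdonald n q halve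

      Λ-cong : ∀ {a b} → a S.≈ b → Λ a ≈ Λ b
      Λ-cong e = DS.at≋ e (replicate n 0)

      Λ-+ : ∀ a b → Λ (a ++ b) ≈ Λ a + Λ b
      Λ-+ a b = pair-++ a b _

      Λ-q : ∀ a → Λ (qS *P a) ≈ q * Λ a
      Λ-q a = trans (Λ-cong (constP-*P q a)) (pair-scale q a _)

      private module LF = LinearForm S R qS q Λ Λ-cong Λ-+ Λ-q refl

      Λ-top : Λ (SS.prodN m U) ≈ qfac q m
      Λ-top = begin
        Λ (SS.prodN m U) ≈⟨ Λ-cong (S.trans TP.top-product (S.trans (S.*-congʳ {X} (S.*-comm (TP.εS m) (SS.qfac qS m))) (S.*-assoc (SS.qfac qS m) (TP.εS m) X))) ⟩
        Λ (SS.qfac qS m *P (TP.εS m *P X)) ≈⟨ trans (LF.Λ-qfac m _) (*-congˡ (LF.Λ-sign m X)) ⟩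
        qfac q m * (ε m * Λ X) ≈⟨ *-congˡ (trans (*-congˡ (reflexive (≡.cong Λ (prodN-S≡T m (λ i → varP n (suc i)))))) (Λ-vars m ≡.refl)) ⟩
        qfac q m * 1# ≈⟨ *-identityʳ _ ⟩
        qfac q m ∎
        where
        module TP = TopProduct m ≡.refl
        X : Pol
        X = SS.prodN m (λ i → varP n (suc i))

      private module RS = RotationSum S R isField charZero qS q nr (varP n) m relS topS Λ Λ-cong Λ-+ Λ-q refl Λ-top ws indec isp len≡m

      value : ℕ → Carrier
      value j = pair (schubert (rot j ws) *P farProd n q) (altM n)

      value-Λ : ∀ j → qfac q m * value j ≈ Λ (WordSum.wordSum S qS U m (rot j ws) 0)
      value-Λ j = begin
        qfac q m * value j ≈⟨ *-congˡ (trans (pair-congᵀ (Universal.WF-* n _ _ wS WF-P) (λ α lα → reflexive (≡.cong (altM n) (≡.sym (≡.trans (replicate-⊕ n α) (take-all n α (ℕₚ.≤-reflexive lα))))))) (sym (Λ≈ev (schubert (rot j ws)) wS))) ⟩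
        qfac q m * Λ (schubert (rot j ws)) ≈⟨ LF.Λ-qfac m _ ⟨
        Λ (SS.qfac qS m *P schubert (rot j ws)) ≡⟨ ≡.cong (λ l → Λ (SS.qfac qS l *P schubert (rot j ws))) (≡.sym rot-len) ⟩
        Λ (SS.qfac qS (len (rot j ws)) *P schubert (rot j ws)) ≈⟨ Λ-cong (macdonald-0 (rot j ws) rot↭) ⟩
        Λ (WordSum.wordSum S qS U (len (rot j ws)) (rot j ws) 0) ≡⟨ ≡.cong (λ l → Λ (WordSum.wordSum S qS U l (rot j ws) 0)) rot-len ⟩
        Λ (WordSum.wordSum S qS U m (rot j ws) 0) ∎
        where
        open RS.At j
        wS : WF n (schubert (rot j ws))
        wS = Schubert.WF-schubert n (rot j ws) rot-length (proj₂ rot-standard)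

      sum-values : sumN (length ws) value ≈ redSum q n (product ws)
      sum-values = RS.sum-rotations value value-Λ

      aW-value : ∀ j → aW q (rot j ws) ≈P constP n (value j)
      aW-value j = ≡.subst (λ k → bracket k q (schubert (rot j ws)) ≈P constP n (value j)) (≡.sym rot-length)
        (bracket-const m q (schubert (rot j ws)) (≡.subst (λ d → Homog n d (schubert (rot j ws))) rot-len (Schubert.Homog-schubert n (rot j ws) rot-length (proj₂ rot-standard))))
        where open RS.At j

      conclusion : sumP (map (λ j → aW q (rot j ws)) (upTo (length ws))) ≈P constP n (redSum q n (product ws))
      conclusion γ = trans (sumP-constP n (length ws) (λ j → aW q (rot j ws)) value aW-value γ) (constP-cong n sum-values γ)

open import Data.Nat using (_+_)

theorem7p6 : {c ℓ : Level} (R : CommutativeRing c ℓ) → let open Poly R in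
    IsField → CharZero →
    (q : CommutativeRing.Carrier R) → NotNontrivialRootOfUnity q →
    (n : ℕ) (w : List ℕ) → IsPerm n w → len w + 1 ≡ n →
    (ws : List (List ℕ)) → All Indecomposable ws → w ≡ foldr _×ₚ_ [] ws →
    sumP (map (λ j → aW q (rot j ws)) (upTo (length ws)))
    ≈P constP n (redSum q n w)
theorem7p6 R isField charZero q nr n w isp length-w ws indec ≡.refl with ≡.trans (≡.sym length-w) (ℕₚ.+-comm (len w) 1)
... | ≡.refl = PolynomialSide.Conclusion.Assembly.conclusion R isField charZero q nr (len w) ws indec isp ≡.refl
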